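{- Let $d\ge 7$ be an integer and let $\mathcal P\subset\mathbb R^d$ be an integral convex polytope of dimension $d$. Then $$g_{d-3}(\mathcal P)\ \ge\ \frac{1}{d!}\Big(-\mathrm{stirl}(d+1,d-2)+(d!\,\mathrm{vol}(\mathcal P)-1)\,N_{d-3,d}\Big),$$ and this bound is best possible for any volume: for every positive integer $m$ there exists an integral convex polytope $\mathcal P$ of dimension $d$ with $d!\,\mathrm{vol}(\mathcal P)=m$ for which equality holds. Moreover, $M_{d-3,d}<N_{d-3,d}$.
   Context: An integral convex polytope is a convex polytope in $\mathbb R^d$ all of whose vertices lie in $\mathbb Z^d$. For such $\mathcal P$ of dimension $d$, the Ehrhart polynomial is $L_{\mathcal P}(n)=|n\mathcal P\cap\mathbb Z^d|$ (a polynomial in $n$ of degree $d$), and $g_r(\mathcal P)$ denotes the coefficient of $n^r$ in $L_{\mathcal P}(n)$. $\mathrm{vol}$ is the usual $d$-dimensional volume. The Stirling numbers of the first kind $\mathrm{stirl}(d,i)$ are defined by $\prod_{i=0}^{d-1}(z-i)=\sum_{i=1}^d \mathrm{stirl}(d,i)z^i$. For integers $i$ and $d$, let $c_i(z)=(z+i)(z+i-1)\cdots(z+i-(d-1))=d!\binom{z+i}{d}$, and let $C^d_{r,i}$ denote the coefficient of $z^r$ in $c_i(z)$. For $d\ge 3$, $M_{r,d}=\min\{C^d_{r,i}: 1\le i\le d-2\}$ and $N_{r,d}=\min\{C^d_{r,i}: \lceil (d-1)/2\rceil\le i\le d-2\}$. -}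

module Defs where

open import Data.Nat as ℕ using (ℕ; zero; suc; _∸_)
open import Data.Nat.Base using (_!)
open import Data.Nat.Properties using (_!≢0)
open import Data.Nat.DivMod using (_/_)
open import Data.Integer as ℤ using (ℤ; +_)
open import Data.Rational as ℚ using (ℚ; 0ℚ; 1ℚ)
open import Data.Fin using (Fin; zero; suc; toℕ)
open import Data.Vec using (Vec; lookup)
open import Data.List using (List; []; _∷_; length)
import Data.List as L
open import Data.List.Membership.Propositional using (_∈_)
open import Data.List.Relation.Unary.Unique.Propositional using (Unique)
open import Data.Product using (Σ; _×_; ∃; ∃-syntax)
open import Relation.Binary.PropositionalEquality using (_≡_)
open import Function.Bundles using (_⇔_)

Σℚ : {k : ℕ} → (Fin k → ℚ) → ℚ
Σℚ {zero}  f = 0ℚ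
Σℚ {suc k} f = f zero ℚ.+ Σℚ (λ i → f (suc i))

ℤ→ℚ : ℤ → ℚ
ℤ→ℚ z = z ℚ./ 1

ℕ→ℚ : ℕ → ℚ
ℕ→ℚ n = (+ n) ℚ./ 1

Point : ℕ → Set
Point d = Vec ℤ d

-- An integral convex polytope is given as the convex hull of a finite
-- list V of integer points (its vertices are then among the points of V).
-- Real point y ∈ conv(V) with y ∈ ℚ^d is described by rational convex
-- coefficients.

InDilate : {d : ℕ} → List (Point d) → ℕ → Point d → Set
InDilate {d} V n x =
  Σ (Fin (length V) → ℚ) λ λ' →
    (∀ i → 0ℚ ℚ.≤ λ' i) ×
    (Σℚ λ' ≡ 1ℚ) ×
    (∀ (j : Fin d) →
       ℕ→ℚ n ℚ.* Σℚ (λ i → λ' i ℚ.* ℤ→ℚ (lookup (L.lookup V i) j))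
         ≡ ℤ→ℚ (lookup x j))

LatticeCount : {d : ℕ} → List (Point d) → ℕ → ℕ → Set
LatticeCount {d} V n k =
  Σ (List (Point d)) λ xs →
    Unique xs × (∀ x → (x ∈ xs) ⇔ InDilate V n x) × (length xs ≡ k)

AffinelyIndependent : {d : ℕ} → (Fin (suc d) → Point d) → Set
AffinelyIndependent {d} p =
  ∀ (c : Fin (suc d) → ℚ) →
    Σℚ c ≡ 0ℚ →
    (∀ (j : Fin d) → Σℚ (λ i → c i ℚ.* ℤ→ℚ (lookup (p i) j)) ≡ 0ℚ) →
    ∀ i → c i ≡ 0ℚ

FullDimensional : {d : ℕ} → List (Point d) → Set
FullDimensional {d} V =
  Σ (Fin (suc d) → Point d) λ p → (∀ i → p i ∈ V) × AffinelyIndependent p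

IsEhrhartPolynomial : {d : ℕ} → List (Point d) → (Fin (suc d) → ℚ) → Set
IsEhrhartPolynomial {d} V c =
  ∀ (n k : ℕ) → 1 ℕ.≤ n → LatticeCount V n k →
    ℕ→ℚ k ≡ Σℚ (λ r → c r ℚ.* ℕ→ℚ (n ℕ.^ toℕ r))

-- vol(conv V) = v, with volume defined as Jordan content via the grid (1/n)ℤ^d:
-- vol(P) = lim_{n→∞} |P ∩ (1/n)ℤ^d| / n^d = lim_{n→∞} |nP ∩ ℤ^d| / n^d.
HasVolume : {d : ℕ} → List (Point d) → ℚ → Set
HasVolume {d} V v =
  ∀ (ε : ℚ) → 0ℚ ℚ.< ε →
    ∃[ N ] ∀ (n k : ℕ) → N ℕ.≤ n → 1 ℕ.≤ n → LatticeCount V n k →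
      ℚ.∣ ℕ→ℚ k ℚ.- v ℚ.* ℕ→ℚ (n ℕ.^ d) ∣ ℚ.< ε ℚ.* ℕ→ℚ (n ℕ.^ d)

-- Polynomials over ℤ as coefficient lists (coefficient of z^0 first)

Poly : Set
Poly = List ℤ

_+ₚ_ : Poly → Poly → Poly
[]       +ₚ q        = q
(a ∷ p)  +ₚ []       = a ∷ p
(a ∷ p)  +ₚ (b ∷ q)  = (a ℤ.+ b) ∷ (p +ₚ q)

mulLin : ℤ → Poly → Poly
mulLin a p = (+ 0 ∷ p) +ₚ L.map (a ℤ.*_) p

prodLin : List ℤ → Poly
prodLin []       = + 1 ∷ []
prodLin (a ∷ as) = mulLin a (prodLin as)

coeff : Poly → ℕ → ℤ
coeff []      _       = + 0
coeff (a ∷ p) zero    = a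
coeff (a ∷ p) (suc r) = coeff p r

stirl : ℕ → ℕ → ℤ
stirl d i = coeff (prodLin (L.map (λ j → ℤ.- (+ j)) (L.upTo d))) i

cpoly : ℕ → ℤ → Poly
cpoly d i = prodLin (L.map (λ j → i ℤ.- (+ j)) (L.upTo d))

C : ℕ → ℕ → ℤ → ℤ
C d r i = coeff (cpoly d i) r

minFrom : (ℕ → ℤ) → ℕ → ℕ → ℤ
minFrom f a zero    = f a
minFrom f a (suc k) = f a ℤ.⊓ minFrom f (suc a) k

-- min { f i : lo ≤ i ≤ hi }   (used only with lo ≤ hi)
minRange : (ℕ → ℤ) → ℕ → ℕ → ℤ
minRange f lo hi = minFrom f lo (hi ∸ lo)

ceilHalf : ℕ → ℕ
ceilHalf m = (m ℕ.+ 1) / 2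

M : ℕ → ℕ → ℤ
M r d = minRange (λ i → C d r (+ i)) 1 (d ∸ 2)

N : ℕ → ℕ → ℤ
N r d = minRange (λ i → C d r (+ i)) (ceilHalf (d ∸ 1)) (d ∸ 2)

bound : ℕ → ℚ → ℚ
bound d v =
  ((+ 1) ℚ./ (d !)) {{d !≢0}} ℚ.*
    (ℚ.- ℤ→ℚ (stirl (suc d) (d ∸ 2))
      ℚ.+ (ℕ→ℚ (d !) ℚ.* v ℚ.- 1ℚ) ℚ.* ℤ→ℚ (N (d ∸ 3) d))

coefAt : {d : ℕ} → (Fin (suc d) → ℚ) → ℕ → ℚ
coefAt         c zero    = c zero
coefAt {zero}  c (suc r) = 0ℚ
coefAt {suc d} c (suc r) = coefAt (λ i → c (suc i)) r

{-# OPTIONS --safe #-}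
-- Write L(n) = Σⱼ hⱼ binom(n + d − j, d). Then d! g_{d−3} = Σⱼ hⱼ C(d, d−3, d−j), and the weights are an odd cubic
-- function of d + 1 − 2j. Bounding it from below by an odd monotone function θ and summing by parts, the inequality
-- follows from hⱼ ≥ 0 and h₁ + … + hⱼ ≥ h_d + … + h_{d+1−j}. The latter holds because the h-vector A of the boundary
-- satisfies Aⱼ = Σ_{i≤j} (hᵢ − h_{d+1−i}) and 1 = A₀ ≤ Aⱼ.
--
-- The lattice points are counted by half-open decompositions. The cells of a triangulation are the optimal bases of a
-- linear program with generic cost: if an interior point q is expensive, the optimal bases triangulate the cone over the
-- polytope; if the coefficient of q is maximised, every optimal basis consists of q and a simplex in the boundary.
-- A lattice point is assigned to the cell that is feasible after a lexicographic perturbation of the point; the opposite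
-- perturbation assigns exactly the interior points, which gives reciprocity. Perturbing q along the vertices of one
-- boundary cell, with some of them reflected, produces cells with any prescribed number of open sides, so Aⱼ ≥ 1.
--
-- Equality holds for a simplex all of whose nonzero box points have the height at which the minimum N is attained.

module Submission where

open import Defs
open import Data.Nat as ℕ using (ℕ; zero; suc)
import Data.Nat.Properties as ℕₚ
open import Data.Integer as ℤ using (ℤ) renaming (+_ to posℤ)
import Data.Integer.Properties as ℤₚ
open import Data.Rational as ℚ using (ℚ; 0ℚ; 1ℚ; nonNegative; positive; ≢-nonZero; toℚᵘ)
open import Data.Fin as Fin using (Fin; zero; suc; toℕ; punchIn; punchOut)
import Data.Fin.Properties as Finₚ
open import Data.Vec as Vec using (Vec; []; _∷_; lookup)
open import Data.List as List using (List; []; _∷_; length)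
open import Data.List.Membership.Propositional using (_∈_)
open import Data.List.Relation.Unary.Any using (Any; here; there)
open import Data.List.Relation.Unary.All using (All; []; _∷_)
open import Data.Product using (Σ; _×_; _,_; ∃; ∃-syntax; proj₁; proj₂)
open import Data.Sum using (_⊎_; inj₁; inj₂)
open import Data.Empty using (⊥; ⊥-elim)
open import Data.Bool using (Bool; true; false; if_then_else_)
open import Relation.Nullary using (¬_; Dec; yes; no; does)
open import Relation.Binary.PropositionalEquality
open import Relation.Binary.Definitions using (Tri; tri<; tri≈; tri>)
open import Tactic.RingSolver using (solve-∀)
import Data.Integer.DivMod as ℤD
import Data.Integer.Tactic.RingSolver as ℤSolver
import Data.List.Membership.Propositional.Properties as ∈ₚ
import Data.List.Properties as Listₚ
import Data.List.Relation.Unary.All as All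
import Data.List.Relation.Unary.All.Properties as Allₚ
import Data.List.Relation.Unary.Any as Any
import Data.List.Relation.Unary.Any.Properties as Anyₚ
import Data.List.Relation.Unary.Unique.Propositional.Properties as Uniqueₚ
import Data.Nat.DivMod as ℕD
import Data.Nat.Tactic.RingSolver as ℕSolver
import Data.Rational.Properties as ℚₚ
import Data.Rational.Unnormalised as ℚᵘ
import Data.Rational.Unnormalised.Properties as ℚᵘₚ
import Data.Sum
import Data.Vec.Properties as Vecₚ
import Relation.Nullary
import Tactic.RingSolver.Core.AlmostCommutativeRing as ACR
open import Algebra using (IsCommutativeRing; CommutativeRing)
open import Data.Bool using (not)
open import Data.Bool.Properties using (not-involutive)
open import Data.List.Relation.Unary.AllPairs using (AllPairs; []; _∷_)
open import Data.List.Relation.Unary.AllPairs using ([]; _∷_)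
open import Data.List.Relation.Unary.Unique.Propositional using (Unique)
open import Data.Maybe using (just; nothing)
open import Data.Unit using (⊤; tt)
open import Function.Bundles using (_⇔_; mk⇔)
open import Function.Bundles using (_⇔_; mk⇔; Equivalence)
open import Function.Bundles using (mk⇔)
open import Level using (0ℓ)
open import Relation.Nullary.Decidable using (dec-true; dec-false)
open ≡-Reasoning

-- Bounding every weight separately would only give the bound with `M` in place of `N`: weights
-- beyond the middle of the h*-vector may lie below `N`. By oddness such a deficit is matched by a
-- surplus at the mirror index d + 1 - j, and the inequalities between the partial sums from both
-- ends are what allows the two to be offset. The arguments i in the range of `N` correspond to
-- heights k = d - i ≥ 2 with 2k ≤ d + 1; a simplex can have all its nonzero box points at such a
-- height, so no larger constant is possible. A polytope is given only as a list of points, some of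
-- them perhaps redundant, and neither faces nor topology are available. Cells, facets and interior
-- are therefore expressed through coordinates with respect to bases picked from the list, which
-- takes the place of a shelling of the boundary. Perturbations are compared lexicographically
-- because no single small number serves the lattice points of all dilates at once, whereas the sign
-- pattern that decides which sides of a cell are open depends on the perturbation alone and not on
-- the point.

module Rationals where
  open import Data.Rational using (_≤_; _<_)
  open ℚₚ public using (_≟_; _≤?_; _<?_; <-cmp; ≤-refl; ≤-trans; ≤-reflexive; ≤-antisym; <⇒≤; <⇒≢; <-irrefl; <-asym; <-≤-trans; ≤-<-trans; ≮⇒≥; ≰⇒>; 1≢0)

  infixl 7 _*_
  infixl 6 _+_ _-_
  infix 8 -_

  -- The operations of ℚ compute by pattern matching, which blocks unification; these copies are rigid.
  opaque
    _+_ _*_ : ℚ → ℚ → ℚ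
    _+_ = ℚ._+_
    _*_ = ℚ._*_

    -_ : ℚ → ℚ
    -_ = ℚ.-_

  opaque
    ⟦_⟧ : ℤ → ℚ
    ⟦_⟧ = ℤ→ℚ

  _-_ : ℚ → ℚ → ℚ
  a - b = a + (- b)

  ⟦_⟧ℕ : ℕ → ℚ
  ⟦ n ⟧ℕ = ⟦ posℤ n ⟧

  opaque
    sum : ∀ {n} → (Fin n → ℚ) → ℚ
    sum {zero}  f = 0ℚ
    sum {suc n} f = f zero + sum (λ i → f (suc i))

  opaque
    unfolding _+_

    +-*-isCommutativeRing : IsCommutativeRing _≡_ _+_ _*_ -_ 0ℚ 1ℚ
    +-*-isCommutativeRing = ℚₚ.+-*-isCommutativeRing

    +-mono-≤ : ∀ {a b c d} → a ≤ b → c ≤ d → a + c ≤ b + d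
    +-mono-≤ = ℚₚ.+-mono-≤

    +-mono-<-≤ : ∀ {a b c d} → a < b → c ≤ d → a + c < b + d
    +-mono-<-≤ = ℚₚ.+-mono-<-≤

    +-mono-≤-< : ∀ {a b c d} → a ≤ b → c < d → a + c < b + d
    +-mono-≤-< = ℚₚ.+-mono-≤-<

    0≤* : ∀ {a b} → 0ℚ ≤ a → 0ℚ ≤ b → 0ℚ ≤ a * b
    0≤* {a} {b} p q = ℚₚ.nonNegative⁻¹ (a ℚ.* b) {{ℚₚ.nonNeg*nonNeg⇒nonNeg a {{nonNegative p}} b {{nonNegative q}}}}

    0<* : ∀ {a b} → 0ℚ < a → 0ℚ < b → 0ℚ < a * b
    0<* {a} {b} p q = ℚₚ.positive⁻¹ (a ℚ.* b) {{ℚₚ.pos*pos⇒pos a {{positive p}} b {{positive q}}}}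

    inverse : ∀ {a} → a ≢ 0ℚ → ∃[ b ] a * b ≡ 1ℚ
    inverse {a} a≢0 = (ℚ.1/ a) {{≢-nonZero a≢0}} , ℚₚ.*-inverseʳ a {{≢-nonZero a≢0}}

    neg-antimono-≤ : ∀ {a b} → a ≤ b → - b ≤ - a
    neg-antimono-≤ = ℚₚ.neg-antimono-≤

    neg-antimono-< : ∀ {a b} → a < b → - b < - a
    neg-antimono-< = ℚₚ.neg-antimono-<

    neg-0 : - 0ℚ ≡ 0ℚ
    neg-0 = refl

  opaque
    unfolding _+_ sum

    sum≡Σℚ : ∀ {n} (f : Fin n → ℚ) → sum f ≡ Σℚ f
    sum≡Σℚ {zero}  f = refl
    sum≡Σℚ {suc n} f = cong (f zero ℚ.+_) (sum≡Σℚ (λ i → f (suc i)))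

  open IsCommutativeRing +-*-isCommutativeRing public
    using (+-assoc; +-comm; *-assoc; *-comm; +-identityˡ; +-identityʳ; *-identityˡ; *-identityʳ; distribˡ; distribʳ; zeroˡ; zeroʳ)
    renaming (-‿inverseʳ to +-inverseʳ)

  +-*-commutativeRing : CommutativeRing 0ℓ 0ℓ
  +-*-commutativeRing = record { isCommutativeRing = +-*-isCommutativeRing }

  ringℚ : ACR.AlmostCommutativeRing 0ℓ 0ℓ
  ringℚ = ACR.fromCommutativeRing +-*-commutativeRing zero?
    where
    zero? : ∀ x → _
    zero? x with 0ℚ ≟ x
    ... | yes p = just p
    ... | no _  = nothing

  +-monoˡ-≤ : ∀ {b c} a → b ≤ c → b + a ≤ c + a
  +-monoˡ-≤ a p = +-mono-≤ p ≤-refl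

  +-monoˡ-< : ∀ {b c} a → b < c → b + a < c + a
  +-monoˡ-< a p = +-mono-<-≤ p ≤-refl

  0<1 : 0ℚ < 1ℚ
  0<1 = ℚₚ.positive⁻¹ 1ℚ

  0≤1 : 0ℚ ≤ 1ℚ
  0≤1 = <⇒≤ 0<1

  ≤⇒0≤- : ∀ {a b} → a ≤ b → 0ℚ ≤ b - a
  ≤⇒0≤- {a} {b} p = subst (_≤ b - a) (+-inverseʳ a) (+-monoˡ-≤ (- a) p)

  private
    opaque
      unfolding _+_
      cancel-- : ∀ a b → (b - a) + a ≡ b
      cancel-- = solve-∀ ringℚ

  0≤-⇒≤ : ∀ {a b} → 0ℚ ≤ b - a → a ≤ b
  0≤-⇒≤ {a} {b} p = subst₂ _≤_ (+-identityˡ a) (cancel-- a b) (+-monoˡ-≤ a p)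

  <⇒0<- : ∀ {a b} → a < b → 0ℚ < b - a
  <⇒0<- {a} {b} p = subst (_< b - a) (+-inverseʳ a) (+-monoˡ-< (- a) p)

  0<-⇒< : ∀ {a b} → 0ℚ < b - a → a < b
  0<-⇒< {a} {b} p = subst₂ _<_ (+-identityˡ a) (cancel-- a b) (+-monoˡ-< a p)

  0≤+ : ∀ {a b} → 0ℚ ≤ a → 0ℚ ≤ b → 0ℚ ≤ a + b
  0≤+ {a} {b} p q = subst (_≤ a + b) (+-identityˡ 0ℚ) (+-mono-≤ p q)

  0<+≤ : ∀ {a b} → 0ℚ < a → 0ℚ ≤ b → 0ℚ < a + b
  0<+≤ {a} {b} p q = subst (_< a + b) (+-identityˡ 0ℚ) (+-mono-<-≤ p q)

  0≤+< : ∀ {a b} → 0ℚ ≤ a → 0ℚ < b → 0ℚ < a + b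
  0≤+< {a} {b} p q = subst (_< a + b) (+-identityˡ 0ℚ) (+-mono-≤-< p q)

  opaque
    unfolding _+_
    0≤neg : ∀ {a} → a ≤ 0ℚ → 0ℚ ≤ - a
    0≤neg p = ℚₚ.neg-antimono-≤ p

    0<neg : ∀ {a} → a < 0ℚ → 0ℚ < - a
    0<neg p = ℚₚ.neg-antimono-< p

    neg<0 : ∀ {a} → 0ℚ < a → - a < 0ℚ
    neg<0 p = ℚₚ.neg-antimono-< p

  opaque
    unfolding _+_
    neg-involutive : ∀ a → - (- a) ≡ a
    neg-involutive = solve-∀ ringℚ

  >⇒≢ : ∀ {a} → 0ℚ < a → a ≢ 0ℚ
  >⇒≢ p e = <⇒≢ p (sym e)

  ≤∧≢⇒< : ∀ {a b} → a ≤ b → a ≢ b → a < b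
  ≤∧≢⇒< {a} {b} p q with <-cmp a b
  ... | tri< r _ _ = r
  ... | tri≈ _ r _ = ⊥-elim (q r)
  ... | tri> _ _ r = ⊥-elim (<⇒≢ (<-≤-trans r p) refl)

  -- The value at 0 is 0.
  recip : ℚ → ℚ
  recip a with a ≟ 0ℚ
  ... | yes _ = 0ℚ
  ... | no a≢0 = proj₁ (inverse a≢0)

  *-recip : ∀ {a} → a ≢ 0ℚ → a * recip a ≡ 1ℚ
  *-recip {a} a≢0 with a ≟ 0ℚ
  ... | yes p = ⊥-elim (a≢0 p)
  ... | no q  = proj₂ (inverse q)

  recip-pos : ∀ {a} → 0ℚ < a → 0ℚ < recip a
  recip-pos {a} 0<a with <-cmp 0ℚ (recip a)
  ... | tri< p _ _ = p
  ... | tri≈ _ p _ = ⊥-elim (1≢0 (trans (sym (*-recip (>⇒≢ 0<a))) (trans (cong (a *_) (sym p)) (zeroʳ a))))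
  ... | tri> _ _ p = ⊥-elim (<-asym 0<1 (subst (_< 0ℚ) e (neg<0 (0<* 0<a (0<neg p)))))
    where
    opaque
      unfolding _+_
      f : ∀ a b → - (a * (- b)) ≡ a * b
      f = solve-∀ ringℚ
    e : - (a * (- recip a)) ≡ 1ℚ
    e = trans (f a (recip a)) (*-recip (>⇒≢ 0<a))

  *-cancel-0 : ∀ {a b} → a * b ≡ 0ℚ → a ≢ 0ℚ → b ≡ 0ℚ
  *-cancel-0 {a} {b} p q = begin
    b                 ≡⟨ sym (*-identityˡ b) ⟩
    1ℚ * b            ≡⟨ cong (_* b) (sym (*-recip q)) ⟩
    (a * recip a) * b ≡⟨ f a (recip a) b ⟩
    recip a * (a * b) ≡⟨ cong (recip a *_) p ⟩
    recip a * 0ℚ      ≡⟨ zeroʳ (recip a) ⟩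
    0ℚ ∎
    where
    opaque
      unfolding _+_
      f : ∀ a r b → (a * r) * b ≡ r * (a * b)
      f = solve-∀ ringℚ

  0<*-cancel : ∀ {a b} → 0ℚ < a → 0ℚ < a * b → 0ℚ < b
  0<*-cancel {a} {b} p q with <-cmp 0ℚ b
  ... | tri< r _ _ = r
  ... | tri≈ _ refl _ = ⊥-elim (<⇒≢ q (sym (zeroʳ a)))
  ... | tri> _ _ r = ⊥-elim (<-asym q (subst (_< 0ℚ) (f a b) (neg<0 (0<* p (0<neg r)))))
    where
    opaque
      unfolding _+_
      f : ∀ a b → - (a * (- b)) ≡ a * b
      f = solve-∀ ringℚ

  0≤*-cancel : ∀ {a b} → 0ℚ < a → 0ℚ ≤ a * b → 0ℚ ≤ b
  0≤*-cancel {a} {b} p q = ≮⇒≥ (λ r → <⇒≢ (≤-<-trans q (subst (_< 0ℚ) (f a b) (neg<0 (0<* p (0<neg r))))) refl)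
    where
    opaque
      unfolding _+_
      f : ∀ a b → - (a * (- b)) ≡ a * b
      f = solve-∀ ringℚ

  *-cancelˡ : ∀ {a b c} → a ≢ 0ℚ → a * b ≡ a * c → b ≡ c
  *-cancelˡ {a} {b} {c} a≢0 p = begin
    b ≡⟨ g b c ⟩
    (b - c) + c ≡⟨ cong (_+ c) (*-cancel-0 (trans (f a b c) (trans (cong (_- a * c) p) (+-inverseʳ (a * c)))) a≢0) ⟩
    0ℚ + c ≡⟨ +-identityˡ c ⟩
    c ∎
    where
    opaque
      unfolding _+_
      f : ∀ a b c → a * (b - c) ≡ a * b - a * c
      f = solve-∀ ringℚ
    opaque
      unfolding _+_
      g : ∀ b c → b ≡ (b - c) + c
      g = solve-∀ ringℚ

  -≡0⇒≡ : ∀ {a b} → a - b ≡ 0ℚ → a ≡ b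
  -≡0⇒≡ {a} {b} p = trans (sym (cancel-- b a)) (trans (cong (_+ b) p) (+-identityˡ b))

  private
    opaque
      unfolding _+_
      +-interchange : ∀ a b c d → (a + b) + (c + d) ≡ (a + c) + (b + d)
      +-interchange = solve-∀ ringℚ
      neg-distrib-+ : ∀ a b → - (a + b) ≡ - a + - b
      neg-distrib-+ = solve-∀ ringℚ
      +-left-comm : ∀ a b c → a + (b + c) ≡ b + (a + c)
      +-left-comm = solve-∀ ringℚ

  opaque
    unfolding sum

    sum-zero : (f : Fin 0 → ℚ) → sum f ≡ 0ℚ
    sum-zero f = refl

    sum-suc : ∀ {n} (f : Fin (suc n) → ℚ) → sum f ≡ f zero + sum (λ i → f (suc i))
    sum-suc f = refl

    Σ-cong : ∀ {n} {f g : Fin n → ℚ} → (∀ i → f i ≡ g i) → sum f ≡ sum g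
    Σ-cong {zero}  p = refl
    Σ-cong {suc n} p = cong₂ _+_ (p zero) (Σ-cong (λ i → p (suc i)))

    Σ-0 : ∀ {n} {f : Fin n → ℚ} → (∀ i → f i ≡ 0ℚ) → sum f ≡ 0ℚ
    Σ-0 {zero}  p = refl
    Σ-0 {suc n} p = trans (cong₂ _+_ (p zero) (Σ-0 {n} (λ i → p (suc i)))) (+-identityˡ 0ℚ)

    Σ-+ : ∀ {n} (f g : Fin n → ℚ) → sum (λ i → f i + g i) ≡ sum f + sum g
    Σ-+ {zero}  f g = sym (+-identityˡ 0ℚ)
    Σ-+ {suc n} f g = trans (cong (f zero + g zero +_) (Σ-+ (λ i → f (suc i)) (λ i → g (suc i)))) (+-interchange (f zero) (g zero) _ _)

    Σ-* : ∀ {n} a (f : Fin n → ℚ) → sum (λ i → a * f i) ≡ a * sum f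
    Σ-* {zero}  a f = sym (zeroʳ a)
    Σ-* {suc n} a f = trans (cong (a * f zero +_) (Σ-* a (λ i → f (suc i)))) (sym (distribˡ a _ _))

    Σ-*ʳ : ∀ {n} a (f : Fin n → ℚ) → sum (λ i → f i * a) ≡ sum f * a
    Σ-*ʳ a f = trans (Σ-cong (λ i → *-comm (f i) a)) (trans (Σ-* a f) (*-comm a _))

    Σ-neg : ∀ {n} (f : Fin n → ℚ) → sum (λ i → - f i) ≡ - sum f
    Σ-neg {zero}  f = sym neg-0
    Σ-neg {suc n} f = trans (cong (- f zero +_) (Σ-neg (λ i → f (suc i)))) (sym (neg-distrib-+ (f zero) _))

    Σ-- : ∀ {n} (f g : Fin n → ℚ) → sum (λ i → f i - g i) ≡ sum f - sum g
    Σ-- f g = trans (Σ-+ f (λ i → - g i)) (cong (sum f +_) (Σ-neg g))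

    Σ-swap : ∀ {m n} (f : Fin m → Fin n → ℚ) →
      sum (λ i → sum (λ j → f i j)) ≡ sum (λ j → sum (λ i → f i j))
    Σ-swap {zero} {n} f = sym (Σ-0 {n} {λ _ → 0ℚ} (λ _ → refl))
    Σ-swap {suc m} f = trans (cong (sum (f zero) +_) (Σ-swap (λ i → f (suc i)))) (sym (Σ-+ (f zero) _))

    Σ-nonneg : ∀ {n} {f : Fin n → ℚ} → (∀ i → 0ℚ ≤ f i) → 0ℚ ≤ sum f
    Σ-nonneg {zero}  p = ≤-refl
    Σ-nonneg {suc n} p = 0≤+ (p zero) (Σ-nonneg (λ i → p (suc i)))

    Σ-pos : ∀ {n} {f : Fin n → ℚ} → (∀ i → 0ℚ ≤ f i) → ∀ k → 0ℚ < f k → 0ℚ < sum f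
    Σ-pos p zero    q = 0<+≤ q (Σ-nonneg (λ i → p (suc i)))
    Σ-pos p (suc k) q = 0≤+< (p zero) (Σ-pos (λ i → p (suc i)) k q)

    Σ-≤ : ∀ {n} {f g : Fin n → ℚ} → (∀ i → f i ≤ g i) → sum f ≤ sum g
    Σ-≤ {f = f} {g} p = 0≤-⇒≤ (subst (0ℚ ≤_) (Σ-- g f) (Σ-nonneg (λ i → ≤⇒0≤- (p i))))

    Σ-term0 : ∀ {n} {f : Fin n → ℚ} → (∀ i → 0ℚ ≤ f i) → sum f ≤ 0ℚ → ∀ k → f k ≡ 0ℚ
    Σ-term0 {f = f} p q k with <-cmp 0ℚ (f k)
    ... | tri< r _ _ = ⊥-elim (<⇒≢ (<-≤-trans (Σ-pos p k r) q) refl)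
    ... | tri≈ _ r _ = sym r
    ... | tri> _ _ r = ⊥-elim (<⇒≢ (<-≤-trans r (p k)) refl)

    Σ-punchIn : ∀ {n} (p : Fin (suc n)) (f : Fin (suc n) → ℚ) →
      sum f ≡ f p + sum (λ i → f (punchIn p i))
    Σ-punchIn zero f = refl
    Σ-punchIn {suc n} (suc p) f =
      trans (cong (f zero +_) (Σ-punchIn p (λ i → f (suc i)))) (+-left-comm (f zero) _ _)

  δ : ∀ {n} → Fin n → Fin n → ℚ
  δ i j = if does (i Finₚ.≟ j) then 1ℚ else 0ℚ

  δ-refl : ∀ {n} (i : Fin n) → δ i i ≡ 1ℚ
  δ-refl i with i Finₚ.≟ i
  ... | yes _ = refl
  ... | no q = ⊥-elim (q refl)

  δ-≡ : ∀ {n} {i j : Fin n} → i ≡ j → δ i j ≡ 1ℚ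
  δ-≡ {i = i} refl = δ-refl i

  δ-≢ : ∀ {n} {i j : Fin n} → i ≢ j → δ i j ≡ 0ℚ
  δ-≢ {i = i} {j} q with i Finₚ.≟ j
  ... | yes p = ⊥-elim (q p)
  ... | no _ = refl

  δ-sym : ∀ {n} (i j : Fin n) → δ i j ≡ δ j i
  δ-sym i j with i Finₚ.≟ j
  ... | yes p = sym (δ-≡ (sym p))
  ... | no q = sym (δ-≢ (λ e → q (sym e)))

  δ-suc : ∀ {n} (i j : Fin n) → δ (suc i) (suc j) ≡ δ i j
  δ-suc i j with i Finₚ.≟ j
  ... | yes _ = refl
  ... | no _ = refl

  δ-nonneg : ∀ {n} (i j : Fin n) → 0ℚ ≤ δ i j
  δ-nonneg i j with i Finₚ.≟ j
  ... | yes _ = 0≤1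
  ... | no _ = ≤-refl


  opaque
    unfolding sum

    Σ-δ : ∀ {n} (l : Fin n) (f : Fin n → ℚ) → sum (λ k → δ l k * f k) ≡ f l
    Σ-δ {suc n} zero f = trans (cong₂ _+_ (*-identityˡ (f zero)) (Σ-0 {f = λ k → 0ℚ * f (suc k)} (λ k → zeroˡ (f (suc k))))) (+-identityʳ _)
    Σ-δ {suc n} (suc l) f = trans (cong₂ _+_ (zeroˡ (f zero)) (trans (Σ-cong (λ k → cong (_* f (suc k)) (δ-suc l k))) (Σ-δ l (λ k → f (suc k))))) (+-identityˡ _)

  Σ-δʳ : ∀ {n} (l : Fin n) (f : Fin n → ℚ) → sum (λ k → f k * δ k l) ≡ f l
  Σ-δʳ l f = trans (Σ-cong (λ k → trans (*-comm (f k) _) (cong (_* f k) (δ-sym k l)))) (Σ-δ l f)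

  opaque
    unfolding _+_ ⟦_⟧

    private
      ι : ℤ → ℚᵘ.ℚᵘ
      ι z = ℚᵘ.mkℚᵘ z 0

      toι : ∀ z → toℚᵘ (⟦ z ⟧) ℚᵘ.≃ ι z
      toι z = ℚₚ.toℚᵘ-fromℚᵘ (ι z)

    ⟦⟧-+ : ∀ a b → ⟦ a ℤ.+ b ⟧ ≡ ⟦ a ⟧ + ⟦ b ⟧
    ⟦⟧-+ a b = ℚₚ.toℚᵘ-injective (ℚᵘₚ.≃-trans (toι (a ℤ.+ b)) (ℚᵘₚ.≃-trans (ℚᵘ.*≡* e)
        (ℚᵘₚ.≃-trans (ℚᵘₚ.+-cong (ℚᵘₚ.≃-sym (toι a)) (ℚᵘₚ.≃-sym (toι b))) (ℚᵘₚ.≃-sym (ℚₚ.toℚᵘ-homo-+ (⟦ a ⟧) (⟦ b ⟧))))))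
      where
      e : (a ℤ.+ b) ℤ.* posℤ 1 ≡ (a ℤ.* posℤ 1 ℤ.+ b ℤ.* posℤ 1) ℤ.* posℤ 1
      e = cong (ℤ._* posℤ 1) (sym (cong₂ ℤ._+_ (ℤₚ.*-identityʳ a) (ℤₚ.*-identityʳ b)))

    ⟦⟧-* : ∀ a b → ⟦ a ℤ.* b ⟧ ≡ ⟦ a ⟧ * ⟦ b ⟧
    ⟦⟧-* a b = ℚₚ.toℚᵘ-injective (ℚᵘₚ.≃-trans (toι (a ℤ.* b))
        (ℚᵘₚ.≃-trans (ℚᵘₚ.*-cong (ℚᵘₚ.≃-sym (toι a)) (ℚᵘₚ.≃-sym (toι b))) (ℚᵘₚ.≃-sym (ℚₚ.toℚᵘ-homo-* (⟦ a ⟧) (⟦ b ⟧)))))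

    ⟦⟧-neg : ∀ a → ⟦ ℤ.- a ⟧ ≡ - ⟦ a ⟧
    ⟦⟧-neg a = ℚₚ.toℚᵘ-injective (ℚᵘₚ.≃-trans (toι (ℤ.- a))
        (ℚᵘₚ.≃-trans (ℚᵘₚ.-‿cong (ℚᵘₚ.≃-sym (toι a))) (ℚᵘₚ.≃-sym (ℚₚ.toℚᵘ-homo‿- (⟦ a ⟧)))))

    ⟦⟧-- : ∀ a b → ⟦ a ℤ.- b ⟧ ≡ ⟦ a ⟧ - ⟦ b ⟧
    ⟦⟧-- a b = trans (⟦⟧-+ a (ℤ.- b)) (cong (⟦ a ⟧ +_) (⟦⟧-neg b))

    ⟦⟧-mono-≤ : ∀ {a b} → a ℤ.≤ b → ⟦ a ⟧ ≤ ⟦ b ⟧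
    ⟦⟧-mono-≤ {a} {b} p = ℚₚ.toℚᵘ-cancel-≤ (ℚᵘₚ.≤-respˡ-≃ (ℚᵘₚ.≃-sym (toι a)) (ℚᵘₚ.≤-respʳ-≃ (ℚᵘₚ.≃-sym (toι b))
      (ℚᵘ.*≤* (ℤₚ.*-monoʳ-≤-nonNeg (posℤ 1) p))))

    ⟦⟧-cancel-≤ : ∀ {a b} → ⟦ a ⟧ ≤ ⟦ b ⟧ → a ℤ.≤ b
    ⟦⟧-cancel-≤ {a} {b} p with ℚᵘₚ.≤-respˡ-≃ (toι a) (ℚᵘₚ.≤-respʳ-≃ (toι b) (ℚₚ.toℚᵘ-mono-≤ p))
    ... | ℚᵘ.*≤* q = ℤₚ.*-cancelʳ-≤-pos a b (posℤ 1) q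

    ⟦⟧-injective : ∀ {a b} → ⟦ a ⟧ ≡ ⟦ b ⟧ → a ≡ b
    ⟦⟧-injective p = ℤₚ.≤-antisym (⟦⟧-cancel-≤ (≤-reflexive p)) (⟦⟧-cancel-≤ (≤-reflexive (sym p)))

    ⟦⟧-mono-< : ∀ {a b} → a ℤ.< b → ⟦ a ⟧ < ⟦ b ⟧
    ⟦⟧-mono-< p = ≤∧≢⇒< (⟦⟧-mono-≤ (ℤₚ.<⇒≤ p)) (λ e → ℤₚ.<⇒≢ p (⟦⟧-injective e))

    ⟦⟧-cancel-< : ∀ {a b} → ⟦ a ⟧ < ⟦ b ⟧ → a ℤ.< b
    ⟦⟧-cancel-< p = ℤₚ.≤∧≢⇒< (⟦⟧-cancel-≤ (<⇒≤ p)) (λ e → <⇒≢ p (cong ⟦_⟧ e))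

    ⟦0⟧ : ⟦ 0 ⟧ℕ ≡ 0ℚ
    ⟦0⟧ = refl

    ⟦1⟧ : ⟦ 1 ⟧ℕ ≡ 1ℚ
    ⟦1⟧ = refl

    -- Integer division of the numerator by the denominator leaves a nonnegative remainder even for
    -- negative numerators, so it rounds down.
    floor : ∀ p → Σ ℤ λ z → ⟦ z ⟧ ≤ p × p < ⟦ z ⟧ + 1ℚ
    floor p@record{} = z , lower , upper
      where
      z : ℤ
      z = ℚ.↥ p ℤD./ ℚ.↧ p
      r : ℕ
      r = ℚ.↥ p ℤD.% ℚ.↧ p
      eq : ℚ.↥ p ≡ posℤ r ℤ.+ z ℤ.* ℚ.↧ p
      eq = ℤD.a≡a%n+[a/n]*n (ℚ.↥ p) (ℚ.↧ p)
      lower : ⟦ z ⟧ ≤ p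
      lower = ℚₚ.toℚᵘ-cancel-≤ (ℚᵘₚ.≤-respˡ-≃ (ℚᵘₚ.≃-sym (toι z))
        (ℚᵘ.*≤* (subst (z ℤ.* ℚ.↧ p ℤ.≤_) (sym (trans (ℤₚ.*-identityʳ (ℚ.↥ p)) eq)) (ℤₚ.i≤j+i (z ℤ.* ℚ.↧ p) (posℤ r)))))
      upper' : ℤ.suc z ℤ.* ℚ.↧ p ℤ.> ℚ.↥ p
      upper' = subst₂ ℤ._<_ (sym eq) (sym (ℤₚ.suc-* z (ℚ.↧ p))) (ℤₚ.+-monoˡ-< (z ℤ.* ℚ.↧ p) (ℤ.+<+ (ℤD.n%d<d (ℚ.↥ p) (ℚ.↧ p))))
      upper : p < ⟦ z ⟧ + 1ℚ
      upper = subst (p <_) (trans (⟦⟧-+ (posℤ 1) z) (+-comm 1ℚ (⟦ z ⟧)))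
        (ℚₚ.toℚᵘ-cancel-< (ℚᵘₚ.<-respʳ-≃ (ℚᵘₚ.≃-sym (toι (ℤ.suc z)))
          (ℚᵘ.*<* (subst (ℤ._< ℤ.suc z ℤ.* ℚ.↧ p) (sym (ℤₚ.*-identityʳ (ℚ.↥ p))) upper'))))

  ⟦⟧ℕ-+ : ∀ a b → ⟦ a ℕ.+ b ⟧ℕ ≡ ⟦ a ⟧ℕ + ⟦ b ⟧ℕ
  ⟦⟧ℕ-+ a b = ⟦⟧-+ (posℤ a) (posℤ b)

  ⟦⟧ℕ-* : ∀ a b → ⟦ a ℕ.* b ⟧ℕ ≡ ⟦ a ⟧ℕ * ⟦ b ⟧ℕ
  ⟦⟧ℕ-* a b = trans (cong ⟦_⟧ (ℤₚ.pos-* a b)) (⟦⟧-* (posℤ a) (posℤ b))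

  ⟦⟧ℕ-suc : ∀ a → ⟦ suc a ⟧ℕ ≡ 1ℚ + ⟦ a ⟧ℕ
  ⟦⟧ℕ-suc a = trans (⟦⟧ℕ-+ 1 a) (cong (_+ ⟦ a ⟧ℕ) ⟦1⟧)

  ⟦⟧ℕ-nonneg : ∀ a → 0ℚ ≤ ⟦ a ⟧ℕ
  ⟦⟧ℕ-nonneg a = subst (_≤ ⟦ a ⟧ℕ) ⟦0⟧ (⟦⟧-mono-≤ (ℤ.+≤+ ℕ.z≤n))

  ⟦⟧ℕ-pos : ∀ {a} → 1 ℕ.≤ a → 0ℚ < ⟦ a ⟧ℕ
  ⟦⟧ℕ-pos {a} p = subst (_< ⟦ a ⟧ℕ) ⟦0⟧ (⟦⟧-mono-< (ℤ.+<+ p))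

  ⟦⟧ℕ-mono-≤ : ∀ {a b} → a ℕ.≤ b → ⟦ a ⟧ℕ ≤ ⟦ b ⟧ℕ
  ⟦⟧ℕ-mono-≤ p = ⟦⟧-mono-≤ (ℤ.+≤+ p)

  opaque
    unfolding _+_ ⟦_⟧

    *-ℚ : ∀ a b → a * b ≡ a ℚ.* b
    *-ℚ a b = refl

    ⟦⟧-ℚ : ∀ z → ⟦ z ⟧ ≡ ℤ→ℚ z
    ⟦⟧-ℚ z = refl

-- Linear algebra over ℚ: elimination, bases among given generators, exchange of a basis vector.

module LinearAlgebra where
  open import Data.Rational using (_≤_; _<_)
  open Rationals

  dot : ∀ {D} → (Fin D → ℚ) → (Fin D → ℚ) → ℚ
  dot a x = sum (λ j → a j * x j)

  dot-cong : ∀ {D} {a : Fin D → ℚ} {x y : Fin D → ℚ} → (∀ j → x j ≡ y j) → dot a x ≡ dot a y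
  dot-cong {a = a} p = Σ-cong (λ j → cong (a j *_) (p j))

  dot-comm : ∀ {D} (a x : Fin D → ℚ) → dot a x ≡ dot x a
  dot-comm a x = Σ-cong (λ j → *-comm (a j) (x j))

  dot-0 : ∀ {D} (a : Fin D → ℚ) {x : Fin D → ℚ} → (∀ j → x j ≡ 0ℚ) → dot a x ≡ 0ℚ
  dot-0 a p = Σ-0 (λ j → trans (cong (a j *_) (p j)) (zeroʳ (a j)))

  dot-+ : ∀ {D} (a x y : Fin D → ℚ) → dot a (λ j → x j + y j) ≡ dot a x + dot a y
  dot-+ a x y = trans (Σ-cong (λ j → distribˡ (a j) (x j) (y j))) (Σ-+ _ _)

  dot-* : ∀ {D} (a : Fin D → ℚ) c (x : Fin D → ℚ) → dot a (λ j → c * x j) ≡ c * dot a x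
  dot-* a c x = trans (Σ-cong (λ j → lem (a j) c (x j))) (Σ-* c _)
    where
    opaque
      unfolding _+_
      lem : ∀ a c x → a * (c * x) ≡ c * (a * x)
      lem = solve-∀ ringℚ

  dot-neg : ∀ {D} (a x : Fin D → ℚ) → dot a (λ j → - x j) ≡ - dot a x
  dot-neg a x = trans (Σ-cong (λ j → lem (a j) (x j))) (Σ-neg _)
    where
    opaque
      unfolding _+_
      lem : ∀ a x → a * (- x) ≡ - (a * x)
      lem = solve-∀ ringℚ

  dot-- : ∀ {D} (a x y : Fin D → ℚ) → dot a (λ j → x j - y j) ≡ dot a x - dot a y
  dot-- a x y = trans (dot-+ a x (λ j → - y j)) (cong (dot a x +_) (dot-neg a y))

  dot-Σ : ∀ {D n} (a : Fin D → ℚ) (c : Fin n → ℚ) (v : Fin n → Fin D → ℚ) →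
    dot a (λ j → sum (λ k → c k * v k j)) ≡ sum (λ k → c k * dot a (v k))
  dot-Σ a c v = begin
    sum (λ j → a j * sum (λ k → c k * v k j))       ≡⟨ Σ-cong (λ j → sym (Σ-* (a j) _)) ⟩
    sum (λ j → sum (λ k → a j * (c k * v k j)))     ≡⟨ Σ-swap _ ⟩
    sum (λ k → sum (λ j → a j * (c k * v k j)))     ≡⟨ Σ-cong (λ k → dot-* a (c k) (v k)) ⟩
    sum (λ k → c k * dot a (v k)) ∎

  dot-δ : ∀ {D} (a : Fin D → ℚ) l → dot a (δ l) ≡ a l
  dot-δ a l = trans (dot-comm a (δ l)) (Σ-δ l a)

  -- A two-sided inverse with both halves stored, duality and expansion; deriving one from the other
  -- would take a rank argument.
  Inverse : ∀ {n} → (Fin n → Fin n → ℚ) → Set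
  Inverse {n} v = Σ (Fin n → Fin n → ℚ) λ a →
    (∀ k l → dot (a k) (v l) ≡ δ k l) × (∀ x j → sum (λ k → dot (a k) x * v k j) ≡ x j)

  Relation : ∀ {n} → (Fin n → Fin n → ℚ) → Set
  Relation {n} v = Σ (Fin n → ℚ) λ μ → (∃[ k ] μ k ≢ 0ℚ) × (∀ j → sum (λ k → μ k * v k j) ≡ 0ℚ)

  -- Case distinction between the pivot and the other indices, in the form in which `Σ-punchIn`
  -- splits a sum.
  data PunchView {n} (p : Fin (suc n)) : Fin (suc n) → Set where
    same  : PunchView p p
    other : ∀ j → PunchView p (punchIn p j)

  punchView : ∀ {n} (p j : Fin (suc n)) → PunchView p j
  punchView p j with p Finₚ.≟ j
  ... | yes refl = same
  ... | no q = subst (PunchView p) (Finₚ.punchIn-punchOut q) (other (punchOut q))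

  -- One step of Gaussian elimination: v₀ has pivot entry p, and w are the remaining vectors reduced modulo v₀ with coordinate p dropped.
  module Eliminate {n} (v : Fin (suc n) → Fin (suc n) → ℚ) (p : Fin (suc n)) (t : ℚ) (vt : v zero p * t ≡ 1ℚ) where
    red : (Fin (suc n) → ℚ) → Fin n → ℚ
    red x j = x (punchIn p j) - (x p * t) * v zero (punchIn p j)

    w : Fin n → Fin n → ℚ
    w k = red (v (suc k))

    tv : t * v zero p ≡ 1ℚ
    tv = trans (*-comm t (v zero p)) vt

    opaque
      unfolding _+_
      e1 : ∀ x d s t → (x * t) * (- d) + s ≡ s - (x * t) * d
      e1 = solve-∀ ringℚ
      e2 : ∀ t d x → - (t * d) * x ≡ (x * t) * (- d)
      e2 = solve-∀ ringℚ
      e3 : ∀ x → x - 1ℚ * x ≡ 0ℚ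
      e3 = solve-∀ ringℚ
      e4 : ∀ t x s v → t * (x - s) * v ≡ (x - s) * (t * v)
      e4 = solve-∀ ringℚ
      e5 : ∀ x s → (x - s) * 1ℚ + s ≡ x
      e5 = solve-∀ ringℚ
      e6 : ∀ t x s v r → t * (x - s) * v + r ≡ (x * t) * v + (r - (s * t) * v)
      e6 = solve-∀ ringℚ
      e7 : ∀ a b → a + (b - a) ≡ b
      e7 = solve-∀ ringℚ
      e8 : ∀ c x y t v → c * (x - (y * t) * v) ≡ c * x - (c * y) * (t * v)
      e8 = solve-∀ ringℚ
      e9 : ∀ s t v → s * (t * v) ≡ (s * t) * v
      e9 = solve-∀ ringℚ

    red-v0 : ∀ j → red (v zero) j ≡ 0ℚ
    red-v0 j = trans (cong (λ z → v zero (punchIn p j) - z * v zero (punchIn p j)) vt) (e3 _)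

    fromInverse : Inverse w → Inverse v
    fromInverse (a , dual , span) = A , dualA , spanA
      where
      -- The entry at `p` is chosen so that `B k` kills `v zero`; on every vector `B k` then agrees
      -- with `a k` on its reduction.
      B : Fin n → Fin (suc n) → ℚ
      B k j with p Finₚ.≟ j
      ... | yes _ = - (t * dot (a k) (λ i → v zero (punchIn p i)))
      ... | no q  = a k (punchOut q)

      B-p : ∀ k → B k p ≡ - (t * dot (a k) (λ i → v zero (punchIn p i)))
      B-p k with p Finₚ.≟ p
      ... | yes _ = refl
      ... | no q = ⊥-elim (q refl)

      B-punch : ∀ k i → B k (punchIn p i) ≡ a k i
      B-punch k i with p Finₚ.≟ punchIn p i
      ... | yes e = ⊥-elim (Finₚ.punchInᵢ≢i p i (sym e))
      ... | no q = cong (a k) (Finₚ.punchOut-punchIn p)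

      dot-B : ∀ k x → dot (B k) x ≡ dot (a k) (red x)
      dot-B k x = begin
        dot (B k) x
          ≡⟨ Σ-punchIn p _ ⟩
        B k p * x p + sum (λ i → B k (punchIn p i) * x (punchIn p i))
          ≡⟨ cong₂ _+_ (cong (_* x p) (B-p k)) (Σ-cong (λ i → cong (_* x (punchIn p i)) (B-punch k i))) ⟩
        - (t * d) * x p + s
          ≡⟨ cong (_+ s) (e2 t d (x p)) ⟩
        (x p * t) * (- d) + s
          ≡⟨ e1 (x p) d s t ⟩
        s - (x p * t) * d
          ≡⟨ cong (λ z → s - z) (sym (dot-* (a k) (x p * t) _)) ⟩
        s - dot (a k) (λ i → (x p * t) * v zero (punchIn p i))
          ≡⟨ sym (dot-- (a k) _ _) ⟩
        dot (a k) (red x) ∎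
        where
        d = dot (a k) (λ i → v zero (punchIn p i))
        s = dot (a k) (λ i → x (punchIn p i))

      S : (Fin (suc n) → ℚ) → Fin (suc n) → ℚ
      S x j = sum (λ k → dot (B k) x * v (suc k) j)

      A : Fin (suc n) → Fin (suc n) → ℚ
      -- What the other vectors leave over is a multiple of `v zero`; the multiple is its coordinate
      -- `p` divided by the pivot.
      A zero    j = t * (δ p j - sum (λ k → v (suc k) p * B k j))
      A (suc k) = B k

      dot-A0 : ∀ x → dot (A zero) x ≡ t * (x p - S x p)
      dot-A0 x = begin
        dot (A zero) x ≡⟨ dot-comm (A zero) x ⟩
        dot x (A zero) ≡⟨ dot-* x t _ ⟩
        t * dot x (λ j → δ p j - sum (λ k → v (suc k) p * B k j)) ≡⟨ cong (t *_) (dot-- x (δ p) _) ⟩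
        t * (dot x (δ p) - dot x (λ j → sum (λ k → v (suc k) p * B k j)))
          ≡⟨ cong (t *_) (cong₂ _-_ (dot-δ x p) (trans (dot-Σ x (λ k → v (suc k) p) B)
               (Σ-cong (λ k → trans (*-comm (v (suc k) p) _) (cong (_* v (suc k) p) (dot-comm x (B k))))))) ⟩
        t * (x p - S x p) ∎

      dotB-v0 : ∀ k → dot (B k) (v zero) ≡ 0ℚ
      dotB-v0 k = trans (dot-B k (v zero)) (dot-0 (a k) red-v0)

      dotB-v : ∀ k l → dot (B k) (v (suc l)) ≡ δ k l
      dotB-v k l = trans (dot-B k (v (suc l))) (dual k l)

      dualA : ∀ k l → dot (A k) (v l) ≡ δ k l
      dualA zero zero = begin
        dot (A zero) (v zero)           ≡⟨ dot-A0 (v zero) ⟩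
        t * (v zero p - S (v zero) p)   ≡⟨ cong (λ z → t * (v zero p - z)) (Σ-0 (λ k → trans (cong (_* v (suc k) p) (dotB-v0 k)) (zeroˡ (v (suc k) p)))) ⟩
        t * (v zero p - 0ℚ)             ≡⟨ cong (t *_) (trans (cong (v zero p +_) neg-0) (+-identityʳ (v zero p))) ⟩
        t * v zero p                    ≡⟨ tv ⟩
        1ℚ ∎
      dualA zero (suc l) = begin
        dot (A zero) (v (suc l))                ≡⟨ dot-A0 (v (suc l)) ⟩
        t * (v (suc l) p - S (v (suc l)) p)     ≡⟨ cong (λ z → t * (v (suc l) p - z)) (trans (Σ-cong (λ k → cong (_* v (suc k) p) (trans (dotB-v k l) (δ-sym k l)))) (Σ-δ l (λ k → v (suc k) p))) ⟩
        t * (v (suc l) p - v (suc l) p)         ≡⟨ cong (t *_) (+-inverseʳ (v (suc l) p)) ⟩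
        t * 0ℚ                                  ≡⟨ zeroʳ t ⟩
        0ℚ ∎
      dualA (suc k) zero = dotB-v0 k
      dualA (suc k) (suc l) = trans (dotB-v k l) (sym (δ-suc k l))

      spanA : ∀ x j → sum (λ k → dot (A k) x * v k j) ≡ x j
      spanA x j = trans (sum-suc _) (trans (cong (λ z → z * v zero j + S x j) (dot-A0 x)) (go (punchView p j)))
        where
        go : ∀ {j} → PunchView p j → t * (x p - S x p) * v zero j + S x j ≡ x j
        go same = begin
          t * (x p - S x p) * v zero p + S x p    ≡⟨ cong (_+ S x p) (e4 t (x p) (S x p) (v zero p)) ⟩
          (x p - S x p) * (t * v zero p) + S x p  ≡⟨ cong (λ z → (x p - S x p) * z + S x p) tv ⟩
          (x p - S x p) * 1ℚ + S x p              ≡⟨ e5 (x p) (S x p) ⟩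
          x p ∎
        go (other i) = begin
          t * (x p - S x p) * vi + S x pi         ≡⟨ e6 t (x p) (S x p) vi (S x pi) ⟩
          (x p * t) * vi + (S x pi - (S x p * t) * vi)
            ≡⟨ cong (λ z → (x p * t) * vi + z) (sym sp) ⟩
          (x p * t) * vi + sum (λ k → dot (B k) x * w k i)
            ≡⟨ cong (λ z → (x p * t) * vi + z) (trans (Σ-cong (λ k → cong (_* w k i) (dot-B k x))) (span (red x) i)) ⟩
          (x p * t) * vi + (x pi - (x p * t) * vi)
            ≡⟨ e7 ((x p * t) * vi) (x pi) ⟩
          x pi ∎
          where
          pi = punchIn p i
          vi = v zero pi
          sp : sum (λ k → dot (B k) x * w k i) ≡ S x pi - (S x p * t) * vi
          sp = trans (Σ-cong (λ k → e8 (dot (B k) x) (v (suc k) pi) (v (suc k) p) t vi))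
                 (trans (Σ-- _ _) (cong (λ z → S x pi - z) (trans (Σ-*ʳ (t * vi) (λ k → dot (B k) x * v (suc k) p)) (e9 (S x p) t vi))))

    fromRelation : Relation w → Relation v
    fromRelation (μ , (k₀ , μk₀) , rel) = μ' , (suc k₀ , μk₀) , λ j → go (punchView p j)
      where
      R : ℚ
      R = sum (λ k → μ k * v (suc k) p)
      μ' : Fin (suc n) → ℚ
      -- Forced by coordinate `p`, on which the relation among the reduced vectors says nothing.
      μ' zero    = - (R * t)
      μ' (suc k) = μ k
      opaque
        unfolding _+_
        f1 : ∀ r t v → - (r * t) * v + r ≡ r - r * (t * v)
        f1 = solve-∀ ringℚ
        f2 : ∀ r → r - r * 1ℚ ≡ 0ℚ
        f2 = solve-∀ ringℚ
        f3 : ∀ r t v s → - (r * t) * v + s ≡ s - r * (t * v)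
        f3 = solve-∀ ringℚ
      go : ∀ {j} → PunchView p j → sum (λ k → μ' k * v k j) ≡ 0ℚ
      go same = trans (sum-suc _) (trans (f1 R t (v zero p)) (trans (cong (λ z → R - R * z) tv) (f2 R)))
      go (other i) = trans (sum-suc _) (begin
        - (R * t) * vi + sum (λ k → μ k * v (suc k) pi) ≡⟨ f3 R t vi _ ⟩
        sum (λ k → μ k * v (suc k) pi) - R * (t * vi)   ≡⟨ cong (λ z → sum (λ k → μ k * v (suc k) pi) - z) (sym (Σ-*ʳ (t * vi) (λ k → μ k * v (suc k) p))) ⟩
        sum (λ k → μ k * v (suc k) pi) - sum (λ k → (μ k * v (suc k) p) * (t * vi)) ≡⟨ sym (Σ-- _ _) ⟩
        sum (λ k → μ k * v (suc k) pi - (μ k * v (suc k) p) * (t * vi)) ≡⟨ Σ-cong (λ k → sym (e8 (μ k) (v (suc k) pi) (v (suc k) p) t vi)) ⟩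
        sum (λ k → μ k * w k i) ≡⟨ rel i ⟩
        0ℚ ∎)
        where
        pi = punchIn p i
        vi = v zero pi

  opaque
    -- Gaussian elimination. Failure is reported as an explicit dependency, which is what affine
    -- independence can refute.
    invertible? : ∀ {n} (v : Fin n → Fin n → ℚ) → Inverse v ⊎ Relation v
    invertible? {zero} v = inj₁ ((λ ()) , (λ ()) , λ x ())
    invertible? {suc n} v with Finₚ.all? (λ j → v zero j ≟ 0ℚ)
    ... | yes z = inj₂ (δ zero , (zero , λ e → 1≢0 (trans (sym (δ-refl (zero {n}))) e)) , λ j → trans (Σ-δ zero (λ k → v k j)) (z j))
    ... | no ¬z with Finₚ.¬∀⟶∃¬ (suc n) (λ j → v zero j ≡ 0ℚ) (λ j → v zero j ≟ 0ℚ) ¬z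
    ... | p , v0p≢0 with invertible? (Eliminate.w v p (recip (v zero p)) (*-recip v0p≢0))
    ... | inj₁ i = inj₁ (Eliminate.fromInverse v p _ (*-recip v0p≢0) i)
    ... | inj₂ r = inj₂ (Eliminate.fromRelation v p _ (*-recip v0p≢0) r)

  -- The coordinates are determined by `idx` (see `co-≡idx`), but `inv` and the proofs are not equal
  -- on the nose; bases are therefore enumerated and compared through `idx`.
  record Basis {m D : ℕ} (g : Fin m → Fin D → ℚ) : Set where
    no-eta-equality
    field
      idx  : Vec (Fin m) D
      inv  : Fin D → Fin D → ℚ
    ix : Fin D → Fin m
    ix = lookup idx
    co : Fin D → (Fin D → ℚ) → ℚ
    co k x = dot (inv k) x
    field
      dual : ∀ k l → co k (g (ix l)) ≡ δ k l
      span : ∀ x j → sum (λ k → co k x * g (ix k) j) ≡ x j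

    -- The linear functional taking the value f i at each basis vector g i.
    val : (Fin m → ℚ) → (Fin D → ℚ) → ℚ
    val f x = sum (λ k → co k x * f (ix k))

    co-unique : ∀ {x : Fin D → ℚ} (μ : Fin D → ℚ) → (∀ j → x j ≡ sum (λ k → μ k * g (ix k) j)) → ∀ k → co k x ≡ μ k
    co-unique {x} μ p k = begin
      co k x                                    ≡⟨ dot-cong p ⟩
      co k (λ j → sum (λ l → μ l * g (ix l) j)) ≡⟨ dot-Σ (inv k) μ (λ l → g (ix l)) ⟩
      sum (λ l → μ l * co k (g (ix l)))         ≡⟨ Σ-cong (λ l → trans (cong (μ l *_) (trans (dual k l) (δ-sym k l))) refl) ⟩
      sum (λ l → μ l * δ l k)                   ≡⟨ Σ-δʳ k μ ⟩
      μ k ∎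

    val-Σ : ∀ {n} f (c : Fin n → ℚ) (v : Fin n → Fin D → ℚ) →
      val f (λ j → sum (λ k → c k * v k j)) ≡ sum (λ k → c k * val f (v k))
    val-Σ f c v = begin
      sum (λ l → co l (λ j → sum (λ k → c k * v k j)) * f (ix l)) ≡⟨ Σ-cong (λ l → trans (cong (_* f (ix l)) (dot-Σ (inv l) c v)) (sym (Σ-*ʳ (f (ix l)) _))) ⟩
      sum (λ l → sum (λ k → (c k * co l (v k)) * f (ix l)))       ≡⟨ Σ-swap _ ⟩
      sum (λ k → sum (λ l → (c k * co l (v k)) * f (ix l)))       ≡⟨ Σ-cong (λ k → trans (Σ-cong (λ l → *-assoc (c k) _ _)) (Σ-* (c k) _)) ⟩
      sum (λ k → c k * val f (v k)) ∎

    val-cong : ∀ f {x y : Fin D → ℚ} → (∀ j → x j ≡ y j) → val f x ≡ val f y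
    val-cong f p = Σ-cong (λ k → cong (_* f (ix k)) (dot-cong p))

    val-basis : ∀ f l → val f (g (ix l)) ≡ f (ix l)
    val-basis f l = trans (Σ-cong (λ k → cong (_* f (ix k)) (trans (dual k l) (δ-sym k l)))) (Σ-δ l (λ k → f (ix k)))

    ix-injective : ∀ {k l} → ix k ≡ ix l → k ≡ l
    ix-injective {k} {l} e with k Finₚ.≟ l
    ... | yes p = p
    ... | no q = ⊥-elim (1≢0 (trans (sym (trans (dual k k) (δ-refl k))) (trans (cong (λ i → co k (g i)) e) (trans (dual k l) (δ-≢ q)))))

  open Basis

  co-≡idx : ∀ {m D} {g : Fin m → Fin D → ℚ} (B B' : Basis g) → idx B ≡ idx B' → ∀ k x → co B k x ≡ co B' k x
  co-≡idx {g = g} B B' e k x = co-unique B (λ k → co B' k x) (λ j → trans (sym (span B' x j)) (Σ-cong (λ l → cong (λ is → co B' l x * g (lookup is l) j) (sym e)))) k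

  opaque
    basis? : ∀ {m D} (g : Fin m → Fin D → ℚ) (is : Vec (Fin m) D) → Dec (Σ (Basis g) λ B → idx B ≡ is)
    basis? g is with invertible? (λ k → g (lookup is k))
    ... | inj₁ (a , d , s) = yes (record { idx = is ; inv = a ; dual = d ; span = s } , refl)
    ... | inj₂ (μ , (k , μk) , rel) = no λ where
      (B , refl) → μk (trans (sym (co-unique B {λ _ → 0ℚ} μ (λ j → sym (rel j)) k)) (dot-0 (inv B k) (λ _ → refl)))

  module Pivot {m D} {g : Fin m → Fin D → ℚ} (B : Basis g) (k : Fin D) (i : Fin m) (T≢0 : co B k (g i) ≢ 0ℚ) where
    T u : ℚ
    T = co B k (g i)
    u = recip T

    Tu : T * u ≡ 1ℚ
    Tu = *-recip T≢0

    -- The eta column of the revised simplex method: subtracting `η l` times the `k`-th coordinate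
    -- divides the `k`-th coordinate by the pivot `T` and corrects all others by one formula.
    η : Fin D → ℚ
    η l = (co B l (g i) - δ k l) * u

    inv' : Fin D → Fin D → ℚ
    inv' l j = inv B l j - η l * inv B k j

    idx' : Vec (Fin m) D
    idx' = idx B Vec.[ k ]≔ i

    co' : Fin D → (Fin D → ℚ) → ℚ
    co' l x = dot (inv' l) x

    co'≡ : ∀ l x → co' l x ≡ co B l x - η l * co B k x
    co'≡ l x = trans (dot-comm (inv' l) x) (trans (dot-- x _ _) (cong₂ _-_ (dot-comm x (inv B l)) (trans (dot-* x (η l) (inv B k)) (cong (η l *_) (dot-comm x (inv B k))))))

    ix'-k : lookup idx' k ≡ i
    ix'-k = Vecₚ.lookup∘updateAt k (idx B)

    ix'-≢ : ∀ {l} → l ≢ k → lookup idx' l ≡ ix B l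
    ix'-≢ {l} q = Vecₚ.lookup∘updateAt′ l k q (idx B)

    f' : (Fin m → ℚ) → Fin D → ℚ
    f' f l = f (lookup idx' l)

    f'≡ : ∀ f l → f' f l ≡ f (ix B l) + δ k l * (f i - f (ix B k))
    f'≡ f l with k Finₚ.≟ l
    ... | yes refl = trans (cong f ix'-k) (g1 (f i) (f (ix B k)))
      where
      opaque
        unfolding _+_
        g1 : ∀ a b → a ≡ b + 1ℚ * (a - b)
        g1 = solve-∀ ringℚ
    ... | no q = trans (cong f (ix'-≢ (λ e → q (sym e)))) (g2 (f (ix B l)) (f i - f (ix B k)))
      where
      opaque
        unfolding _+_
        g2 : ∀ a b → a ≡ a + 0ℚ * b
        g2 = solve-∀ ringℚ

    opaque
      unfolding _+_
      h1 : ∀ c η c₀ f d e → (c - η * c₀) * (f + d * e) ≡ (c * f - c₀ * (η * f)) + d * ((c - η * c₀) * e)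
      h1 = solve-∀ ringℚ
      h2 : ∀ G d u f → ((G - d) * u) * f ≡ u * (G * f) - u * (d * f)
      h2 = solve-∀ ringℚ
      h3 : ∀ A c₀ u V F T fi → (A - c₀ * (u * V - u * F)) + (c₀ - ((T - 1ℚ) * u) * c₀) * (fi - F) ≡ (A + (c₀ * u) * (fi - V)) + (c₀ * (fi - F)) * (1ℚ - T * u)
      h3 = solve-∀ ringℚ
      h4 : ∀ a b → a + b * (1ℚ - 1ℚ) ≡ a
      h4 = solve-∀ ringℚ

    -- The change is the ratio `co B k x / T` times the reduced cost of the entering generator. For
    -- `f` a coordinate of the generators the reduced cost is zero, and the identity says that the
    -- new basis spans.
    val' : ∀ f x → sum (λ l → co' l x * f (lookup idx' l)) ≡ val B f x + (co B k x * u) * (f i - val B f (g i))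
    val' f x = begin
      sum (λ l → co' l x * f' f l)
        ≡⟨ Σ-cong (λ l → trans (cong₂ _*_ (co'≡ l x) (f'≡ f l)) (h1 (co B l x) (η l) c₀ (f (ix B l)) (δ k l) (f i - F))) ⟩
      sum (λ l → (co B l x * f (ix B l) - c₀ * (η l * f (ix B l))) + δ k l * ((co B l x - η l * c₀) * (f i - F)))
        ≡⟨ trans (Σ-+ _ _) (cong₂ _+_ (trans (Σ-- _ _) (cong (λ z → val B f x - z) (trans (Σ-* c₀ _) (cong (c₀ *_) Ση)))) (Σ-δ k _)) ⟩
      (val B f x - c₀ * (u * V - u * F)) + (c₀ - η k * c₀) * (f i - F)
        ≡⟨ cong (λ z → (val B f x - c₀ * (u * V - u * F)) + (c₀ - ((T - z) * u) * c₀) * (f i - F)) (δ-refl k) ⟩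
      (val B f x - c₀ * (u * V - u * F)) + (c₀ - ((T - 1ℚ) * u) * c₀) * (f i - F)
        ≡⟨ h3 (val B f x) c₀ u V F T (f i) ⟩
      (val B f x + (c₀ * u) * (f i - V)) + (c₀ * (f i - F)) * (1ℚ - T * u)
        ≡⟨ trans (cong (λ z → (val B f x + (c₀ * u) * (f i - V)) + (c₀ * (f i - F)) * (1ℚ - z)) Tu) (h4 _ _) ⟩
      val B f x + (c₀ * u) * (f i - V) ∎
      where
      c₀ = co B k x
      F = f (ix B k)
      V = val B f (g i)
      Ση : sum (λ l → η l * f (ix B l)) ≡ u * V - u * F
      Ση = trans (Σ-cong (λ l → h2 (co B l (g i)) (δ k l) u (f (ix B l)))) (trans (Σ-- _ _) (cong₂ _-_ (Σ-* u _) (trans (Σ-* u _) (cong (u *_) (Σ-δ k (λ l → f (ix B l)))))))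

    pivot : Basis g
    pivot = record { idx = idx' ; inv = inv' ; dual = dual' ; span = span' }
      where
      opaque
        unfolding _+_
        h6 : ∀ a b → a - b * 0ℚ ≡ a
        h6 = solve-∀ ringℚ
        h7 : ∀ G d u T → G - ((G - d) * u) * T ≡ d + (G - d) * (1ℚ - T * u)
        h7 = solve-∀ ringℚ
      span' : ∀ x j → sum (λ l → co' l x * g (lookup idx' l) j) ≡ x j
      span' x j = trans (val' (λ i → g i j) x) (trans (cong₂ (λ a b → a + (co B k x * u) * (g i j - b)) (span B x j) (span B (g i) j)) (lem _ _ _))
        where
        opaque
          unfolding _+_
          lem : ∀ a b c → a + b * (c - c) ≡ a
          lem = solve-∀ ringℚ
      dual' : ∀ l n → co' l (g (lookup idx' n)) ≡ δ l n
      dual' l n with n Finₚ.≟ k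
      ... | no q = begin
        co' l (g (lookup idx' n))      ≡⟨ cong (λ i → co' l (g i)) (ix'-≢ q) ⟩
        co' l (g (ix B n))             ≡⟨ co'≡ l _ ⟩
        co B l (g (ix B n)) - η l * co B k (g (ix B n)) ≡⟨ cong₂ (λ a b → a - η l * b) (dual B l n) (trans (dual B k n) (δ-≢ (λ e → q (sym e)))) ⟩
        δ l n - η l * 0ℚ               ≡⟨ h6 (δ l n) (η l) ⟩
        δ l n ∎
      ... | yes refl = begin
        co' l (g (lookup idx' n))      ≡⟨ cong (λ i → co' l (g i)) ix'-k ⟩
        co' l (g i)                    ≡⟨ co'≡ l _ ⟩
        co B l (g i) - ((co B l (g i) - δ n l) * u) * T ≡⟨ h7 (co B l (g i)) (δ n l) u T ⟩
        δ n l + (co B l (g i) - δ n l) * (1ℚ - T * u)   ≡⟨ trans (cong (λ z → δ n l + (co B l (g i) - δ n l) * (1ℚ - z)) Tu) (h4 _ _) ⟩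
        δ n l                          ≡⟨ δ-sym n l ⟩
        δ l n ∎

-- Lexicographic signs and their realisation by small positive weights.

module Lexicographic where
  open import Data.Rational using (_≤_; _<_)
  open Rationals
  open LinearAlgebra using (dot)

  -- The sign of z₀ + z₁ε + z₂ε² + ... for an infinitesimal ε > 0.
  LexPos : ∀ {r} → (Fin r → ℚ) → Set
  LexPos {zero}  z = ⊥
  LexPos {suc r} z = 0ℚ < z zero ⊎ (z zero ≡ 0ℚ × LexPos (λ j → z (suc j)))

  lex-tri : ∀ {r} (z : Fin r → ℚ) → LexPos z ⊎ (∀ j → z j ≡ 0ℚ) ⊎ LexPos (λ j → - z j)
  lex-tri {zero}  z = inj₂ (inj₁ (λ ()))
  lex-tri {suc r} z with <-cmp 0ℚ (z zero)
  ... | tri< p _ _ = inj₁ (inj₁ p)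
  ... | tri> _ _ p = inj₂ (inj₂ (inj₁ (0<neg p)))
  ... | tri≈ _ p _ with lex-tri (λ j → z (suc j))
  ... | inj₁ q = inj₁ (inj₂ (sym p , q))
  ... | inj₂ (inj₂ q) = inj₂ (inj₂ (inj₂ (trans (cong -_ (sym p)) neg-0 , q)))
  ... | inj₂ (inj₁ q) = inj₂ (inj₁ λ { zero → sym p ; (suc j) → q j })

  lex-cong : ∀ {r} {z z' : Fin r → ℚ} → (∀ j → z j ≡ z' j) → LexPos z → LexPos z'
  lex-cong {suc r} p (inj₁ q) = inj₁ (subst (0ℚ <_) (p zero) q)
  lex-cong {suc r} p (inj₂ (e , q)) = inj₂ (trans (sym (p zero)) e , lex-cong (λ j → p (suc j)) q)

  lex-head : ∀ {r} {z : Fin (suc r) → ℚ} → LexPos z → 0ℚ ≤ z zero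
  lex-head (inj₁ p) = <⇒≤ p
  lex-head (inj₂ (e , _)) = ≤-reflexive (sym e)

  lex-asym : ∀ {r} {z : Fin r → ℚ} → LexPos z → LexPos (λ j → - z j) → ⊥
  lex-asym {suc r} {z} (inj₁ p) (inj₁ q) = <-asym q (neg<0 p)
  lex-asym {suc r} {z} (inj₁ p) (inj₂ (e , _)) = <⇒≢ (neg<0 p) e
  lex-asym {suc r} {z} (inj₂ (e , _)) (inj₁ q) = <⇒≢ q (sym (trans (cong -_ e) neg-0))
  lex-asym {suc r} {z} (inj₂ (_ , p)) (inj₂ (_ , q)) = lex-asym p q

  lexPos? : ∀ {r} (z : Fin r → ℚ) → Dec (LexPos z)
  lexPos? {zero} z = no λ ()
  lexPos? {suc r} z with <-cmp 0ℚ (z zero)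
  ... | tri< p _ _ = yes (inj₁ p)
  ... | tri> ¬p ¬e _ = no λ { (inj₁ p) → ¬p p ; (inj₂ (e , _)) → ¬e (sym e) }
  ... | tri≈ ¬p e _ with lexPos? (λ j → z (suc j))
  ... | yes q = yes (inj₂ (sym e , q))
  ... | no ¬q = no λ { (inj₁ p) → ¬p p ; (inj₂ (_ , q)) → ¬q q }

  private
    abs : ℚ → ℚ
    abs t with 0ℚ ≤? t
    ... | yes _ = t
    ... | no _ = - t

    abs-nonneg : ∀ t → 0ℚ ≤ abs t
    abs-nonneg t with 0ℚ ≤? t
    ... | yes p = p
    ... | no ¬p = <⇒≤ (0<neg (≰⇒> ¬p))

    abs-bound : ∀ t → 0ℚ ≤ t + abs t
    abs-bound t with 0ℚ ≤? t
    ... | yes p = 0≤+ p p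
    ... | no ¬p = ≤-reflexive (sym (+-inverseʳ t))

    -- The threshold is a / (|t| + 1). The conclusion covers all smaller d, so that finitely many
    -- thresholds can be merged by taking their minimum.
    small₁ : ∀ a t → 0ℚ < a → ∃[ e ] (0ℚ < e × (∀ d → 0ℚ < d → d ≤ e → 0ℚ < a + d * t))
    small₁ a t 0<a = f , 0<* 0<a (recip-pos 0<s) , go
      where
      s = abs t + 1ℚ
      f = a * recip s
      0<s : 0ℚ < s
      0<s = 0≤+< (abs-nonneg t) 0<1
      opaque
        unfolding _+_
        e1 : ∀ a d t s f → a + d * t ≡ (a - f * (s + 1ℚ)) + ((d * (t + s) + d) + (f - d) * (s + 1ℚ))
        e1 = solve-∀ ringℚ
        e2 : ∀ a r s → a - (a * r) * s ≡ a * (1ℚ - s * r)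
        e2 = solve-∀ ringℚ
      fe : a - f * s ≡ 0ℚ
      fe = trans (e2 a (recip s) s) (trans (cong (λ z → a * (1ℚ - z)) (*-recip (>⇒≢ 0<s))) (trans (cong (a *_) (+-inverseʳ 1ℚ)) (zeroʳ a)))
      go : ∀ d → 0ℚ < d → d ≤ f → 0ℚ < a + d * t
      go d 0<d d≤f = subst (0ℚ <_) (sym (trans (e1 a d t (abs t) f) (trans (cong (_+ r) fe) (+-identityˡ r))))
        (0<+≤ (0≤+< (0≤* (<⇒≤ 0<d) (abs-bound t)) 0<d) (0≤* (≤⇒0≤- d≤f) (<⇒≤ 0<s)))
        where
        r = (d * (t + abs t) + d) + (f - d) * s

    small : ∀ {A : Set} (xs : List A) (a t : A → ℚ) →
      ∃[ e ] (0ℚ < e × (∀ x → x ∈ xs → 0ℚ < a x → ∀ d → 0ℚ < d → d ≤ e → 0ℚ < a x + d * t x))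
    small [] a t = 1ℚ , 0<1 , λ x ()
    small (y ∷ xs) a t with small xs a t | 0ℚ <? a y
    ... | e , 0<e , p | no ¬q = e , 0<e , λ { x (here refl) q → ⊥-elim (¬q q) ; x (there m) → p x m }
    ... | e , 0<e , p | yes q with small₁ (a y) (t y) q
    ... | f , 0<f , r with ℚₚ.≤-total e f
    ... | inj₁ e≤f = e , 0<e , λ { x (here refl) _ d 0<d d≤e → r d 0<d (≤-trans d≤e e≤f) ; x (there m) → p x m }
    ... | inj₂ f≤e = f , 0<f , λ { x (here refl) _ → r ; x (there m) q' d 0<d d≤f → p x m q' d 0<d (≤-trans d≤f f≤e) }

  -- ω = (1, ε, ε², …) with ε small enough for the finitely many vectors z x.
  opaque
    lex-generic : ∀ {A : Set} {r} (xs : List A) (z : A → Fin r → ℚ) →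
      Σ (Fin r → ℚ) λ ω → (∀ j → 0ℚ < ω j) × (∀ x → x ∈ xs → LexPos (z x) → 0ℚ < dot (z x) ω)
    lex-generic {r = zero}  xs z = (λ ()) , (λ ()) , λ x _ ()
    lex-generic {r = suc r} xs z with lex-generic xs (λ x j → z x (suc j))
    ... | ω , 0<ω , p with small xs (λ x → z x zero) (λ x → dot (λ j → z x (suc j)) ω)
    ... | e , 0<e , q = ω' , 0<ω' , go
      where
      ω' : Fin (suc r) → ℚ
      ω' zero = 1ℚ
      ω' (suc j) = e * ω j
      0<ω' : ∀ j → 0ℚ < ω' j
      0<ω' zero = 0<1
      0<ω' (suc j) = 0<* 0<e (0<ω j)
      opaque
        unfolding _+_
        e1 : ∀ z e w → z * (e * w) ≡ e * (z * w)
        e1 = solve-∀ ringℚ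
      eq : ∀ x → dot (z x) ω' ≡ z x zero + e * dot (λ j → z x (suc j)) ω
      eq x = trans (sum-suc _) (cong₂ _+_ (trans (*-comm _ 1ℚ) (*-identityˡ _)) (trans (Σ-cong (λ j → e1 _ _ _)) (Σ-* e _)))
      go : ∀ x → x ∈ xs → LexPos (z x) → 0ℚ < dot (z x) ω'
      go x m (inj₁ 0<z) = subst (0ℚ <_) (sym (eq x)) (q x m 0<z e 0<e ≤-refl)
      go x m (inj₂ (z0 , l)) = subst (0ℚ <_) (sym (trans (eq x) (trans (cong (_+ e * dot (λ j → z x (suc j)) ω) z0) (+-identityˡ _)))) (0<* 0<e (p x m l))

-- Linear programs: optimal bases, the simplex method and generic costs.

module LinearPrograms where
  open import Data.Rational using (_≤_; _<_)
  open Rationals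
  open LinearAlgebra
  open Lexicographic
  open Basis

  allVecs : ∀ m n → List (Vec (Fin m) n)
  allVecs m zero    = [] ∷ []
  allVecs m (suc n) = List.cartesianProductWith _∷_ (List.allFin m) (allVecs m n)

  ∈-allVecs : ∀ {m n} (is : Vec (Fin m) n) → is ∈ allVecs m n
  ∈-allVecs [] = here refl
  ∈-allVecs (i ∷ is) = ∈ₚ.∈-cartesianProductWith⁺ _∷_ (∈ₚ.∈-allFin i) (∈-allVecs is)

  opaque
    argmin : ∀ {A : Set} (f : A → ℚ) (xs : List A) {x₀} → x₀ ∈ xs → ∃[ x ] (x ∈ xs × (∀ y → y ∈ xs → f x ≤ f y))
    argmin f (x ∷ []) _ = x , here refl , λ { y (here refl) → ≤-refl }
    argmin f (x ∷ x' ∷ xs) _ with argmin f (x' ∷ xs) (here refl)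
    ... | y , y∈ , p with f x ≤? f y
    ... | yes q = x , here refl , λ { z (here refl) → ≤-refl ; z (there m) → ≤-trans q (p z m) }
    ... | no ¬q = y , there y∈ , λ { z (here refl) → <⇒≤ (≰⇒> ¬q) ; z (there m) → p z m }

  opaque
    representatives : ∀ {A : Set} {R : A → A → Set} → (∀ x y → Dec (R x y)) → (∀ x → R x x) → (xs : List A) →
      Σ (List A) λ ys → (∀ y → y ∈ ys → y ∈ xs) × (∀ x → x ∈ xs → ∃[ y ] (y ∈ ys × R x y)) × AllPairs (λ x y → ¬ R x y) ys
    representatives R? R-refl [] = [] , (λ _ ()) , (λ _ ()) , []
    representatives {R = R} R? R-refl (x ∷ xs) with representatives R? R-refl xs
    ... | ys , sub , cover , pairs with All.all? (λ y → Relation.Nullary.¬? (R? x y)) ys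
    ... | yes new = x ∷ ys , (λ { y (here e) → here e ; y (there m) → there (sub y m) }) ,
          (λ { y (here refl) → y , here refl , R-refl y ; y (there m) → let z , z∈ , r = cover y m in z , there z∈ , r }) , new ∷ pairs
    ... | no ¬new = ys , (λ y m → there (sub y m)) , (λ { y (here refl) → found ; y (there m) → cover y m }) , pairs
      where
      search : ∀ zs → ¬ All (λ y → ¬ R x y) zs → ∃[ y ] (y ∈ zs × R x y)
      search [] ¬a = ⊥-elim (¬a [])
      search (z ∷ zs) ¬a with R? x z
      ... | yes r = z , here refl , r
      ... | no ¬r with search zs (λ a → ¬a (¬r ∷ a))
      ... | y , m , r = y , there m , r
      found : ∃[ y ] (y ∈ ys × R x y)
      found = search ys ¬new

  lookup-distinct : ∀ {A : Set} {R : A → A → Set} → (∀ {x y} → R x y → R y x) → (xs : List A) →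
    AllPairs (λ x y → ¬ R x y) xs → ∀ i j → R (List.lookup xs i) (List.lookup xs j) → i ≡ j
  lookup-distinct R-sym (x ∷ xs) (a ∷ ps) zero zero r = refl
  lookup-distinct R-sym (x ∷ xs) (a ∷ ps) zero (suc j) r = ⊥-elim (All.lookup a (∈ₚ.∈-lookup j) r)
  lookup-distinct R-sym (x ∷ xs) (a ∷ ps) (suc i) zero r = ⊥-elim (All.lookup a (∈ₚ.∈-lookup i) (R-sym r))
  lookup-distinct R-sym (x ∷ xs) (a ∷ ps) (suc i) (suc j) r = cong suc (lookup-distinct R-sym xs ps i j r)

  module LinearProgram {m D : ℕ} (g : Fin m → Fin D → ℚ) where

    private
      collect : (xs : List (Vec (Fin m) D)) → Σ (List (Basis g)) λ bs → ∀ (B : Basis g) → idx B ∈ xs → ∃[ B' ] (B' ∈ bs × idx B ≡ idx B')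
      collect [] = [] , λ B ()
      collect (is ∷ xs) with collect xs | basis? g is
      ... | bs , p | yes (B' , e) = B' ∷ bs , λ { B (here e') → B' , here refl , trans e' (sym e) ; B (there m) → let B'' , q , r = p B m in B'' , there q , r }
      ... | bs , p | no ¬b = bs , λ { B (here e') → ⊥-elim (¬b (B , e')) ; B (there m) → p B m }

    opaque
      bases : List (Basis g)
      bases = proj₁ (collect (allVecs m D))

      bases-complete : ∀ (B : Basis g) → ∃[ B' ] (B' ∈ bases × idx B ≡ idx B')
      bases-complete B = proj₂ (collect (allVecs m D)) B (∈-allVecs (idx B))

    -- The reduced cost: how far the cost of a generator lies above the linear functional that
    -- agrees with `c` on the basis.
    rc : Basis g → (Fin m → ℚ) → Fin m → ℚ
    rc B c i = c i - val B c (g i)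

    -- Geometrically, the generators are lifted to the heights `c`, and the basis spans part of a
    -- lower face of the lifted cone; these bases are the cells of the subdivision induced by `c`.
    DualFeasible : (Fin m → ℚ) → Basis g → Set
    DualFeasible c B = ∀ i → 0ℚ ≤ rc B c i

    -- Strict, because degenerate right-hand sides are always perturbed away beforehand.
    Feasible : (Fin D → ℚ) → Basis g → Set
    Feasible b B = ∀ k → 0ℚ < co B k b

    val-≡idx : ∀ (B B' : Basis g) c x → idx B ≡ idx B' → val B c x ≡ val B' c x
    val-≡idx B B' c x e = Σ-cong (λ k → cong₂ _*_ (co-≡idx B B' e k x) (cong (λ is → c (lookup is k)) e))

    rc-≡idx : ∀ (B B' : Basis g) c i → idx B ≡ idx B' → rc B c i ≡ rc B' c i
    rc-≡idx B B' c i e = cong (λ z → c i - z) (val-≡idx B B' c (g i) e)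

    val-change : ∀ (B B' : Basis g) c x → val B c x ≡ sum (λ k → co B' k x * val B c (g (ix B' k)))
    val-change B B' c x = trans (val-cong B c (λ j → sym (span B' x j))) (val-Σ B c (λ k → co B' k x) (λ k → g (ix B' k)))

    -- Weak duality as an identity: when `B` is dual feasible and `B'` has nonnegative coordinates
    -- at `x`, all terms on the left are nonnegative.
    gap : ∀ (B B' : Basis g) c x → sum (λ k → co B' k x * rc B c (ix B' k)) ≡ val B' c x - val B c x
    gap B B' c x = begin
      sum (λ k → co B' k x * (c (ix B' k) - val B c (g (ix B' k))))
        ≡⟨ Σ-cong (λ k → lem (co B' k x) _ _) ⟩
      sum (λ k → co B' k x * c (ix B' k) - co B' k x * val B c (g (ix B' k)))
        ≡⟨ Σ-- _ _ ⟩
      val B' c x - sum (λ k → co B' k x * val B c (g (ix B' k)))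
        ≡⟨ cong (λ z → val B' c x - z) (sym (val-change B B' c x)) ⟩
      val B' c x - val B c x ∎
      where
      opaque
        unfolding _+_
        lem : ∀ a b c → a * (b - c) ≡ a * b - a * c
        lem = solve-∀ ringℚ

    -- Weak duality in both directions makes the two costs at `x` equal, so a sum of nonnegative
    -- terms vanishes, and with it every term.
    complementary-slackness : ∀ {c} {B B' : Basis g} → DualFeasible c B → DualFeasible c B' → ∀ x →
      (∀ k → 0ℚ ≤ co B k x) → (∀ k → 0ℚ ≤ co B' k x) → ∀ k → 0ℚ < co B' k x → rc B c (ix B' k) ≡ 0ℚ
    complementary-slackness {c} {B} {B'} df df' x p p' k 0<k =
      *-cancel-0 (Σ-term0 (λ l → 0≤* (p' l) (df (ix B' l))) (subst (_≤ 0ℚ) (sym (gap B B' c x)) le) k) (>⇒≢ 0<k)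
      where
      opaque
        unfolding _+_
        lem : ∀ a b → 0ℚ - (a - b) ≡ b - a
        lem = solve-∀ ringℚ
      le : val B' c x - val B c x ≤ 0ℚ
      le = 0≤-⇒≤ (subst (0ℚ ≤_) (trans (gap B' B c x) (sym (lem _ _))) (Σ-nonneg (λ l → 0≤* (p l) (df' (ix B l)))))

    -- Equality of the underlying sets of generators: the order in which `idx` lists them does not
    -- affect the cell.
    Same : Basis g → Basis g → Set
    Same B B' = (∀ k → ∃[ l ] ix B k ≡ ix B' l) × (∀ l → ∃[ k ] ix B' l ≡ ix B k)

    same? : ∀ (B B' : Basis g) → Dec (Same B B')
    same? B B' = Finₚ.all? (λ k → Finₚ.any? (λ l → ix B k Finₚ.≟ ix B' l)) Relation.Nullary.×-dec
                 Finₚ.all? (λ l → Finₚ.any? (λ k → ix B' l Finₚ.≟ ix B k))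

    same-refl : ∀ (B : Basis g) → Same B B
    same-refl B = (λ k → k , refl) , (λ k → k , refl)

    same-sym : ∀ {B B' : Basis g} → Same B B' → Same B' B
    same-sym (p , q) = q , p

    co-same : ∀ {B B' : Basis g} → Same B B' → ∀ {k l} → ix B k ≡ ix B' l → ∀ x → co B k x ≡ co B' l x
    co-same {B} {B'} (p , _) {k} {l} e x = begin
      co B k x                                     ≡⟨ sym (Σ-δ k (λ n → co B n x)) ⟩
      sum (λ n → δ k n * co B n x)                 ≡⟨ Σ-cong (λ n → trans (*-comm _ _) (cong (co B n x *_) (sym (eq n)))) ⟩
      sum (λ n → co B n x * co B' l (g (ix B n)))  ≡⟨ sym (dot-Σ (inv B' l) (λ n → co B n x) (λ n → g (ix B n))) ⟩
      co B' l (λ j → sum (λ n → co B n x * g (ix B n) j)) ≡⟨ dot-cong (span B x) ⟩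
      co B' l x ∎
      where
      eq : ∀ n → co B' l (g (ix B n)) ≡ δ k n
      eq n with p n
      ... | n' , en with k Finₚ.≟ n
      ... | yes refl = trans (cong (λ i → co B' l (g i)) e) (trans (dual B' l l) (δ-refl l))
      ... | no k≢n = trans (cong (λ i → co B' l (g i)) en) (trans (dual B' l n') (δ-≢ (λ l≡n' → k≢n (ix-injective B (trans e (trans (cong (ix B') l≡n') (sym en)))))))

    -- The lower faces of the lifted cone are then simplicial, and the induced subdivision is a
    -- triangulation.
    Generic : (Fin m → ℚ) → Set
    Generic c = ∀ (B : Basis g) i → rc B c i ≡ 0ℚ → ∃[ k ] i ≡ ix B k

    -- Since `b` is strictly inside both cells, complementary slackness gives each vector of one
    -- basis reduced cost zero in the other, and genericity makes it a member. This is the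
    -- disjointness of cells.
    optimal-same : ∀ {c} → Generic c → ∀ {B B' : Basis g} → DualFeasible c B → DualFeasible c B' → ∀ b → Feasible b B → Feasible b B' → Same B B'
    optimal-same gen {B} {B'} df df' b f f' =
      (λ k → gen B' _ (complementary-slackness {B = B'} {B} df' df b (λ l → <⇒≤ (f' l)) (λ l → <⇒≤ (f l)) k (f k))) ,
      (λ l → gen B _ (complementary-slackness {B = B} {B'} df df' b (λ l → <⇒≤ (f l)) (λ l → <⇒≤ (f' l)) l (f' l)))

    opaque
      least-ratio : ∀ (b T : Fin D → ℚ) k₁ → 0ℚ < T k₁ → ∃[ k ] (0ℚ < T k × (∀ l → 0ℚ < T l → b k * recip (T k) ≤ b l * recip (T l)))
      least-ratio b T k₁ q₁ with argmin (λ k → b k * recip (T k)) (List.filter (λ k → 0ℚ <? T k) (List.allFin D)) (∈ₚ.∈-filter⁺ (λ k → 0ℚ <? T k) (∈ₚ.∈-allFin k₁) q₁)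
      ... | k , m , p = k , proj₂ (∈ₚ.∈-filter⁻ (λ k → 0ℚ <? T k) {xs = List.allFin D} m) , λ l q → p l (∈ₚ.∈-filter⁺ (λ k → 0ℚ <? T k) (∈ₚ.∈-allFin l) q)

    private
      module Improve (c : Fin m → ℚ) (b : Fin D → ℚ) (nondeg : ∀ (B : Basis g) k → co B k b ≢ 0ℚ) (B : Basis g) (fB : Feasible b B)
        (i : Fin m) (r<0 : rc B c i < 0ℚ) (k : Fin D) (0<T : 0ℚ < co B k (g i))
        (best : ∀ l → 0ℚ < co B l (g i) → co B k b * recip (co B k (g i)) ≤ co B l b * recip (co B l (g i))) where
        module Piv = Pivot B k i (>⇒≢ 0<T)
        t : ℚ
        t = co B k b * recip (co B k (g i))
        0<t : 0ℚ < t
        0<t = 0<* (fB k) (recip-pos 0<T)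
        opaque
          unfolding _+_
          e2 : ∀ b T d s r → b - ((T - d) * s) * r ≡ (b - T * (r * s)) + d * (r * s)
          e2 = solve-∀ ringℚ
          e3 : ∀ b T r t → b - T * t ≡ (b * (1ℚ - T * r)) + T * (b * r - t)
          e3 = solve-∀ ringℚ
          e4 : ∀ b T t → b - T * t ≡ b + (- T) * t
          e4 = solve-∀ ringℚ
          e5 : ∀ b x → b * (1ℚ - 1ℚ) + x ≡ x
          e5 = solve-∀ ringℚ
          e6 : ∀ v t r → v - (v + t * r) ≡ t * (- r)
          e6 = solve-∀ ringℚ
        -- On the way to the new basis the coordinates of `b` fall at the rates given by the column
        -- of `i`; the minimality of the ratio `t` means that none has passed zero.
        keep : ∀ l → 0ℚ ≤ co B l b - co B l (g i) * t
        keep l = go (0ℚ <? co B l (g i))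
          where
          bl = co B l b
          Tl = co B l (g i)
          go : Dec (0ℚ < Tl) → 0ℚ ≤ bl - Tl * t
          go (no ¬q) = subst (0ℚ ≤_) (sym (e4 bl Tl t)) (0≤+ (<⇒≤ (fB l)) (0≤* (0≤neg (≮⇒≥ ¬q)) (<⇒≤ 0<t)))
          go (yes q) = subst (0ℚ ≤_) (sym (trans (e3 bl Tl (recip Tl) t) (trans (cong (λ z → bl * (1ℚ - z) + Tl * (bl * recip Tl - t)) (*-recip (>⇒≢ q))) (e5 bl _))))
                        (0≤* (<⇒≤ q) (≤⇒0≤- (best l q)))
        feasible' : Feasible b Piv.pivot
        feasible' l = ≤∧≢⇒< (subst (0ℚ ≤_) (sym (trans (Piv.co'≡ l b) (e2 (co B l b) (co B l (g i)) (δ k l) (recip (co B k (g i))) (co B k b))))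
            (0≤+ (keep l) (0≤* (δ-nonneg k l) (<⇒≤ 0<t)))) (λ e → nondeg Piv.pivot l (sym e))
        lower : val Piv.pivot c b < val B c b
        lower = 0<-⇒< (subst (0ℚ <_) (sym (trans (cong (λ z → val B c b - z) (Piv.val' c b)) (e6 (val B c b) t (rc B c i)))) (0<* 0<t (0<neg r<0)))

    val-nonpos : ∀ (B : Basis g) c x → (∀ i → 0ℚ ≤ c i) → (∀ k → co B k x ≤ 0ℚ) → val B c x ≤ 0ℚ
    val-nonpos B c x 0≤c p = 0≤-⇒≤ (subst (0ℚ ≤_) (trans (Σ-neg _) (sym (+-identityˡ _)))
      (Σ-nonneg (λ k → subst (0ℚ ≤_) (lem (co B k x) (c (ix B k))) (0≤* (0≤neg (p k)) (0≤c (ix B k))))))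
      where
      opaque
        unfolding _+_
        lem : ∀ a b → (- a) * b ≡ - (a * b)
        lem = solve-∀ ringℚ

    least-cost-optimal : ∀ c → (∀ i → 0ℚ ≤ c i) → ∀ b → (∀ (B : Basis g) k → co B k b ≢ 0ℚ) → ∀ (B : Basis g) → Feasible b B →
      (∀ (B' : Basis g) → Feasible b B' → val B c b ≤ val B' c b) → DualFeasible c B
    least-cost-optimal c 0≤c b nondeg B fB least i = go (0ℚ ≤? rc B c i) (Finₚ.any? (λ k → 0ℚ <? co B k (g i)))
      where
      go : Dec (0ℚ ≤ rc B c i) → Dec (∃[ k ] 0ℚ < co B k (g i)) → 0ℚ ≤ rc B c i
      go (yes p) _ = p
      -- A column without positive entry would be a direction of unbounded improvement; nonnegative
      -- costs forbid it, as the value at `g i` is then at most zero.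
      go (no ¬p) (no none) = 0≤+ (0≤c i) (0≤neg (val-nonpos B c (g i) 0≤c (λ k → ≮⇒≥ (λ q → none (k , q)))))
      go (no ¬p) (yes (k₁ , q₁)) = contra (least-ratio (λ k → co B k b) (λ k → co B k (g i)) k₁ q₁)
        where
        contra : _ → 0ℚ ≤ rc B c i
        contra (k , 0<T , best) = ⊥-elim (<-irrefl refl (<-≤-trans (I.lower) (least I.Piv.pivot I.feasible')))
          where module I = Improve c b nondeg B fB i (≰⇒> ¬p) k 0<T best

    -- The simplex method: a feasible basis of least cost is dual feasible, since otherwise a pivot would lower the cost.
    opaque
      optimal-exists : ∀ c → (∀ i → 0ℚ ≤ c i) → ∀ b → (∀ (B : Basis g) k → co B k b ≢ 0ℚ) → ∀ B₀ → Feasible b B₀ →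
        ∃[ B ] (Feasible b B × DualFeasible c B)
      optimal-exists c 0≤c b nondeg B₀ f₀ = finish (argmin (λ B → val B c b) (List.filter feasible? bases) (proj₁ (proj₂ (listed B₀ f₀))))
        where
        feasible? : ∀ (B : Basis g) → Dec (Feasible b B)
        feasible? B = Finₚ.all? (λ k → 0ℚ <? co B k b)
        listed : ∀ (B : Basis g) → Feasible b B → ∃[ B' ] (B' ∈ List.filter feasible? bases × idx B ≡ idx B')
        listed B f with bases-complete B
        ... | B' , m , e = B' , ∈ₚ.∈-filter⁺ feasible? m (λ k → subst (0ℚ <_) (co-≡idx B B' e k b) (f k)) , e
        finish : (∃[ B ] (B ∈ List.filter feasible? bases × (∀ (B' : Basis g) → B' ∈ List.filter feasible? bases → val B c b ≤ val B' c b))) →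
          ∃[ B ] (Feasible b B × DualFeasible c B)
        finish (B , m , least) = B , fB , least-cost-optimal c 0≤c b nondeg B fB λ B' f →
            let B'' , m' , e = listed B' f in subst (val B c b ≤_) (sym (val-≡idx B' B'' c b e)) (least B'' m')
          where
          fB : Feasible b B
          fB = proj₂ (∈ₚ.∈-filter⁻ feasible? {xs = bases} m)

    rc-Σ : ∀ {r} (B : Basis g) (ω : Fin r → ℚ) (K : Fin r → Fin m → ℚ) i → rc B (λ i → sum (λ j → ω j * K j i)) i ≡ sum (λ j → ω j * rc B (K j) i)
    rc-Σ B ω K i = begin
      sum (λ j → ω j * K j i) - sum (λ k → co B k (g i) * sum (λ j → ω j * K j (ix B k)))
        ≡⟨ cong (λ z → sum (λ j → ω j * K j i) - z) (begin
          sum (λ k → co B k (g i) * sum (λ j → ω j * K j (ix B k))) ≡⟨ Σ-cong (λ k → trans (sym (Σ-* (co B k (g i)) _)) (Σ-cong (λ j → lem _ _ _))) ⟩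
          sum (λ k → sum (λ j → ω j * (co B k (g i) * K j (ix B k)))) ≡⟨ Σ-swap _ ⟩
          sum (λ j → sum (λ k → ω j * (co B k (g i) * K j (ix B k)))) ≡⟨ Σ-cong (λ j → Σ-* (ω j) _) ⟩
          sum (λ j → ω j * val B (K j) (g i)) ∎) ⟩
      sum (λ j → ω j * K j i) - sum (λ j → ω j * val B (K j) (g i)) ≡⟨ sym (Σ-- _ _) ⟩
      sum (λ j → ω j * K j i - ω j * val B (K j) (g i)) ≡⟨ Σ-cong (λ j → lem' _ _ _) ⟩
      sum (λ j → ω j * rc B (K j) i) ∎
      where
      opaque
        unfolding _+_
        lem : ∀ a b c → a * (b * c) ≡ b * (a * c)
        lem = solve-∀ ringℚ
        lem' : ∀ a b c → a * b - a * c ≡ a * (b - c)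
        lem' = solve-∀ ringℚ

    private
      module Perturb (c₀ : Fin m → ℚ) (0≤c₀ : ∀ i → 0ℚ ≤ c₀ i) where
        -- The cost `c₀` dominates; below it every generator receives an infinitesimal cost of an
        -- order of its own.
        K : Fin (suc m) → Fin m → ℚ
        K zero    = c₀
        K (suc j) = λ i → δ i j
        0≤K : ∀ j i → 0ℚ ≤ K j i
        0≤K zero    i = 0≤c₀ i
        0≤K (suc j) i = δ-nonneg i j
        Code : Set
        Code = Bool × (Basis g × Fin m)
        codes : List Code
        codes = List.cartesianProduct (true ∷ false ∷ []) (List.cartesianProduct bases (List.allFin m))
        z : Code → Fin (suc m) → ℚ
        z (true  , B , i) j = rc B (K j) i
        z (false , B , i) j = - rc B (K j) i
        code∈ : ∀ s {B : Basis g} i → B ∈ bases → (s , B , i) ∈ codes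
        code∈ true  i m = ∈ₚ.∈-cartesianProduct⁺ {xs = true ∷ false ∷ []} (here refl) (∈ₚ.∈-cartesianProduct⁺ m (∈ₚ.∈-allFin i))
        code∈ false i m = ∈ₚ.∈-cartesianProduct⁺ {xs = true ∷ false ∷ []} (there (here refl)) (∈ₚ.∈-cartesianProduct⁺ m (∈ₚ.∈-allFin i))

        module _ (ω : Fin (suc m) → ℚ) (signs : ∀ x → x ∈ codes → LexPos (z x) → 0ℚ < dot (z x) ω) where
          c : Fin m → ℚ
          c i = sum (λ j → ω j * K j i)
          rc≡ : ∀ (B : Basis g) i → rc B c i ≡ dot (λ j → rc B (K j) i) ω
          rc≡ B i = trans (rc-Σ B ω K i) (Σ-cong (λ j → *-comm (ω j) _))
          rc-pos : ∀ {B : Basis g} i → B ∈ bases → LexPos (λ j → rc B (K j) i) → 0ℚ < rc B c i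
          rc-pos {B} i m l = subst (0ℚ <_) (sym (rc≡ B i)) (signs _ (code∈ true i m) l)
          rc-neg : ∀ {B : Basis g} i → B ∈ bases → LexPos (λ j → - rc B (K j) i) → 0ℚ < - rc B c i
          rc-neg {B} i m l = subst (0ℚ <_) (trans (dot-comm _ ω) (trans (dot-neg ω _) (cong -_ (trans (dot-comm ω _) (sym (rc≡ B i))))))
            (signs _ (code∈ false i m) l)
          generic : Generic c
          generic B i e = go (bases-complete B) (Finₚ.any? (λ k → i Finₚ.≟ ix B k))
            where
            go : (∃[ B' ] (B' ∈ bases × idx B ≡ idx B')) → Dec (∃[ k ] i ≡ ix B k) → ∃[ k ] i ≡ ix B k
            go _ (yes p) = p
            go (B' , m , e') (no none) = ⊥-elim (split (lex-tri (λ j → rc B' (K j) i)))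
              where
              rc0 : rc B' c i ≡ 0ℚ
              rc0 = trans (sym (rc-≡idx B B' c i e')) e
              -- The unit cost of a generator outside the basis vanishes on the basis, so the vector
              -- of reduced costs cannot be zero.
              one : rc B' (K (suc i)) i ≡ 1ℚ
              one = trans (cong₂ _-_ (δ-refl i) (Σ-0 (λ k → trans (cong (co B' k (g i) *_) (δ-≢ (λ q → none (k , trans (sym q) (cong (λ is → lookup is k) (sym e')))))) (zeroʳ (co B' k (g i))))))
                        (trans (cong (1ℚ +_) neg-0) (+-identityʳ 1ℚ))
              split : LexPos (λ j → rc B' (K j) i) ⊎ (∀ j → rc B' (K j) i ≡ 0ℚ) ⊎ LexPos (λ j → - rc B' (K j) i) → ⊥
              split (inj₁ l) = >⇒≢ (rc-pos i m l) rc0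
              split (inj₂ (inj₂ l)) = >⇒≢ (rc-neg i m l) (trans (cong -_ rc0) neg-0)
              split (inj₂ (inj₁ zr)) = 1≢0 (trans (sym one) (zr (suc i)))
          refine : ∀ (B : Basis g) → DualFeasible c B → DualFeasible c₀ B
          refine B df i = go (bases-complete B)
            where
            go : (∃[ B' ] (B' ∈ bases × idx B ≡ idx B')) → 0ℚ ≤ rc B c₀ i
            go (B' , m , e') = split (lex-tri (λ j → rc B' (K j) i))
              where
              split : LexPos (λ j → rc B' (K j) i) ⊎ (∀ j → rc B' (K j) i ≡ 0ℚ) ⊎ LexPos (λ j → - rc B' (K j) i) → 0ℚ ≤ rc B c₀ i
              split (inj₁ l) = subst (0ℚ ≤_) (sym (rc-≡idx B B' c₀ i e')) (lex-head {z = λ j → rc B' (K j) i} l)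
              split (inj₂ (inj₁ zr)) = ≤-reflexive (sym (trans (rc-≡idx B B' c₀ i e') (zr zero)))
              split (inj₂ (inj₂ l)) = ⊥-elim (<-irrefl refl (≤-<-trans (df i) (subst₂ _<_ (trans (neg-involutive _) (sym (rc-≡idx B B' c i e'))) refl (neg<0 (rc-neg i m l)))))

    opaque
      -- A negative reduced cost for `c₀` would dominate all the smaller terms. Hence the
      -- triangulation induced by `c` refines the subdivision induced by `c₀`, which is how the two
      -- special costs on q keep their effect.
      generic-cost : ∀ c₀ → (∀ i → 0ℚ ≤ c₀ i) → Σ (Fin m → ℚ) λ c →
        (∀ i → 0ℚ ≤ c i) × Generic c × (∀ (B : Basis g) → DualFeasible c B → DualFeasible c₀ B)
      generic-cost c₀ 0≤c₀ with lex-generic codes z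
        where open Perturb c₀ 0≤c₀
      ... | ω , 0<ω , signs = P.c ω signs , (λ i → Σ-nonneg (λ j → 0≤* (<⇒≤ (0<ω j)) (P.0≤K j i))) , P.generic ω signs , P.refine ω signs
        where module P = Perturb c₀ 0≤c₀

    -- The triangulation induced by `c`, with one basis for each cell.
    Cells : (Fin m → ℚ) → Set
    Cells c = Σ ℕ λ t → Σ (Fin t → Basis g) λ T →
      (∀ i → DualFeasible c (T i)) × (∀ (B : Basis g) → DualFeasible c B → ∃[ i ] Same B (T i)) × (∀ i j → Same (T i) (T j) → i ≡ j)

    opaque
      cells : ∀ c → Cells c
      cells c = from-representatives (representatives same? same-refl (List.filter df? bases))
        where
        df? : ∀ (B : Basis g) → Dec (DualFeasible c B)
        df? B = Finₚ.all? (λ i → 0ℚ ≤? rc B c i)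
        from-representatives : (Σ (List (Basis g)) λ ys → (∀ y → y ∈ ys → y ∈ List.filter df? bases) ×
          (∀ x → x ∈ List.filter df? bases → ∃[ y ] (y ∈ ys × Same x y)) × AllPairs (λ x y → ¬ Same x y) ys) → Cells c
        from-representatives (ys , sub , cover , pairs) =
          length ys , List.lookup ys , (λ i → proj₂ (∈ₚ.∈-filter⁻ df? {xs = bases} (sub _ (∈ₚ.∈-lookup i)))) ,
          complete , lookup-distinct (λ {B} {B'} → same-sym {B} {B'}) ys pairs
          where
          complete : ∀ (B : Basis g) → DualFeasible c B → ∃[ i ] Same B (List.lookup ys i)
          complete B df with bases-complete B
          ... | B' , m , e with cover B' (∈ₚ.∈-filter⁺ df? m (λ i → subst (0ℚ ≤_) (rc-≡idx B B' c i e) (df i)))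
          ... | B'' , m' , (p , q) = Any.index m' , subst (Same B) (Anyₚ.lookup-index m')
            ((λ k → let l , r = p k in l , trans (cong (λ is → lookup is k) e) r) , (λ l → let k , r = q l in k , trans r (cong (λ is → lookup is k) (sym e))))

-- Finite cardinalities, and counting along the generators of a cone.

module Cardinality where
  open import Data.Rational using (_≤_; _<_)
  open Equivalence using (to; from)

  -- `LatticeCount V n` is the instance with `InDilate V n` for `P`.
  Card : ∀ {A : Set} → (A → Set) → ℕ → Set
  Card {A} P k = Σ (List A) λ xs → Unique xs × (∀ x → (x ∈ xs) ⇔ P x) × (length xs ≡ k)

  private
    lookup-unique : ∀ {A : Set} {xs : List A} → Unique xs → ∀ i j → List.lookup xs i ≡ List.lookup xs j → i ≡ j
    lookup-unique (a ∷ u) zero zero e = refl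
    lookup-unique (a ∷ u) zero (suc j) e = ⊥-elim (All.lookup a (∈ₚ.∈-lookup j) e)
    lookup-unique (a ∷ u) (suc i) zero e = ⊥-elim (All.lookup a (∈ₚ.∈-lookup i) (sym e))
    lookup-unique (a ∷ u) (suc i) (suc j) e = cong suc (lookup-unique u i j e)

  card-≤ : ∀ {A B : Set} {P : A → Set} {Q : B → Set} {k l} → Card P k → Card Q l →
    (f : A → B) → (∀ x → P x → Q (f x)) → (∀ x y → P x → P y → f x ≡ f y → x ≡ y) → k ℕ.≤ l
  card-≤ {A} {B} {P} {Q} (xs , uxs , mxs , refl) (ys , uys , mys , refl) f fQ inj = Finₚ.injective⇒≤ {f = h} h-inj
    where
    pt : ∀ i → P (List.lookup xs i)
    pt i = to (mxs _) (∈ₚ.∈-lookup i)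
    h∈ : ∀ i → f (List.lookup xs i) ∈ ys
    h∈ i = from (mys _) (fQ _ (pt i))
    h : Fin (length xs) → Fin (length ys)
    h i = Any.index (h∈ i)
    h-inj : ∀ {i j} → h i ≡ h j → i ≡ j
    h-inj {i} {j} e = lookup-unique uxs i j (inj _ _ (pt i) (pt j)
      (trans (Anyₚ.lookup-index (h∈ i)) (trans (cong (List.lookup ys) e) (sym (Anyₚ.lookup-index (h∈ j))))))

  card-unique : ∀ {A : Set} {P : A → Set} {k l} → Card P k → Card P l → k ≡ l
  card-unique c d = ℕₚ.≤-antisym (card-≤ c d (λ x → x) (λ _ p → p) (λ _ _ _ _ e → e)) (card-≤ d c (λ x → x) (λ _ p → p) (λ _ _ _ _ e → e))

  card-resp : ∀ {A : Set} {P Q : A → Set} {k} → (∀ x → P x → Q x) → (∀ x → Q x → P x) → Card P k → Card Q k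
  card-resp f g (xs , u , m , e) = xs , u , (λ x → mk⇔ (λ q → f x (to (m x) q)) (λ q → from (m x) (g x q))) , e

  card-bij : ∀ {A B : Set} {P : A → Set} {Q : B → Set} {k} → Card P k → (f : A → B) →
    (∀ x y → P x → P y → f x ≡ f y → x ≡ y) → (∀ x → P x → Q (f x)) → (∀ y → Q y → ∃[ x ] (P x × f x ≡ y)) → Card Q k
  card-bij {A} {B} {P} {Q} (xs , u , m , e) f inj fQ onto =
    List.map f xs , unique xs u (λ x x∈ → to (m x) x∈) ,
    (λ y → mk⇔ (λ y∈ → let x , x∈ , eq = ∈ₚ.∈-map⁻ f y∈ in subst Q (sym eq) (fQ x (to (m x) x∈)))
               (λ q → let x , p , eq = onto y q in subst (_∈ List.map f xs) eq (∈ₚ.∈-map⁺ f (from (m x) p)))) ,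
    trans (Listₚ.length-map f xs) e
    where
    unique : ∀ zs → Unique zs → (∀ x → x ∈ zs → P x) → Unique (List.map f zs)
    unique [] _ _ = []
    unique (z ∷ zs) (a ∷ u) p = Allₚ.map⁺ (All.tabulate (λ {x} x∈ eq → All.lookup a x∈ (inj z x (p z (here refl)) (p x (there x∈)) eq))) ∷ unique zs u (λ x x∈ → p x (there x∈))

  card-⊎ : ∀ {A : Set} {P Q : A → Set} {k l} → Card P k → Card Q l → (∀ x → P x → Q x → ⊥) → Card (λ x → P x ⊎ Q x) (k ℕ.+ l)
  card-⊎ {P = P} {Q} (xs , u , m , e) (ys , u' , m' , e') disj =
    xs List.++ ys , Uniqueₚ.++⁺ u u' (λ {x} (p , q) → disj x (to (m x) p) (to (m' x) q)) ,
    (λ x → mk⇔ (λ x∈ → Data.Sum.map (to (m x)) (to (m' x)) (∈ₚ.∈-++⁻ xs x∈))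
               (λ { (inj₁ p) → ∈ₚ.∈-++⁺ˡ (from (m x) p) ; (inj₂ q) → ∈ₚ.∈-++⁺ʳ xs (from (m' x) q) })) ,
    trans (Listₚ.length-++ xs) (cong₂ ℕ._+_ e e')

  card-0 : ∀ {A : Set} {P : A → Set} → (∀ x → ¬ P x) → Card P 0
  card-0 n = [] , [] , (λ x → mk⇔ (λ ()) (λ p → ⊥-elim (n x p))) , refl

  card-1 : ∀ {A : Set} {P : A → Set} a → P a → (∀ x → P x → x ≡ a) → Card P 1
  card-1 {P = P} a p only = a ∷ [] , [] ∷ [] , (λ x → mk⇔ (λ { (here e) → subst P (sym e) p ; (there ()) }) (λ q → here (only x q))) , refl

  card-pos : ∀ {A : Set} {P : A → Set} {k} a → P a → Card P k → 1 ℕ.≤ k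
  card-pos a p c = card-≤ (card-1 {P = λ x → x ≡ a} a refl (λ _ e → e)) c (λ x → x) (λ { _ refl → p }) (λ _ _ _ _ e → e)

  sumℕ : ∀ {t} → (Fin t → ℕ) → ℕ
  sumℕ {zero}  f = 0
  sumℕ {suc t} f = f zero ℕ.+ sumℕ (λ i → f (suc i))

  card-⋃ : ∀ {A : Set} {t} {P : Fin t → A → Set} {k : Fin t → ℕ} → (∀ i → Card (P i) (k i)) →
    (∀ i j x → P i x → P j x → i ≡ j) → Card (λ x → ∃[ i ] P i x) (sumℕ k)
  card-⋃ {t = zero} c disj = card-0 λ { x (() , _) }
  card-⋃ {t = suc t} {P} c disj = card-resp
    (λ { x (inj₁ p) → zero , p ; x (inj₂ (i , p)) → suc i , p })
    (λ { x (zero , p) → inj₁ p ; x (suc i , p) → inj₂ (i , p) })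
    (card-⊎ (c zero) (card-⋃ {P = λ i → P (suc i)} (λ i → c (suc i)) (λ i j x p q → Finₚ.suc-injective (disj (suc i) (suc j) x p q)))
      (λ { x p (i , q) → contra (disj zero (suc i) x p q) }))
    where
    contra : ∀ {i : Fin t} → Fin.zero ≡ suc i → ⊥
    contra ()

  card-dec : ∀ {A : Set} {P Q : A → Set} {k} → Card P k → (∀ x → Dec (Q x)) → ∃[ l ] Card (λ x → P x × Q x) l
  card-dec {P = P} {Q} (xs , u , m , e) Q? = _ , List.filter Q? xs , Uniqueₚ.filter⁺ Q? u ,
    (λ x → mk⇔ (λ x∈ → let x∈' , q = ∈ₚ.∈-filter⁻ Q? {xs = xs} x∈ in to (m x) x∈' , q) (λ { (p , q) → ∈ₚ.∈-filter⁺ Q? (from (m x) p) q })) , refl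

  -- On generating functions S is multiplication by 1/(1 − t).
  S : (ℕ → ℕ) → ℕ → ℕ
  S f zero    = f zero
  S f (suc n) = S f n ℕ.+ f (suc n)

  Sⁿ : ℕ → (ℕ → ℕ) → ℕ → ℕ
  Sⁿ zero    f = f
  Sⁿ (suc s) f = S (Sⁿ s f)

  -- The shape of a lattice point of height n in a half-open simplicial cone: a box point β of
  -- height j, and multiplicities κ of the s generators, which have height 1.
  Stack : ∀ {A : Set} → (ℕ → A → Set) → (s n : ℕ) → Vec ℕ s × A → Set
  Stack P s n (κ , β) = Σ ℕ λ j → (Vec.sum κ ℕ.+ j ≡ n) × P j β

  -- Either the multiplicity of the leading generator is zero, which removes this generator, or it
  -- can be lowered by one, which lowers the height: the recursion of `S`.
  card-stack : ∀ {A : Set} {P : ℕ → A → Set} {b : ℕ → ℕ} → (∀ j → Card (P j) (b j)) → ∀ s n → Card (Stack P s n) (Sⁿ s b n)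
  card-stack {P = P} c zero n = card-bij (c n) (λ β → [] , β) (λ { x y _ _ refl → refl }) (λ β p → n , refl , p) (λ { ([] , β) (j , refl , p) → β , p , refl })
  card-stack {P = P} c (suc s) zero = card-bij (card-stack c s zero) (λ { (κ , β) → 0 ∷ κ , β }) (λ { x y _ _ refl → refl })
    (λ { (κ , β) (j , e , p) → j , e , p }) (λ { (zero ∷ κ , β) (j , e , p) → (κ , β) , (j , e , p) , refl ; (suc a ∷ κ , β) (j , () , p) })
  card-stack {A} {P} c (suc s) (suc n) = card-resp
    (λ { (zero ∷ κ , β) (inj₁ (_ , ())) ; (suc a ∷ κ , β) (inj₁ (q , _)) → q ; (zero ∷ κ , β) (inj₂ (q , _)) → q ; (suc a ∷ κ , β) (inj₂ (_ , ())) })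
    (λ { (zero ∷ κ , β) q → inj₂ (q , refl) ; (suc a ∷ κ , β) q → inj₁ (q , ℕ.s≤s ℕ.z≤n) })
    (card-⊎ incremented zeros (λ { (zero ∷ κ , β) (_ , ()) _ ; (suc a ∷ κ , β) _ (_ , ()) }))
    where
    inc : Vec ℕ (suc s) × A → Vec ℕ (suc s) × A
    inc (a ∷ κ , β) = suc a ∷ κ , β
    incremented : Card (λ x → Stack P (suc s) (suc n) x × 1 ℕ.≤ Vec.head (proj₁ x)) (Sⁿ (suc s) _ n)
    incremented = card-bij (card-stack c (suc s) n) inc (λ { (_ ∷ _ , _) (_ ∷ _ , _) _ _ refl → refl })
      (λ { (a ∷ κ , β) (j , e , p) → (j , cong suc e , p) , ℕ.s≤s ℕ.z≤n })
      (λ { (zero ∷ κ , β) (_ , ()) ; (suc a ∷ κ , β) ((j , e , p) , _) → (a ∷ κ , β) , (j , ℕₚ.suc-injective e , p) , refl })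
    zeros : Card (λ x → Stack P (suc s) (suc n) x × Vec.head (proj₁ x) ≡ 0) (Sⁿ s _ (suc n))
    zeros = card-bij (card-stack c s (suc n)) (λ { (κ , β) → 0 ∷ κ , β }) (λ { x y _ _ refl → refl })
      (λ { (κ , β) (j , e , p) → (j , e , p) , refl }) (λ { (zero ∷ κ , β) ((j , e , p) , refl) → (κ , β) , (j , e , p) , refl })

-- Half-open lattice simplices and their box points.

module Cells where
  open import Data.Rational using (_≤_; _<_)
  open Rationals
  open LinearAlgebra
  open Cardinality
  open Equivalence using (to; from)

  lookup-ext : ∀ {A : Set} {n} {xs ys : Vec A n} → (∀ i → lookup xs i ≡ lookup ys i) → xs ≡ ys
  lookup-ext {xs = []} {[]} p = refl
  lookup-ext {xs = x ∷ xs} {y ∷ ys} p = cong₂ _∷_ (p zero) (lookup-ext (λ i → p (suc i)))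

  sum-1 : ∀ n → sum (λ (k : Fin n) → ⟦ 1 ⟧ℕ) ≡ ⟦ n ⟧ℕ
  sum-1 zero    = trans (sum-zero (λ k → ⟦ 1 ⟧ℕ)) (sym ⟦0⟧)
  sum-1 (suc n) = trans (sum-suc (λ k → ⟦ 1 ⟧ℕ)) (trans (cong (⟦ 1 ⟧ℕ +_) (sum-1 n)) (sym (⟦⟧ℕ-+ 1 n)))

  -- Homogenisation: a point of the n-th dilate becomes the point (n, y) at height n in the cone
  -- over the polytope.
  hom : ∀ {d} → ℕ → Point d → Fin (suc d) → ℚ
  hom n y zero    = ⟦ n ⟧ℕ
  hom n y (suc j) = ⟦ lookup y j ⟧

  hom-injective : ∀ {d m n} {y z : Point d} → (∀ j → hom m y j ≡ hom n z j) → y ≡ z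
  hom-injective p = lookup-ext (λ j → ⟦⟧-injective (p (suc j)))

  -- true stands for a closed side of a half-open cone, false for an open one.
  Nonneg Frac : Bool → ℚ → Set
  Nonneg true  a = 0ℚ ≤ a
  Nonneg false a = 0ℚ < a
  Frac true  a = 0ℚ ≤ a × a < 1ℚ
  Frac false a = 0ℚ < a × a ≤ 1ℚ

  nonneg-≤ : ∀ σ {a} → Nonneg σ a → 0ℚ ≤ a
  nonneg-≤ true  p = p
  nonneg-≤ false p = <⇒≤ p

  frac? : ∀ σ a → Dec (Frac σ a)
  frac? true  a = (0ℚ ≤? a) Relation.Nullary.×-dec (a <? 1ℚ)
  frac? false a = (0ℚ <? a) Relation.Nullary.×-dec (a ≤? 1ℚ)

  frac-nonneg : ∀ σ {a} → Frac σ a → Nonneg σ a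
  frac-nonneg true  (p , _) = p
  frac-nonneg false (p , _) = p

  frac-≤1 : ∀ σ {a} → Frac σ a → a ≤ 1ℚ
  frac-≤1 true  (_ , p) = <⇒≤ p
  frac-≤1 false (_ , p) = p

  private
    opaque
      unfolding _+_
      r2 : ∀ a b → (a - b) + b ≡ a
      r2 = solve-∀ ringℚ
      r3 : ∀ a b → a + b - a ≡ b
      r3 = solve-∀ ringℚ
      r4 : ∀ a z → (z + 1ℚ) - a ≡ 1ℚ - (a - z)
      r4 = solve-∀ ringℚ
      r5 : ∀ a k → 1ℚ - (a - k) ≡ (- a) - (- (1ℚ + k))
      r5 = solve-∀ ringℚ
      r6 : ∀ a k → (- (1ℚ + k) + 1ℚ) - (- a) ≡ a - k
      r6 = solve-∀ ringℚ
      r7 : ∀ a → 1ℚ - (1ℚ - a) ≡ a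
      r7 = solve-∀ ringℚ

  frac-flip : ∀ σ {a} → Frac σ a → Frac (not σ) (1ℚ - a)
  frac-flip true  {a} (p , q) = <⇒0<- q , 0≤-⇒≤ (subst (0ℚ ≤_) (sym (r7 a)) p)
  frac-flip false {a} (p , q) = ≤⇒0≤- q , 0<-⇒< (subst (0ℚ <_) (sym (r7 a)) p)

  private
    ⟦-[1+]⟧ : ∀ k → ⟦ ℤ.-[1+ k ] ⟧ ≡ - (1ℚ + ⟦ k ⟧ℕ)
    ⟦-[1+]⟧ k = trans (⟦⟧-neg (posℤ (suc k))) (cong -_ (⟦⟧ℕ-suc k))

  frac-part : ∀ σ a → Nonneg σ a → ∃[ k ] Frac σ (a - ⟦ k ⟧ℕ)
  frac-part true a 0≤a = go (floor a)
    where
    go : Σ ℤ (λ z → ⟦ z ⟧ ≤ a × a < ⟦ z ⟧ + 1ℚ) → _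
    go (posℤ k , p , q) = k , ≤⇒0≤- p , 0<-⇒< (subst (0ℚ <_) (r4 a ⟦ k ⟧ℕ) (<⇒0<- q))
    go (ℤ.-[1+ k ] , p , q) = ⊥-elim (<-irrefl refl (≤-<-trans 0≤a (<-≤-trans q
      (0≤-⇒≤ (subst (0ℚ ≤_) (sym (trans (cong (λ z → 0ℚ - (z + 1ℚ)) (⟦-[1+]⟧ k)) (lem ⟦ k ⟧ℕ))) (⟦⟧ℕ-nonneg k))))))
      where
      opaque
        unfolding _+_
        lem : ∀ k → 0ℚ - (- (1ℚ + k) + 1ℚ) ≡ k
        lem = solve-∀ ringℚ
  -- For an open side the remainder must lie in (0, 1], so k = ⌈a⌉ - 1; this is read off from the
  -- floor -(1 + k) of -a.
  frac-part false a 0<a = go (floor (- a))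
    where
    go : Σ ℤ (λ z → ⟦ z ⟧ ≤ - a × - a < ⟦ z ⟧ + 1ℚ) → _
    go (posℤ k , p , q) = ⊥-elim (<-irrefl refl (≤-<-trans (⟦⟧ℕ-nonneg k) (≤-<-trans p (neg<0 0<a))))
    go (ℤ.-[1+ k ] , p , q) = k ,
      subst (0ℚ <_) (trans (cong (λ z → z + 1ℚ - (- a)) (⟦-[1+]⟧ k)) (r6 a ⟦ k ⟧ℕ)) (<⇒0<- q) ,
      0≤-⇒≤ (subst (0ℚ ≤_) (trans (cong (λ z → - a - z) (⟦-[1+]⟧ k)) (sym (r5 a ⟦ k ⟧ℕ))) (≤⇒0≤- p))

  frac-<-absurd : ∀ σ {f f'} k k' → Frac σ f → Frac σ f' → ⟦ k ⟧ℕ + f ≡ ⟦ k' ⟧ℕ + f' → k ℕ.< k' → ⊥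
  frac-<-absurd σ {f} {f'} k k' p p' e k<k' = go σ p p'
    where
    opaque
      unfolding _+_
      lem : ∀ k f → f ≡ (k + f) - k
      lem = solve-∀ ringℚ
      lem' : ∀ k k' f' → (k' + f') - k - (1ℚ + f') ≡ k' - (1ℚ + k)
      lem' = solve-∀ ringℚ
    big : 1ℚ + f' ≤ f
    big = 0≤-⇒≤ (subst (0ℚ ≤_) (sym (trans (cong (_- (1ℚ + f')) (trans (lem ⟦ k ⟧ℕ f) (cong (_- ⟦ k ⟧ℕ) e))) (lem' ⟦ k ⟧ℕ ⟦ k' ⟧ℕ f')))
      (≤⇒0≤- (subst (_≤ ⟦ k' ⟧ℕ) (⟦⟧ℕ-suc k) (⟦⟧ℕ-mono-≤ k<k'))))
    go : ∀ σ → Frac σ f → Frac σ f' → ⊥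
    go true  (_ , f<1) (0≤f' , _) = <-irrefl refl (<-≤-trans f<1 (≤-trans (subst (_≤ 1ℚ + f') (+-identityʳ 1ℚ) (+-mono-≤ ≤-refl 0≤f')) big))
    go false (_ , f≤1) (0<f' , _) = <-irrefl refl (<-≤-trans (subst (_< 1ℚ + f') (+-identityʳ 1ℚ) (+-mono-≤-< ≤-refl 0<f')) (≤-trans big f≤1))

  frac-unique : ∀ σ {f f'} k k' → Frac σ f → Frac σ f' → ⟦ k ⟧ℕ + f ≡ ⟦ k' ⟧ℕ + f' → k ≡ k'
  frac-unique σ k k' p p' e with ℕₚ.<-cmp k k'
  ... | tri< l _ _ = ⊥-elim (frac-<-absurd σ k k' p p' e l)
  ... | tri≈ _ q _ = q
  ... | tri> _ _ l = ⊥-elim (frac-<-absurd σ k' k p' p (sym e) l)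

  sumℤ : ∀ {n} → (Fin n → ℤ) → ℤ
  sumℤ {zero}  f = posℤ 0
  sumℤ {suc n} f = f zero ℤ.+ sumℤ (λ i → f (suc i))

  ⟦⟧-sumℤ : ∀ {n} (f : Fin n → ℤ) → ⟦ sumℤ f ⟧ ≡ sum (λ i → ⟦ f i ⟧)
  ⟦⟧-sumℤ {zero}  f = trans ⟦0⟧ (sym (sum-zero (λ i → ⟦ f i ⟧)))
  ⟦⟧-sumℤ {suc n} f = trans (⟦⟧-+ (f zero) _) (trans (cong (⟦ f zero ⟧ +_) (⟦⟧-sumℤ (λ i → f (suc i)))) (sym (sum-suc (λ i → ⟦ f i ⟧))))

  ⟦⟧-sumℕ : ∀ {n} (f : Fin n → ℕ) → ⟦ sumℕ f ⟧ℕ ≡ sum (λ i → ⟦ f i ⟧ℕ)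
  ⟦⟧-sumℕ {zero}  f = trans ⟦0⟧ (sym (sum-zero (λ i → ⟦ f i ⟧ℕ)))
  ⟦⟧-sumℕ {suc n} f = trans (⟦⟧ℕ-+ (f zero) _) (trans (cong (⟦ f zero ⟧ℕ +_) (⟦⟧-sumℕ (λ i → f (suc i)))) (sym (sum-suc (λ i → ⟦ f i ⟧ℕ))))

  ⟦⟧-sumVec : ∀ {n} (κ : Vec ℕ n) → ⟦ Vec.sum κ ⟧ℕ ≡ sum (λ i → ⟦ lookup κ i ⟧ℕ)
  ⟦⟧-sumVec [] = trans ⟦0⟧ (sym (sum-zero (λ i → ⟦ lookup [] i ⟧ℕ)))
  ⟦⟧-sumVec (k ∷ κ) = trans (⟦⟧ℕ-+ k _) (trans (cong (⟦ k ⟧ℕ +_) (⟦⟧-sumVec κ)) (sym (sum-suc (λ i → ⟦ lookup (k ∷ κ) i ⟧ℕ))))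

  card-vec : ∀ {A : Set} {d} {P : Fin d → A → Set} → (∀ j → ∃[ k ] Card (P j) k) → ∃[ l ] Card (λ (y : Vec A d) → ∀ j → P j (lookup y j)) l
  card-vec {d = zero} c = 1 , card-1 [] (λ ()) (λ { [] _ → refl })
  card-vec {A} {suc d} {P} c with c zero | card-vec {P = λ j → P (suc j)} (λ j → c (suc j))
  ... | _ , xs , u , m , _ | _ , ys , u' , m' , _ =
    _ , List.cartesianProductWith _∷_ xs ys ,
    Uniqueₚ.cartesianProductWith⁺ _∷_ (λ { refl → refl , refl }) u u' , (λ y → mk⇔ (fwd y) (bwd y)) , refl
    where
    fwd : ∀ y → y ∈ List.cartesianProductWith _∷_ xs ys → ∀ j → P j (lookup y j)
    fwd y y∈ j with ∈ₚ.∈-cartesianProductWith⁻ _∷_ xs ys y∈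
    fwd _ y∈ zero    | a , b , a∈ , b∈ , refl = to (m a) a∈
    fwd _ y∈ (suc j) | a , b , a∈ , b∈ , refl = to (m' b) b∈ j
    bwd : ∀ y → (∀ j → P j (lookup y j)) → y ∈ List.cartesianProductWith _∷_ xs ys
    bwd (a ∷ y) p = ∈ₚ.∈-cartesianProductWith⁺ _∷_ (from (m a) (p zero)) (from (m' y) (λ j → p (suc j)))

  -- The integers of absolute value at most M, as i − M with i ≤ 2M.
  card-interval : ∀ M → ∃[ k ] Card (λ z → ℤ.- posℤ M ℤ.≤ z × z ℤ.≤ posℤ M) k
  card-interval M = _ , List.map f (List.upTo (suc (M ℕ.+ M))) , Uniqueₚ.map⁺ f-inj (Uniqueₚ.upTo⁺ (suc (M ℕ.+ M))) , (λ z → mk⇔ (fwd z) (bwd z)) , refl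
    where
    f : ℕ → ℤ
    f i = posℤ i ℤ.- posℤ M
    f-inj : ∀ {i j} → f i ≡ f j → i ≡ j
    f-inj {i} {j} e = ℤₚ.+-injective (trans (sym (lem (posℤ i) (posℤ M))) (trans (cong (ℤ._+ posℤ M) e) (lem (posℤ j) (posℤ M))))
      where
      lem : ∀ a m → (a ℤ.- m) ℤ.+ m ≡ a
      lem = ℤSolver.solve-∀
    fwd : ∀ z → z ∈ List.map f (List.upTo (suc (M ℕ.+ M))) → ℤ.- posℤ M ℤ.≤ z × z ℤ.≤ posℤ M
    fwd z z∈ with ∈ₚ.∈-map⁻ f z∈
    ... | i , i∈ , refl = ℤₚ.i≤j+i (ℤ.- posℤ M) (posℤ i) ,
      subst (posℤ i ℤ.- posℤ M ℤ.≤_) (lem (posℤ M)) (ℤₚ.+-monoˡ-≤ (ℤ.- posℤ M) (ℤ.+≤+ (ℕ.s≤s⁻¹ (∈ₚ.∈-upTo⁻ i∈))))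
      where
      lem : ∀ a → (a ℤ.+ a) ℤ.- a ≡ a
      lem = ℤSolver.solve-∀
    bwd : ∀ z → ℤ.- posℤ M ℤ.≤ z × z ℤ.≤ posℤ M → z ∈ List.map f (List.upTo (suc (M ℕ.+ M)))
    bwd z (p , q) with z ℤ.+ posℤ M in eq
    ... | posℤ i = subst (_∈ List.map f (List.upTo (suc (M ℕ.+ M)))) fi (∈ₚ.∈-map⁺ f (∈ₚ.∈-upTo⁺ (ℕ.s≤s (ℤₚ.drop‿+≤+ (subst (ℤ._≤ posℤ M ℤ.+ posℤ M) eq (ℤₚ.+-monoˡ-≤ (posℤ M) q))))))
      where
      lem : ∀ z a → (z ℤ.+ a) ℤ.- a ≡ z
      lem = ℤSolver.solve-∀
      fi : f i ≡ z
      fi = trans (cong (ℤ._- posℤ M) (sym eq)) (lem z (posℤ M))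
    ... | ℤ.-[1+ i ] = ⊥-elim (absurd (subst₂ ℤ._≤_ (ℤₚ.+-inverseˡ (posℤ M)) eq (ℤₚ.+-monoˡ-≤ (posℤ M) p)))
      where
      absurd : posℤ 0 ℤ.≤ ℤ.-[1+ i ] → ⊥
      absurd ()

  -- Full simplices have s = d + 1, boundary simplices s = d. In the second case the dual
  -- functionals `fn` are arbitrary off the span of the vertices, so lying in the span is the
  -- separate condition `Supported`.
  record Cell (d s : ℕ) : Set where
    no-eta-equality
    field
      vs : Fin s → Point d
      fn : Fin s → Fin (suc d) → ℚ
    coord : ℕ → Point d → Fin s → ℚ
    coord n y k = dot (fn k) (hom n y)
    field
      dual : ∀ k l → coord 1 (vs l) k ≡ δ k l

    Supported : ℕ → Point d → Set
    Supported n y = ∀ j → sum (λ k → coord n y k * hom 1 (vs k) j) ≡ hom n y j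

    InCell Box : (Fin s → Bool) → ℕ → Point d → Set
    InCell σ n y = (∀ k → Nonneg (σ k) (coord n y k)) × Supported n y
    Box    σ n y = (∀ k → Frac   (σ k) (coord n y k)) × Supported n y

    coord-sum : ∀ {n y} → Supported n y → sum (coord n y) ≡ ⟦ n ⟧ℕ
    coord-sum {n} {y} sup = trans (Σ-cong (λ k → trans (sym (trans (*-comm _ 1ℚ) (*-identityˡ _))) (cong (coord n y k *_) (sym ⟦1⟧)))) (sup zero)

    coord-unique : ∀ {n y} (a : Fin s → ℚ) → (∀ j → hom n y j ≡ sum (λ k → a k * hom 1 (vs k) j)) → ∀ k → coord n y k ≡ a k
    coord-unique {n} {y} a p k = begin
      dot (fn k) (hom n y)                               ≡⟨ dot-cong p ⟩
      dot (fn k) (λ j → sum (λ l → a l * hom 1 (vs l) j)) ≡⟨ dot-Σ (fn k) a (λ l → hom 1 (vs l)) ⟩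
      sum (λ l → a l * coord 1 (vs l) k)                 ≡⟨ Σ-cong (λ l → cong (a l *_) (trans (dual k l) (δ-sym k l))) ⟩
      sum (λ l → a l * δ l k)                            ≡⟨ Σ-δʳ k a ⟩
      a k ∎

    supported-by : ∀ {n y} (a : Fin s → ℚ) → (∀ j → hom n y j ≡ sum (λ k → a k * hom 1 (vs k) j)) → Supported n y
    supported-by a p j = trans (Σ-cong (λ k → cong (_* hom 1 (vs k) j) (coord-unique a p k))) (sym (p j))

    translate : (Fin s → ℤ) → Point d → Point d
    translate κ y = Vec.tabulate (λ j → lookup y j ℤ.+ sumℤ (λ k → κ k ℤ.* lookup (vs k) j))

    hom-translate : ∀ κ y m m' → ⟦ m' ⟧ℕ ≡ ⟦ m ⟧ℕ + sum (λ k → ⟦ κ k ⟧) → ∀ j → hom m' (translate κ y) j ≡ hom m y j + sum (λ k → ⟦ κ k ⟧ * hom 1 (vs k) j)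
    hom-translate κ y m m' e zero = trans e (cong (⟦ m ⟧ℕ +_) (Σ-cong (λ k → sym (trans (cong (⟦ κ k ⟧ *_) ⟦1⟧) (trans (*-comm _ 1ℚ) (*-identityˡ _))))))
    hom-translate κ y m m' e (suc j) = trans (cong ⟦_⟧ (Vecₚ.lookup∘tabulate (λ j → lookup y j ℤ.+ sumℤ (λ k → κ k ℤ.* lookup (vs k) j)) j))
      (trans (⟦⟧-+ (lookup y j) _) (cong (⟦ lookup y j ⟧ +_) (trans (⟦⟧-sumℤ (λ k → κ k ℤ.* lookup (vs k) j)) (Σ-cong (λ k → ⟦⟧-* (κ k) (lookup (vs k) j))))))

    private
      translate-expansion : ∀ κ y m m' → ⟦ m' ⟧ℕ ≡ ⟦ m ⟧ℕ + sum (λ k → ⟦ κ k ⟧) → Supported m y →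
        ∀ j → hom m' (translate κ y) j ≡ sum (λ k → (coord m y k + ⟦ κ k ⟧) * hom 1 (vs k) j)
      translate-expansion κ y m m' e sup j = trans (hom-translate κ y m m' e j) (trans (cong (_+ sum (λ k → ⟦ κ k ⟧ * hom 1 (vs k) j)) (sym (sup j)))
        (trans (sym (Σ-+ _ _)) (Σ-cong (λ k → sym (distribʳ (hom 1 (vs k) j) (coord m y k) ⟦ κ k ⟧)))))

    coord-translate : ∀ κ y m m' → ⟦ m' ⟧ℕ ≡ ⟦ m ⟧ℕ + sum (λ k → ⟦ κ k ⟧) → Supported m y → ∀ k → coord m' (translate κ y) k ≡ coord m y k + ⟦ κ k ⟧
    coord-translate κ y m m' e sup = coord-unique (λ k → coord m y k + ⟦ κ k ⟧) (translate-expansion κ y m m' e sup)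

    supported-translate : ∀ κ y m m' → ⟦ m' ⟧ℕ ≡ ⟦ m ⟧ℕ + sum (λ k → ⟦ κ k ⟧) → Supported m y → Supported m' (translate κ y)
    supported-translate κ y m m' e sup = supported-by (λ k → coord m y k + ⟦ κ k ⟧) (translate-expansion κ y m m' e sup)

    private
      assemble : Vec ℕ s × Point d → Point d
      assemble (κ , β) = translate (λ k → posℤ (lookup κ k)) β

      height : ∀ {κ : Vec ℕ s} {j n} → Vec.sum κ ℕ.+ j ≡ n → ⟦ n ⟧ℕ ≡ ⟦ j ⟧ℕ + sum (λ k → ⟦ lookup κ k ⟧ℕ)
      height {κ} {j} refl = trans (⟦⟧ℕ-+ (Vec.sum κ) j) (trans (+-comm _ _) (cong (⟦ j ⟧ℕ +_) (⟦⟧-sumVec κ)))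

      nonneg-+ : ∀ σ {a} k → Nonneg σ a → Nonneg σ (a + ⟦ k ⟧ℕ)
      nonneg-+ true  k p = 0≤+ p (⟦⟧ℕ-nonneg k)
      nonneg-+ false k p = 0<+≤ p (⟦⟧ℕ-nonneg k)

    -- Removing from each coordinate the integer that leaves a remainder in the box range writes a
    -- lattice point of the half-open cone uniquely as a box point plus a nonnegative integer
    -- combination of the vertices.
    card-cell : ∀ σ {b} → (∀ j → Card (Box σ j) (b j)) → ∀ n → Card (InCell σ n) (Sⁿ s b n)
    card-cell σ c n = card-bij (card-stack c s n) assemble inj into onto
      where
      into : ∀ x → Stack (Box σ) s n x → InCell σ n (assemble x)
      into (κ , β) (j , e , fr , sup) =
        (λ k → subst (Nonneg (σ k)) (sym (coord-translate _ β j n (height {κ} e) sup k)) (nonneg-+ (σ k) (lookup κ k) (frac-nonneg (σ k) (fr k)))) ,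
        supported-translate _ β j n (height {κ} e) sup
      inj : ∀ x x' → Stack (Box σ) s n x → Stack (Box σ) s n x' → assemble x ≡ assemble x' → x ≡ x'
      inj (κ , β) (κ' , β') (j , e , fr , sup) (j' , e' , fr' , sup') eq = cong₂ _,_ κ≡ β≡
        where
        same-coord : ∀ k → ⟦ lookup κ k ⟧ℕ + coord j β k ≡ ⟦ lookup κ' k ⟧ℕ + coord j' β' k
        same-coord k = trans (+-comm _ _) (trans (sym (coord-translate _ β j n (height {κ} e) sup k)) (trans (cong (λ y → coord n y k) eq)
          (trans (coord-translate _ β' j' n (height {κ'} e') sup' k) (+-comm _ _))))
        κ≡ : κ ≡ κ'
        κ≡ = lookup-ext (λ k → frac-unique (σ k) (lookup κ k) (lookup κ' k) (fr k) (fr' k) (same-coord k))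
        cancel : ∀ x {y z} → x + y ≡ x + z → y ≡ z
        cancel x {y} {z} p = trans (sym (r3 x y)) (trans (cong (_- x) p) (r3 x z))
        β≡ : β ≡ β'
        β≡ = hom-injective {m = j} {j'} (λ i → trans (sym (sup i)) (trans (Σ-cong (λ k → cong (_* hom 1 (vs k) i)
          (cancel ⟦ lookup κ k ⟧ℕ (trans (same-coord k) (cong (λ κ → ⟦ lookup κ k ⟧ℕ + coord j' β' k) (sym κ≡)))))) (sup' i)))
      onto : ∀ y → InCell σ n y → ∃[ x ] (Stack (Box σ) s n x × assemble x ≡ y)
      onto y (nn , sup) = (κ , β) , (j , ℕₚ.m+[n∸m]≡n κ≤n , (λ k → subst (Frac (σ k)) (sym (coordβ k)) (fr k)) , supβ) , back
        where
        κ : Vec ℕ s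
        κ = Vec.tabulate (λ k → proj₁ (frac-part (σ k) (coord n y k) (nn k)))
        fr : ∀ k → Frac (σ k) (coord n y k - ⟦ lookup κ k ⟧ℕ)
        fr k = subst (λ z → Frac (σ k) (coord n y k - ⟦ z ⟧ℕ)) (sym (Vecₚ.lookup∘tabulate (λ k → proj₁ (frac-part (σ k) (coord n y k) (nn k))) k))
          (proj₂ (frac-part (σ k) (coord n y k) (nn k)))
        -- The remainders are nonnegative and add up to n minus the sum of κ; hence the truncated
        -- subtraction in `j` is exact.
        κ≤n : Vec.sum κ ℕ.≤ n
        κ≤n = ℤₚ.drop‿+≤+ (⟦⟧-cancel-≤ (0≤-⇒≤ (subst (0ℚ ≤_) (trans (Σ-- _ _) (cong₂ _-_ (coord-sum sup) (sym (⟦⟧-sumVec κ))))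
          (Σ-nonneg (λ k → nonneg-≤ (σ k) (frac-nonneg (σ k) (fr k)))))))
        j = n ℕ.∸ Vec.sum κ
        neg-κ : Fin s → ℤ
        neg-κ k = ℤ.- posℤ (lookup κ k)
        β = translate neg-κ y
        opaque
          unfolding _+_
          lem : ∀ a b → (a + b) + - a ≡ b
          lem = solve-∀ ringℚ
        hj : ⟦ j ⟧ℕ ≡ ⟦ n ⟧ℕ + sum (λ k → ⟦ neg-κ k ⟧)
        hj = sym (trans (cong₂ _+_ (trans (cong ⟦_⟧ℕ (sym (ℕₚ.m+[n∸m]≡n κ≤n))) (⟦⟧ℕ-+ (Vec.sum κ) j))
               (trans (Σ-cong (λ k → ⟦⟧-neg (posℤ (lookup κ k)))) (trans (Σ-neg _) (cong -_ (sym (⟦⟧-sumVec κ))))))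
               (lem ⟦ Vec.sum κ ⟧ℕ ⟦ j ⟧ℕ))
        supβ : Supported j β
        supβ = supported-translate neg-κ y n j hj sup
        coordβ : ∀ k → coord j β k ≡ coord n y k - ⟦ lookup κ k ⟧ℕ
        coordβ k = trans (coord-translate neg-κ y n j hj sup k) (cong (coord n y k +_) (⟦⟧-neg (posℤ (lookup κ k))))
        back : assemble (κ , β) ≡ y
        back = hom-injective {m = n} {n} (λ i → trans (sym (supported-translate _ β j n (height {κ} (ℕₚ.m+[n∸m]≡n κ≤n)) supβ i))
          (trans (Σ-cong (λ k → cong (_* hom 1 (vs k) i) (trans (coord-translate _ β j n (height {κ} (ℕₚ.m+[n∸m]≡n κ≤n)) supβ k)
            (trans (cong (_+ ⟦ lookup κ k ⟧ℕ) (coordβ k)) (r2 _ _))))) (sup i)))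

    flip : Point d → Point d
    flip y = Vec.tabulate (λ j → sumℤ (λ k → lookup (vs k) j) ℤ.- lookup y j)

    private
      flip-expansion : ∀ {j y} → j ℕ.≤ s → Supported j y → ∀ i → hom (s ℕ.∸ j) (flip y) i ≡ sum (λ k → (1ℚ - coord j y k) * hom 1 (vs k) i)
      flip-expansion {j} {y} j≤s sup i = trans (lhs i) (sym (begin
        sum (λ k → (1ℚ - coord j y k) * hom 1 (vs k) i)            ≡⟨ Σ-cong (λ k → lem (coord j y k) (hom 1 (vs k) i)) ⟩
        sum (λ k → hom 1 (vs k) i - coord j y k * hom 1 (vs k) i)  ≡⟨ Σ-- _ _ ⟩
        sum (λ k → hom 1 (vs k) i) - sum (λ k → coord j y k * hom 1 (vs k) i) ≡⟨ cong (λ z → sum (λ k → hom 1 (vs k) i) - z) (sup i) ⟩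
        sum (λ k → hom 1 (vs k) i) - hom j y i ∎))
        where
        opaque
          unfolding _+_
          lem : ∀ a h → (1ℚ - a) * h ≡ h - a * h
          lem = solve-∀ ringℚ
          lem' : ∀ a b → b ≡ (a + b) - a
          lem' = solve-∀ ringℚ
        lhs : ∀ i → hom (s ℕ.∸ j) (flip y) i ≡ sum (λ k → hom 1 (vs k) i) - hom j y i
        lhs zero = trans (lem' ⟦ j ⟧ℕ _) (cong (_- ⟦ j ⟧ℕ) (trans (sym (⟦⟧ℕ-+ j (s ℕ.∸ j))) (trans (cong ⟦_⟧ℕ (ℕₚ.m+[n∸m]≡n j≤s)) (sym (sum-1 s)))))
        lhs (suc i) = trans (cong ⟦_⟧ (Vecₚ.lookup∘tabulate (λ j → sumℤ (λ k → lookup (vs k) j) ℤ.- lookup y j) i))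
          (trans (⟦⟧-- (sumℤ (λ k → lookup (vs k) i)) _) (cong (_- ⟦ lookup y i ⟧) (⟦⟧-sumℤ (λ k → lookup (vs k) i))))

    flip-box : ∀ σ {j y} → j ℕ.≤ s → Box σ j y → Box (λ k → not (σ k)) (s ℕ.∸ j) (flip y)
    flip-box σ {j} {y} j≤s (fr , sup) =
      (λ k → subst (Frac (not (σ k))) (sym (coord-unique (λ k → 1ℚ - coord j y k) (flip-expansion j≤s sup) k)) (frac-flip (σ k) (fr k))) ,
      supported-by (λ k → 1ℚ - coord j y k) (flip-expansion j≤s sup)

    flip-involutive : ∀ y → flip (flip y) ≡ y
    flip-involutive y = lookup-ext (λ j → trans (Vecₚ.lookup∘tabulate (λ j → V j ℤ.- lookup (flip y) j) j)
      (trans (cong (λ z → V j ℤ.- z) (Vecₚ.lookup∘tabulate (λ j → V j ℤ.- lookup y j) j)) (lem (V j) (lookup y j))))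
      where
      V : Fin d → ℤ
      V j = sumℤ (λ k → lookup (vs k) j)
      lem : ∀ a b → a ℤ.- (a ℤ.- b) ≡ b
      lem = ℤSolver.solve-∀

    opaque
      -- Reflection of the parallelepiped in its centre sends a coordinate a to 1 - a, which
      -- exchanges closed and open sides and the heights j and s - j. This is Ehrhart reciprocity
      -- for a single cell.
      card-box-flip : ∀ σ {j b} → j ℕ.≤ s → Card (Box σ j) b → Card (Box (λ k → not (σ k)) (s ℕ.∸ j)) b
      card-box-flip σ {j} j≤s c = card-bij c flip (λ x y _ _ e → trans (sym (flip-involutive x)) (trans (cong flip e) (flip-involutive y)))
        (λ y → flip-box σ j≤s)
        (λ y p → flip y , back y p , flip-involutive y)
        where
        back : ∀ y → Box (λ k → not (σ k)) (s ℕ.∸ j) y → Box σ j (flip y)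
        back y p with flip-box (λ k → not (σ k)) (ℕₚ.m∸n≤m s j) p
        ... | fr , sup = subst (λ i → (∀ k → Frac (σ k) (coord i (flip y) k)) × Supported i (flip y)) (ℕₚ.m∸[m∸n]≡n j≤s)
                           ((λ k → subst (λ t → Frac t (coord (s ℕ.∸ (s ℕ.∸ j)) (flip y) k)) (not-involutive (σ k)) (fr k)) , sup)

    box-height : ∀ σ {j y} → Box σ j y → j ℕ.≤ s
    box-height σ {j} {y} (fr , sup) = ℤₚ.drop‿+≤+ (⟦⟧-cancel-≤ (subst₂ _≤_ (coord-sum sup) (sum-1 s) (Σ-≤ (λ k → subst (coord j y k ≤_) (sym ⟦1⟧) (frac-≤1 (σ k) (fr k))))))

    opaque
      -- Box coordinates lie between 0 and 1, so each entry of a box point is bounded by the sum of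
      -- the absolute values of that entry over the vertices; the box is filtered out of this finite
      -- grid.
      card-box : ∀ σ j → ∃[ b ] Card (Box σ j) b
      card-box σ j with card-vec {P = λ l z → ℤ.- posℤ (M' l) ℤ.≤ z × z ℤ.≤ posℤ (M' l)} (λ l → card-interval (M' l))
        where
        M' : Fin d → ℕ
        M' l = sumℕ (λ k → ℤ.∣ lookup (vs k) l ∣)
      ... | _ , c with card-dec c (λ y → Finₚ.all? (λ k → frac? (σ k) (coord j y k)) Relation.Nullary.×-dec Finₚ.all? (λ i → sum (λ k → coord j y k * hom 1 (vs k) i) ≟ hom j y i))
      ... | b , c' = b , card-resp (λ y → proj₂) (λ y p → bounded y p , p) c'
        where
        abs-bounds : ∀ z → ⟦ z ⟧ ≤ ⟦ ℤ.∣ z ∣ ⟧ℕ × - ⟦ z ⟧ ≤ ⟦ ℤ.∣ z ∣ ⟧ℕ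
        abs-bounds (posℤ n) = ≤-refl , ≤-trans (subst (- ⟦ n ⟧ℕ ≤_) neg-0 (neg-antimono-≤ (⟦⟧ℕ-nonneg n))) (⟦⟧ℕ-nonneg n)
        abs-bounds ℤ.-[1+ n ] = ⟦⟧-mono-≤ ℤ.-≤+ , ≤-reflexive (trans (cong -_ (⟦⟧-neg (posℤ (suc n)))) (neg-involutive _))
        opaque
          unfolding _+_
          lem : ∀ a h z → h - a * z ≡ (1ℚ - a) * h + a * (h - z)
          lem = solve-∀ ringℚ
          lem' : ∀ a h z → a * z - - h ≡ (1ℚ - a) * h + a * (h - - z)
          lem' = solve-∀ ringℚ
        bounded : ∀ y → Box σ j y → ∀ l → ℤ.- posℤ (sumℕ (λ k → ℤ.∣ lookup (vs k) l ∣)) ℤ.≤ lookup y l × lookup y l ℤ.≤ posℤ (sumℕ (λ k → ℤ.∣ lookup (vs k) l ∣))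
        bounded y (fr , sup) l =
          ⟦⟧-cancel-≤ (subst₂ _≤_ (trans (Σ-neg _) (trans (cong -_ (sym (⟦⟧-sumℕ _))) (sym (⟦⟧-neg (posℤ _))))) (sup (suc l))
            (Σ-≤ (λ k → 0≤-⇒≤ (subst (0ℚ ≤_) (sym (lem' (coord j y k) ⟦ ℤ.∣ lookup (vs k) l ∣ ⟧ℕ ⟦ lookup (vs k) l ⟧)) (0≤+ (0≤* (≤⇒0≤- (frac-≤1 (σ k) (fr k))) (⟦⟧ℕ-nonneg ℤ.∣ lookup (vs k) l ∣)) (0≤* (nonneg-≤ (σ k) (frac-nonneg (σ k) (fr k))) (≤⇒0≤- (proj₂ (abs-bounds (lookup (vs k) l)))))))))) ,
          ⟦⟧-cancel-≤ (subst₂ _≤_ (sup (suc l)) (sym (⟦⟧-sumℕ (λ k → ℤ.∣ lookup (vs k) l ∣)))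
            (Σ-≤ (λ k → 0≤-⇒≤ (subst (0ℚ ≤_) (sym (lem (coord j y k) ⟦ ℤ.∣ lookup (vs k) l ∣ ⟧ℕ ⟦ lookup (vs k) l ⟧)) (0≤+ (0≤* (≤⇒0≤- (frac-≤1 (σ k) (fr k))) (⟦⟧ℕ-nonneg ℤ.∣ lookup (vs k) l ∣)) (0≤* (nonneg-≤ (σ k) (frac-nonneg (σ k) (fr k))) (≤⇒0≤- (proj₁ (abs-bounds (lookup (vs k) l))))))))))

    -- The corner with coordinate 1 exactly on the open sides is a box point.
    card-box-corner : ∀ σ {b} → Card (Box σ (sumℕ (λ k → if σ k then 0 else 1))) b → 1 ℕ.≤ b
    card-box-corner σ = card-pos (translate κ origin)
      ((λ k → subst (Frac (σ k)) (sym (trans (coord-translate κ origin 0 n height' sup k) (trans (cong (_+ ⟦ κ k ⟧) (coord0 k)) (+-identityˡ ⟦ κ k ⟧)))) (frac (σ k))) ,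
       supported-translate κ origin 0 n height' sup)
      where
      κ : Fin s → ℤ
      κ k = posℤ (if σ k then 0 else 1)
      n = sumℕ (λ k → if σ k then 0 else 1)
      origin : Point d
      origin = Vec.replicate d (posℤ 0)
      hom0 : ∀ j → hom 0 origin j ≡ 0ℚ
      hom0 zero    = ⟦0⟧
      hom0 (suc j) = trans (cong ⟦_⟧ (Vecₚ.lookup-replicate j (posℤ 0))) ⟦0⟧
      expansion : ∀ j → hom 0 origin j ≡ sum (λ k → 0ℚ * hom 1 (vs k) j)
      expansion j = trans (hom0 j) (sym (Σ-0 (λ k → zeroˡ (hom 1 (vs k) j))))
      coord0 : ∀ k → coord 0 origin k ≡ 0ℚ
      coord0 = coord-unique (λ _ → 0ℚ) expansion
      sup : Supported 0 origin
      sup = supported-by (λ _ → 0ℚ) expansion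
      height' : ⟦ n ⟧ℕ ≡ ⟦ 0 ⟧ℕ + sum (λ k → ⟦ κ k ⟧)
      height' = trans (⟦⟧-sumℕ (λ k → if σ k then 0 else 1)) (sym (trans (cong (_+ sum (λ k → ⟦ κ k ⟧)) ⟦0⟧) (+-identityˡ _)))
      frac : ∀ t → Frac t ⟦ posℤ (if t then 0 else 1) ⟧
      frac true  = ≤-reflexive (sym ⟦0⟧) , subst (_< 1ℚ) (sym ⟦0⟧) 0<1
      frac false = subst (0ℚ <_) (sym ⟦1⟧) 0<1 , ≤-reflexive ⟦1⟧

-- The coefficients of c_i: recurrences, closed forms, evaluation.

module Coefficients where
  open import Data.Rational using (_≤_; _<_)
  open Rationals

  coeff-+ : ∀ p q r → coeff (p +ₚ q) r ≡ coeff p r ℤ.+ coeff q r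
  coeff-+ []      q       r       = sym (ℤₚ.+-identityˡ (coeff q r))
  coeff-+ (a ∷ p) []      zero    = sym (ℤₚ.+-identityʳ a)
  coeff-+ (a ∷ p) []      (suc r) = sym (ℤₚ.+-identityʳ (coeff p r))
  coeff-+ (a ∷ p) (b ∷ q) zero    = refl
  coeff-+ (a ∷ p) (b ∷ q) (suc r) = coeff-+ p q r

  coeff-map : ∀ a p r → coeff (List.map (a ℤ.*_) p) r ≡ a ℤ.* coeff p r
  coeff-map a []      r       = sym (ℤₚ.*-zeroʳ a)
  coeff-map a (b ∷ p) zero    = refl
  coeff-map a (b ∷ p) (suc r) = coeff-map a p r

  coeff-mulLin : ∀ a p r → coeff (mulLin a p) (suc r) ≡ coeff p r ℤ.+ a ℤ.* coeff p (suc r)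
  coeff-mulLin a p r = trans (coeff-+ (posℤ 0 ∷ p) (List.map (a ℤ.*_) p) (suc r)) (cong (λ z → coeff p r ℤ.+ z) (coeff-map a p (suc r)))

  coeff-mulLin-0 : ∀ a p → coeff (mulLin a p) 0 ≡ a ℤ.* coeff p 0
  coeff-mulLin-0 a p = trans (coeff-+ (posℤ 0 ∷ p) (List.map (a ℤ.*_) p) 0) (trans (ℤₚ.+-identityˡ _) (coeff-map a p 0))

  map-upTo-suc : ∀ (f g : ℕ → ℤ) n → (∀ j → f (suc j) ≡ g j) → List.map f (List.upTo (suc n)) ≡ f 0 ∷ List.map g (List.upTo n)
  map-upTo-suc f g n p = cong (f 0 ∷_) (trans (Listₚ.map-applyUpTo suc f n) (trans (go n (λ j → j)) (sym (Listₚ.map-applyUpTo (λ j → j) g n))))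
    where
    go : ∀ n (h : ℕ → ℕ) → List.applyUpTo (λ j → f (suc (h j))) n ≡ List.applyUpTo (λ j → g (h j)) n
    go zero    h = refl
    go (suc n) h = cong₂ _∷_ (p (h 0)) (go n (λ j → h (suc j)))

  cpoly-suc : ∀ d i → cpoly (suc d) i ≡ mulLin i (cpoly d (i ℤ.- posℤ 1))
  cpoly-suc d i = trans (cong prodLin (map-upTo-suc (λ j → i ℤ.- posℤ j) (λ j → i ℤ.- posℤ 1 ℤ.- posℤ j) d (λ j → lem i (posℤ j))))
    (cong (λ z → mulLin z (cpoly d (i ℤ.- posℤ 1))) (ℤₚ.+-identityʳ i))
    where
    lem : ∀ i j → i ℤ.- (posℤ 1 ℤ.+ j) ≡ i ℤ.- posℤ 1 ℤ.- j
    lem = ℤSolver.solve-∀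

  -- The product z(z - 1)...(z - d) is z times c_i(z) for i = -1. Oddness of the cubic will turn
  -- this coefficient into the weight of h₀.
  stirl-suc : ∀ d r → stirl (suc d) (suc r) ≡ C d r (ℤ.- posℤ 1)
  stirl-suc d r = begin
    coeff (prodLin (List.map (λ j → ℤ.- posℤ j) (List.upTo (suc d)))) (suc r)
      ≡⟨ cong (λ as → coeff (prodLin as) (suc r)) (map-upTo-suc (λ j → ℤ.- posℤ j) (λ j → ℤ.- posℤ 1 ℤ.- posℤ j) d (λ j → lem (posℤ j))) ⟩
    coeff (mulLin (posℤ 0) (cpoly d (ℤ.- posℤ 1))) (suc r)
      ≡⟨ coeff-mulLin (posℤ 0) (cpoly d (ℤ.- posℤ 1)) r ⟩
    C d r (ℤ.- posℤ 1) ℤ.+ posℤ 0 ℤ.* coeff (cpoly d (ℤ.- posℤ 1)) (suc r)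
      ≡⟨ ℤₚ.+-identityʳ _ ⟩
    C d r (ℤ.- posℤ 1) ∎
    where
    lem : ∀ j → ℤ.- (posℤ 1 ℤ.+ j) ≡ ℤ.- posℤ 1 ℤ.- j
    lem = ℤSolver.solve-∀

  private
    ⟦i-1⟧ : ∀ i → ⟦ i ℤ.- posℤ 1 ⟧ ≡ ⟦ i ⟧ - 1ℚ
    ⟦i-1⟧ i = trans (⟦⟧-- i (posℤ 1)) (cong (λ z → ⟦ i ⟧ - z) ⟦1⟧)

  C-suc : ∀ d r i → ⟦ C (suc d) (suc r) i ⟧ ≡ ⟦ C d r (i ℤ.- posℤ 1) ⟧ + ⟦ i ⟧ * ⟦ C d (suc r) (i ℤ.- posℤ 1) ⟧
  C-suc d r i = trans (cong ⟦_⟧ (trans (cong (λ p → coeff p (suc r)) (cpoly-suc d i)) (coeff-mulLin i (cpoly d (i ℤ.- posℤ 1)) r)))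
    (trans (⟦⟧-+ _ _) (cong (⟦ C d r (i ℤ.- posℤ 1) ⟧ +_) (⟦⟧-* i _)))

  C-zero : ∀ d i → ⟦ C (suc d) 0 i ⟧ ≡ ⟦ i ⟧ * ⟦ C d 0 (i ℤ.- posℤ 1) ⟧
  C-zero d i = trans (cong ⟦_⟧ (trans (cong (λ p → coeff p 0) (cpoly-suc d i)) (coeff-mulLin-0 i (cpoly d (i ℤ.- posℤ 1))))) (⟦⟧-* i _)

  C-above : ∀ d r i → ⟦ C d (suc (d ℕ.+ r)) i ⟧ ≡ 0ℚ
  C-above zero    r i = ⟦0⟧
  C-above (suc d) r i = trans (C-suc d (suc (d ℕ.+ r)) i) (trans (cong₂ (λ a b → a + ⟦ i ⟧ * b) (C-above d r (i ℤ.- posℤ 1))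
    (trans (cong (λ s → ⟦ C d (suc s) (i ℤ.- posℤ 1) ⟧) (sym (ℕₚ.+-suc d r))) (C-above d (suc r) (i ℤ.- posℤ 1)))) (trans (cong (0ℚ +_) (zeroʳ ⟦ i ⟧)) (+-identityˡ 0ℚ)))

  C-top : ∀ d i → ⟦ C d d i ⟧ ≡ 1ℚ
  C-top zero    i = ⟦1⟧
  C-top (suc d) i = trans (C-suc d d i) (trans (cong₂ (λ a b → a + ⟦ i ⟧ * b) (C-top d (i ℤ.- posℤ 1))
    (trans (cong (λ s → ⟦ C d (suc s) (i ℤ.- posℤ 1) ⟧) (sym (ℕₚ.+-identityʳ d))) (C-above d 0 (i ℤ.- posℤ 1)))) (trans (cong (1ℚ +_) (zeroʳ ⟦ i ⟧)) (+-identityʳ 1ℚ)))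

  2ℚ 3ℚ 24ℚ 48ℚ : ℚ
  2ℚ = 1ℚ + 1ℚ
  3ℚ = 2ℚ + 1ℚ
  24ℚ = 2ℚ * 2ℚ * 2ℚ * 3ℚ
  48ℚ = 2ℚ * 24ℚ

  -- The factors of c_i have arithmetic mean X/2, where X = 2 i − d + 1; the closed forms are polynomials in X.
  centred : ℚ → ℚ → ℚ
  centred D i = 2ℚ * i - D + 1ℚ

  -- 48 times the third elementary symmetric polynomial of the numbers i - j. Their deviations from
  -- the mean X/2 are symmetric about 0, so no even power of X survives; 48 = 6 · 8 clears binom(d,
  -- 3) and the cube of X/2.
  cubic : ℚ → ℚ → ℚ
  cubic D X = D * (D - 1ℚ) * (D - 2ℚ) * (X * (X * X - (D + 1ℚ)))

  private
    quadratic : ℚ → ℚ → ℚ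
    quadratic D X = D * (D - 1ℚ) * (3ℚ * (X * X) - (D + 1ℚ))

    opaque
      unfolding _+_
      b1 : ∀ i → 2ℚ * (i * 1ℚ) ≡ 1ℚ * (2ℚ * i - 1ℚ + 1ℚ)
      b1 = solve-∀ ringℚ
      s1 : ∀ D i → D * (2ℚ * (i - 1ℚ) - D + 1ℚ) + 2ℚ * (i * 1ℚ) ≡ (1ℚ + D) * (2ℚ * i - (1ℚ + D) + 1ℚ)
      s1 = solve-∀ ringℚ
      d1 : ∀ a b i → 2ℚ * (a + i * b) ≡ 2ℚ * a + 2ℚ * (i * b)
      d1 = solve-∀ ringℚ
      b2 : ∀ i → 24ℚ * (i * ((i - 1ℚ) * 1ℚ)) ≡ ((1ℚ + 1ℚ) * ((1ℚ + 1ℚ) - 1ℚ) * (3ℚ * ((2ℚ * i - (1ℚ + 1ℚ) + 1ℚ) * (2ℚ * i - (1ℚ + 1ℚ) + 1ℚ)) - ((1ℚ + 1ℚ) + 1ℚ)))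
      b2 = solve-∀ ringℚ
      d2 : ∀ a b i → 24ℚ * (a + i * b) ≡ 24ℚ * a + 2ℚ * 2ℚ * 3ℚ * i * (2ℚ * b)
      d2 = solve-∀ ringℚ
      s2 : ∀ D i → (D * (D - 1ℚ) * (3ℚ * ((2ℚ * (i - 1ℚ) - D + 1ℚ) * (2ℚ * (i - 1ℚ) - D + 1ℚ)) - (D + 1ℚ))) + 2ℚ * 2ℚ * 3ℚ * i * (D * (2ℚ * (i - 1ℚ) - D + 1ℚ)) ≡ ((1ℚ + D) * ((1ℚ + D) - 1ℚ) * (3ℚ * ((2ℚ * i - (1ℚ + D) + 1ℚ) * (2ℚ * i - (1ℚ + D) + 1ℚ)) - ((1ℚ + D) + 1ℚ)))
      s2 = solve-∀ ringℚ
      b3 : ∀ i → 48ℚ * (i * ((i - 1ℚ) * ((i - 1ℚ - 1ℚ) * 1ℚ))) ≡ ((1ℚ + (1ℚ + 1ℚ)) * ((1ℚ + (1ℚ + 1ℚ)) - 1ℚ) * ((1ℚ + (1ℚ + 1ℚ)) - 2ℚ) * ((2ℚ * i - (1ℚ + (1ℚ + 1ℚ)) + 1ℚ) * ((2ℚ * i - (1ℚ + (1ℚ + 1ℚ)) + 1ℚ) * (2ℚ * i - (1ℚ + (1ℚ + 1ℚ)) + 1ℚ) - ((1ℚ + (1ℚ + 1ℚ)) + 1ℚ))))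
      b3 = solve-∀ ringℚ
      d3 : ∀ a b i → 48ℚ * (a + i * b) ≡ 48ℚ * a + 2ℚ * i * (24ℚ * b)
      d3 = solve-∀ ringℚ
      s3 : ∀ D i → (D * (D - 1ℚ) * (D - 2ℚ) * ((2ℚ * (i - 1ℚ) - D + 1ℚ) * ((2ℚ * (i - 1ℚ) - D + 1ℚ) * (2ℚ * (i - 1ℚ) - D + 1ℚ) - (D + 1ℚ)))) + 2ℚ * i * (D * (D - 1ℚ) * (3ℚ * ((2ℚ * (i - 1ℚ) - D + 1ℚ) * (2ℚ * (i - 1ℚ) - D + 1ℚ)) - (D + 1ℚ))) ≡ ((1ℚ + D) * ((1ℚ + D) - 1ℚ) * ((1ℚ + D) - 2ℚ) * ((2ℚ * i - (1ℚ + D) + 1ℚ) * ((2ℚ * i - (1ℚ + D) + 1ℚ) * (2ℚ * i - (1ℚ + D) + 1ℚ) - ((1ℚ + D) + 1ℚ))))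
      s3 = solve-∀ ringℚ

    C-1 : ∀ r i → 2ℚ * ⟦ C (suc r) r i ⟧ ≡ ⟦ suc r ⟧ℕ * centred ⟦ suc r ⟧ℕ ⟦ i ⟧
    C-1 zero i = trans (cong (2ℚ *_) (trans (C-zero 0 i) (cong (⟦ i ⟧ *_) (C-top 0 (i ℤ.- posℤ 1))))) (trans (b1 ⟦ i ⟧) (cong (λ D → D * centred D ⟦ i ⟧) (sym ⟦1⟧)))
    C-1 (suc r) i = begin
      2ℚ * ⟦ C (suc (suc r)) (suc r) i ⟧
        ≡⟨ cong (2ℚ *_) (trans (C-suc (suc r) r i) (cong (λ z → ⟦ C (suc r) r (i ℤ.- posℤ 1) ⟧ + ⟦ i ⟧ * z) (C-top (suc r) (i ℤ.- posℤ 1)))) ⟩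
      2ℚ * (⟦ C (suc r) r (i ℤ.- posℤ 1) ⟧ + ⟦ i ⟧ * 1ℚ)
        ≡⟨ d1 _ 1ℚ ⟦ i ⟧ ⟩
      2ℚ * ⟦ C (suc r) r (i ℤ.- posℤ 1) ⟧ + 2ℚ * (⟦ i ⟧ * 1ℚ)
        ≡⟨ cong (_+ 2ℚ * (⟦ i ⟧ * 1ℚ)) (trans (C-1 r (i ℤ.- posℤ 1)) (cong (λ z → ⟦ suc r ⟧ℕ * centred ⟦ suc r ⟧ℕ z) (⟦i-1⟧ i))) ⟩
      ⟦ suc r ⟧ℕ * centred ⟦ suc r ⟧ℕ (⟦ i ⟧ - 1ℚ) + 2ℚ * (⟦ i ⟧ * 1ℚ)
        ≡⟨ s1 ⟦ suc r ⟧ℕ ⟦ i ⟧ ⟩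
      (1ℚ + ⟦ suc r ⟧ℕ) * centred (1ℚ + ⟦ suc r ⟧ℕ) ⟦ i ⟧
        ≡⟨ cong (λ D → D * centred D ⟦ i ⟧) (sym (⟦⟧ℕ-suc (suc r))) ⟩
      ⟦ suc (suc r) ⟧ℕ * centred ⟦ suc (suc r) ⟧ℕ ⟦ i ⟧ ∎

    ⟦2⟧ : ⟦ 2 ⟧ℕ ≡ 1ℚ + 1ℚ
    ⟦2⟧ = trans (⟦⟧ℕ-suc 1) (cong (1ℚ +_) ⟦1⟧)

    C-2 : ∀ r i → 24ℚ * ⟦ C (2 ℕ.+ r) r i ⟧ ≡ quadratic ⟦ 2 ℕ.+ r ⟧ℕ (centred ⟦ 2 ℕ.+ r ⟧ℕ ⟦ i ⟧)
    C-2 zero i = trans (cong (24ℚ *_) (trans (C-zero 1 i) (cong (⟦ i ⟧ *_) (trans (C-zero 0 (i ℤ.- posℤ 1)) (cong₂ _*_ (⟦i-1⟧ i) (C-top 0 (i ℤ.- posℤ 1 ℤ.- posℤ 1)))))))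
      (trans (b2 ⟦ i ⟧) (cong (λ D → quadratic D (centred D ⟦ i ⟧)) (sym ⟦2⟧)))
    C-2 (suc r) i = begin
      24ℚ * ⟦ C (2 ℕ.+ suc r) (suc r) i ⟧
        ≡⟨ cong (24ℚ *_) (C-suc (2 ℕ.+ r) r i) ⟩
      24ℚ * (⟦ C (2 ℕ.+ r) r (i ℤ.- posℤ 1) ⟧ + ⟦ i ⟧ * ⟦ C (2 ℕ.+ r) (suc r) (i ℤ.- posℤ 1) ⟧)
        ≡⟨ d2 _ _ ⟦ i ⟧ ⟩
      24ℚ * ⟦ C (2 ℕ.+ r) r (i ℤ.- posℤ 1) ⟧ + 2ℚ * 2ℚ * 3ℚ * ⟦ i ⟧ * (2ℚ * ⟦ C (2 ℕ.+ r) (suc r) (i ℤ.- posℤ 1) ⟧)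
        ≡⟨ cong₂ (λ a b → a + 2ℚ * 2ℚ * 3ℚ * ⟦ i ⟧ * b)
             (trans (C-2 r (i ℤ.- posℤ 1)) (cong (λ z → quadratic ⟦ 2 ℕ.+ r ⟧ℕ (centred ⟦ 2 ℕ.+ r ⟧ℕ z)) (⟦i-1⟧ i)))
             (trans (C-1 (suc r) (i ℤ.- posℤ 1)) (cong (λ z → ⟦ 2 ℕ.+ r ⟧ℕ * centred ⟦ 2 ℕ.+ r ⟧ℕ z) (⟦i-1⟧ i))) ⟩
      quadratic ⟦ 2 ℕ.+ r ⟧ℕ (centred ⟦ 2 ℕ.+ r ⟧ℕ (⟦ i ⟧ - 1ℚ)) + 2ℚ * 2ℚ * 3ℚ * ⟦ i ⟧ * (⟦ 2 ℕ.+ r ⟧ℕ * centred ⟦ 2 ℕ.+ r ⟧ℕ (⟦ i ⟧ - 1ℚ))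
        ≡⟨ s2 ⟦ 2 ℕ.+ r ⟧ℕ ⟦ i ⟧ ⟩
      quadratic (1ℚ + ⟦ 2 ℕ.+ r ⟧ℕ) (centred (1ℚ + ⟦ 2 ℕ.+ r ⟧ℕ) ⟦ i ⟧)
        ≡⟨ cong (λ D → quadratic D (centred D ⟦ i ⟧)) (sym (⟦⟧ℕ-suc (2 ℕ.+ r))) ⟩
      quadratic ⟦ 2 ℕ.+ suc r ⟧ℕ (centred ⟦ 2 ℕ.+ suc r ⟧ℕ ⟦ i ⟧) ∎

  -- Each use of the recurrence `C-suc` brings in the next higher coefficient, hence the ladder
  -- `C-top`, `C-1`, `C-2` below this one.
  C-3 : ∀ r i → 48ℚ * ⟦ C (3 ℕ.+ r) r i ⟧ ≡ cubic ⟦ 3 ℕ.+ r ⟧ℕ (centred ⟦ 3 ℕ.+ r ⟧ℕ ⟦ i ⟧)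
  C-3 zero i = trans (cong (48ℚ *_) (trans (C-zero 2 i) (cong (⟦ i ⟧ *_) (trans (C-zero 1 (i ℤ.- posℤ 1)) (cong₂ _*_ (⟦i-1⟧ i)
      (trans (C-zero 0 (i ℤ.- posℤ 1 ℤ.- posℤ 1)) (cong₂ _*_ (trans (⟦i-1⟧ (i ℤ.- posℤ 1)) (cong (_- 1ℚ) (⟦i-1⟧ i))) (C-top 0 (i ℤ.- posℤ 1 ℤ.- posℤ 1 ℤ.- posℤ 1)))))))))
    (trans (b3 ⟦ i ⟧) (cong (λ D → cubic D (centred D ⟦ i ⟧)) (sym (trans (⟦⟧ℕ-suc 2) (cong (1ℚ +_) ⟦2⟧)))))
  C-3 (suc r) i = begin
    48ℚ * ⟦ C (3 ℕ.+ suc r) (suc r) i ⟧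
      ≡⟨ cong (48ℚ *_) (C-suc (3 ℕ.+ r) r i) ⟩
    48ℚ * (⟦ C (3 ℕ.+ r) r (i ℤ.- posℤ 1) ⟧ + ⟦ i ⟧ * ⟦ C (3 ℕ.+ r) (suc r) (i ℤ.- posℤ 1) ⟧)
      ≡⟨ d3 _ _ ⟦ i ⟧ ⟩
    48ℚ * ⟦ C (3 ℕ.+ r) r (i ℤ.- posℤ 1) ⟧ + 2ℚ * ⟦ i ⟧ * (24ℚ * ⟦ C (3 ℕ.+ r) (suc r) (i ℤ.- posℤ 1) ⟧)
      ≡⟨ cong₂ (λ a b → a + 2ℚ * ⟦ i ⟧ * b)
           (trans (C-3 r (i ℤ.- posℤ 1)) (cong (λ z → cubic ⟦ 3 ℕ.+ r ⟧ℕ (centred ⟦ 3 ℕ.+ r ⟧ℕ z)) (⟦i-1⟧ i)))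
           (trans (C-2 (suc r) (i ℤ.- posℤ 1)) (cong (λ z → quadratic ⟦ 3 ℕ.+ r ⟧ℕ (centred ⟦ 3 ℕ.+ r ⟧ℕ z)) (⟦i-1⟧ i))) ⟩
    cubic ⟦ 3 ℕ.+ r ⟧ℕ (centred ⟦ 3 ℕ.+ r ⟧ℕ (⟦ i ⟧ - 1ℚ)) + 2ℚ * ⟦ i ⟧ * quadratic ⟦ 3 ℕ.+ r ⟧ℕ (centred ⟦ 3 ℕ.+ r ⟧ℕ (⟦ i ⟧ - 1ℚ))
      ≡⟨ s3 ⟦ 3 ℕ.+ r ⟧ℕ ⟦ i ⟧ ⟩
    cubic (1ℚ + ⟦ 3 ℕ.+ r ⟧ℕ) (centred (1ℚ + ⟦ 3 ℕ.+ r ⟧ℕ) ⟦ i ⟧)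
      ≡⟨ cong (λ D → cubic D (centred D ⟦ i ⟧)) (sym (⟦⟧ℕ-suc (3 ℕ.+ r))) ⟩
    cubic ⟦ 3 ℕ.+ suc r ⟧ℕ (centred ⟦ 3 ℕ.+ suc r ⟧ℕ ⟦ i ⟧) ∎

  falling : ℕ → ℚ → ℚ
  falling zero    x = 1ℚ
  falling (suc s) x = x * falling s (x - 1ℚ)

  falling-end : ∀ s x → falling (suc s) x ≡ falling s x * (x - ⟦ s ⟧ℕ)
  falling-end zero    x = trans (*-comm x 1ℚ) (cong (1ℚ *_) (sym (trans (cong (λ z → x - z) ⟦0⟧) (trans (cong (x +_) neg-0) (+-identityʳ x)))))
  falling-end (suc s) x = trans (cong (x *_) (falling-end s (x - 1ℚ))) (trans (lem x (falling s (x - 1ℚ)) ⟦ s ⟧ℕ) (cong (λ z → (x * falling s (x - 1ℚ)) * (x - z)) (sym (⟦⟧ℕ-suc s))))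
    where
    opaque
      unfolding _+_
      lem : ∀ x f s → x * (f * ((x - 1ℚ) - s)) ≡ (x * f) * (x - (1ℚ + s))
      lem = solve-∀ ringℚ

  falling-small : ∀ s t → t ℕ.< s → falling s ⟦ t ⟧ℕ ≡ 0ℚ
  falling-small (suc s) zero    _ = trans (cong (_* falling s (⟦ 0 ⟧ℕ - 1ℚ)) ⟦0⟧) (zeroˡ (falling s (⟦ 0 ⟧ℕ - 1ℚ)))
  falling-small (suc s) (suc t) (ℕ.s≤s p) = trans (cong (λ z → ⟦ suc t ⟧ℕ * falling s z) (trans (cong (_- 1ℚ) (⟦⟧ℕ-suc t)) (lem ⟦ t ⟧ℕ)))
    (trans (cong (⟦ suc t ⟧ℕ *_) (falling-small s t p)) (zeroʳ ⟦ suc t ⟧ℕ))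
    where
    opaque
      unfolding _+_
      lem : ∀ t → (1ℚ + t) - 1ℚ ≡ t
      lem = solve-∀ ringℚ

  peval : Poly → ℚ → ℚ
  peval []      x = 0ℚ
  peval (a ∷ p) x = ⟦ a ⟧ + x * peval p x

  private
    opaque
      unfolding _+_
      p1 : ∀ a b x u v → (a + b) + x * (u + v) ≡ (a + x * u) + (b + x * v)
      p1 = solve-∀ ringℚ
      p2 : ∀ a b x u → a * b + x * (a * u) ≡ a * (b + x * u)
      p2 = solve-∀ ringℚ
      p3 : ∀ a x u → (0ℚ + x * u) + a * u ≡ (x + a) * u
      p3 = solve-∀ ringℚ

    peval-+ : ∀ p q x → peval (p +ₚ q) x ≡ peval p x + peval q x
    peval-+ []      q       x = sym (+-identityˡ _)
    peval-+ (a ∷ p) []      x = sym (+-identityʳ _)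
    peval-+ (a ∷ p) (b ∷ q) x = trans (cong₂ (λ u v → u + x * v) (⟦⟧-+ a b) (peval-+ p q x)) (p1 ⟦ a ⟧ ⟦ b ⟧ x _ _)

    peval-map : ∀ a p x → peval (List.map (a ℤ.*_) p) x ≡ ⟦ a ⟧ * peval p x
    peval-map a []      x = sym (zeroʳ ⟦ a ⟧)
    peval-map a (b ∷ p) x = trans (cong₂ (λ u v → u + x * v) (⟦⟧-* a b) (peval-map a p x)) (p2 ⟦ a ⟧ ⟦ b ⟧ x _)

    peval-mulLin : ∀ a p x → peval (mulLin a p) x ≡ (x + ⟦ a ⟧) * peval p x
    peval-mulLin a p x = trans (peval-+ (posℤ 0 ∷ p) (List.map (a ℤ.*_) p) x) (trans (cong₂ (λ u v → (u + x * peval p x) + v) ⟦0⟧ (peval-map a p x)) (p3 ⟦ a ⟧ x (peval p x)))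

  peval-cpoly : ∀ d i x → peval (cpoly d i) x ≡ falling d (x + ⟦ i ⟧)
  peval-cpoly zero    i x = trans (cong₂ _+_ ⟦1⟧ (zeroʳ x)) (+-identityʳ 1ℚ)
  peval-cpoly (suc d) i x = trans (cong (λ p → peval p x) (cpoly-suc d i)) (trans (peval-mulLin i (cpoly d (i ℤ.- posℤ 1)) x)
    (cong ((x + ⟦ i ⟧) *_) (trans (peval-cpoly d (i ℤ.- posℤ 1) x) (cong (falling d) (trans (cong (x +_) (⟦i-1⟧ i)) (sym (+-assoc x ⟦ i ⟧ (- 1ℚ))))))))

  private
    length-+ₚ : ∀ p q n → length p ℕ.≤ n → length q ℕ.≤ n → length (p +ₚ q) ℕ.≤ n
    length-+ₚ []      q       n       _ l = l
    length-+ₚ (a ∷ p) []      n       l _ = l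
    length-+ₚ (a ∷ p) (b ∷ q) (suc n) (ℕ.s≤s l) (ℕ.s≤s l') = ℕ.s≤s (length-+ₚ p q n l l')

  length-cpoly : ∀ d i → length (cpoly d i) ℕ.≤ suc d
  length-cpoly zero    i = ℕ.s≤s ℕ.z≤n
  length-cpoly (suc d) i = subst (λ p → length p ℕ.≤ suc (suc d)) (sym (cpoly-suc d i))
    (length-+ₚ (posℤ 0 ∷ p) (List.map (i ℤ.*_) p) (suc (suc d)) (ℕ.s≤s (length-cpoly d (i ℤ.- posℤ 1)))
      (subst (ℕ._≤ suc (suc d)) (sym (Listₚ.length-map (i ℤ.*_) p)) (ℕₚ.m≤n⇒m≤1+n (length-cpoly d (i ℤ.- posℤ 1)))))
    where
    p = cpoly d (i ℤ.- posℤ 1)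

  peval-coeff : ∀ p N n → length p ℕ.≤ N → sum (λ (r : Fin N) → ⟦ coeff p (toℕ r) ⟧ * ⟦ n ℕ.^ toℕ r ⟧ℕ) ≡ peval p ⟦ n ⟧ℕ
  peval-coeff []      N       n _ = Σ-0 (λ r → trans (cong (_* ⟦ n ℕ.^ toℕ r ⟧ℕ) ⟦0⟧) (zeroˡ ⟦ n ℕ.^ toℕ r ⟧ℕ))
  peval-coeff (a ∷ p) (suc N) n (ℕ.s≤s l) = trans (sum-suc (λ (r : Fin (suc N)) → ⟦ coeff (a ∷ p) (toℕ r) ⟧ * ⟦ n ℕ.^ toℕ r ⟧ℕ))
    (cong₂ _+_ (trans (cong (⟦ a ⟧ *_) ⟦1⟧) (trans (*-comm ⟦ a ⟧ 1ℚ) (*-identityˡ ⟦ a ⟧)))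
      (trans (Σ-cong (λ (r : Fin N) → trans (cong (⟦ coeff p (toℕ r) ⟧ *_) (⟦⟧ℕ-* n (n ℕ.^ toℕ r))) (lem ⟦ coeff p (toℕ r) ⟧ ⟦ n ⟧ℕ ⟦ n ℕ.^ toℕ r ⟧ℕ)))
        (trans (Σ-* ⟦ n ⟧ℕ _) (cong (⟦ n ⟧ℕ *_) (peval-coeff p N n l)))))
    where
    opaque
      unfolding _+_
      lem : ∀ a b c → a * (b * c) ≡ b * (a * c)
      lem = solve-∀ ringℚ

  C-eval : ∀ d i n → sum (λ (r : Fin (suc d)) → ⟦ C d (toℕ r) i ⟧ * ⟦ n ℕ.^ toℕ r ⟧ℕ) ≡ falling d (⟦ n ⟧ℕ + ⟦ i ⟧)
  C-eval d i n = trans (peval-coeff (cpoly d i) (suc d) n (length-cpoly d i)) (peval-cpoly d i ⟦ n ⟧ℕ)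

-- Polynomials in n, their growth, and the polynomial with a given h*-vector.

module Polynomials where
  open import Data.Rational using (_≤_; _<_)
  open Rationals
  open Cardinality
  open Coefficients

  sumTo : ℕ → (ℕ → ℚ) → ℚ
  sumTo zero    f = 0ℚ
  sumTo (suc n) f = sumTo n f + f n

  sumTo-cong : ∀ n {f g : ℕ → ℚ} → (∀ i → i ℕ.< n → f i ≡ g i) → sumTo n f ≡ sumTo n g
  sumTo-cong zero    p = refl
  sumTo-cong (suc n) p = cong₂ _+_ (sumTo-cong n (λ i l → p i (ℕₚ.m≤n⇒m≤1+n l))) (p n ℕₚ.≤-refl)

  sumTo-+ : ∀ n f g → sumTo n (λ i → f i + g i) ≡ sumTo n f + sumTo n g
  sumTo-+ zero    f g = sym (+-identityˡ 0ℚ)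
  sumTo-+ (suc n) f g = trans (cong (_+ (f n + g n)) (sumTo-+ n f g)) (lem (sumTo n f) (sumTo n g) (f n) (g n))
    where
    opaque
      unfolding _+_
      lem : ∀ a b c d → (a + b) + (c + d) ≡ (a + c) + (b + d)
      lem = solve-∀ ringℚ

  sumTo-* : ∀ n a f → sumTo n (λ i → a * f i) ≡ a * sumTo n f
  sumTo-* zero    a f = sym (zeroʳ a)
  sumTo-* (suc n) a f = trans (cong (_+ a * f n) (sumTo-* n a f)) (sym (distribˡ a _ _))

  sumTo-*ʳ : ∀ n a f → sumTo n (λ i → f i * a) ≡ sumTo n f * a
  sumTo-*ʳ n a f = trans (sumTo-cong n (λ i _ → *-comm (f i) a)) (trans (sumTo-* n a f) (*-comm a (sumTo n f)))

  sumTo-0 : ∀ n {f : ℕ → ℚ} → (∀ i → i ℕ.< n → f i ≡ 0ℚ) → sumTo n f ≡ 0ℚ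
  sumTo-0 zero    p = refl
  sumTo-0 (suc n) p = trans (cong₂ _+_ (sumTo-0 n (λ i l → p i (ℕₚ.m≤n⇒m≤1+n l))) (p n ℕₚ.≤-refl)) (+-identityˡ 0ℚ)

  sumTo-suc : ∀ n f → sumTo (suc n) f ≡ f 0 + sumTo n (λ i → f (suc i))
  sumTo-suc zero    f = +-comm 0ℚ (f 0)
  sumTo-suc (suc n) f = trans (cong (_+ f (suc n)) (sumTo-suc n f)) (+-assoc (f 0) _ _)

  sumTo-nonneg : ∀ n {f : ℕ → ℚ} → (∀ i → i ℕ.< n → 0ℚ ≤ f i) → 0ℚ ≤ sumTo n f
  sumTo-nonneg zero    p = ≤-refl
  sumTo-nonneg (suc n) p = 0≤+ (sumTo-nonneg n (λ i l → p i (ℕₚ.m≤n⇒m≤1+n l))) (p n ℕₚ.≤-refl)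

  sum-sumTo : ∀ n (f : ℕ → ℚ) → sum (λ (i : Fin n) → f (toℕ i)) ≡ sumTo n f
  sum-sumTo zero    f = sum-zero (λ i → f (toℕ i))
  sum-sumTo (suc n) f = trans (sum-suc {n} (λ i → f (toℕ i))) (trans (cong (f 0 +_) (sum-sumTo n (λ i → f (suc i)))) (sym (sumTo-suc n f)))

  sumTo-swap : ∀ m n (f : ℕ → ℕ → ℚ) → sumTo m (λ i → sumTo n (λ j → f i j)) ≡ sumTo n (λ j → sumTo m (λ i → f i j))
  sumTo-swap zero    n f = sym (sumTo-0 n (λ _ _ → refl))
  sumTo-swap (suc m) n f = trans (cong (_+ sumTo n (f m)) (sumTo-swap m n f)) (sym (sumTo-+ n _ _))

  sumTo-single : ∀ n j (f : ℕ → ℚ) → j ℕ.< n → (∀ i → i ≢ j → f i ≡ 0ℚ) → sumTo n f ≡ f j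
  sumTo-single (suc n) j f l p with j ℕₚ.≟ n
  ... | yes refl = trans (cong (_+ f n) (sumTo-0 n (λ i i<n → p i (ℕₚ.<⇒≢ i<n)))) (+-identityˡ (f n))
  ... | no q = trans (cong₂ _+_ (sumTo-single n j f (ℕₚ.≤∧≢⇒< (ℕ.s≤s⁻¹ l) q) p) (p n (λ e → q (sym e)))) (+-identityʳ (f j))

  ∣_∣ : ℚ → ℚ
  ∣_∣ = ℚ.∣_∣

  opaque
    unfolding _+_
    ∣+∣ : ∀ a b → ∣ a + b ∣ ≤ ∣ a ∣ + ∣ b ∣
    ∣+∣ = ℚₚ.∣p+q∣≤∣p∣+∣q∣

    ∣*∣ : ∀ a b → ∣ a * b ∣ ≡ ∣ a ∣ * ∣ b ∣
    ∣*∣ = ℚₚ.∣p*q∣≡∣p∣*∣q∣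

    ∣neg∣ : ∀ a → ∣ - a ∣ ≡ ∣ a ∣
    ∣neg∣ = ℚₚ.∣-p∣≡∣p∣

  ∣∣-nonneg : ∀ a → 0ℚ ≤ ∣ a ∣
  ∣∣-nonneg = ℚₚ.0≤∣p∣

  ∣⟦⟧∣ : ∀ n → ∣ ⟦ n ⟧ℕ ∣ ≡ ⟦ n ⟧ℕ
  ∣⟦⟧∣ n = ℚₚ.0≤p⇒∣p∣≡p (⟦⟧ℕ-nonneg n)

  archimedean : ∀ a → ∃[ n ] a < ⟦ n ⟧ℕ
  archimedean a = go (floor a)
    where
    go : Σ ℤ (λ z → ⟦ z ⟧ ≤ a × a < ⟦ z ⟧ + 1ℚ) → ∃[ n ] a < ⟦ n ⟧ℕ
    go (posℤ n , _ , q) = suc n , subst (a <_) (trans (+-comm _ 1ℚ) (sym (⟦⟧ℕ-suc n))) q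
    go (ℤ.-[1+ n ] , _ , q) = 1 , <-≤-trans q (subst₂ _≤_ refl (trans (+-identityˡ 1ℚ) (sym ⟦1⟧)) (+-mono-≤ (subst (⟦ ℤ.-[1+ n ] ⟧ ≤_) ⟦0⟧ (⟦⟧-mono-≤ ℤ.-≤+)) ≤-refl))

  poly : ℕ → (ℕ → ℚ) → ℕ → ℚ
  poly N c n = sumTo N (λ r → c r * ⟦ n ℕ.^ r ⟧ℕ)

  private
    weight : ℕ → (ℕ → ℚ) → ℚ
    weight N c = sumTo N (λ r → ∣ c r ∣)

    -- The degree is at most N - 1; the factor n on the left avoids this exponent and with it the
    -- case N = 0.
    poly-growth : ∀ N c n → 1 ℕ.≤ n → ∣ poly N c n ∣ * ⟦ n ⟧ℕ ≤ weight N c * ⟦ n ℕ.^ N ⟧ℕ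
    poly-growth zero    c n _ = ≤-reflexive (trans (zeroˡ ⟦ n ⟧ℕ) (sym (zeroˡ ⟦ 1 ⟧ℕ)))
    poly-growth (suc N) c n 1≤n = ≤-trans
      (0≤-⇒≤ (subst (0ℚ ≤_) (lem (∣ poly N c n ∣) (∣ c N * nN ∣) (∣ poly N c n + c N * nN ∣) ⟦ n ⟧ℕ) (0≤* (≤⇒0≤- (∣+∣ (poly N c n) (c N * nN))) (⟦⟧ℕ-nonneg n))))
      (≤-trans (+-mono-≤ (≤-trans (poly-growth N c n 1≤n) step) (≤-reflexive top)) (≤-reflexive (sym (distribʳ nN1 (weight N c) (∣ c N ∣)))))
      where
      nN = ⟦ n ℕ.^ N ⟧ℕ
      nN1 = ⟦ n ℕ.^ suc N ⟧ℕ
      nN1≡ : nN1 ≡ ⟦ n ⟧ℕ * nN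
      nN1≡ = ⟦⟧ℕ-* n (n ℕ.^ N)
      opaque
        unfolding _+_
        lem : ∀ a b c n → (a + b - c) * n ≡ (a * n + b * n) - c * n
        lem = solve-∀ ringℚ
        lem' : ∀ a b c → (a * b) * c ≡ a * (c * b)
        lem' = solve-∀ ringℚ
        lem'' : ∀ w n m → w * (n * m) - w * m ≡ w * m * (n - 1ℚ)
        lem'' = solve-∀ ringℚ
      step : weight N c * nN ≤ weight N c * nN1
      step = 0≤-⇒≤ (subst (0ℚ ≤_) (sym (trans (cong (λ z → weight N c * z - weight N c * nN) nN1≡) (lem'' (weight N c) ⟦ n ⟧ℕ nN)))
        (0≤* (0≤* (sumTo-nonneg N (λ r _ → ∣∣-nonneg (c r))) (⟦⟧ℕ-nonneg (n ℕ.^ N))) (≤⇒0≤- (subst (_≤ ⟦ n ⟧ℕ) ⟦1⟧ (⟦⟧ℕ-mono-≤ 1≤n)))))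
      top : ∣ c N * nN ∣ * ⟦ n ⟧ℕ ≡ ∣ c N ∣ * nN1
      top = trans (cong (_* ⟦ n ⟧ℕ) (trans (∣*∣ (c N) nN) (cong (∣ c N ∣ *_) (∣⟦⟧∣ (n ℕ.^ N))))) (trans (lem' (∣ c N ∣) nN ⟦ n ⟧ℕ) (cong (∣ c N ∣ *_) (sym nN1≡)))

  poly-little-o : ∀ d c ε → 0ℚ < ε → ∃[ n₀ ] ∀ n → n₀ ℕ.≤ n → 1 ℕ.≤ n → ∣ poly d c n ∣ < ε * ⟦ n ℕ.^ d ⟧ℕ
  poly-little-o d c ε 0<ε with archimedean (weight d c * recip ε)
  ... | n₀ , p = n₀ , go
    where
    opaque
      unfolding _+_
      lem : ∀ e n m w → e * m * n - w * m ≡ m * (e * n - w)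
      lem = solve-∀ ringℚ
      lem' : ∀ e w r n → e * n - w ≡ e * (n - w * r) + w * (e * r - 1ℚ)
      lem' = solve-∀ ringℚ
      lem3 : ∀ a w → a + w * (1ℚ - 1ℚ) ≡ a
      lem3 = solve-∀ ringℚ
      lem4 : ∀ n a b → n * (b - a) ≡ b * n - a * n
      lem4 = solve-∀ ringℚ
    go : ∀ n → n₀ ℕ.≤ n → 1 ℕ.≤ n → ∣ poly d c n ∣ < ε * ⟦ n ℕ.^ d ⟧ℕ
    go n l 1≤n = 0<-⇒< (0<*-cancel (⟦⟧ℕ-pos 1≤n) (subst (0ℚ <_) (sym (lem4 ⟦ n ⟧ℕ _ _)) (<⇒0<- (≤-<-trans (poly-growth d c n 1≤n) upper))))
      where
      upper : weight d c * ⟦ n ℕ.^ d ⟧ℕ < ε * ⟦ n ℕ.^ d ⟧ℕ * ⟦ n ⟧ℕ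
      big : 0ℚ < ε * ⟦ n ⟧ℕ - weight d c
      upper = 0<-⇒< (subst (0ℚ <_) (sym (lem ε ⟦ n ⟧ℕ ⟦ n ℕ.^ d ⟧ℕ (weight d c))) (0<* (⟦⟧ℕ-pos (ℕₚ.m^n>0 n {{ℕ.>-nonZero 1≤n}} d)) big))
      big = subst (0ℚ <_) (sym (trans (lem' ε (weight d c) (recip ε) ⟦ n ⟧ℕ) (trans (cong (λ z → ε * (⟦ n ⟧ℕ - weight d c * recip ε) + weight d c * (z - 1ℚ)) (*-recip (>⇒≢ 0<ε))) (lem3 _ _))))
        (0<* 0<ε (<⇒0<- (<-≤-trans p (⟦⟧ℕ-mono-≤ l))))

  -- Otherwise, with ε half of the absolute value of `c d`, both the polynomial and its part of
  -- lower degree would eventually be smaller than ε nᵈ, while their difference is the leading term.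
  poly-leading-0 : ∀ d c → (∀ ε → 0ℚ < ε → ∃[ n₀ ] ∀ n → n₀ ℕ.≤ n → 1 ℕ.≤ n → ∣ poly (suc d) c n ∣ < ε * ⟦ n ℕ.^ d ⟧ℕ) → c d ≡ 0ℚ
  poly-leading-0 d c small with c d ≟ 0ℚ
  ... | yes p = p
  ... | no q = ⊥-elim (contra (small ε 0<ε) (poly-little-o d c ε 0<ε))
    where
    half = recip 2ℚ
    0<2 : 0ℚ < 2ℚ
    0<2 = 0<+≤ 0<1 0≤1
    ε = ∣ c d ∣ * half
    0<∣c∣ : 0ℚ < ∣ c d ∣
    0<∣c∣ = ≤∧≢⇒< (∣∣-nonneg (c d)) (λ e → q (ℚₚ.∣p∣≡0⇒p≡0 (c d) (sym e)))
    0<ε : 0ℚ < ε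
    0<ε = 0<* 0<∣c∣ (recip-pos 0<2)
    opaque
      unfolding _+_
      lem : ∀ P t → t ≡ (P + t) + (- P)
      lem = solve-∀ ringℚ
      lem' : ∀ a h m → a * h * m + a * h * m ≡ a * m * (2ℚ * h)
      lem' = solve-∀ ringℚ
    contra : (∃[ n₀ ] ∀ n → n₀ ℕ.≤ n → 1 ℕ.≤ n → ∣ poly (suc d) c n ∣ < ε * ⟦ n ℕ.^ d ⟧ℕ) →
      (∃[ n₀ ] ∀ n → n₀ ℕ.≤ n → 1 ℕ.≤ n → ∣ poly d c n ∣ < ε * ⟦ n ℕ.^ d ⟧ℕ) → ⊥
    contra (n₀ , p) (n₁ , p₁) = <-irrefl refl (≤-<-trans bound₁ (≤-<-trans (+-mono-≤ (<⇒≤ (p n l₀ 1≤n)) ≤-refl) (<-≤-trans (+-mono-≤-< ≤-refl (p₁ n l₁ 1≤n)) (≤-reflexive sum≡))))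
      where
      n = suc (n₀ ℕ.+ n₁)
      1≤n : 1 ℕ.≤ n
      1≤n = ℕ.s≤s ℕ.z≤n
      l₀ : n₀ ℕ.≤ n
      l₀ = ℕₚ.m≤n⇒m≤1+n (ℕₚ.m≤m+n n₀ n₁)
      l₁ : n₁ ℕ.≤ n
      l₁ = ℕₚ.m≤n⇒m≤1+n (ℕₚ.m≤n+m n₁ n₀)
      m = ⟦ n ℕ.^ d ⟧ℕ
      bound₁ : ∣ c d ∣ * m ≤ ∣ poly (suc d) c n ∣ + ∣ poly d c n ∣
      bound₁ = subst₂ _≤_ (trans (cong ∣_∣ (sym (lem (poly d c n) (c d * m)))) (trans (∣*∣ (c d) m) (cong (∣ c d ∣ *_) (∣⟦⟧∣ (n ℕ.^ d)))))
        (cong (∣ poly (suc d) c n ∣ +_) (∣neg∣ (poly d c n))) (∣+∣ (poly (suc d) c n) (- poly d c n))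
      sum≡ : ε * m + ε * m ≡ ∣ c d ∣ * m
      sum≡ = trans (lem' (∣ c d ∣) half m) (trans (cong (∣ c d ∣ * m *_) (*-recip (>⇒≢ 0<2))) (trans (*-comm _ 1ℚ) (*-identityˡ _)))

  poly-0 : ∀ N c n₀ → (∀ n → n₀ ℕ.≤ n → poly N c n ≡ 0ℚ) → ∀ r → r ℕ.< N → c r ≡ 0ℚ
  poly-0 (suc N) c n₀ p r l = go (r ℕₚ.≟ N)
    where
    top : c N ≡ 0ℚ
    top = poly-leading-0 N c (λ ε 0<ε → n₀ , λ n l 1≤n → subst (_< ε * ⟦ n ℕ.^ N ⟧ℕ) (sym (cong ∣_∣ (p n l))) (0<* 0<ε (⟦⟧ℕ-pos (ℕₚ.m^n>0 n {{ℕ.>-nonZero 1≤n}} N))))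
    go : Dec (r ≡ N) → c r ≡ 0ℚ
    go (yes refl) = top
    go (no q) = poly-0 N c n₀ (λ n l → trans (sym (+-identityʳ (poly N c n))) (trans (cong (poly N c n +_) (sym (trans (cong (_* ⟦ n ℕ.^ N ⟧ℕ) top) (zeroˡ ⟦ n ℕ.^ N ⟧ℕ)))) (p n l))) r (ℕₚ.≤∧≢⇒< (ℕ.s≤s⁻¹ l) q)

  ind : ℕ → ℕ → ℕ
  ind zero    zero    = 1
  ind zero    (suc i) = 0
  ind (suc j) zero    = 0
  ind (suc j) (suc i) = ind j i

  ind-refl : ∀ j → ind j j ≡ 1
  ind-refl zero    = refl
  ind-refl (suc j) = ind-refl j

  ind-≢ : ∀ j i → j ≢ i → ind j i ≡ 0
  ind-≢ zero    zero    q = ⊥-elim (q refl)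
  ind-≢ zero    (suc i) q = refl
  ind-≢ (suc j) zero    q = refl
  ind-≢ (suc j) (suc i) q = ind-≢ j i (λ e → q (cong suc e))

  private
    Sⁿ-ind-below : ∀ s j n → n ℕ.< j → Sⁿ s (ind j) n ≡ 0
    Sⁿ-ind-below zero    j n       l = ind-≢ j n (λ e → ℕₚ.<⇒≢ l (sym e))
    Sⁿ-ind-below (suc s) j zero    l = Sⁿ-ind-below s j zero l
    Sⁿ-ind-below (suc s) j (suc n) l = cong₂ ℕ._+_ (Sⁿ-ind-below (suc s) j n (ℕₚ.<-trans ℕₚ.≤-refl l)) (Sⁿ-ind-below s j (suc n) l)

    S-at : ∀ s j → Sⁿ (suc s) (ind j) j ≡ Sⁿ s (ind j) j
    S-at s zero    = refl
    S-at s (suc j) = cong (ℕ._+ Sⁿ s (ind (suc j)) (suc j)) (Sⁿ-ind-below (suc s) (suc j) j ℕₚ.≤-refl)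

    Sⁿ-at : ∀ s j → Sⁿ s (ind j) j ≡ 1
    Sⁿ-at zero    j = ind-refl j
    Sⁿ-at (suc s) j = trans (S-at s j) (Sⁿ-at s j)

    falling-fact : ∀ s → falling s ⟦ s ⟧ℕ ≡ ⟦ s ℕ.! ⟧ℕ
    falling-fact zero    = sym ⟦1⟧
    falling-fact (suc s) = trans (cong (⟦ suc s ⟧ℕ *_) (trans (cong (falling s) (trans (cong (_- 1ℚ) (⟦⟧ℕ-suc s)) (lem ⟦ s ⟧ℕ))) (falling-fact s))) (sym (⟦⟧ℕ-* (suc s) (s ℕ.!)))
      where
      opaque
        unfolding _+_
        lem : ∀ t → (1ℚ + t) - 1ℚ ≡ t
        lem = solve-∀ ringℚ

    -- The coefficient of t^(j+m) in t^j / (1 - t)^(s+1) is binom(m + s, s); the double induction is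
    -- Pascal's rule.
    Sⁿ-ind-above : ∀ s j m → ⟦ Sⁿ (suc s) (ind j) (j ℕ.+ m) ⟧ℕ * ⟦ s ℕ.! ⟧ℕ ≡ falling s (⟦ m ⟧ℕ + ⟦ s ⟧ℕ)
    Sⁿ-ind-above s j zero = trans (cong₂ (λ a b → ⟦ a ⟧ℕ * b) (trans (cong (Sⁿ (suc s) (ind j)) (ℕₚ.+-identityʳ j)) (Sⁿ-at (suc s) j)) (sym (falling-fact s)))
      (trans (cong (_* falling s ⟦ s ⟧ℕ) ⟦1⟧) (trans (*-identityˡ _) (cong (falling s) (sym (trans (cong (_+ ⟦ s ⟧ℕ) ⟦0⟧) (+-identityˡ ⟦ s ⟧ℕ))))))
    Sⁿ-ind-above zero j (suc m) = begin
      ⟦ Sⁿ 1 (ind j) (j ℕ.+ suc m) ⟧ℕ * ⟦ 1 ⟧ℕ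
        ≡⟨ cong (λ i → ⟦ Sⁿ 1 (ind j) i ⟧ℕ * ⟦ 1 ⟧ℕ) (ℕₚ.+-suc j m) ⟩
      ⟦ Sⁿ 1 (ind j) (j ℕ.+ m) ℕ.+ ind j (suc (j ℕ.+ m)) ⟧ℕ * ⟦ 1 ⟧ℕ
        ≡⟨ cong (λ z → ⟦ z ⟧ℕ * ⟦ 1 ⟧ℕ) (trans (cong (Sⁿ 1 (ind j) (j ℕ.+ m) ℕ.+_) (ind-≢ j (suc (j ℕ.+ m)) (ℕₚ.<⇒≢ (ℕ.s≤s (ℕₚ.m≤m+n j m))))) (ℕₚ.+-identityʳ _)) ⟩
      ⟦ Sⁿ 1 (ind j) (j ℕ.+ m) ⟧ℕ * ⟦ 1 ⟧ℕ
        ≡⟨ Sⁿ-ind-above zero j m ⟩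
      1ℚ ∎
    Sⁿ-ind-above (suc s) j (suc m) = begin
      ⟦ Sⁿ (2 ℕ.+ s) (ind j) (j ℕ.+ suc m) ⟧ℕ * ⟦ suc s ℕ.! ⟧ℕ
        ≡⟨ cong (λ i → ⟦ Sⁿ (2 ℕ.+ s) (ind j) i ⟧ℕ * ⟦ suc s ℕ.! ⟧ℕ) (ℕₚ.+-suc j m) ⟩
      ⟦ Sⁿ (2 ℕ.+ s) (ind j) (j ℕ.+ m) ℕ.+ Sⁿ (suc s) (ind j) (suc (j ℕ.+ m)) ⟧ℕ * ⟦ suc s ℕ.! ⟧ℕ
        ≡⟨ cong₂ _*_ (⟦⟧ℕ-+ a b) (⟦⟧ℕ-* (suc s) (s ℕ.!)) ⟩
      (⟦ a ⟧ℕ + ⟦ b ⟧ℕ) * (⟦ suc s ⟧ℕ * ⟦ s ℕ.! ⟧ℕ)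
        ≡⟨ lem ⟦ a ⟧ℕ ⟦ b ⟧ℕ ⟦ suc s ⟧ℕ ⟦ s ℕ.! ⟧ℕ ⟩
      ⟦ a ⟧ℕ * (⟦ suc s ⟧ℕ * ⟦ s ℕ.! ⟧ℕ) + ⟦ suc s ⟧ℕ * (⟦ b ⟧ℕ * ⟦ s ℕ.! ⟧ℕ)
        ≡⟨ cong₂ (λ u v → u + ⟦ suc s ⟧ℕ * v) (trans (cong (⟦ a ⟧ℕ *_) (sym (⟦⟧ℕ-* (suc s) (s ℕ.!)))) (Sⁿ-ind-above (suc s) j m))
             (trans (cong (λ i → ⟦ Sⁿ (suc s) (ind j) i ⟧ℕ * ⟦ s ℕ.! ⟧ℕ) (sym (ℕₚ.+-suc j m))) (Sⁿ-ind-above s j (suc m))) ⟩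
      falling (suc s) (⟦ m ⟧ℕ + ⟦ suc s ⟧ℕ) + ⟦ suc s ⟧ℕ * falling s (⟦ suc m ⟧ℕ + ⟦ s ⟧ℕ)
        ≡⟨ cong₂ (λ u v → falling (suc s) u + ⟦ suc s ⟧ℕ * falling s v) e₁ e₂ ⟩
      falling (suc s) x + ⟦ suc s ⟧ℕ * falling s x
        ≡⟨ cong₂ (λ u v → u + v * falling s x) (falling-end s x) (⟦⟧ℕ-suc s) ⟩
      falling s x * (x - ⟦ s ⟧ℕ) + (1ℚ + ⟦ s ⟧ℕ) * falling s x
        ≡⟨ lem' (falling s x) x ⟦ s ⟧ℕ ⟩
      (x + 1ℚ) * falling s x
        ≡⟨ cong₂ (λ u v → u * falling s v) (sym e₃) (trans (lem'' x) (cong (_- 1ℚ) (sym e₃))) ⟩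
      falling (suc s) (⟦ suc m ⟧ℕ + ⟦ suc s ⟧ℕ) ∎
      where
      a = Sⁿ (2 ℕ.+ s) (ind j) (j ℕ.+ m)
      b = Sⁿ (suc s) (ind j) (suc (j ℕ.+ m))
      x = ⟦ suc (m ℕ.+ s) ⟧ℕ
      opaque
        unfolding _+_
        lem : ∀ a b s f → (a + b) * (s * f) ≡ a * (s * f) + s * (b * f)
        lem = solve-∀ ringℚ
        lem' : ∀ f x s → f * (x - s) + (1ℚ + s) * f ≡ (x + 1ℚ) * f
        lem' = solve-∀ ringℚ
        lem'' : ∀ x → x ≡ (x + 1ℚ) - 1ℚ
        lem'' = solve-∀ ringℚ
      e₁ : ⟦ m ⟧ℕ + ⟦ suc s ⟧ℕ ≡ x
      e₁ = trans (sym (⟦⟧ℕ-+ m (suc s))) (cong ⟦_⟧ℕ (ℕₚ.+-suc m s))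
      e₂ : ⟦ suc m ⟧ℕ + ⟦ s ⟧ℕ ≡ x
      e₂ = sym (⟦⟧ℕ-+ (suc m) s)
      e₃ : ⟦ suc m ⟧ℕ + ⟦ suc s ⟧ℕ ≡ x + 1ℚ
      e₃ = trans (sym (⟦⟧ℕ-+ (suc m) (suc s))) (trans (cong (λ z → ⟦ suc z ⟧ℕ) (ℕₚ.+-suc m s)) (trans (⟦⟧ℕ-suc (suc (m ℕ.+ s))) (+-comm 1ℚ x)))

  -- For n < j both sides vanish: the falling factorial is taken at a natural number less than s.
  -- The hypothesis keeps this number from being negative, where the polynomial identity would fail.
  Sⁿ-ind : ∀ s j n → j ℕ.≤ n ℕ.+ s → ⟦ Sⁿ (suc s) (ind j) n ⟧ℕ * ⟦ s ℕ.! ⟧ℕ ≡ falling s (⟦ n ⟧ℕ + (⟦ s ⟧ℕ - ⟦ j ⟧ℕ))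
  Sⁿ-ind s j n l with j ℕₚ.≤? n
  ... | yes j≤n = trans (cong (λ i → ⟦ Sⁿ (suc s) (ind j) i ⟧ℕ * ⟦ s ℕ.! ⟧ℕ) (sym n≡)) (trans (Sⁿ-ind-above s j (n ℕ.∸ j))
      (cong (falling s) (trans (lem ⟦ j ⟧ℕ ⟦ n ℕ.∸ j ⟧ℕ ⟦ s ⟧ℕ) (cong (_+ (⟦ s ⟧ℕ - ⟦ j ⟧ℕ)) (trans (sym (⟦⟧ℕ-+ j (n ℕ.∸ j))) (cong ⟦_⟧ℕ n≡))))))
    where
    n≡ : j ℕ.+ (n ℕ.∸ j) ≡ n
    n≡ = ℕₚ.m+[n∸m]≡n j≤n
    opaque
      unfolding _+_
      lem : ∀ j m s → m + s ≡ (j + m) + (s - j)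
      lem = solve-∀ ringℚ
  ... | no j≰n = trans (cong (λ z → ⟦ z ⟧ℕ * ⟦ s ℕ.! ⟧ℕ) (Sⁿ-ind-below (suc s) j n (ℕₚ.≰⇒> j≰n))) (trans (cong (_* ⟦ s ℕ.! ⟧ℕ) ⟦0⟧) (trans (zeroˡ _)
      (sym (trans (cong (falling s) e) (falling-small s (n ℕ.+ s ℕ.∸ j) small)))))
    where
    opaque
      unfolding _+_
      lem : ∀ n s j → n + (s - j) ≡ (n + s) - j
      lem = solve-∀ ringℚ
      lem' : ∀ j t → (j + t) - j ≡ t
      lem' = solve-∀ ringℚ
    e : ⟦ n ⟧ℕ + (⟦ s ⟧ℕ - ⟦ j ⟧ℕ) ≡ ⟦ n ℕ.+ s ℕ.∸ j ⟧ℕ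
    e = trans (lem ⟦ n ⟧ℕ ⟦ s ⟧ℕ ⟦ j ⟧ℕ) (trans (cong (_- ⟦ j ⟧ℕ) (trans (sym (⟦⟧ℕ-+ n s)) (trans (cong ⟦_⟧ℕ (sym (ℕₚ.m+[n∸m]≡n l))) (⟦⟧ℕ-+ j (n ℕ.+ s ℕ.∸ j))))) (lem' ⟦ j ⟧ℕ ⟦ n ℕ.+ s ℕ.∸ j ⟧ℕ))
    small : n ℕ.+ s ℕ.∸ j ℕ.< s
    small = ℕₚ.+-cancelˡ-< j _ _ (subst (ℕ._< j ℕ.+ s) (sym (ℕₚ.m+[n∸m]≡n l)) (ℕₚ.+-monoˡ-< s (ℕₚ.≰⇒> j≰n)))

  private
    Sⁿ-linear : ∀ J (H : ℕ → ℕ) → (∀ j → J ℕ.≤ j → H j ≡ 0) → ∀ s n → ⟦ Sⁿ s H n ⟧ℕ ≡ sumTo J (λ j → ⟦ H j ⟧ℕ * ⟦ Sⁿ s (ind j) n ⟧ℕ)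
    Sⁿ-linear J H z zero n with n ℕₚ.<? J
    ... | yes l = sym (trans (sumTo-single J n _ l (λ i i≢n → trans (cong (λ t → ⟦ H i ⟧ℕ * ⟦ t ⟧ℕ) (ind-≢ i n i≢n)) (trans (cong (⟦ H i ⟧ℕ *_) ⟦0⟧) (zeroʳ _))))
                       (trans (cong (λ t → ⟦ H n ⟧ℕ * ⟦ t ⟧ℕ) (ind-refl n)) (trans (cong (⟦ H n ⟧ℕ *_) ⟦1⟧) (trans (*-comm _ 1ℚ) (*-identityˡ _)))))
    ... | no ¬l = trans (cong ⟦_⟧ℕ (z n (ℕₚ.≮⇒≥ ¬l))) (trans ⟦0⟧ (sym (sumTo-0 J (λ i l → trans (cong (λ t → ⟦ H i ⟧ℕ * ⟦ t ⟧ℕ) (ind-≢ i n (λ { refl → ¬l l }))) (trans (cong (⟦ H i ⟧ℕ *_) ⟦0⟧) (zeroʳ _))))))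
    Sⁿ-linear J H z (suc s) zero = Sⁿ-linear J H z s zero
    Sⁿ-linear J H z (suc s) (suc n) = trans (⟦⟧ℕ-+ (Sⁿ (suc s) H n) _) (trans (cong₂ _+_ (Sⁿ-linear J H z (suc s) n) (Sⁿ-linear J H z s (suc n)))
      (trans (sym (sumTo-+ J _ _)) (sumTo-cong J (λ j _ → trans (sym (distribˡ ⟦ H j ⟧ℕ _ _)) (cong (⟦ H j ⟧ℕ *_) (sym (⟦⟧ℕ-+ (Sⁿ (suc s) (ind j) n) _)))))))

  -- Σⱼ hⱼ binom(n + d − j, d) as a polynomial in n.
  hstar-poly : ∀ J d (H : ℕ → ℕ) → (∀ j → J ℕ.≤ j → H j ≡ 0) → ∀ n → J ℕ.≤ suc (n ℕ.+ d) →
    ⟦ Sⁿ (suc d) H n ⟧ℕ * ⟦ d ℕ.! ⟧ℕ ≡ poly (suc d) (λ r → sumTo J (λ j → ⟦ H j ⟧ℕ * ⟦ C d r (posℤ d ℤ.- posℤ j) ⟧)) n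
  hstar-poly J d H z n l = begin
    ⟦ Sⁿ (suc d) H n ⟧ℕ * ⟦ d ℕ.! ⟧ℕ
      ≡⟨ cong (_* ⟦ d ℕ.! ⟧ℕ) (Sⁿ-linear J H z (suc d) n) ⟩
    sumTo J (λ j → ⟦ H j ⟧ℕ * ⟦ Sⁿ (suc d) (ind j) n ⟧ℕ) * ⟦ d ℕ.! ⟧ℕ
      ≡⟨ trans (sym (sumTo-*ʳ J ⟦ d ℕ.! ⟧ℕ _)) (sumTo-cong J (λ j j<J → trans (*-assoc ⟦ H j ⟧ℕ _ _) (cong (⟦ H j ⟧ℕ *_) (value j (ℕ.s≤s⁻¹ (ℕₚ.≤-trans j<J l)))))) ⟩
    sumTo J (λ j → ⟦ H j ⟧ℕ * sumTo (suc d) (λ r → ⟦ C d r (posℤ d ℤ.- posℤ j) ⟧ * ⟦ n ℕ.^ r ⟧ℕ))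
      ≡⟨ sumTo-cong J (λ j _ → sym (sumTo-* (suc d) ⟦ H j ⟧ℕ _)) ⟩
    sumTo J (λ j → sumTo (suc d) (λ r → ⟦ H j ⟧ℕ * (⟦ C d r (posℤ d ℤ.- posℤ j) ⟧ * ⟦ n ℕ.^ r ⟧ℕ)))
      ≡⟨ sumTo-swap J (suc d) _ ⟩
    sumTo (suc d) (λ r → sumTo J (λ j → ⟦ H j ⟧ℕ * (⟦ C d r (posℤ d ℤ.- posℤ j) ⟧ * ⟦ n ℕ.^ r ⟧ℕ)))
      ≡⟨ sumTo-cong (suc d) (λ r _ → trans (sumTo-cong J (λ j _ → sym (*-assoc ⟦ H j ⟧ℕ _ _))) (sumTo-*ʳ J ⟦ n ℕ.^ r ⟧ℕ _)) ⟩
    poly (suc d) (λ r → sumTo J (λ j → ⟦ H j ⟧ℕ * ⟦ C d r (posℤ d ℤ.- posℤ j) ⟧)) n ∎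
    where
    value : ∀ j → j ℕ.≤ n ℕ.+ d → ⟦ Sⁿ (suc d) (ind j) n ⟧ℕ * ⟦ d ℕ.! ⟧ℕ ≡ sumTo (suc d) (λ r → ⟦ C d r (posℤ d ℤ.- posℤ j) ⟧ * ⟦ n ℕ.^ r ⟧ℕ)
    value j l = trans (Sⁿ-ind d j n l) (trans (cong (λ z → falling d (⟦ n ⟧ℕ + z)) (sym (⟦⟧-- (posℤ d) (posℤ j)))) (trans (sym (C-eval d (posℤ d ℤ.- posℤ j) n)) (sum-sumTo (suc d) (λ r → ⟦ C d r (posℤ d ℤ.- posℤ j) ⟧ * ⟦ n ℕ.^ r ⟧ℕ))))

-- The inequality for h*-vectors, and the comparison of M with N.

module Inequality where
  open import Data.Rational using (_≤_; _<_)
  open Rationals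
  open Cardinality
  open Coefficients
  open Polynomials

  minFrom-≤ : ∀ f a k i → a ℕ.≤ i → i ℕ.≤ a ℕ.+ k → minFrom f a k ℤ.≤ f i
  minFrom-≤ f a zero i p q = ℤₚ.≤-reflexive (cong f (ℕₚ.≤-antisym p (subst (i ℕ.≤_) (ℕₚ.+-identityʳ a) q)))
  minFrom-≤ f a (suc k) i p q with a ℕₚ.≟ i
  ... | yes refl = ℤₚ.i⊓j≤i (f a) _
  ... | no a≢i = ℤₚ.≤-trans (ℤₚ.i⊓j≤j (f a) _) (minFrom-≤ f (suc a) k i (ℕₚ.≤∧≢⇒< p a≢i) (subst (i ℕ.≤_) (ℕₚ.+-suc a k) q))

  minFrom-attained : ∀ f a k → ∃[ i ] (a ℕ.≤ i × i ℕ.≤ a ℕ.+ k × minFrom f a k ≡ f i)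
  minFrom-attained f a zero = a , ℕₚ.≤-refl , ℕₚ.≤-reflexive (sym (ℕₚ.+-identityʳ a)) , refl
  minFrom-attained f a (suc k) with minFrom-attained f (suc a) k | ℤₚ.⊓-sel (f a) (minFrom f (suc a) k)
  ... | _ | inj₁ e = a , ℕₚ.≤-refl , ℕₚ.m≤m+n a (suc k) , e
  ... | i , p , q , e' | inj₂ e = i , ℕₚ.<⇒≤ p , subst (i ℕ.≤_) (sym (ℕₚ.+-suc a k)) q , trans e e'

  minRange-≤ : ∀ f lo hi i → lo ℕ.≤ hi → lo ℕ.≤ i → i ℕ.≤ hi → minRange f lo hi ℤ.≤ f i
  minRange-≤ f lo hi i l p q = minFrom-≤ f lo (hi ℕ.∸ lo) i p (subst (i ℕ.≤_) (sym (ℕₚ.m+[n∸m]≡n l)) q)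

  minRange-attained : ∀ f lo hi → lo ℕ.≤ hi → ∃[ i ] (lo ℕ.≤ i × i ℕ.≤ hi × minRange f lo hi ≡ f i)
  minRange-attained f lo hi l with minFrom-attained f lo (hi ℕ.∸ lo)
  ... | i , p , q , e = i , p , subst (i ℕ.≤_) (ℕₚ.m+[n∸m]≡n l) q , e

  ceilHalf-≥ : ∀ m → m ℕ.≤ 2 ℕ.* ceilHalf m
  ceilHalf-≥ m = subst (m ℕ.≤_) (ℕₚ.*-comm (ceilHalf m) 2) (ℕ.s≤s⁻¹ (subst (ℕ._≤ suc (ceilHalf m ℕ.* 2)) (ℕₚ.+-comm m 1)
    (ℕₚ.≤-trans (ℕₚ.≤-reflexive (ℕD.m≡m%n+[m/n]*n (m ℕ.+ 1) 2)) (ℕₚ.+-monoˡ-≤ (ceilHalf m ℕ.* 2) (ℕ.s≤s⁻¹ (ℕD.m%n<n (m ℕ.+ 1) 2))))))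

  ceilHalf-≤ : ∀ m → 2 ℕ.* ceilHalf m ℕ.≤ suc m
  ceilHalf-≤ m = subst₂ ℕ._≤_ (ℕₚ.*-comm (ceilHalf m) 2) (ℕₚ.+-comm m 1) (ℕD.m/n*n≤m (m ℕ.+ 1) 2)

  ceilHalf-least : ∀ m i → m ℕ.≤ 2 ℕ.* i → ceilHalf m ℕ.≤ i
  ceilHalf-least m i p = ℕ.s≤s⁻¹ (ℕₚ.*-cancelˡ-< 2 (ceilHalf m) (suc i) (ℕₚ.<-≤-trans (ℕ.s≤s (ℕₚ.≤-trans (ceilHalf-≤ m) (ℕ.s≤s p))) (ℕₚ.≤-reflexive (sym (ℕₚ.*-suc 2 i)))))

  sumTo-reverse : ∀ n f → sumTo n (λ i → f (n ℕ.∸ suc i)) ≡ sumTo n f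
  sumTo-reverse zero    f = refl
  sumTo-reverse (suc n) f = trans (sumTo-suc n (λ i → f (n ℕ.∸ i))) (trans (cong (f n +_) (sumTo-reverse n f)) (+-comm (f n) (sumTo n f)))

  S-sumTo : ∀ f n → ⟦ S f n ⟧ℕ ≡ sumTo (suc n) (λ i → ⟦ f i ⟧ℕ)
  S-sumTo f zero    = sym (+-identityˡ ⟦ f 0 ⟧ℕ)
  S-sumTo f (suc n) = trans (⟦⟧ℕ-+ (S f n) (f (suc n))) (cong (_+ ⟦ f (suc n) ⟧ℕ) (S-sumTo f n))

  -- Summation by parts: replacing the weight θ n by the smaller θ (n + 1) costs a nonnegative
  -- multiple of a partial sum.
  abel : ∀ n (g θ : ℕ → ℚ) → (∀ k → k ℕ.≤ n → 0ℚ ≤ sumTo (suc k) g) → (∀ k → k ℕ.< n → θ (suc k) ≤ θ k) →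
    sumTo (suc n) g * θ n ≤ sumTo (suc n) (λ i → g i * θ i)
  abel zero g θ p q = ≤-reflexive (lem (g 0) (θ 0))
    where
    opaque
      unfolding _+_
      lem : ∀ a b → (0ℚ + a) * b ≡ 0ℚ + a * b
      lem = solve-∀ ringℚ
  abel (suc n) g θ p q = ≤-trans (0≤-⇒≤ (subst (0ℚ ≤_) (lem (sumTo (suc n) g) (θ n) (θ (suc n)) (g (suc n)))
      (0≤* (p n (ℕₚ.n≤1+n n)) (≤⇒0≤- (q n ℕₚ.≤-refl)))))
    (+-mono-≤ (abel n g θ (λ k l → p k (ℕₚ.m≤n⇒m≤1+n l)) (λ k l → q k (ℕₚ.m≤n⇒m≤1+n l))) ≤-refl)
    where
    opaque
      unfolding _+_
      lem : ∀ s a b g → s * (a - b) ≡ (s * a + g * b) - (s + g) * b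
      lem = solve-∀ ringℚ

  positivePart : ℚ → ℚ
  positivePart a with 0ℚ ≤? a
  ... | yes _ = a
  ... | no _  = 0ℚ

  positivePart-nonneg : ∀ a → 0ℚ ≤ positivePart a
  positivePart-nonneg a with 0ℚ ≤? a
  ... | yes p = p
  ... | no _  = ≤-refl

  positivePart-≥ : ∀ a → a ≤ positivePart a
  positivePart-≥ a with 0ℚ ≤? a
  ... | yes _ = ≤-refl
  ... | no ¬p = <⇒≤ (≰⇒> ¬p)

  positivePart-≤ : ∀ {a b} → 0ℚ ≤ b → (0ℚ < a → a ≤ b) → positivePart a ≤ b
  positivePart-≤ {a} {b} p q with 0ℚ ≤? a
  ... | no _ = p
  ... | yes r with a ≟ 0ℚ
  ... | yes refl = p
  ... | no a≢0 = q (≤∧≢⇒< r (λ e → a≢0 (sym e)))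

  0<48 : 0ℚ < 48ℚ
  0<48 = 0<* 0<2 (0<* (0<* (0<* 0<2 0<2) 0<2) (0<+≤ 0<2 0≤1))
    where
    0<2 : 0ℚ < 2ℚ
    0<2 = 0<+≤ 0<1 0≤1

  -- With d = 7 + e the subtractions `d ∸ 2` and `d ∸ 3` compute, and estimates for d ≥ 7 become
  -- positivity of polynomials in `E`.
  module CubicBounds (e : ℕ) where
    r d : ℕ
    r = 4 ℕ.+ e
    d = 7 ℕ.+ e

    E D κ n₄₈ : ℚ
    E = ⟦ e ⟧ℕ
    D = ⟦ d ⟧ℕ
    κ = D * (D - 1ℚ) * (D - 2ℚ)

    f : ℤ → ℚ
    f i = ⟦ C d r i ⟧

    Φ : ℚ → ℚ
    Φ X = cubic D X

    X : ℤ → ℚ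
    X i = centred D ⟦ i ⟧

    n₄₈ = 48ℚ * ⟦ N r d ⟧

    f≡Φ : ∀ i → 48ℚ * f i ≡ Φ (X i)
    f≡Φ i = C-3 r i

    7ℚ : ℚ
    7ℚ = 2ℚ + 2ℚ + 3ℚ

    D≡ : D ≡ 7ℚ + E
    D≡ = trans (⟦⟧ℕ-+ 7 e) (cong (_+ E) seven)
      where
      opaque
        unfolding _+_ ⟦_⟧
        seven : ⟦ 7 ⟧ℕ ≡ 7ℚ
        seven = refl

    0≤E : 0ℚ ≤ E
    0≤E = ⟦⟧ℕ-nonneg e

    0<2 : 0ℚ < 2ℚ
    0<2 = 0<+≤ 0<1 0≤1

    opaque
      unfolding _+_
      k1 : ∀ E → 2ℚ + 2ℚ + 3ℚ + E - 1ℚ ≡ 2ℚ + 2ℚ + 2ℚ + E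
      k1 = solve-∀ ringℚ
      k2 : ∀ E → 2ℚ + 2ℚ + 3ℚ + E - 2ℚ ≡ 2ℚ + 3ℚ + E
      k2 = solve-∀ ringℚ
      c1 : ∀ D X Y → D * (D - 1ℚ) * (D - 2ℚ) * (Y * (Y * Y - (D + 1ℚ))) - D * (D - 1ℚ) * (D - 2ℚ) * (X * (X * X - (D + 1ℚ))) ≡
           D * (D - 1ℚ) * (D - 2ℚ) * ((Y - X) * ((X * X - (D + 1ℚ)) + (X * Y + Y * Y)))
      c1 = solve-∀ ringℚ
      c2 : ∀ D X → D * (D - 1ℚ) * (D - 2ℚ) * ((- X) * ((- X) * (- X) - (D + 1ℚ))) ≡ - (D * (D - 1ℚ) * (D - 2ℚ) * (X * (X * X - (D + 1ℚ))))
      c2 = solve-∀ ringℚ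

    0<3 : 0ℚ < 3ℚ
    0<3 = 0<+≤ 0<2 0≤1

    0<κ : 0ℚ < κ
    0<κ = subst (λ D → 0ℚ < D * (D - 1ℚ) * (D - 2ℚ)) (sym D≡) (0<* (0<* (0<+≤ (0<+≤ (0<+≤ 0<2 (<⇒≤ 0<2)) (<⇒≤ 0<3)) 0≤E)
      (subst (0ℚ <_) (sym (k1 E)) (0<+≤ (0<+≤ (0<+≤ 0<2 (<⇒≤ 0<2)) (<⇒≤ 0<2)) 0≤E))) (subst (0ℚ <_) (sym (k2 E)) (0<+≤ (0<+≤ 0<2 (<⇒≤ 0<3)) 0≤E)))

    Φ-odd : ∀ X → Φ (- X) ≡ - Φ X
    Φ-odd X = c2 D X

    lo hi : ℕ
    lo = ceilHalf (6 ℕ.+ e)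
    hi = 5 ℕ.+ e

    lo≤hi : lo ℕ.≤ hi
    lo≤hi = ceilHalf-least (6 ℕ.+ e) hi (subst (6 ℕ.+ e ℕ.≤_) refl (ℕₚ.≤-trans (ℕₚ.+-monoˡ-≤ e {6} {10} (ℕₚ.≤ᵇ⇒≤ 6 10 _)) (subst₂ ℕ._≤_ refl (sym (ℕₚ.*-distribˡ-+ 2 5 e)) (ℕₚ.+-monoʳ-≤ 10 (ℕₚ.m≤m+n e (e ℕ.+ 0))))))

    X-nonneg : ∀ i → 6 ℕ.+ e ℕ.≤ 2 ℕ.* i → 0ℚ ≤ X (posℤ i)
    X-nonneg i p = subst (0ℚ ≤_) eq (≤⇒0≤- (⟦⟧ℕ-mono-≤ p))
      where
      opaque
        unfolding _+_
        lem : ∀ I q → 2ℚ * I - q ≡ 2ℚ * I - (1ℚ + q) + 1ℚ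
        lem = solve-∀ ringℚ
        two : ∀ I → I + (I + 0ℚ) ≡ 2ℚ * I
        two = solve-∀ ringℚ
      eq : ⟦ 2 ℕ.* i ⟧ℕ - ⟦ 6 ℕ.+ e ⟧ℕ ≡ X (posℤ i)
      eq = trans (cong (_- ⟦ 6 ℕ.+ e ⟧ℕ) (trans (⟦⟧ℕ-+ i (i ℕ.+ 0)) (trans (cong (⟦ i ⟧ℕ +_) (trans (⟦⟧ℕ-+ i 0) (cong (⟦ i ⟧ℕ +_) ⟦0⟧))) (two ⟦ i ⟧ℕ))))
        (trans (lem ⟦ i ⟧ℕ ⟦ 6 ℕ.+ e ⟧ℕ) (cong (λ z → 2ℚ * ⟦ i ⟧ℕ - z + 1ℚ) (sym (⟦⟧ℕ-suc (6 ℕ.+ e)))))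

    argminN : ∃[ i ] (lo ℕ.≤ i × i ℕ.≤ hi × N r d ≡ C d r (posℤ i))
    argminN = minRange-attained (λ i → C d r (posℤ i)) lo hi lo≤hi

    N-least : ∀ i → lo ℕ.≤ i → i ℕ.≤ hi → n₄₈ ≤ Φ (X (posℤ i))
    N-least i p q = subst (n₄₈ ≤_) (f≡Φ (posℤ i)) (0≤-⇒≤ (subst (0ℚ ≤_) (lem _ _ _) (0≤* (<⇒≤ 0<48) (≤⇒0≤- (⟦⟧-mono-≤ (minRange-≤ (λ i → C d r (posℤ i)) lo hi i lo≤hi p q))))))
      where
      opaque
        unfolding _+_
        lem : ∀ a b c → a * (b - c) ≡ a * b - a * c
        lem = solve-∀ ringℚ

    -- At the lower end of the range X is 0 or 1, and there X (X² - (d + 1)) is not positive.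
    n₄₈≤0 : n₄₈ ≤ 0ℚ
    n₄₈≤0 = ≤-trans (N-least lo ℕₚ.≤-refl lo≤hi) Φlo≤0
      where
      Xl = X (posℤ lo)
      0≤X : 0ℚ ≤ Xl
      0≤X = X-nonneg lo (ceilHalf-≥ (6 ℕ.+ e))
      opaque
        unfolding _+_
        lem : ∀ I q → (1ℚ + q) - 2ℚ * I ≡ 1ℚ - (2ℚ * I - (1ℚ + q) + 1ℚ) + 1ℚ - 1ℚ
        lem = solve-∀ ringℚ
        two : ∀ I → I + (I + 0ℚ) ≡ 2ℚ * I
        two = solve-∀ ringℚ
        lem' : ∀ k X s → 0ℚ - k * (X * s) ≡ k * (X * (0ℚ - s))
        lem' = solve-∀ ringℚ
        lem2 : ∀ X D → 0ℚ - (X * X - (D + 1ℚ)) ≡ (1ℚ - X) * (1ℚ + X) + D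
        lem2 = solve-∀ ringℚ
        lem3 : ∀ a → a + 1ℚ - 1ℚ ≡ a
        lem3 = solve-∀ ringℚ
      0≤1-X : 0ℚ ≤ 1ℚ - Xl
      0≤1-X = subst (0ℚ ≤_) eq (≤⇒0≤- (⟦⟧ℕ-mono-≤ (ceilHalf-≤ (6 ℕ.+ e))))
        where
        eq : ⟦ suc (6 ℕ.+ e) ⟧ℕ - ⟦ 2 ℕ.* lo ⟧ℕ ≡ 1ℚ - Xl
        eq = trans (cong₂ _-_ (⟦⟧ℕ-suc (6 ℕ.+ e)) (trans (⟦⟧ℕ-+ lo (lo ℕ.+ 0)) (trans (cong (⟦ lo ⟧ℕ +_) (trans (⟦⟧ℕ-+ lo 0) (cong (⟦ lo ⟧ℕ +_) ⟦0⟧))) (two ⟦ lo ⟧ℕ))))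
          (trans (lem ⟦ lo ⟧ℕ ⟦ 6 ℕ.+ e ⟧ℕ) (trans (lem3 _) (cong (λ z → 1ℚ - (2ℚ * ⟦ lo ⟧ℕ - z + 1ℚ)) (sym (⟦⟧ℕ-suc (6 ℕ.+ e))))))
      Φlo≤0 : Φ Xl ≤ 0ℚ
      Φlo≤0 = 0≤-⇒≤ (subst (0ℚ ≤_) (sym (lem' κ Xl _)) (0≤* (<⇒≤ 0<κ) (0≤* 0≤X (subst (0ℚ ≤_) (sym (lem2 Xl D)) (0≤+ (0≤* 0≤1-X (0≤+ 0≤1 0≤X)) (⟦⟧ℕ-nonneg d))))))

    -- On X ≥ 0 the cubic dips below zero before it rises; where it is positive, X² exceeds d + 1
    -- and all factors of the difference are nonnegative.
    Φ-mono : ∀ X Y → 0ℚ ≤ X → X ≤ Y → 0ℚ < Φ X → Φ X ≤ Φ Y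
    Φ-mono X Y 0≤X X≤Y 0<ΦX = 0≤-⇒≤ (subst (0ℚ ≤_) (sym (c1 D X Y)) (0≤* (<⇒≤ 0<κ) (0≤* (≤⇒0≤- X≤Y) (0≤+ (<⇒≤ 0<s) (0≤+ (0≤* 0≤X 0≤Y) (0≤* 0≤Y 0≤Y))))))
      where
      0≤Y : 0ℚ ≤ Y
      0≤Y = ≤-trans 0≤X X≤Y
      0<Xs : 0ℚ < X * (X * X - (D + 1ℚ))
      0<Xs = 0<*-cancel 0<κ 0<ΦX
      X≢0 : X ≢ 0ℚ
      X≢0 e = <⇒≢ 0<Xs (sym (trans (cong (_* (X * X - (D + 1ℚ))) e) (zeroˡ _)))
      0<s : 0ℚ < X * X - (D + 1ℚ)
      0<s = 0<*-cancel (≤∧≢⇒< 0≤X (λ e → X≢0 (sym e))) 0<Xs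

    -- For X < 0 the desired estimate θ ≤ Φ - `n₄₈` says, when θ is odd, that θ(-X) ≥ Φ(-X) + `n₄₈`.
    -- On the positive side `m` is the least nonnegative function with this property; θ is its odd
    -- extension.
    m : ℚ → ℚ
    m X = positivePart (Φ X + n₄₈)

    m-mono : ∀ X Y → 0ℚ ≤ X → X ≤ Y → m X ≤ m Y
    m-mono X Y p q = positivePart-≤ (positivePart-nonneg (Φ Y + n₄₈)) (λ 0<a → ≤-trans (+-mono-≤ (Φ-mono X Y p q (0<-⇒< (subst (0ℚ <_) (lem (Φ X) n₄₈) (0<+≤ 0<a (0≤neg n₄₈≤0))))) ≤-refl) (positivePart-≥ (Φ Y + n₄₈)))
      where
      opaque
        unfolding _+_
        lem : ∀ a b → a + b + (- b) ≡ a - 0ℚ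
        lem = solve-∀ ringℚ

    θ : ℚ → ℚ
    θ X with 0ℚ ≤? X
    ... | yes _ = m X
    ... | no _  = - m (- X)

    θ-nonneg : ∀ {X} → 0ℚ ≤ X → θ X ≡ m X
    θ-nonneg {X} p with 0ℚ ≤? X
    ... | yes _ = refl
    ... | no ¬p = ⊥-elim (¬p p)

    θ-neg : ∀ {X} → X < 0ℚ → θ X ≡ - m (- X)
    θ-neg {X} p with 0ℚ ≤? X
    ... | yes q = ⊥-elim (<-irrefl refl (<-≤-trans p q))
    ... | no _ = refl

    m-0 : m 0ℚ ≡ 0ℚ
    m-0 = ≤-antisym (positivePart-≤ ≤-refl (λ _ → subst (_≤ 0ℚ) (lem D n₄₈) n₄₈≤0)) (positivePart-nonneg (Φ 0ℚ + n₄₈))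
      where
      opaque
        unfolding _+_
        lem : ∀ D n → n ≡ D * (D - 1ℚ) * (D - 2ℚ) * (0ℚ * (0ℚ * 0ℚ - (D + 1ℚ))) + n
        lem = solve-∀ ringℚ

    θ-odd : ∀ X → θ (- X) ≡ - θ X
    θ-odd X with <-cmp 0ℚ X
    ... | tri< p _ _ = trans (θ-neg (neg<0 p)) (trans (cong (λ z → - m z) (neg-involutive X)) (cong -_ (sym (θ-nonneg (<⇒≤ p)))))
    ... | tri≈ _ refl _ = trans (cong θ neg-0) (trans (trans (θ-nonneg ≤-refl) m-0) (sym (trans (cong -_ (trans (θ-nonneg ≤-refl) m-0)) neg-0)))
    ... | tri> _ _ p = trans (θ-nonneg (<⇒≤ (0<neg p))) (sym (trans (cong -_ (θ-neg p)) (neg-involutive _)))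

    θ-mono : ∀ X Y → X ≤ Y → θ X ≤ θ Y
    θ-mono X Y p with 0ℚ ≤? X | 0ℚ ≤? Y
    ... | yes x | yes y = m-mono X Y x p
    ... | yes x | no ¬y = ⊥-elim (¬y (≤-trans x p))
    ... | no ¬x | yes y = ≤-trans (subst (- m (- X) ≤_) neg-0 (neg-antimono-≤ (positivePart-nonneg (Φ (- X) + n₄₈)))) (positivePart-nonneg (Φ Y + n₄₈))
    ... | no ¬x | no ¬y = neg-antimono-≤ (m-mono (- Y) (- X) (0≤neg (<⇒≤ (≰⇒> ¬y))) (neg-antimono-≤ p))

    -- For X < 0 this is how `m` was chosen. For X ≥ 0, minimality of N gives 0 ≤ Φ - `n₄₈`, and Φ +
    -- `n₄₈` ≤ Φ - `n₄₈` because `n₄₈` is not positive.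
    Φ-θ : ∀ X → (0ℚ ≤ X → n₄₈ ≤ Φ X) → θ X ≤ Φ X - n₄₈
    Φ-θ X least with 0ℚ ≤? X
    ... | yes p = positivePart-≤ (≤⇒0≤- (least p)) (λ _ → +-mono-≤ ≤-refl (≤-trans n₄₈≤0 (0≤neg n₄₈≤0)))
    ... | no ¬p = subst (- m (- X) ≤_) (trans (cong (λ z → - (z + n₄₈)) (Φ-odd X)) (lem (Φ X) n₄₈)) (neg-antimono-≤ (positivePart-≥ (Φ (- X) + n₄₈)))
      where
      opaque
        unfolding _+_
        lem : ∀ a n → - (- a + n) ≡ a - n
        lem = solve-∀ ringℚ

    -- The index j = i + 1 of the h*-vector.
    Xᵢ : ℕ → ℚ
    Xᵢ i = X (posℤ d ℤ.- posℤ (suc i))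

    Xᵢ≡ : ∀ i → Xᵢ i ≡ D - 1ℚ - 2ℚ * ⟦ i ⟧ℕ
    Xᵢ≡ i = trans (cong (λ z → 2ℚ * z - D + 1ℚ) (trans (⟦⟧-- (posℤ d) (posℤ (suc i))) (cong (λ z → D - z) (⟦⟧ℕ-suc i)))) (lem D ⟦ i ⟧ℕ)
      where
      opaque
        unfolding _+_
        lem : ∀ D i → 2ℚ * (D - (1ℚ + i)) - D + 1ℚ ≡ D - 1ℚ - 2ℚ * i
        lem = solve-∀ ringℚ

    -- The case i = 0 belongs to the argument d - 1, just outside the range of N; there X = d - 1
    -- and the cubic is nonnegative. All other i with X ≥ 0 fall into the range.
    Xᵢ-least : ∀ i → i ℕ.< d → 0ℚ ≤ Xᵢ i → n₄₈ ≤ Φ (Xᵢ i)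
    Xᵢ-least zero _ _ = ≤-trans n₄₈≤0 (subst (0ℚ ≤_) (cong Φ (sym (trans (Xᵢ≡ 0) (trans (cong₂ (λ D z → D - 1ℚ - 2ℚ * z) D≡ ⟦0⟧) (lem E)))))
        (subst (λ z → 0ℚ ≤ κ * ((6ℚ + E) * ((6ℚ + E) * (6ℚ + E) - (z + 1ℚ)))) (sym D≡) (0≤* (<⇒≤ 0<κ) (0≤* (0≤+ (<⇒≤ 0<6) 0≤E)
          (subst (0ℚ ≤_) (sym (lem' E)) (0≤+ (0≤+ (<⇒≤ (0<* (0<* 0<2 0<2) (0<+≤ 0<6 0≤1))) (0≤* (0≤+ (<⇒≤ 0<6) (0≤+ (<⇒≤ 0<2) (<⇒≤ 0<3))) 0≤E)) (0≤* 0≤E 0≤E)))))))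
      where
      6ℚ : ℚ
      6ℚ = 2ℚ + 2ℚ + 2ℚ
      0<6 : 0ℚ < 6ℚ
      0<6 = 0<+≤ (0<+≤ 0<2 (<⇒≤ 0<2)) (<⇒≤ 0<2)
      opaque
        unfolding _+_
        lem : ∀ E → 2ℚ + 2ℚ + 3ℚ + E - 1ℚ - 2ℚ * 0ℚ ≡ 2ℚ + 2ℚ + 2ℚ + E
        lem = solve-∀ ringℚ
        lem' : ∀ E → (2ℚ + 2ℚ + 2ℚ + E) * (2ℚ + 2ℚ + 2ℚ + E) - (2ℚ + 2ℚ + 3ℚ + E + 1ℚ) ≡ (2ℚ * 2ℚ * (2ℚ + 2ℚ + 2ℚ + 1ℚ) + (2ℚ + 2ℚ + 2ℚ + (2ℚ + 3ℚ)) * E) + E * E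
        lem' = solve-∀ ringℚ
    Xᵢ-least (suc i) l p = subst (λ z → n₄₈ ≤ Φ (X z)) eq (N-least k (ceilHalf-least (6 ℕ.+ e) k low) (ℕₚ.m∸n≤m (5 ℕ.+ e) i))
      where
      k = 5 ℕ.+ e ℕ.∸ i
      i≤ : i ℕ.≤ 5 ℕ.+ e
      i≤ = ℕ.s≤s⁻¹ (ℕ.s≤s⁻¹ l)
      k+i : i ℕ.+ k ≡ 5 ℕ.+ e
      k+i = ℕₚ.m+[n∸m]≡n i≤
      eq : posℤ k ≡ posℤ d ℤ.- posℤ (suc (suc i))
      eq = trans (lem (posℤ i) (posℤ k)) (cong (λ z → posℤ 2 ℤ.+ posℤ z ℤ.- (posℤ 2 ℤ.+ posℤ i)) k+i)
        where
        lem : ∀ i k → k ≡ posℤ 2 ℤ.+ (i ℤ.+ k) ℤ.- (posℤ 2 ℤ.+ i)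
        lem = ℤSolver.solve-∀
      opaque
        unfolding _+_
        lem : ∀ K q → 2ℚ * K - (1ℚ + q) + 1ℚ ≡ K + (K + 0ℚ) - q
        lem = solve-∀ ringℚ
      low : 6 ℕ.+ e ℕ.≤ 2 ℕ.* k
      low = ℤₚ.drop‿+≤+ (⟦⟧-cancel-≤ (0≤-⇒≤ (subst (0ℚ ≤_) (trans (cong (λ z → 2ℚ * ⟦ k ⟧ℕ - z + 1ℚ) (⟦⟧ℕ-suc (6 ℕ.+ e))) (trans (lem ⟦ k ⟧ℕ ⟦ 6 ℕ.+ e ⟧ℕ)
        (cong (_- ⟦ 6 ℕ.+ e ⟧ℕ) (sym (trans (⟦⟧ℕ-+ k (k ℕ.+ 0)) (cong (⟦ k ⟧ℕ +_) (trans (⟦⟧ℕ-+ k 0) (cong (⟦ k ⟧ℕ +_) ⟦0⟧)))))))) (subst (λ z → 0ℚ ≤ X z) (sym eq) p))))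

    θᵢ : ℕ → ℚ
    θᵢ i = θ (Xᵢ i)

    θᵢ-decreasing : ∀ k → θᵢ (suc k) ≤ θᵢ k
    θᵢ-decreasing k = θ-mono _ _ (0≤-⇒≤ (subst (0ℚ ≤_) (sym (trans (cong₂ _-_ (Xᵢ≡ k) (trans (Xᵢ≡ (suc k)) (cong (λ z → D - 1ℚ - 2ℚ * z) (⟦⟧ℕ-suc k)))) (lem D ⟦ k ⟧ℕ))) (<⇒≤ 0<2)))
      where
      opaque
        unfolding _+_
        lem : ∀ D k → (D - 1ℚ - 2ℚ * k) - (D - 1ℚ - 2ℚ * (1ℚ + k)) ≡ 2ℚ
        lem = solve-∀ ringℚ

    θᵢ-reverse : ∀ i → i ℕ.< d → θᵢ (d ℕ.∸ suc i) ≡ - θᵢ i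
    θᵢ-reverse i l = trans (cong θ eq) (θ-odd (Xᵢ i))
      where
      opaque
        unfolding _+_
        lem : ∀ i k → (1ℚ + i + k) - 1ℚ - 2ℚ * k ≡ - ((1ℚ + i + k) - 1ℚ - 2ℚ * i)
        lem = solve-∀ ringℚ
      D≡' : D ≡ 1ℚ + ⟦ i ⟧ℕ + ⟦ d ℕ.∸ suc i ⟧ℕ
      D≡' = trans (cong ⟦_⟧ℕ (sym (ℕₚ.m+[n∸m]≡n l))) (trans (⟦⟧ℕ-+ (suc i) (d ℕ.∸ suc i)) (cong (_+ ⟦ d ℕ.∸ suc i ⟧ℕ) (⟦⟧ℕ-suc i)))
      eq : Xᵢ (d ℕ.∸ suc i) ≡ - Xᵢ i
      eq = trans (Xᵢ≡ _) (trans (cong (λ D → D - 1ℚ - 2ℚ * ⟦ d ℕ.∸ suc i ⟧ℕ) D≡') (trans (lem ⟦ i ⟧ℕ ⟦ d ℕ.∸ suc i ⟧ℕ)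
        (cong -_ (sym (trans (Xᵢ≡ i) (cong (λ D → D - 1ℚ - 2ℚ * ⟦ i ⟧ℕ) D≡'))))))

    module _ (H A : ℕ → ℕ) (H0 : H 0 ≡ 1) (Hd : H (suc d) ≡ 0) (A≥1 : ∀ j → j ℕ.≤ d → 1 ℕ.≤ A j)
      (rel : ∀ j → j ℕ.≤ d → S H j ≡ S (λ i → H (suc d ℕ.∸ i)) j ℕ.+ A j) where

      h g : ℕ → ℚ
      h i = ⟦ H (suc i) ⟧ℕ
      g i = h i - h (d ℕ.∸ suc i)

      -- Splitting off h₀ = 1 on one side of `rel` and h_{d+1} = 0 on the other shows that the
      -- partial sum is A_{k+1} - 1.
      partial : ∀ k → k ℕ.< d → 0ℚ ≤ sumTo (suc k) g
      partial k l = subst (0ℚ ≤_) (sym eq) (≤⇒0≤- (subst (_≤ ⟦ A (suc k) ⟧ℕ) ⟦1⟧ (⟦⟧ℕ-mono-≤ (A≥1 (suc k) l))))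
        where
        h' : ℕ → ℚ
        h' i = ⟦ H (suc d ℕ.∸ suc i) ⟧ℕ
        back : sumTo (suc k) (λ i → h (d ℕ.∸ suc i)) ≡ sumTo (suc k) h'
        back = sumTo-cong (suc k) (λ i i<k → cong (λ z → ⟦ H z ⟧ℕ) (sym (ℕₚ.+-∸-assoc 1 {d} {suc i} (ℕₚ.≤-trans i<k l))))
        opaque
          unfolding _+_
          lem : ∀ a b → a - b ≡ (1ℚ + a) - (0ℚ + b) - 1ℚ
          lem = solve-∀ ringℚ
          lem' : ∀ a b → (a + b) - a - 1ℚ ≡ b - 1ℚ
          lem' = solve-∀ ringℚ
        lhs : ⟦ S H (suc k) ⟧ℕ ≡ 1ℚ + sumTo (suc k) h
        lhs = trans (S-sumTo H (suc k)) (trans (sumTo-suc (suc k) _) (cong (_+ sumTo (suc k) h) (trans (cong ⟦_⟧ℕ H0) ⟦1⟧)))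
        rhs : ⟦ S (λ i → H (suc d ℕ.∸ i)) (suc k) ⟧ℕ ≡ 0ℚ + sumTo (suc k) h'
        rhs = trans (S-sumTo (λ i → H (suc d ℕ.∸ i)) (suc k)) (trans (sumTo-suc (suc k) _) (cong (_+ sumTo (suc k) h') (trans (cong ⟦_⟧ℕ Hd) ⟦0⟧)))
        neg-sum : ∀ n f → sumTo n (λ i → - f i) ≡ - sumTo n f
        neg-sum zero    f = sym neg-0
        neg-sum (suc n) f = trans (cong (_+ - f n) (neg-sum n f)) (lem'' (sumTo n f) (f n))
          where
          opaque
            unfolding _+_
            lem'' : ∀ a b → - a + - b ≡ - (a + b)
            lem'' = solve-∀ ringℚ
        eq : sumTo (suc k) g ≡ ⟦ A (suc k) ⟧ℕ - 1ℚ
        eq = begin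
          sumTo (suc k) g ≡⟨ sumTo-+ (suc k) h (λ i → - h (d ℕ.∸ suc i)) ⟩
          sumTo (suc k) h + sumTo (suc k) (λ i → - h (d ℕ.∸ suc i)) ≡⟨ cong (sumTo (suc k) h +_) (trans (neg-sum (suc k) _) (cong -_ back)) ⟩
          sumTo (suc k) h - sumTo (suc k) h' ≡⟨ lem (sumTo (suc k) h) (sumTo (suc k) h') ⟩
          (1ℚ + sumTo (suc k) h) - (0ℚ + sumTo (suc k) h') - 1ℚ ≡⟨ cong₂ (λ a b → a - b - 1ℚ) (trans (sym lhs) (trans (cong ⟦_⟧ℕ (rel (suc k) l)) (⟦⟧ℕ-+ _ (A (suc k))))) (sym rhs) ⟩
          (⟦ S (λ i → H (suc d ℕ.∸ i)) (suc k) ⟧ℕ + ⟦ A (suc k) ⟧ℕ) - ⟦ S (λ i → H (suc d ℕ.∸ i)) (suc k) ⟧ℕ - 1ℚ ≡⟨ lem' ⟦ S (λ i → H (suc d ℕ.∸ i)) (suc k) ⟧ℕ ⟦ A (suc k) ⟧ℕ ⟩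
          ⟦ A (suc k) ⟧ℕ - 1ℚ ∎

      T : ℚ
      T = sumTo d (λ i → h i * θᵢ i)

      T-reverse : sumTo d (λ i → h (d ℕ.∸ suc i) * θᵢ i) ≡ - T
      T-reverse = begin
        sumTo d (λ i → h (d ℕ.∸ suc i) * θᵢ i)
          ≡⟨ sumTo-cong d (λ i l → lem _ _ _ (θᵢ-reverse i l)) ⟩
        sumTo d (λ i → (- 1ℚ) * (h (d ℕ.∸ suc i) * θᵢ (d ℕ.∸ suc i)))
          ≡⟨ sumTo-* d (- 1ℚ) _ ⟩
        (- 1ℚ) * sumTo d (λ i → h (d ℕ.∸ suc i) * θᵢ (d ℕ.∸ suc i))
          ≡⟨ cong ((- 1ℚ) *_) (sumTo-reverse d (λ i → h i * θᵢ i)) ⟩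
        (- 1ℚ) * T
          ≡⟨ lem' T ⟩
        - T ∎
        where
        opaque
          unfolding _+_
          l1 : ∀ a b → a * b ≡ (- 1ℚ) * (a * (- b))
          l1 = solve-∀ ringℚ
          lem' : ∀ a → (- 1ℚ) * a ≡ - a
          lem' = solve-∀ ringℚ
        lem : ∀ a b c → c ≡ - b → a * b ≡ (- 1ℚ) * (a * c)
        lem a b c e = trans (l1 a b) (cong (λ z → (- 1ℚ) * (a * z)) (sym e))

      -- As θ is antisymmetric under reversal, Σ gᵢθᵢ = 2T. Summation by parts bounds this below by
      -- the last weight times the total of g, and that total is zero.
      0≤T : 0ℚ ≤ T
      0≤T = 0≤*-cancel 0<2 (subst (0ℚ ≤_) double (≤-trans (≤-reflexive (sym total)) (abel (6 ℕ.+ e) g θᵢ (λ k l → partial k (ℕ.s≤s l)) (λ k _ → θᵢ-decreasing k))))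
        where
        opaque
          unfolding _+_
          l1 : ∀ a b c → (a - b) * c ≡ a * c + (- 1ℚ) * (b * c)
          l1 = solve-∀ ringℚ
          l2 : ∀ T → T + (- 1ℚ) * (- T) ≡ 2ℚ * T
          l2 = solve-∀ ringℚ
          l3 : ∀ a b → a - b ≡ a + (- 1ℚ) * b
          l3 = solve-∀ ringℚ
          l4 : ∀ a → a + (- 1ℚ) * a ≡ 0ℚ
          l4 = solve-∀ ringℚ
        double : sumTo d (λ i → g i * θᵢ i) ≡ 2ℚ * T
        double = trans (sumTo-cong d (λ i _ → l1 (h i) (h (d ℕ.∸ suc i)) (θᵢ i))) (trans (sumTo-+ d _ _) (trans (cong (T +_) (trans (sumTo-* d (- 1ℚ) _) (cong ((- 1ℚ) *_) T-reverse))) (l2 T)))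
        total : sumTo d g * θᵢ (6 ℕ.+ e) ≡ 0ℚ
        total = trans (cong (_* θᵢ (6 ℕ.+ e)) (trans (sumTo-cong d (λ i _ → l3 (h i) (h (d ℕ.∸ suc i)))) (trans (sumTo-+ d _ _)
          (trans (cong (sumTo d h +_) (trans (sumTo-* d (- 1ℚ) _) (cong ((- 1ℚ) *_) (sumTo-reverse d h)))) (l4 (sumTo d h)))))) (zeroˡ (θᵢ (6 ℕ.+ e)))

      -- After multiplication by 48 the difference of the two sides is Σ hᵢ (48 cᵢ - `n₄₈`), where
      -- h₀ has dropped out; termwise it is at least T.
      hstar-bound : f (posℤ d) + (sumTo (suc d) (λ j → ⟦ H j ⟧ℕ) - 1ℚ) * ⟦ N r d ⟧ ≤ sumTo (suc d) (λ j → ⟦ H j ⟧ℕ * f (posℤ d ℤ.- posℤ j))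
      hstar-bound = 0≤-⇒≤ (0≤*-cancel 0<48 (subst (0ℚ ≤_) (sym eq) (≤-trans 0≤T T≤)))
        where
        c : ℕ → ℚ
        c i = f (posℤ d ℤ.- posℤ (suc i))
        T≤ : T ≤ sumTo d (λ i → h i * (48ℚ * c i - n₄₈))
        T≤ = 0≤-⇒≤ (subst (0ℚ ≤_) (trans (sumTo-cong d (λ i _ → l1 _ _ _)) (trans (sumTo-+ d _ _) (cong (sumTo d (λ i → h i * (48ℚ * c i - n₄₈)) +_) (trans (sumTo-* d (- 1ℚ) _) (l2 T)))))
          (sumTo-nonneg d (λ i l → 0≤* (⟦⟧ℕ-nonneg (H (suc i))) (≤⇒0≤- (subst (λ z → θᵢ i ≤ z - n₄₈) (sym (f≡Φ (posℤ d ℤ.- posℤ (suc i)))) (Φ-θ (Xᵢ i) (Xᵢ-least i l)))))))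
          where
          opaque
            unfolding _+_
            l1 : ∀ h a b → h * (a - b) ≡ h * a + (- 1ℚ) * (h * b)
            l1 = solve-∀ ringℚ
            l2 : ∀ T → (- 1ℚ) * T ≡ - T
            l2 = solve-∀ ringℚ
        opaque
          unfolding _+_
          l3 : ∀ F s t N k → k * ((1ℚ * F + s) - (F + ((1ℚ + t) - 1ℚ) * N)) ≡ k * s + (- (k * N)) * t
          l3 = solve-∀ ringℚ
          l4 : ∀ k h c n → k * (h * c) + (- n) * h ≡ h * (k * c - n)
          l4 = solve-∀ ringℚ
        eq : 48ℚ * (sumTo (suc d) (λ j → ⟦ H j ⟧ℕ * f (posℤ d ℤ.- posℤ j)) - (f (posℤ d) + (sumTo (suc d) (λ j → ⟦ H j ⟧ℕ) - 1ℚ) * ⟦ N r d ⟧)) ≡ sumTo d (λ i → h i * (48ℚ * c i - n₄₈))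
        eq = begin
          48ℚ * (sumTo (suc d) (λ j → ⟦ H j ⟧ℕ * f (posℤ d ℤ.- posℤ j)) - (f (posℤ d) + (sumTo (suc d) (λ j → ⟦ H j ⟧ℕ) - 1ℚ) * ⟦ N r d ⟧))
            ≡⟨ cong₂ (λ a b → 48ℚ * (a - (f (posℤ d) + (b - 1ℚ) * ⟦ N r d ⟧)))
                 (trans (sumTo-suc d _) (cong (_+ sumTo d (λ i → h i * c i)) (cong₂ _*_ (trans (cong ⟦_⟧ℕ H0) ⟦1⟧) (cong f (ℤₚ.+-identityʳ (posℤ d))))))
                 (trans (sumTo-suc d _) (cong (_+ sumTo d h) (trans (cong ⟦_⟧ℕ H0) ⟦1⟧))) ⟩
          48ℚ * ((1ℚ * f (posℤ d) + sumTo d (λ i → h i * c i)) - (f (posℤ d) + ((1ℚ + sumTo d h) - 1ℚ) * ⟦ N r d ⟧))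
            ≡⟨ l3 (f (posℤ d)) (sumTo d (λ i → h i * c i)) (sumTo d h) ⟦ N r d ⟧ 48ℚ ⟩
          48ℚ * sumTo d (λ i → h i * c i) + (- n₄₈) * sumTo d h
            ≡⟨ cong₂ _+_ (sym (sumTo-* d 48ℚ _)) (sym (sumTo-* d (- n₄₈) _)) ⟩
          sumTo d (λ i → 48ℚ * (h i * c i)) + sumTo d (λ i → (- n₄₈) * h i)
            ≡⟨ sym (sumTo-+ d _ _) ⟩
          sumTo d (λ i → 48ℚ * (h i * c i) + (- n₄₈) * h i)
            ≡⟨ sumTo-cong d (λ i _ → l4 48ℚ (h i) (c i) n₄₈) ⟩
          sumTo d (λ i → h i * (48ℚ * c i - n₄₈)) ∎

    -- The argument 1 counts for M and has X = -Y with Y = d - 3. Against any X ≥ 0 the difference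
    -- of the cubics is a positive multiple of X + Y times a bracket, and 4 times the bracket is (2X
    -- - Y)² + 3Y² - 4(d + 1). The part free of X beyond the square is 16 for d = 7, but -1 for d =
    -- 6.
    M<N : M r d ℤ.< N r d
    M<N = go argminN
      where
      opaque
        unfolding _+_
        l1 : ∀ E X → (2ℚ * 2ℚ) * ((((0ℚ - (2ℚ * 2ℚ + E)) * (0ℚ - (2ℚ * 2ℚ + E))) - ((2ℚ + 2ℚ + 3ℚ + E) + 1ℚ)) + ((0ℚ - (2ℚ * 2ℚ + E)) * X + X * X)) ≡
             (2ℚ * X - (2ℚ * 2ℚ + E)) * (2ℚ * X - (2ℚ * 2ℚ + E)) + (2ℚ * 2ℚ * 2ℚ * 2ℚ + (2ℚ * 2ℚ * (2ℚ + 3ℚ)) * E + 3ℚ * (E * E))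
        l1 = solve-∀ ringℚ
        l2 : ∀ E → 2ℚ * 1ℚ - (2ℚ + 2ℚ + 3ℚ + E) + 1ℚ ≡ 0ℚ - (2ℚ * 2ℚ + E)
        l2 = solve-∀ ringℚ
        l3 : ∀ a b k → k * a - k * b ≡ k * (a - b)
        l3 = solve-∀ ringℚ
        l4 : ∀ X Y → X - (0ℚ - Y) ≡ X + Y
        l4 = solve-∀ ringℚ
        square : ∀ a → a * a ≡ (- a) * (- a)
        square = solve-∀ ringℚ
      0≤square : ∀ a → 0ℚ ≤ a * a
      0≤square a with 0ℚ ≤? a
      ... | yes p = 0≤* p p
      ... | no ¬p = subst (0ℚ ≤_) (sym (square a)) (0≤* (0≤neg (<⇒≤ (≰⇒> ¬p))) (0≤neg (<⇒≤ (≰⇒> ¬p))))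
      go : (∃[ i ] (lo ℕ.≤ i × i ℕ.≤ hi × N r d ≡ C d r (posℤ i))) → M r d ℤ.< N r d
      go (i , p , q , eN) = ℤₚ.≤-<-trans (minRange-≤ (λ i → C d r (posℤ i)) 1 hi 1 (ℕ.s≤s ℕ.z≤n) ℕₚ.≤-refl (ℕ.s≤s ℕ.z≤n))
        (subst (C d r (posℤ 1) ℤ.<_) (sym eN) (⟦⟧-cancel-< (0<-⇒< (0<*-cancel 0<48 (subst (0ℚ <_) (trans (cong₂ _-_ (sym (f≡Φ (posℤ i))) (sym (f≡Φ (posℤ 1)))) (l3 _ _ 48ℚ)) Φ<)))))
        where
        Xi = X (posℤ i)
        Y = 2ℚ * 2ℚ + E
        0<Y : 0ℚ < Y
        0<Y = 0<+≤ (0<* 0<2 0<2) 0≤E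
        0≤Xi : 0ℚ ≤ Xi
        0≤Xi = X-nonneg i (ℕₚ.≤-trans (ceilHalf-≥ (6 ℕ.+ e)) (ℕₚ.*-monoʳ-≤ 2 p))
        X1 : X (posℤ 1) ≡ 0ℚ - Y
        X1 = trans (cong₂ (λ D z → 2ℚ * z - D + 1ℚ) D≡ ⟦1⟧) (l2 E)
        bracket : 0ℚ < ((0ℚ - Y) * (0ℚ - Y) - (7ℚ + E + 1ℚ)) + ((0ℚ - Y) * Xi + Xi * Xi)
        bracket = 0<*-cancel (0<* 0<2 0<2) (subst (0ℚ <_) (sym (l1 E Xi)) (0≤+< (0≤square _) (0<+≤ (0<+≤ (0<* (0<* (0<* 0<2 0<2) 0<2) 0<2) (0≤* (<⇒≤ (0<* (0<* 0<2 0<2) (0<+≤ 0<2 (<⇒≤ 0<3)))) 0≤E)) (0≤* (<⇒≤ 0<3) (0≤* 0≤E 0≤E)))))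
        Φ< : 0ℚ < Φ Xi - Φ (X (posℤ 1))
        Φ< = subst (λ z → 0ℚ < Φ Xi - Φ z) (sym X1) (subst (0ℚ <_) (sym (c1 D (0ℚ - Y) Xi)) (0<* 0<κ (0<* (subst (0ℚ <_) (sym (l4 Xi Y)) (0≤+< 0≤Xi 0<Y))
          (subst (λ D → 0ℚ < ((0ℚ - Y) * (0ℚ - Y) - (D + 1ℚ)) + ((0ℚ - Y) * Xi + Xi * Xi)) (sym D≡) bracket))))

-- Lexicographic perturbation of the right-hand side of a linear program.

module Perturbations where
  open import Data.Rational using (_≤_; _<_)
  open Rationals
  open LinearAlgebra
  open Lexicographic
  open LinearPrograms
  open Cells
  open Basis

  lex-nonneg : ∀ {r} (z : Fin r → ℚ) → (∀ j → 0ℚ ≤ z j) → LexPos (λ j → - z j) → ⊥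
  lex-nonneg {suc r} z p (inj₁ q) = <-irrefl refl (<-≤-trans q (subst (- z zero ≤_) neg-0 (neg-antimono-≤ (p zero))))
  lex-nonneg {suc r} z p (inj₂ (_ , q)) = lex-nonneg (λ j → z (suc j)) (λ j → p (suc j)) q

  -- Entries from e on may have any sign: a positive entry before them has already decided.
  lex-prefix : ∀ {r} (z : Fin r → ℚ) e → (∀ j → toℕ j ℕ.< e → 0ℚ ≤ z j) → ∀ k → toℕ k ℕ.< e → 0ℚ < z k → LexPos z
  lex-prefix {suc r} z (suc e) p zero _ q = inj₁ q
  lex-prefix {suc r} z (suc e) p (suc k) (ℕ.s≤s l) q with z zero ≟ 0ℚ
  ... | yes e0 = inj₂ (e0 , lex-prefix (λ j → z (suc j)) e (λ j l → p (suc j) (ℕ.s≤s l)) k l q)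
  ... | no ne = inj₁ (≤∧≢⇒< (p zero (ℕ.s≤s ℕ.z≤n)) (λ e' → ne (sym e')))

  lex-nonneg-pos : ∀ {r} (z : Fin r → ℚ) → (∀ j → 0ℚ ≤ z j) → ∀ k → 0ℚ < z k → LexPos z
  lex-nonneg-pos {r} z p k = lex-prefix z r (λ j _ → p j) k (Finₚ.toℕ<n k)

  -- Whether a vanishing coordinate counts as positive is decided by the perturbation z.
  lex-sign : ∀ {r} → (Fin r → ℚ) → Bool
  lex-sign z = does (lexPos? z)

  lex-sign-nonneg : ∀ {r} (z : Fin r → ℚ) {a} → 0ℚ < a ⊎ (a ≡ 0ℚ × LexPos z) → Nonneg (lex-sign z) a
  lex-sign-nonneg z {a} p with lexPos? z | p
  ... | yes _ | inj₁ q = <⇒≤ q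
  ... | yes _ | inj₂ (e , _) = ≤-reflexive (sym e)
  ... | no _  | inj₁ q = q
  ... | no ¬l | inj₂ (_ , l) = ⊥-elim (¬l l)

  nonneg-lex-sign : ∀ {r} (z : Fin r → ℚ) {a} → Nonneg (lex-sign z) a → 0ℚ < a ⊎ (a ≡ 0ℚ × LexPos z)
  nonneg-lex-sign z {a} p with lexPos? z
  ... | no _ = inj₁ p
  ... | yes l with a ≟ 0ℚ
  ... | yes e = inj₂ (e , l)
  ... | no ne = inj₁ (≤∧≢⇒< p (λ e → ne (sym e)))

  lex-sign-nonneg-opposite : ∀ {r} (z : Fin r → ℚ) {a} → 0ℚ < a ⊎ (a ≡ 0ℚ × LexPos (λ j → - z j)) → Nonneg (not (lex-sign z)) a
  lex-sign-nonneg-opposite z {a} p with lexPos? z | p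
  ... | no _  | inj₁ q = <⇒≤ q
  ... | no _  | inj₂ (e , _) = ≤-reflexive (sym e)
  ... | yes _ | inj₁ q = q
  ... | yes l | inj₂ (_ , l') = ⊥-elim (lex-asym l l')

  nonneg-lex-sign-opposite : ∀ {r} (z : Fin r → ℚ) {a} → ((∀ j → z j ≡ 0ℚ) → ⊥) → Nonneg (not (lex-sign z)) a → 0ℚ < a ⊎ (a ≡ 0ℚ × LexPos (λ j → - z j))
  nonneg-lex-sign-opposite z {a} nz p with lexPos? z
  ... | yes _ = inj₁ p
  ... | no ¬l with a ≟ 0ℚ
  ... | no ne = inj₁ (≤∧≢⇒< p (λ e → ne (sym e)))
  ... | yes e with lex-tri z
  ... | inj₁ l = ⊥-elim (¬l l)
  ... | inj₂ (inj₁ zr) = ⊥-elim (nz zr)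
  ... | inj₂ (inj₂ l) = inj₂ (e , l)

  cons : ∀ {r} {A : Set} → A → (Fin r → A) → Fin (suc r) → A
  cons a f zero    = a
  cons a f (suc j) = f j

  combination : ∀ {r D} → (Fin r → ℚ) → (Fin r → Fin D → ℚ) → Fin D → ℚ
  combination ω X i = sum (λ j → ω j * X j i)

  module Perturbation {m D : ℕ} (g : Fin m → Fin D → ℚ) where
    open LinearProgram g

    -- Strict feasibility for the vector X₀ + εX₁ + ε²X₂ + ... with infinitesimal ε.
    LexFeasible : ∀ {r} → (Fin r → Fin D → ℚ) → Basis g → Set
    LexFeasible X B = ∀ k → LexPos (λ j → co B k (X j))

    -- No wall of any cell contains all of the vectors X, so the perturbed vector is nondegenerate.
    Separating : ∀ {r} → (Fin r → Fin D → ℚ) → Set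
    Separating X = ∀ (B : Basis g) k → (∀ j → co B k (X j) ≡ 0ℚ) → ⊥

    -- A coordinate functional that vanishes on a basis vanishes identically, yet it is 1 on the
    -- basis vector to which it belongs.
    separating-basis : ∀ (B₀ : Basis g) {r} (X : Fin r → Fin D → ℚ) → (∀ (B : Basis g) k → (∀ j → co B k (X j) ≡ 0ℚ) → ∀ l → co B k (g (ix B₀ l)) ≡ 0ℚ) → Separating X
    separating-basis B₀ X h B k z = 1≢0 (begin
      1ℚ ≡⟨ sym (trans (dual B k k) (δ-refl k)) ⟩
      co B k x ≡⟨ dot-cong (λ j → sym (span B₀ x j)) ⟩
      co B k (λ j → sum (λ l → co B₀ l x * g (ix B₀ l) j)) ≡⟨ dot-Σ (inv B k) (λ l → co B₀ l x) (λ l → g (ix B₀ l)) ⟩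
      sum (λ l → co B₀ l x * co B k (g (ix B₀ l))) ≡⟨ Σ-0 (λ l → trans (cong (co B₀ l x *_) (h B k z l)) (zeroʳ (co B₀ l x))) ⟩
      0ℚ ∎)
      where
      x = g (ix B k)

    co-combination : ∀ (B : Basis g) k {r} (ω : Fin r → ℚ) X → co B k (combination ω X) ≡ dot (λ j → co B k (X j)) ω
    co-combination B k ω X = trans (dot-Σ (inv B k) ω X) (Σ-cong (λ j → *-comm (ω j) _))

    -- Rational weights that realise the lexicographic signs for all bases simultaneously, which is
    -- possible because there are finitely many.
    Perturbed : ∀ {r} → (Fin r → Fin D → ℚ) → Set
    Perturbed {r} X = Σ (Fin r → ℚ) λ ω → (∀ j → 0ℚ < ω j) ×
        (∀ (B : Basis g) k → LexPos (λ j → co B k (X j)) → 0ℚ < co B k (combination ω X)) ×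
        (∀ (B : Basis g) k → LexPos (λ j → - co B k (X j)) → co B k (combination ω X) < 0ℚ)

    opaque
      perturb : ∀ {r} (X : Fin r → Fin D → ℚ) → Perturbed X
      perturb {r} X = finish (lex-generic codes z)
        where
        Code : Set
        Code = Bool × (Basis g × Fin D)
        codes : List Code
        codes = List.cartesianProduct (true ∷ false ∷ []) (List.cartesianProduct bases (List.allFin D))
        z : Code → Fin r → ℚ
        z (true  , B , k) j = co B k (X j)
        z (false , B , k) j = - co B k (X j)
        code∈ : ∀ s {B : Basis g} k → B ∈ bases → (s , B , k) ∈ codes
        code∈ true  k m = ∈ₚ.∈-cartesianProduct⁺ {xs = true ∷ false ∷ []} (here refl) (∈ₚ.∈-cartesianProduct⁺ m (∈ₚ.∈-allFin k))
        code∈ false k m = ∈ₚ.∈-cartesianProduct⁺ {xs = true ∷ false ∷ []} (there (here refl)) (∈ₚ.∈-cartesianProduct⁺ m (∈ₚ.∈-allFin k))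
        finish : (Σ (Fin r → ℚ) λ ω → (∀ j → 0ℚ < ω j) × (∀ x → x ∈ codes → LexPos (z x) → 0ℚ < dot (z x) ω)) → Perturbed X
        finish (ω , 0<ω , signs) = ω , 0<ω , positive' , negative'
          where
          positive' : ∀ (B : Basis g) k → LexPos (λ j → co B k (X j)) → 0ℚ < co B k (combination ω X)
          positive' B k l with bases-complete B
          ... | B' , m , e = subst (0ℚ <_) (trans (sym (co-combination B' k ω X)) (sym (co-≡idx B B' e k (combination ω X))))
            (signs _ (code∈ true k m) (lex-cong (λ j → co-≡idx B B' e k (X j)) l))
          negative' : ∀ (B : Basis g) k → LexPos (λ j → - co B k (X j)) → co B k (combination ω X) < 0ℚ
          negative' B k l with bases-complete B
          ... | B' , m , e = subst (_< 0ℚ) (trans (neg-involutive _) (trans (sym (co-combination B' k ω X)) (sym (co-≡idx B B' e k (combination ω X)))))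
            (neg<0 (subst (0ℚ <_) (trans (dot-comm _ ω) (trans (dot-neg ω _) (cong -_ (dot-comm ω _)))) (signs _ (code∈ false k m) (lex-cong (λ j → cong -_ (co-≡idx B B' e k (X j))) l))))

    nondegenerate : ∀ {r} (X : Fin r → Fin D → ℚ) → Separating X → (p : Perturbed X) →
      (∀ (B : Basis g) k → co B k (combination (proj₁ p) X) ≢ 0ℚ) × (∀ (B : Basis g) k → 0ℚ < co B k (combination (proj₁ p) X) → LexPos (λ j → co B k (X j)))
    nondegenerate X sep (ω , _ , p , n) = (λ B k e → nz B k (lex-tri (λ j → co B k (X j))) e) , (λ B k q → lp B k (lex-tri (λ j → co B k (X j))) q)
      where
      nz : ∀ (B : Basis g) k → LexPos (λ j → co B k (X j)) ⊎ (∀ j → co B k (X j) ≡ 0ℚ) ⊎ LexPos (λ j → - co B k (X j)) → co B k (combination ω X) ≢ 0ℚ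
      nz B k (inj₁ l) = >⇒≢ (p B k l)
      nz B k (inj₂ (inj₁ z)) = ⊥-elim (sep B k z)
      nz B k (inj₂ (inj₂ l)) = <⇒≢ (n B k l)
      lp : ∀ (B : Basis g) k → LexPos (λ j → co B k (X j)) ⊎ (∀ j → co B k (X j) ≡ 0ℚ) ⊎ LexPos (λ j → - co B k (X j)) → 0ℚ < co B k (combination ω X) → LexPos (λ j → co B k (X j))
      lp B k (inj₁ l) _ = l
      lp B k (inj₂ (inj₁ z)) _ = ⊥-elim (sep B k z)
      lp B k (inj₂ (inj₂ l)) q = ⊥-elim (<-asym q (n B k l))

    opaque
      -- The simplex method is run on a realised perturbation, and its strict signs are translated
      -- back into lexicographic ones.
      lex-optimal-exists : ∀ c → (∀ i → 0ℚ ≤ c i) → ∀ {r} (X : Fin r → Fin D → ℚ) → Separating X → ∀ (B₀ : Basis g) → LexFeasible X B₀ →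
        ∃[ B ] (LexFeasible X B × DualFeasible c B)
      lex-optimal-exists c 0≤c X sep B₀ f₀ = go (perturb X)
        where
        go : Perturbed X → ∃[ B ] (LexFeasible X B × DualFeasible c B)
        go pt@(ω , 0<ω , p , n) with nondegenerate X sep pt
        ... | nondeg , lexpos with optimal-exists c 0≤c (combination ω X) nondeg B₀ (λ k → p B₀ k (f₀ k))
        ... | B , fB , df = B , (λ k → lexpos B k (fB k)) , df

    lex-optimal-same : ∀ {c} → Generic c → ∀ {B B' : Basis g} → DualFeasible c B → DualFeasible c B' → ∀ {r} (X : Fin r → Fin D → ℚ) →
      LexFeasible X B → LexFeasible X B' → Same B B'
    lex-optimal-same gen {B} {B'} df df' X f f' = go (perturb X)
      where
      go : Perturbed X → Same B B'
      go (ω , 0<ω , p , n) = optimal-same gen {B} {B'} df df' (combination ω X) (λ k → p B k (f k)) (λ k → p B' k (f' k))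

    lexfeasible-same : ∀ {B B' : Basis g} → Same B B' → ∀ {r} (X : Fin r → Fin D → ℚ) → LexFeasible X B → LexFeasible X B'
    lexfeasible-same {B} {B'} s@(_ , q) X f l with q l
    ... | k , e = lex-cong (λ j → co-same {B} {B'} s (sym e) (X j)) (f k)

-- The cone over the polytope, its facet functionals and its two kinds of cells.

module Cones where
  open import Data.Rational using (_≤_; _<_)
  open Rationals
  open LinearAlgebra
  open Lexicographic
  open LinearPrograms
  open Cardinality
  open Cells
  open Perturbations
  open Basis

  record Spanning {d : ℕ} (V : List (Point d)) : Set where
    no-eta-equality
    field
      vertex : Fin (suc d) → Fin (length V)
      independent : AffinelyIndependent (λ k → List.lookup V (vertex k))

  spanning : ∀ {d} (V : List (Point d)) → FullDimensional V → Spanning V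
  spanning {d} V (p , p∈ , ind) = record
    { vertex = λ k → Any.index (p∈ k)
    ; independent = λ c s h → ind c s (λ j → trans (Σℚ-cong (λ i → cong (λ y → c i ℚ.* ℤ→ℚ (lookup y j)) (Anyₚ.lookup-index (p∈ i)))) (h j)) }
    where
    Σℚ-cong : ∀ {n} {f g : Fin n → ℚ} → (∀ i → f i ≡ g i) → Σℚ f ≡ Σℚ g
    Σℚ-cong {f = f} {g} e = trans (sym (sum≡Σℚ f)) (trans (Σ-cong e) (sum≡Σℚ g))

  module Polytope {d : ℕ} (V : List (Point d)) (spn : Spanning V) where
    open Spanning spn

    size : ℕ
    size = length V

    u : Fin size → Fin (suc d) → ℚ
    u i = hom 1 (List.lookup V i)

    p : Fin (suc d) → Fin (suc d) → ℚ
    p k = u (vertex k)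

    -- Left at height d + 1 instead of being scaled to height 1, since only its ray matters. Being a
    -- sum of spanning vertices, it is interior.
    q : Fin (suc d) → ℚ
    q j = sum (λ k → p k j)

    -- The generators of the cone over conv V, preceded by the interior point q.
    gen : Fin (suc size) → Fin (suc d) → ℚ
    gen zero    = q
    gen (suc i) = u i

    open LinearProgram gen
    open Perturbation gen

    opaque
      inv₀ : Inverse p
      inv₀ with invertible? p
      ... | inj₁ i = i
      ... | inj₂ (μ , (k , μk≢0) , rel) = ⊥-elim (μk≢0 (independent μ
          (trans (sym (sum≡Σℚ μ)) (trans (Σ-cong (λ i → sym (trans (cong (μ i *_) ⟦1⟧) (trans (*-comm (μ i) 1ℚ) (*-identityˡ (μ i)))))) (rel zero)))
          (λ j → trans (sym (trans (Σ-cong (λ i → trans (*-ℚ (μ i) (u (vertex i) (suc j))) (cong (μ i ℚ.*_) (⟦⟧-ℚ _)))) (sum≡Σℚ (λ i → μ i ℚ.* ℤ→ℚ (lookup (List.lookup V (vertex i)) j))))) (rel (suc j))) k))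

      B₀ : Basis gen
      B₀ = record { idx = Vec.tabulate (λ k → suc (vertex k)) ; inv = proj₁ inv₀
        ; dual = λ k l → trans (dot-cong (λ j → cong (λ i → gen i j) (Vecₚ.lookup∘tabulate (λ k → suc (vertex k)) l))) (proj₁ (proj₂ inv₀) k l)
        ; span = λ x j → trans (Σ-cong (λ k → cong (λ i → dot (proj₁ inv₀ k) x * gen i j) (Vecₚ.lookup∘tabulate (λ k → suc (vertex k)) k))) (proj₂ (proj₂ inv₀) x j) }

      ix₀ : ∀ k → ix B₀ k ≡ suc (vertex k)
      ix₀ k = Vecₚ.lookup∘tabulate (λ k → suc (vertex k)) k

    q-expansion : ∀ j → q j ≡ sum (λ k → 1ℚ * p k j)
    q-expansion j = Σ-cong (λ k → sym (*-identityˡ (p k j)))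

    fun-q : ∀ (a : Fin (suc d) → ℚ) → dot a q ≡ sum (λ k → dot a (p k))
    fun-q a = trans (dot-cong q-expansion) (trans (dot-Σ a (λ _ → 1ℚ) p) (Σ-cong (λ k → *-identityˡ (dot a (p k)))))

    q-height : q zero ≡ ⟦ suc d ⟧ℕ
    q-height = sum-1 (suc d)

    0<q-height : 0ℚ < q zero
    0<q-height = subst (0ℚ <_) (sym q-height) (⟦⟧ℕ-pos (ℕ.s≤s ℕ.z≤n))

    Cone : (Fin (suc d) → ℚ) → Set
    Cone x = Σ (Fin size → ℚ) λ c → (∀ i → 0ℚ ≤ c i) × (∀ j → x j ≡ sum (λ i → c i * u i j))

    cone-gen : ∀ i → Cone (u i)
    cone-gen i = δ i , δ-nonneg i , (λ j → sym (Σ-δ i (λ k → u k j)))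

    cone-Σ : ∀ {r} (a : Fin r → ℚ) (x : Fin r → Fin (suc d) → ℚ) → (∀ k → 0ℚ ≤ a k) → (∀ k → Cone (x k)) → Cone (λ j → sum (λ k → a k * x k j))
    cone-Σ a x 0≤a cx = (λ i → sum (λ k → a k * proj₁ (cx k) i)) , (λ i → Σ-nonneg (λ k → 0≤* (0≤a k) (proj₁ (proj₂ (cx k)) i))) , λ j → begin
      sum (λ k → a k * x k j) ≡⟨ Σ-cong (λ k → trans (cong (a k *_) (proj₂ (proj₂ (cx k)) j)) (trans (sym (Σ-* (a k) _)) (Σ-cong (λ i → sym (*-assoc (a k) _ _))))) ⟩
      sum (λ k → sum (λ i → (a k * proj₁ (cx k) i) * u i j)) ≡⟨ Σ-swap _ ⟩
      sum (λ i → sum (λ k → (a k * proj₁ (cx k) i) * u i j)) ≡⟨ Σ-cong (λ i → Σ-*ʳ (u i j) (λ k → a k * proj₁ (cx k) i)) ⟩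
      sum (λ i → sum (λ k → a k * proj₁ (cx k) i) * u i j) ∎

    cone-resp : ∀ {x y} → (∀ j → x j ≡ y j) → Cone x → Cone y
    cone-resp e (c , p , h) = c , p , (λ j → trans (sym (e j)) (h j))

    cone-functional : ∀ (a : Fin (suc d) → ℚ) → (∀ i → 0ℚ ≤ dot a (u i)) → ∀ {x} → Cone x → 0ℚ ≤ dot a x
    cone-functional a h (c , 0≤c , e) = subst (0ℚ ≤_) (sym (trans (dot-cong e) (dot-Σ a c u))) (Σ-nonneg (λ i → 0≤* (0≤c i) (h i)))

    K I Bd : ℕ → Point d → Set
    K n y = Cone (hom n y)
    -- y is interior when a small positive combination of the vertices p can be subtracted.
    I n y = Σ ℚ λ ω₀ → Σ (Fin (suc d) → ℚ) λ ω → 0ℚ < ω₀ × (∀ j → 0ℚ < ω j) × Cone (λ i → ω₀ * hom n y i - sum (λ j → ω j * p j i))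
    Bd n y = K n y × ¬ I n y

    unsuc : ∀ {n} (i : Fin (suc n)) → i ≢ zero → ∃[ j ] i ≡ suc j
    unsuc zero    ne = ⊥-elim (ne refl)
    unsuc (suc j) _  = j , refl

    suc≢zero : ∀ {n} {j : Fin n} {i : Fin (suc n)} → i ≡ suc j → i ≢ zero
    suc≢zero refl ()

    -- Boundary cells: maximising the coefficient of q makes every optimal basis contain q, and the other basis vectors span a boundary simplex.

    level-∂ : Fin (suc size) → ℚ
    level-∂ zero    = 0ℚ
    level-∂ (suc _) = 1ℚ

    level-∂-nonneg : ∀ i → 0ℚ ≤ level-∂ i
    level-∂-nonneg zero    = ≤-refl
    level-∂-nonneg (suc _) = 0≤1

    module ∂-Basis (B : Basis gen) (df : DualFeasible level-∂ B) where
      private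
        height-1 : ∀ {i j} → i ≡ suc j → gen i zero ≡ level-∂ i
        height-1 refl = ⟦1⟧

        -- Without q the cost agrees with the height on the whole basis, and the reduced cost of q
        -- would be 0 - (d + 1).
        absent : (∀ k → ix B k ≢ zero) → ⊥
        absent none = <-irrefl refl (≤-<-trans (df zero) (subst (_< 0ℚ) (sym (trans (cong (0ℚ +_) (cong -_ val≡)) (+-identityˡ _))) (neg<0 0<q-height)))
          where
          val≡ : val B level-∂ q ≡ q zero
          val≡ = trans (Σ-cong (λ k → cong (co B k q *_) (sym (height-1 (proj₂ (unsuc (ix B k) (none k))))))) (span B q zero)

      opaque
        k₀ : Fin (suc d)
        k₀ with Finₚ.any? (λ k → ix B k Finₚ.≟ zero)
        ... | yes (k , _) = k
        ... | no none = ⊥-elim (absent (λ k e → none (k , e)))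

        ix-k₀ : ix B k₀ ≡ zero
        ix-k₀ with Finₚ.any? (λ k → ix B k Finₚ.≟ zero)
        ... | yes (k , e) = e
        ... | no none = ⊥-elim (absent (λ k e → none (k , e)))

      others : ∀ l → ∃[ j ] ix B (punchIn k₀ l) ≡ suc j
      others l = unsuc (ix B (punchIn k₀ l)) (λ e → Finₚ.punchInᵢ≢i k₀ l (ix-injective B (trans e (sym ix-k₀))))

      -- The functional of the facet hyperplane through the other basis vectors, normalised to 1 at
      -- q.
      φ : (Fin (suc d) → ℚ) → ℚ
      φ = co B k₀

      φ-q : φ q ≡ 1ℚ
      φ-q = trans (cong (λ i → φ (gen i)) (sym ix-k₀)) (trans (dual B k₀ k₀) (δ-refl k₀))

      co-q : ∀ l → co B (punchIn k₀ l) q ≡ 0ℚ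
      co-q l = trans (cong (λ i → co B (punchIn k₀ l) (gen i)) (sym ix-k₀)) (trans (dual B (punchIn k₀ l) k₀) (δ-≢ (Finₚ.punchInᵢ≢i k₀ l)))

      -- Cost and height agree on every generator but q, so the reduced cost of `u i` is the height
      -- of q times `φ (u i)`.
      φ-u : ∀ i → 0ℚ ≤ φ (u i)
      φ-u i = 0≤*-cancel 0<q-height (subst (0ℚ ≤_) rc≡ (df (suc i)))
        where
        opaque
          unfolding _+_
          lem : ∀ a b → a - (a - b) ≡ b
          lem = solve-∀ ringℚ
        expand : u i zero ≡ φ (u i) * q zero + val B level-∂ (u i)
        expand = begin
          u i zero ≡⟨ sym (span B (u i) zero) ⟩
          sum (λ k → co B k (u i) * gen (ix B k) zero) ≡⟨ Σ-punchIn k₀ _ ⟩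
          φ (u i) * gen (ix B k₀) zero + sum (λ l → co B (punchIn k₀ l) (u i) * gen (ix B (punchIn k₀ l)) zero)
            ≡⟨ cong₂ _+_ (cong (λ j → φ (u i) * gen j zero) ix-k₀) (Σ-cong (λ l → cong (co B (punchIn k₀ l) (u i) *_) (height-1 (proj₂ (others l))))) ⟩
          φ (u i) * q zero + sum (λ l → co B (punchIn k₀ l) (u i) * level-∂ (ix B (punchIn k₀ l)))
            ≡⟨ cong (φ (u i) * q zero +_) (sym (trans (Σ-punchIn k₀ _) (trans (cong (_+ sum (λ l → co B (punchIn k₀ l) (u i) * level-∂ (ix B (punchIn k₀ l))))
                 (trans (cong (λ j → φ (u i) * level-∂ j) ix-k₀) (zeroʳ (φ (u i))))) (+-identityˡ _)))) ⟩
          φ (u i) * q zero + val B level-∂ (u i) ∎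
        opaque
          unfolding _+_
          lem' : ∀ a b → a + b - b ≡ a
          lem' = solve-∀ ringℚ
        rc≡ : rc B level-∂ (suc i) ≡ q zero * φ (u i)
        rc≡ = trans (cong (_- val B level-∂ (u i)) (trans (sym ⟦1⟧) expand)) (trans (lem' (φ (u i) * q zero) (val B level-∂ (u i))) (*-comm (φ (u i)) (q zero)))

      φ-K : ∀ {x} → Cone x → 0ℚ ≤ φ x
      φ-K = cone-functional (inv B k₀) φ-u

      φ-p-sum : sum (λ k → φ (p k)) ≡ 1ℚ
      φ-p-sum = trans (sym (fun-q (inv B k₀))) φ-q

      -- The values of φ on `p` are nonnegative with sum 1, so they cannot all be zero.
      φ-p-positive : ∀ (ω : Fin (suc d) → ℚ) → (∀ j → 0ℚ < ω j) → 0ℚ < sum (λ j → ω j * φ (p j))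
      φ-p-positive ω 0<ω = ≤∧≢⇒< (Σ-nonneg terms) (λ e → 1≢0 (trans (sym φ-p-sum) (Σ-0 (λ j → *-cancel-0 (Σ-term0 terms (≤-reflexive (sym e)) j) (>⇒≢ (0<ω j))))))
        where
        terms : ∀ j → 0ℚ ≤ ω j * φ (p j)
        terms j = 0≤* (<⇒≤ (0<ω j)) (φ-u (vertex j))

      φ-I : ∀ {n y} → I n y → 0ℚ < φ (hom n y)
      φ-I {n} {y} (ω₀ , ω , 0<ω₀ , 0<ω , c) = 0<*-cancel 0<ω₀ (0<-⇒< (subst (0ℚ <_) (sym (lem (ω₀ * φ (hom n y)) s)) (0≤+< (subst (0ℚ ≤_) eq (φ-K c)) (φ-p-positive ω 0<ω))))
        where
        s = sum (λ j → ω j * φ (p j))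
        opaque
          unfolding _+_
          lem : ∀ a s → a - 0ℚ ≡ (a - s) + s
          lem = solve-∀ ringℚ
        eq : φ (λ i → ω₀ * hom n y i - sum (λ j → ω j * p j i)) ≡ ω₀ * φ (hom n y) - s
        eq = trans (dot-- (inv B k₀) _ _) (cong₂ _-_ (dot-* (inv B k₀) ω₀ (hom n y)) (dot-Σ (inv B k₀) ω p))

      facet-part : ∀ x j → sum (λ l → co B (punchIn k₀ l) x * gen (ix B (punchIn k₀ l)) j) ≡ x j - φ x * q j
      facet-part x j = trans (lem (φ x * q j) _) (cong (_- φ x * q j) (trans (cong (λ i → φ x * gen i j + sum (λ l → co B (punchIn k₀ l) x * gen (ix B (punchIn k₀ l)) j)) (sym ix-k₀)) (trans (sym (Σ-punchIn k₀ _)) (span B x j))))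
        where
        opaque
          unfolding _+_
          lem : ∀ a b → b ≡ (a + b) - a
          lem = solve-∀ ringℚ

      cone-facet-part : ∀ x → (∀ l → 0ℚ ≤ co B (punchIn k₀ l) x) → Cone (λ j → x j - φ x * q j)
      cone-facet-part x h = cone-resp (facet-part x) (cone-Σ (λ l → co B (punchIn k₀ l) x) (λ l → gen (ix B (punchIn k₀ l))) h
        (λ l → subst (λ i → Cone (gen i)) (sym (proj₂ (others l))) (cone-gen (proj₁ (others l)))))

      -- Subtracting φ times q leaves a nonnegative combination of facet vertices, and q is the sum
      -- of `p`; the value of φ at the point therefore serves as a common weight.
      interior : ∀ {n y} → (∀ l → 0ℚ ≤ co B (punchIn k₀ l) (hom n y)) → 0ℚ < φ (hom n y) → I n y
      interior {n} {y} h 0<φ = 1ℚ , (λ _ → φ (hom n y)) , 0<1 , (λ _ → 0<φ) ,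
        cone-resp (λ j → cong₂ _-_ (sym (*-identityˡ (hom n y j))) (sym (Σ-* (φ (hom n y)) (λ k → p k j)))) (cone-facet-part (hom n y) h)

      facet : Cell d d
      facet = record
        { vs = λ l → List.lookup V (proj₁ (others l))
        ; fn = λ l → inv B (punchIn k₀ l)
        ; dual = λ k l → trans (cong (λ i → co B (punchIn k₀ k) (gen i)) (sym (proj₂ (others l)))) (trans (dual B (punchIn k₀ k) (punchIn k₀ l)) (δ-punchIn k l)) }
        where
        δ-punchIn : ∀ k l → δ (punchIn k₀ k) (punchIn k₀ l) ≡ δ k l
        δ-punchIn k l with k Finₚ.≟ l
        ... | yes e = δ-≡ (cong (punchIn k₀) e)
        ... | no ne = δ-≢ (λ e → ne (Finₚ.punchIn-injective k₀ k l e))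

      facet-hom : ∀ l j → hom 1 (Cell.vs facet l) j ≡ gen (ix B (punchIn k₀ l)) j
      facet-hom l j = cong (λ i → gen i j) (sym (proj₂ (others l)))

      facet-supported : ∀ {n y} → φ (hom n y) ≡ 0ℚ → Cell.Supported facet n y
      facet-supported {n} {y} e j = trans (Σ-cong (λ l → cong (co B (punchIn k₀ l) (hom n y) *_) (facet-hom l j))) (trans (facet-part (hom n y) j)
        (trans (cong (λ z → hom n y j - z * q j) e) (lem (hom n y j) (q j))))
        where
        opaque
          unfolding _+_
          lem : ∀ a b → a - 0ℚ * b ≡ a
          lem = solve-∀ ringℚ

      supported-facet : ∀ {n y} → Cell.Supported facet n y → φ (hom n y) ≡ 0ℚ
      supported-facet {n} {y} sup = trans (dot-cong (λ j → sym (sup j))) (trans (dot-Σ (inv B k₀) _ _)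
        (Σ-0 (λ l → trans (cong (Cell.coord facet n y l *_) (trans (dot-cong (facet-hom l)) (trans (dual B k₀ (punchIn k₀ l)) (δ-≢ (λ e → Finₚ.punchInᵢ≢i k₀ l (sym e)))))) (zeroʳ _))))

    -- Interior cells: expensive q gives a triangulation of the cone itself.

    level : Fin (suc size) → ℚ
    level zero    = 1ℚ
    level (suc _) = 0ℚ

    level-nonneg : ∀ i → 0ℚ ≤ level i
    level-nonneg zero    = 0≤1
    level-nonneg (suc _) = ≤-refl

    module Full-Basis (B : Basis gen) (df : DualFeasible level B) where
      -- Dual feasibility makes the value of the functional at most 0 on every `p k`, hence on their
      -- sum q, whereas as a basis vector q would have value 1.
      no-q : ∀ k → ix B k ≢ zero
      no-q k e = <-irrefl refl (<-≤-trans 0<1 (subst (_≤ 0ℚ) (trans (val-basis B level k) (cong level e)) (subst (λ i → val B level (gen i) ≤ 0ℚ) (sym e) val-q≤0)))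
        where
        opaque
          unfolding _+_
          lem : ∀ a → 0ℚ - a ≡ - a
          lem = solve-∀ ringℚ
        val-q≤0 : val B level q ≤ 0ℚ
        val-q≤0 = 0≤-⇒≤ (subst (0ℚ ≤_) (trans (Σ-cong (λ j → lem (val B level (p j)))) (trans (Σ-neg _) (sym (trans (lem _) (cong -_
          (trans (val-cong B level q-expansion) (trans (val-Σ B level (λ _ → 1ℚ) p) (Σ-cong (λ j → *-identityˡ _)))))))))
          (Σ-nonneg (λ j → df (suc (vertex j)))))

      members : ∀ k → ∃[ j ] ix B k ≡ suc j
      members k = unsuc (ix B k) (no-q k)

      simplex : Cell d (suc d)
      simplex = record
        { vs = λ k → List.lookup V (proj₁ (members k))
        ; fn = inv B
        ; dual = λ k l → trans (cong (λ i → co B k (gen i)) (sym (proj₂ (members l)))) (dual B k l) }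

      simplex-hom : ∀ k j → hom 1 (Cell.vs simplex k) j ≡ gen (ix B k) j
      simplex-hom k j = cong (λ i → gen i j) (sym (proj₂ (members k)))

      simplex-supported : ∀ n y → Cell.Supported simplex n y
      simplex-supported n y j = trans (Σ-cong (λ k → cong (co B k (hom n y) *_) (simplex-hom k j))) (span B (hom n y) j)

      cone-nonneg : ∀ x → (∀ k → 0ℚ ≤ co B k x) → Cone x
      cone-nonneg x h = cone-resp (span B x) (cone-Σ (λ k → co B k x) (λ k → gen (ix B k)) h (λ k → subst (λ i → Cone (gen i)) (sym (proj₂ (members k))) (cone-gen (proj₁ (members k)))))

-- The h*-vector of a polytope and the h-vector of its boundary.

module HStarVectors where
  open import Data.Rational using (_≤_; _<_)
  open Rationals
  open LinearAlgebra
  open Lexicographic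
  open LinearPrograms
  open Cardinality
  open Cells
  open Perturbations
  open Cones
  open Basis

  S-cong : ∀ {f g : ℕ → ℕ} n → (∀ i → i ℕ.≤ n → f i ≡ g i) → S f n ≡ S g n
  S-cong zero    p = p 0 ℕₚ.≤-refl
  S-cong (suc n) p = cong₂ ℕ._+_ (S-cong n (λ i l → p i (ℕₚ.m≤n⇒m≤1+n l))) (p (suc n) ℕₚ.≤-refl)

  Sⁿ-cong : ∀ s {f g : ℕ → ℕ} n → (∀ i → f i ≡ g i) → Sⁿ s f n ≡ Sⁿ s g n
  Sⁿ-cong zero    n p = p n
  Sⁿ-cong (suc s) n p = S-cong n (λ i _ → Sⁿ-cong s i p)

  S-+ : ∀ f g n → S (λ i → f i ℕ.+ g i) n ≡ S f n ℕ.+ S g n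
  S-+ f g zero    = refl
  S-+ f g (suc n) = trans (cong (ℕ._+ (f (suc n) ℕ.+ g (suc n))) (S-+ f g n)) (lem (S f n) (S g n) (f (suc n)) (g (suc n)))
    where
    lem : ∀ a b c e → (a ℕ.+ b) ℕ.+ (c ℕ.+ e) ≡ (a ℕ.+ c) ℕ.+ (b ℕ.+ e)
    lem = ℕSolver.solve-∀

  Sⁿ-+ : ∀ s f g n → Sⁿ s (λ i → f i ℕ.+ g i) n ≡ Sⁿ s f n ℕ.+ Sⁿ s g n
  Sⁿ-+ zero    f g n = refl
  Sⁿ-+ (suc s) f g n = trans (S-cong n (λ i _ → Sⁿ-+ s f g i)) (S-+ (Sⁿ s f) (Sⁿ s g) n)

  Sⁿ-0 : ∀ s n → Sⁿ s (λ _ → 0) n ≡ 0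
  Sⁿ-0 zero    n       = refl
  Sⁿ-0 (suc s) zero    = Sⁿ-0 s 0
  Sⁿ-0 (suc s) (suc n) = cong₂ ℕ._+_ (Sⁿ-0 (suc s) n) (Sⁿ-0 s (suc n))

  Sⁿ-sumℕ : ∀ {t} s (b : Fin t → ℕ → ℕ) n → sumℕ (λ i → Sⁿ s (b i) n) ≡ Sⁿ s (λ j → sumℕ (λ i → b i j)) n
  Sⁿ-sumℕ {zero}  s b n = sym (Sⁿ-0 s n)
  Sⁿ-sumℕ {suc t} s b n = trans (cong (Sⁿ s (b zero) n ℕ.+_) (Sⁿ-sumℕ s (λ i → b (suc i)) n)) (sym (Sⁿ-+ s (b zero) _ n))

  Sⁿ-S : ∀ s f n → Sⁿ (suc s) f n ≡ Sⁿ s (S f) n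
  Sⁿ-S zero    f n = refl
  Sⁿ-S (suc s) f n = S-cong n (λ i _ → Sⁿ-S s f i)

  S-injective : ∀ f g → (∀ n → S f n ≡ S g n) → ∀ n → f n ≡ g n
  S-injective f g p zero    = p 0
  S-injective f g p (suc n) = ℕₚ.+-cancelˡ-≡ (S f n) _ _ (trans (p (suc n)) (cong (ℕ._+ g (suc n)) (sym (p n))))

  Sⁿ-injective : ∀ s f g → (∀ n → Sⁿ s f n ≡ Sⁿ s g n) → ∀ n → f n ≡ g n
  Sⁿ-injective zero    f g p = p
  Sⁿ-injective (suc s) f g p = Sⁿ-injective s f g (S-injective (Sⁿ s f) (Sⁿ s g) p)

  Sⁿ-at-0 : ∀ s f → Sⁿ s f 0 ≡ f 0
  Sⁿ-at-0 zero    f = refl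
  Sⁿ-at-0 (suc s) f = Sⁿ-at-0 s f

  sumℕ-cong : ∀ {t} {f g : Fin t → ℕ} → (∀ i → f i ≡ g i) → sumℕ f ≡ sumℕ g
  sumℕ-cong {zero}  p = refl
  sumℕ-cong {suc t} p = cong₂ ℕ._+_ (p zero) (sumℕ-cong (λ i → p (suc i)))

  sumℕ-0 : ∀ {t} {f : Fin t → ℕ} → (∀ i → f i ≡ 0) → sumℕ f ≡ 0
  sumℕ-0 {zero}  p = refl
  sumℕ-0 {suc t} p = cong₂ ℕ._+_ (p zero) (sumℕ-0 (λ i → p (suc i)))

  sumℕ-≥ : ∀ {t} (f : Fin t → ℕ) i → f i ℕ.≤ sumℕ f
  sumℕ-≥ f zero    = ℕₚ.m≤m+n (f zero) _
  sumℕ-≥ f (suc i) = ℕₚ.≤-trans (sumℕ-≥ (λ i → f (suc i)) i) (ℕₚ.m≤n+m _ (f zero))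

  card-true : ∀ {d} (σ : Fin d → Bool) → Card (λ k → σ k ≡ true) (sumℕ (λ k → if σ k then 1 else 0))
  card-true {zero} σ = card-0 (λ ())
  card-true {suc d} σ with σ zero in eq
  ... | true = card-resp (λ { k (inj₁ refl) → eq ; k (inj₂ (j , p , refl)) → p }) (λ { zero p → inj₁ refl ; (suc k) p → inj₂ (k , p , refl) })
      (card-⊎ (card-1 {P = λ k → k ≡ zero} zero refl (λ _ e → e)) (card-bij {Q = λ k → ∃[ j ] (σ (suc j) ≡ true × suc j ≡ k)} (card-true (λ k → σ (suc k))) suc (λ _ _ _ _ → Finₚ.suc-injective) (λ j p → j , p , refl) (λ { _ (j , p , e) → j , p , e })) (λ { _ refl (_ , _ , ()) }))
  ... | false = card-bij (card-true (λ k → σ (suc k))) suc (λ _ _ _ _ → Finₚ.suc-injective) (λ j p → p) (λ { zero p → ⊥-elim (contra (trans (sym eq) p)) ; (suc k) p → k , p , refl })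
    where
    contra : false ≡ true → ⊥
    contra ()

  true+false : ∀ {d} (σ : Fin d → Bool) → sumℕ (λ k → if σ k then 1 else 0) ℕ.+ sumℕ (λ k → if σ k then 0 else 1) ≡ d
  true+false {zero} σ = refl
  true+false {suc d} σ with σ zero
  ... | true  = cong suc (true+false (λ k → σ (suc k)))
  ... | false = trans (ℕₚ.+-suc _ _) (cong suc (true+false (λ k → σ (suc k))))

  card-initial : ∀ {d} e → e ℕ.≤ d → Card (λ (l : Fin d) → toℕ l ℕ.< e) e
  card-initial zero _ = card-0 (λ _ ())
  card-initial {suc d} (suc e) (ℕ.s≤s le) = card-resp
    (λ { k (inj₁ refl) → ℕ.s≤s ℕ.z≤n ; k (inj₂ (j , p , refl)) → ℕ.s≤s p }) (λ { zero p → inj₁ refl ; (suc k) (ℕ.s≤s p) → inj₂ (k , p , refl) })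
    (card-⊎ (card-1 {P = λ k → k ≡ zero} zero refl (λ _ e → e)) (card-bij {Q = λ k → ∃[ j ] (toℕ j ℕ.< e × suc j ≡ k)} (card-initial {d} e le) suc (λ _ _ _ _ → Finₚ.suc-injective) (λ j p → j , p , refl) (λ { _ (j , p , e) → j , p , e })) (λ { _ refl (_ , _ , ()) }))

  -- H is the h*-vector and A the h-vector of the boundary; their generating functions satisfy H(t) − tᵈ⁺¹ H(1/t) = (1 − t) A(t).
  record HStar {d : ℕ} (Count : ℕ → ℕ → Set) : Set where
    no-eta-equality
    field
      H A     : ℕ → ℕ
      H-0     : H 0 ≡ 1
      H-above : ∀ j → suc d ℕ.≤ j → H j ≡ 0
      A-pos   : ∀ j → j ℕ.≤ d → 1 ℕ.≤ A j
      H-A     : ∀ j → j ℕ.≤ d → S H j ≡ S (λ i → H (suc d ℕ.∸ i)) j ℕ.+ A j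
      count   : ∀ n → Count n (Sⁿ (suc d) H n)

  module Triangulated {d : ℕ} (V : List (Point d)) (spn : Spanning V) where
    open Spanning spn
    open Polytope V spn
    open LinearProgram gen
    open Perturbation gen

    -- `c∂` and `T∂` describe the division of the cone into pyramids from q over boundary simplices;
    -- `c` and `T` describe a triangulation that avoids q.
    module Counting
      (c∂ : Fin (suc size) → ℚ) (0≤c∂ : ∀ i → 0ℚ ≤ c∂ i) (generic∂ : Generic c∂) (level∂ : ∀ (B : Basis gen) → DualFeasible c∂ B → DualFeasible level-∂ B)
      (c : Fin (suc size) → ℚ) (0≤c : ∀ i → 0ℚ ≤ c i) (generic : Generic c) (level' : ∀ (B : Basis gen) → DualFeasible c B → DualFeasible level B)
      (t∂ : ℕ) (T∂ : Fin t∂ → Basis gen) (df∂ : ∀ i → DualFeasible c∂ (T∂ i))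
      (cover∂ : ∀ (B : Basis gen) → DualFeasible c∂ B → ∃[ i ] Same B (T∂ i)) (distinct∂ : ∀ i j → Same (T∂ i) (T∂ j) → i ≡ j)
      (t : ℕ) (T : Fin t → Basis gen) (df : ∀ i → DualFeasible c (T i))
      (cover : ∀ (B : Basis gen) → DualFeasible c B → ∃[ i ] Same B (T i)) (distinct : ∀ i j → Same (T i) (T j) → i ≡ j) where

      module ∂B (B : Basis gen) (f : DualFeasible c∂ B) = ∂-Basis B (level∂ B f)
      module ∂T (i : Fin t∂) = ∂-Basis (T∂ i) (level∂ (T∂ i) (df∂ i))
      module FT (i : Fin t) = Full-Basis (T i) (level' (T i) (df i))

      co₀-p : ∀ k l → co B₀ k (p l) ≡ δ k l
      co₀-p k l = trans (cong (λ i → co B₀ k (gen i)) (sym (ix₀ l))) (dual B₀ k l)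

      co₀-q : ∀ k → co B₀ k q ≡ 1ℚ
      co₀-q k = trans (fun-q (inv B₀ k)) (trans (Σ-cong (λ l → trans (co₀-p k l) (sym (trans (*-comm (δ k l) 1ℚ) (*-identityˡ (δ k l)))))) (Σ-δ k (λ _ → 1ℚ)))

      separating-p : Separating p
      separating-p = separating-basis B₀ p (λ B k z l → trans (cong (λ i → co B k (gen i)) (ix₀ l)) (z l))

      separating-cons : ∀ {r} (x : Fin (suc d) → ℚ) (X : Fin r → Fin (suc d) → ℚ) → Separating X → Separating (cons x X)
      separating-cons x X sep B k z = sep B k (λ j → z (suc j))

      separating-insert : ∀ {r} (x y : Fin (suc d) → ℚ) (X : Fin r → Fin (suc d) → ℚ) → Separating (cons x X) → Separating (cons x (cons y X))
      separating-insert x y X sep B k z = sep B k (λ { zero → z zero ; (suc j) → z (suc (suc j)) })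

      neg-p : Fin (suc d) → Fin (suc d) → ℚ
      neg-p k j = - p k j

      co-neg : ∀ (B : Basis gen) k j → co B k (neg-p j) ≡ - co B k (p j)
      co-neg B k j = dot-neg (inv B k) (p j)

      separating-neg-p : Separating neg-p
      separating-neg-p B k z = separating-p B k (λ j → trans (sym (neg-involutive (co B k (p j)))) (trans (cong -_ (trans (sym (co-neg B k j)) (z j))) neg-0))

      -- The pyramid entered on leaving q in the direction X. The search can start at `B₀`, where
      -- all coordinates of q are 1.
      exists∂ : ∀ {r} (X : Fin r → Fin (suc d) → ℚ) → Separating (cons q X) → ∃[ i ] LexFeasible (cons q X) (T∂ i)
      exists∂ X sep with lex-optimal-exists c∂ 0≤c∂ (cons q X) sep B₀ (λ k → inj₁ (subst (0ℚ <_) (sym (co₀-q k)) 0<1))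
      ... | B , f , dfB with cover∂ B dfB
      ... | i , s = i , lexfeasible-same {B} {T∂ i} s (cons q X) f

      lex-tail : ∀ i {r} (X : Fin r → Fin (suc d) → ℚ) → LexFeasible (cons q X) (T∂ i) → ∀ l → LexPos (λ j → co (T∂ i) (punchIn (∂T.k₀ i) l) (X j))
      lex-tail i X f l with f (punchIn (∂T.k₀ i) l)
      ... | inj₁ pos = ⊥-elim (<-irrefl refl (subst (0ℚ <_) (∂T.co-q i l) pos))
      ... | inj₂ (_ , lp) = lp

      lex-untail : ∀ i {r} (X : Fin r → Fin (suc d) → ℚ) → (∀ l → LexPos (λ j → co (T∂ i) (punchIn (∂T.k₀ i) l) (X j))) → LexFeasible (cons q X) (T∂ i)
      lex-untail i X f k = go (punchView (∂T.k₀ i) k)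
        where
        go : ∀ {k} → PunchView (∂T.k₀ i) k → LexPos (λ j → co (T∂ i) k (cons q X j))
        go same = inj₁ (subst (0ℚ <_) (sym (∂T.φ-q i)) 0<1)
        go (other l) = inj₂ (∂T.co-q i l , f l)

      -- A feasible start is supplied by the pyramid entered from q in the direction X: its side
      -- coordinates of q vanish, so those of X are positive, and the apex coordinate is positive by
      -- the hypothesis on φ. From there the simplex method optimises `c`.
      exists : ∀ {r} (X : Fin r → Fin (suc d) → ℚ) → Separating X → (∀ i → LexPos (λ j → ∂T.φ i (X j))) → ∃[ i ] LexFeasible X (T i)
      exists X sep h = restart (exists∂ X (separating-cons q X sep))
        where
        relabel : (∃[ B ] (LexFeasible X B × DualFeasible c B)) → ∃[ i ] LexFeasible X (T i)
        relabel (B , f , dfB) = proj₁ (cover B dfB) , lexfeasible-same {B} {T (proj₁ (cover B dfB))} (proj₂ (cover B dfB)) X f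
        restart : (∃[ i ] LexFeasible (cons q X) (T∂ i)) → ∃[ i ] LexFeasible X (T i)
        restart (i , f) = relabel (lex-optimal-exists c 0≤c X sep (T∂ i) (λ k → feasible (punchView (∂T.k₀ i) k)))
          where
          feasible : ∀ {k} → PunchView (∂T.k₀ i) k → LexPos (λ j → co (T∂ i) k (X j))
          feasible same = h i
          feasible (other l) = lex-tail i X f l

      σ : Fin t → Fin (suc d) → Bool
      σ i k = lex-sign (λ j → co (T i) k (p j))

      σ⁻ : Fin t → Fin (suc d) → Bool
      σ⁻ i k = not (σ i k)

      -- Pushing a point of the cone towards `p` keeps it inside: every facet functional is
      -- nonnegative on the point and on `p`, and not zero on all of `p`.
      K→cell : ∀ n y → K n y → ∃[ i ] Cell.InCell (FT.simplex i) (σ i) n y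
      K→cell n y Ky = to-cell (exists (cons (hom n y) p) (separating-cons (hom n y) p separating-p) (λ i → φ-lex i (lex-tri (λ j → ∂T.φ i (cons (hom n y) p j)))))
        where
        φ-lex : ∀ i → LexPos (λ j → ∂T.φ i (cons (hom n y) p j)) ⊎ (∀ j → ∂T.φ i (cons (hom n y) p j) ≡ 0ℚ) ⊎ LexPos (λ j → - ∂T.φ i (cons (hom n y) p j)) →
          LexPos (λ j → ∂T.φ i (cons (hom n y) p j))
        φ-lex i (inj₁ l) = l
        φ-lex i (inj₂ (inj₁ z)) = ⊥-elim (1≢0 (trans (sym (∂T.φ-p-sum i)) (Σ-0 (λ k → z (suc k)))))
        φ-lex i (inj₂ (inj₂ l)) = ⊥-elim (lex-nonneg (λ j → ∂T.φ i (cons (hom n y) p j)) (λ { zero → ∂T.φ-K i Ky ; (suc k) → ∂T.φ-u i (vertex k) }) l)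
        to-cell : (∃[ i ] LexFeasible (cons (hom n y) p) (T i)) → ∃[ i ] Cell.InCell (FT.simplex i) (σ i) n y
        to-cell (i , f) = i , (λ k → lex-sign-nonneg (λ j → co (T i) k (p j)) (f k)) , FT.simplex-supported i n y

      -- An interior point has positive facet functionals, so it may also be pushed in the opposite
      -- direction without leaving the cone.
      I→cell : ∀ n y → I n y → ∃[ i ] Cell.InCell (FT.simplex i) (σ⁻ i) n y
      I→cell n y Iy = to-cell (exists (cons (hom n y) neg-p) (separating-cons (hom n y) neg-p separating-neg-p) (λ i → inj₁ (∂T.φ-I i {n} {y} Iy)))
        where
        opposite : ∀ i {k} → LexPos (λ j → co (T i) k (cons (hom n y) neg-p j)) → 0ℚ < co (T i) k (hom n y) ⊎ (co (T i) k (hom n y) ≡ 0ℚ × LexPos (λ j → - co (T i) k (p j)))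
        opposite i (inj₁ q) = inj₁ q
        opposite i {k} (inj₂ (e , l)) = inj₂ (e , lex-cong (λ j → co-neg (T i) k j) l)
        to-cell : (∃[ i ] LexFeasible (cons (hom n y) neg-p) (T i)) → ∃[ i ] Cell.InCell (FT.simplex i) (σ⁻ i) n y
        to-cell (i , f) = i , (λ k → lex-sign-nonneg-opposite (λ j → co (T i) k (p j)) (opposite i (f k))) , FT.simplex-supported i n y

      cell→K : ∀ n y i → Cell.InCell (FT.simplex i) (σ i) n y → K n y
      cell→K n y i (nn , _) = FT.cone-nonneg i (hom n y) (λ k → nonneg-≤ (σ i k) (nn k))

      lexfeasible+ : ∀ n y i → Cell.InCell (FT.simplex i) (σ i) n y → LexFeasible (cons (hom n y) p) (T i)
      lexfeasible+ n y i (nn , _) k = nonneg-lex-sign (λ j → co (T i) k (p j)) (nn k)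

      lexfeasible⁻ : ∀ n y i → Cell.InCell (FT.simplex i) (σ⁻ i) n y → LexFeasible (cons (hom n y) neg-p) (T i)
      lexfeasible⁻ n y i (nn , _) k = back (nonneg-lex-sign-opposite (λ j → co (T i) k (p j)) (separating-p (T i) k) (nn k))
        where
        back : 0ℚ < co (T i) k (hom n y) ⊎ (co (T i) k (hom n y) ≡ 0ℚ × LexPos (λ j → - co (T i) k (p j))) → LexPos (λ j → co (T i) k (cons (hom n y) neg-p j))
        back (inj₁ q) = inj₁ q
        back (inj₂ (e , l)) = inj₂ (e , lex-cong (λ j → sym (co-neg (T i) k j)) l)

      -- The weights of a realised perturbation along -`p` are precisely the combination of `p` that
      -- `I` asks to be subtracted.
      cell→I : ∀ n y i → Cell.InCell (FT.simplex i) (σ⁻ i) n y → I n y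
      cell→I n y i ic = witness (perturb (cons (hom n y) neg-p))
        where
        opaque
          unfolding _+_
          lem : ∀ a b → a * (- b) ≡ - (a * b)
          lem = solve-∀ ringℚ
        witness : Perturbed (cons (hom n y) neg-p) → I n y
        witness (ω , 0<ω , pos , _) = ω zero , (λ j → ω (suc j)) , 0<ω zero , (λ j → 0<ω (suc j)) ,
          cone-resp eq (FT.cone-nonneg i (combination ω (cons (hom n y) neg-p)) (λ k → <⇒≤ (pos (T i) k (lexfeasible⁻ n y i ic k))))
          where
          eq : ∀ j → combination ω (cons (hom n y) neg-p) j ≡ ω zero * hom n y j - sum (λ k → ω (suc k) * p k j)
          eq j = trans (sum-suc (λ k → ω k * cons (hom n y) neg-p k j)) (cong (ω zero * hom n y j +_) (trans (Σ-cong (λ k → lem (ω (suc k)) (p k j))) (Σ-neg _)))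

      I→K : ∀ n y → I n y → K n y
      I→K n y (ω₀ , ω , 0<ω₀ , 0<ω , cy) = cone-resp eq (cone-Σ a x a-nonneg x-cone)
        where
        a : Fin 2 → ℚ
        a zero = recip ω₀
        a (suc _) = recip ω₀
        x : Fin 2 → Fin (suc d) → ℚ
        x zero i = ω₀ * hom n y i - sum (λ j → ω j * p j i)
        x (suc _) i = sum (λ j → ω j * p j i)
        a-nonneg : ∀ k → 0ℚ ≤ a k
        a-nonneg zero = <⇒≤ (recip-pos 0<ω₀)
        a-nonneg (suc _) = <⇒≤ (recip-pos 0<ω₀)
        x-cone : ∀ k → Cone (x k)
        x-cone zero = cy
        x-cone (suc _) = cone-Σ ω p (λ j → <⇒≤ (0<ω j)) (λ j → cone-gen (vertex j))
        opaque
          unfolding _+_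
          lem : ∀ r w h s → r * (w * h - s) + (r * s + 0ℚ) ≡ (w * r) * h
          lem = solve-∀ ringℚ
        eq : ∀ j → sum (λ k → a k * x k j) ≡ hom n y j
        eq j = trans (trans (sum-suc (λ k → a k * x k j)) (cong (a zero * x zero j +_) (trans (sum-suc (λ k → a (suc k) * x (suc k) j)) (cong (a (suc zero) * x (suc zero) j +_) (sum-zero (λ k → a (suc (suc k)) * x (suc (suc k)) j))))))
          (trans (lem (recip ω₀) ω₀ (hom n y j) _) (trans (cong (_* hom n y j) (*-recip (>⇒≢ 0<ω₀))) (*-identityˡ (hom n y j))))

      module Boundary (w : Fin d → Fin (suc d) → ℚ) (sep-w : Separating (cons q w)) where
        σ∂ : Fin t∂ → Fin d → Bool
        σ∂ i l = lex-sign (λ j → co (T∂ i) (punchIn (∂T.k₀ i) l) (w j))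

        locate : ∀ n y → ∃[ i ] (∀ l → LexPos (λ j → co (T∂ i) (punchIn (∂T.k₀ i) l) (cons (hom n y) w j)))
        locate n y = strip (exists∂ (cons (hom n y) w) (separating-insert q (hom n y) w sep-w))
          where
          strip : (∃[ i ] LexFeasible (cons q (cons (hom n y) w)) (T∂ i)) → ∃[ i ] (∀ l → LexPos (λ j → co (T∂ i) (punchIn (∂T.k₀ i) l) (cons (hom n y) w j)))
          strip (i , f) = i , lex-tail i (cons (hom n y) w) f

        -- The pyramid entered from q in the direction of y, with ties broken by `w`, contains y. A
        -- positive coordinate of q there makes y interior; coordinate zero places it in the
        -- boundary simplex.
        I⊎cell : ∀ n y → K n y → I n y ⊎ ∃[ i ] Cell.InCell (∂T.facet i) (σ∂ i) n y
        I⊎cell n y Ky = split (locate n y)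
          where
          split : (∃[ i ] (∀ l → LexPos (λ j → co (T∂ i) (punchIn (∂T.k₀ i) l) (cons (hom n y) w j)))) → I n y ⊎ ∃[ i ] Cell.InCell (∂T.facet i) (σ∂ i) n y
          split (i , f) = by-φ (0ℚ <? ∂T.φ i (hom n y))
            where
            by-φ : Dec (0ℚ < ∂T.φ i (hom n y)) → I n y ⊎ ∃[ i ] Cell.InCell (∂T.facet i) (σ∂ i) n y
            by-φ (yes 0<φ) = inj₁ (∂T.interior i {n} {y} (λ l → lex-head {z = λ j → co (T∂ i) (punchIn (∂T.k₀ i) l) (cons (hom n y) w j)} (f l)) 0<φ)
            by-φ (no ¬0<φ) = inj₂ (i , (λ l → lex-sign-nonneg (λ j → co (T∂ i) (punchIn (∂T.k₀ i) l) (w j)) (f l)) , ∂T.facet-supported i {n} {y} (≤-antisym (≮⇒≥ ¬0<φ) (∂T.φ-K i Ky)))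

        cell→Bd : ∀ n y i → Cell.InCell (∂T.facet i) (σ∂ i) n y → Bd n y
        cell→Bd n y i (nn , sup) = cone-resp sup (cone-Σ (Cell.coord (∂T.facet i) n y) (λ l → hom 1 (Cell.vs (∂T.facet i) l)) (λ l → nonneg-≤ (σ∂ i l) (nn l)) (λ l → cone-gen _)) ,
          λ Iy → <-irrefl refl (subst (0ℚ <_) (∂T.supported-facet i {n} {y} sup) (∂T.φ-I i {n} {y} Iy))

        unique∂ : ∀ i j n y → Cell.InCell (∂T.facet i) (σ∂ i) n y → Cell.InCell (∂T.facet j) (σ∂ j) n y → i ≡ j
        unique∂ i j n y (nn , _) (nn' , _) = distinct∂ i j (lex-optimal-same {c∂} generic∂ {T∂ i} {T∂ j} (df∂ i) (df∂ j) (cons q (cons (hom n y) w))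
          (lex-untail i (cons (hom n y) w) (λ l → nonneg-lex-sign (λ j → co (T∂ i) (punchIn (∂T.k₀ i) l) (w j)) (nn l)))
          (lex-untail j (cons (hom n y) w) (λ l → nonneg-lex-sign (λ k → co (T∂ j) (punchIn (∂T.k₀ j) l) (w k)) (nn' l))))

        a : Fin t∂ → ℕ → ℕ
        a i j = proj₁ (Cell.card-box (∂T.facet i) (σ∂ i) j)

        A : ℕ → ℕ
        A j = sumℕ (λ i → a i j)

        card-Bd : ∀ n → Card (Bd n) (Sⁿ d A n)
        card-Bd n = subst (Card (Bd n)) (Sⁿ-sumℕ d a n) (card-resp (λ { y (i , ic) → cell→Bd n y i ic })
          (λ { y (Ky , ¬Iy) → Data.Sum.[ (λ Iy → ⊥-elim (¬Iy Iy)) , (λ x → x) ]′ (I⊎cell n y Ky) })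
          (card-⋃ (λ i → Cell.card-cell (∂T.facet i) (σ∂ i) (λ j → proj₂ (Cell.card-box (∂T.facet i) (σ∂ i) j)) n) (λ i j y → unique∂ i j n y)))

      b : Fin t → ℕ → ℕ
      b i j = proj₁ (Cell.card-box (FT.simplex i) (σ i) j)

      card-b : ∀ i j → Card (Cell.Box (FT.simplex i) (σ i) j) (b i j)
      card-b i j = proj₂ (Cell.card-box (FT.simplex i) (σ i) j)

      b⁻ : Fin t → ℕ → ℕ
      b⁻ i j = proj₁ (Cell.card-box (FT.simplex i) (σ⁻ i) j)

      card-b⁻ : ∀ i j → Card (Cell.Box (FT.simplex i) (σ⁻ i) j) (b⁻ i j)
      card-b⁻ i j = proj₂ (Cell.card-box (FT.simplex i) (σ⁻ i) j)

      H H⁻ : ℕ → ℕ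
      H j  = sumℕ (λ i → b i j)
      H⁻ j = sumℕ (λ i → b⁻ i j)

      card-K : ∀ n → Card (K n) (Sⁿ (suc d) H n)
      card-K n = subst (Card (K n)) (Sⁿ-sumℕ (suc d) b n) (card-resp (λ { y (i , ic) → cell→K n y i ic }) (λ y → K→cell n y)
        (card-⋃ (λ i → Cell.card-cell (FT.simplex i) (σ i) (card-b i) n)
          (λ i j y ic jc → distinct i j (lex-optimal-same {c} generic {T i} {T j} (df i) (df j) (cons (hom n y) p) (lexfeasible+ n y i ic) (lexfeasible+ n y j jc)))))

      card-I : ∀ n → Card (I n) (Sⁿ (suc d) H⁻ n)
      card-I n = subst (Card (I n)) (Sⁿ-sumℕ (suc d) b⁻ n) (card-resp (λ { y (i , ic) → cell→I n y i ic }) (λ y → I→cell n y)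
        (card-⋃ (λ i → Cell.card-cell (FT.simplex i) (σ⁻ i) (card-b⁻ i) n)
          (λ i j y ic jc → distinct i j (lex-optimal-same {c} generic {T i} {T j} (df i) (df j) (cons (hom n y) neg-p) (lexfeasible⁻ n y i ic) (lexfeasible⁻ n y j jc)))))

      -- Ehrhart reciprocity, cell by cell: the two perturbations open complementary sets of sides.
      H⁻-reverse : ∀ j → j ℕ.≤ suc d → H⁻ j ≡ H (suc d ℕ.∸ j)
      H⁻-reverse j l = sumℕ-cong (λ i → sym (card-unique
        (subst (λ k → Card (Cell.Box (FT.simplex i) (σ⁻ i) k) (b i (suc d ℕ.∸ j))) (ℕₚ.m∸[m∸n]≡n l)
          (Cell.card-box-flip (FT.simplex i) (σ i) (ℕₚ.m∸n≤m (suc d) j) (card-b i (suc d ℕ.∸ j))))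
        (card-b⁻ i j)))

      H-high : ∀ j → suc (suc d) ℕ.≤ j → H j ≡ 0
      H-high j l = sumℕ-0 (λ i → card-unique (card-b i j) (card-0 (λ y by → ℕₚ.<⇒≱ l (Cell.box-height (FT.simplex i) (σ i) by))))

      H0≡1 : H 0 ≡ 1
      H0≡1 = trans (sym (Sⁿ-at-0 (suc d) H)) (card-unique (card-K 0) (card-1 (Vec.replicate d (posℤ 0)) origin only))
        where
        hom0 : ∀ j → hom {d} 0 (Vec.replicate d (posℤ 0)) j ≡ 0ℚ
        hom0 zero    = ⟦0⟧
        hom0 (suc j) = trans (cong ⟦_⟧ (Vecₚ.lookup-replicate j (posℤ 0))) ⟦0⟧
        origin : K 0 (Vec.replicate d (posℤ 0))
        origin = (λ _ → 0ℚ) , (λ _ → ≤-refl) , (λ j → trans (hom0 j) (sym (Σ-0 (λ i → zeroˡ (u i j)))))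
        only : ∀ y → K 0 y → y ≡ Vec.replicate d (posℤ 0)
        only y (c , 0≤c , e) = hom-injective {m = 0} {0} (λ j → trans (e j) (trans (Σ-0 (λ i → trans (cong (_* u i j) (c0 i)) (zeroˡ (u i j)))) (sym (hom0 j))))
          where
          c0 : ∀ i → c i ≡ 0ℚ
          c0 i = Σ-term0 0≤c (≤-reflexive (trans (Σ-cong (λ i → sym (trans (cong (c i *_) ⟦1⟧) (trans (*-comm (c i) 1ℚ) (*-identityˡ (c i)))))) (trans (sym (e zero)) ⟦0⟧))) i

      H⁻0≡0 : H⁻ 0 ≡ 0
      H⁻0≡0 = trans (sym (Sⁿ-at-0 (suc d) H⁻)) (card-unique (card-I 0) (card-0 none))
        where
        none : ∀ y → ¬ I 0 y
        none y (ω₀ , ω , 0<ω₀ , 0<ω , c , 0≤c , e) = <-irrefl refl (≤-<-trans (subst (0ℚ ≤_) (sym (e zero)) (Σ-nonneg (λ i → 0≤* (0≤c i) (⟦⟧ℕ-nonneg 1))))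
          (subst (_< 0ℚ) (sym eq) (neg<0 (Σ-pos (λ j → 0≤* (<⇒≤ (0<ω j)) (⟦⟧ℕ-nonneg 1)) zero (0<* (0<ω zero) (⟦⟧ℕ-pos ℕₚ.≤-refl))))))
          where
          eq : ω₀ * ⟦ 0 ⟧ℕ - sum (λ j → ω j * p j zero) ≡ - sum (λ j → ω j * p j zero)
          eq = trans (cong (_- sum (λ j → ω j * p j zero)) (trans (cong (ω₀ *_) ⟦0⟧) (zeroʳ ω₀))) (+-identityˡ _)

      -- For the perturbation of q along the vertices of a fixed boundary cell B*, every number of open sides occurs: reflect the last d − e of these vertices.
      module Corners (i* : Fin t∂) where
        B* : Basis gen
        B* = T∂ i*

        k* : Fin (suc d)
        k* = ∂T.k₀ i*

        w : Fin d → Fin (suc d) → ℚ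
        w l = gen (ix B* (punchIn k* l))

        separating-w : Separating (cons q w)
        separating-w = separating-basis B* (cons q w) (λ B k z l → go B k z (punchView k* l))
          where
          go : ∀ (B : Basis gen) k → (∀ j → co B k (cons q w j) ≡ 0ℚ) → ∀ {l} → PunchView k* l → co B k (gen (ix B* l)) ≡ 0ℚ
          go B k z same = trans (cong (λ i → co B k (gen i)) (∂T.ix-k₀ i*)) (z zero)
          go B k z (other l) = z (suc l)

        open Boundary w separating-w

        module Threshold (e : ℕ) (e≤d : e ℕ.≤ d) where
          reflect truncate : ∀ (l : Fin d) → Dec (toℕ l ℕ.< e) → Fin (suc d) → ℚ
          reflect l (yes _) = w l
          reflect l (no _)  = λ j → - w l j
          truncate l (yes _) = w l
          truncate l (no _)  = λ _ → 0ℚ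

          R Tr : Fin d → Fin (suc d) → ℚ
          R l = reflect l (toℕ l ℕₚ.<? e)
          Tr l = truncate l (toℕ l ℕₚ.<? e)

          co-R : ∀ (B : Basis gen) k l → (D : Dec (toℕ l ℕ.< e)) → (toℕ l ℕ.< e × co B k (reflect l D) ≡ co B k (w l)) ⊎ ((toℕ l ℕ.< e → ⊥) × co B k (reflect l D) ≡ - co B k (w l))
          co-R B k l (yes p) = inj₁ (p , refl)
          co-R B k l (no ¬p) = inj₂ (¬p , dot-neg (inv B k) (w l))

          separating-R : Separating (cons q R)
          separating-R B k z = separating-w B k (λ { zero → z zero ; (suc l) → go l (co-R B k l (toℕ l ℕₚ.<? e)) })
            where
            go : ∀ l → _ → co B k (w l) ≡ 0ℚ
            go l (inj₁ (_ , e')) = trans (sym e') (z (suc l))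
            go l (inj₂ (_ , e')) = trans (sym (neg-involutive _)) (trans (cong -_ (trans (sym e') (z (suc l)))) neg-0)

        module Reflected (e : ℕ) (e≤d : e ℕ.≤ d) (i' : Fin t∂) (feasible' : LexFeasible (cons q (Threshold.R e e≤d)) (T∂ i')) where
          open Threshold e e≤d

          B' : Basis gen
          B' = T∂ i'

          k' : Fin (suc d)
          k' = ∂T.k₀ i'

          -- Truncation destroys positivity only by cutting off the deciding entry, and all entries
          -- before that one are zero.
          truncated-nonneg : ∀ {r} (z z' : Fin r → ℚ) (e : ℕ) → (∀ j → toℕ j ℕ.< e → z' j ≡ z j) → (∀ j → ¬ toℕ j ℕ.< e → z' j ≡ 0ℚ) → LexPos z → LexPos z' ⊎ (∀ j → z' j ≡ 0ℚ)
          truncated-nonneg {suc r} z z' zero p p0 l = inj₂ (λ j → p0 j (λ ()))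
          truncated-nonneg {suc r} z z' (suc e) p p0 (inj₁ q) = inj₁ (inj₁ (subst (0ℚ <_) (sym (p zero (ℕ.s≤s ℕ.z≤n))) q))
          truncated-nonneg {suc r} z z' (suc e) p p0 (inj₂ (z0 , l)) with truncated-nonneg (λ j → z (suc j)) (λ j → z' (suc j)) e (λ j q → p (suc j) (ℕ.s≤s q)) (λ j q → p0 (suc j) (λ { (ℕ.s≤s q') → q q' })) l
          ... | inj₁ l' = inj₁ (inj₂ (trans (p zero (ℕ.s≤s ℕ.z≤n)) z0 , l'))
          ... | inj₂ zr = inj₂ (λ { zero → trans (p zero (ℕ.s≤s ℕ.z≤n)) z0 ; (suc j) → zr j })

          co-truncate : ∀ (B : Basis gen) k l → (D : Dec (toℕ l ℕ.< e)) → (toℕ l ℕ.< e → co B k (truncate l D) ≡ co B k (w l)) × (¬ toℕ l ℕ.< e → co B k (truncate l D) ≡ 0ℚ)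
          co-truncate B k l (yes p) = (λ _ → refl) , (λ ¬p → ⊥-elim (¬p p))
          co-truncate B k l (no ¬p) = (λ p → ⊥-elim (¬p p)) , (λ _ → dot-0 (inv B k) (λ _ → refl))

          co-Tr-R : ∀ (B : Basis gen) k l → toℕ l ℕ.< e → co B k (Tr l) ≡ co B k (R l)
          co-Tr-R B k l q = go (co-R B k l (toℕ l ℕₚ.<? e))
            where
            go : (toℕ l ℕ.< e × co B k (R l) ≡ co B k (w l)) ⊎ ((toℕ l ℕ.< e → ⊥) × co B k (R l) ≡ - co B k (w l)) → co B k (Tr l) ≡ co B k (R l)
            go (inj₁ (_ , e')) = trans (proj₁ (co-truncate B k l (toℕ l ℕₚ.<? e)) q) (sym e')
            go (inj₂ (¬q , _)) = ⊥-elim (¬q q)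

          co*-w : ∀ k l → co B* (punchIn k* k) (w l) ≡ δ (punchIn k* k) (punchIn k* l)
          co*-w k l = dual B* (punchIn k* k) (punchIn k* l)

          -- x₀ lies in the relative interior of the cone over q and the first e vertices.
          shared : ∀ l → toℕ l ℕ.< e → ∃[ k ] ix B* (punchIn k* l) ≡ ix B' k
          shared l l<e = from-perturbation (perturb (cons q Tr))
            where
            from-perturbation : Perturbed (cons q Tr) → ∃[ k ] ix B* (punchIn k* l) ≡ ix B' k
            -- `x₀` belongs to both closed cells and has a positive coordinate at this vertex of
            -- `B*`; complementary slackness gives the vertex reduced cost zero in `B'`, and
            -- genericity puts it into `B'`.
            from-perturbation (ω , 0<ω , pos , _) = generic∂ B' _ (complementary-slackness {c∂} {B'} {B*} (df∂ i') (df∂ i*) x₀ nonneg' nonneg* (punchIn k* l) positive*)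
              where
              x₀ : Fin (suc d) → ℚ
              x₀ = combination ω (cons q Tr)
              from-lex : ∀ (B : Basis gen) k → LexPos (λ j → co B k (cons q Tr j)) ⊎ (∀ j → co B k (cons q Tr j) ≡ 0ℚ) → 0ℚ ≤ co B k x₀
              from-lex B k (inj₁ lp) = <⇒≤ (pos B k lp)
              from-lex B k (inj₂ zr) = ≤-reflexive (sym (trans (co-combination B k ω (cons q Tr)) (trans (dot-comm (λ j → co B k (cons q Tr j)) ω) (dot-0 ω zr))))
              nonneg' : ∀ k → 0ℚ ≤ co B' k x₀
              nonneg' k = from-lex B' k (truncated-nonneg (λ j → co B' k (cons q R j)) (λ j → co B' k (cons q Tr j)) (suc e)
                (λ { zero _ → refl ; (suc l) (ℕ.s≤s q) → co-Tr-R B' k l q }) (λ { zero ¬q → ⊥-elim (¬q (ℕ.s≤s ℕ.z≤n)) ; (suc l) ¬q → proj₂ (co-truncate B' k l (toℕ l ℕₚ.<? e)) (λ q → ¬q (ℕ.s≤s q)) }) (feasible' k))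
              entry : ∀ k j → 0ℚ ≤ co B* (punchIn k* k) (cons q Tr j)
              entry k zero = ≤-reflexive (sym (∂T.co-q i* k))
              entry k (suc l) = by (toℕ l ℕₚ.<? e)
                where
                by : (D : Dec (toℕ l ℕ.< e)) → 0ℚ ≤ co B* (punchIn k* k) (truncate l D)
                by (yes q) = subst (0ℚ ≤_) (sym (co*-w k l)) (δ-nonneg (punchIn k* k) (punchIn k* l))
                by (no ¬q) = ≤-reflexive (sym (dot-0 (inv B* (punchIn k* k)) (λ _ → refl)))
              nonneg* : ∀ k → 0ℚ ≤ co B* k x₀
              nonneg* k = go (punchView k* k)
                where
                go : ∀ {k} → PunchView k* k → 0ℚ ≤ co B* k x₀
                go same = <⇒≤ (pos B* k* (inj₁ (subst (0ℚ <_) (sym (∂T.φ-q i*)) 0<1)))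
                go (other l) = subst (0ℚ ≤_) (sym (co-combination B* (punchIn k* l) ω (cons q Tr))) (Σ-nonneg (λ j → 0≤* (entry l j) (<⇒≤ (0<ω j))))
              positive* : 0ℚ < co B* (punchIn k* l) x₀
              positive* = pos B* (punchIn k* l) (lex-nonneg-pos (λ j → co B* (punchIn k* l) (cons q Tr j)) (entry l) (suc l) (subst (0ℚ <_) (sym (trans (proj₁ (co-truncate B* (punchIn k* l) l (toℕ l ℕₚ.<? e)) l<e) (trans (co*-w l l) (δ-refl (punchIn k* l))))) 0<1))

          position : ∀ l → toℕ l ℕ.< e → ∃[ k ] ix B* (punchIn k* l) ≡ ix B' (punchIn k' k)
          position l l<e = go (punchView k' (proj₁ (shared l l<e))) (proj₂ (shared l l<e))
            where
            go : ∀ {k} → PunchView k' k → ix B* (punchIn k* l) ≡ ix B' k → ∃[ k ] ix B* (punchIn k* l) ≡ ix B' (punchIn k' k)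
            go same e' = ⊥-elim (suc≢zero (proj₂ (∂T.others i* l)) (trans e' (∂T.ix-k₀ i')))
            go (other k) e' = k , e'

          co'-w : ∀ l (l<e : toℕ l ℕ.< e) k → co B' (punchIn k' k) (w l) ≡ δ (punchIn k' k) (punchIn k' (proj₁ (position l l<e)))
          co'-w l l<e k = trans (cong (λ i → co B' (punchIn k' k) (gen i)) (proj₂ (position l l<e))) (dual B' (punchIn k' k) (punchIn k' (proj₁ (position l l<e))))

          true-lex : ∀ {r} (z : Fin r → ℚ) → lex-sign z ≡ true → LexPos z
          true-lex z eq with lexPos? z
          true-lex z eq | yes lp = lp
          true-lex z () | no _

          lex-true : ∀ {r} (z : Fin r → ℚ) → LexPos z → lex-sign z ≡ true
          lex-true z lp with lexPos? z
          ... | yes _ = refl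
          ... | no ¬lp = ⊥-elim (¬lp lp)

          -- At a shared vertex the leading e entries of the perturbation are zeros and a one, which
          -- decides the sign before any unshared vertex matters.
          closed : ∀ l (l<e : toℕ l ℕ.< e) → σ∂ i' (proj₁ (position l l<e)) ≡ true
          closed l l<e = lex-true (λ j → co B' (punchIn k' (proj₁ (position l l<e))) (w j)) (lex-prefix (λ j → co B' (punchIn k' (proj₁ (position l l<e))) (w j)) e (λ j q → subst (0ℚ ≤_) (sym (co'-w j q (proj₁ (position l l<e)))) (δ-nonneg (punchIn k' (proj₁ (position l l<e))) (punchIn k' (proj₁ (position j q))))) l l<e
                          (subst (0ℚ <_) (sym (trans (co'-w l l<e (proj₁ (position l l<e))) (δ-refl (punchIn k' (proj₁ (position l l<e)))))) 0<1))

          -- At any other side the leading e entries vanish, so the reflected perturbation coincides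
          -- there with -`w`; it is lexicographically positive by feasibility, hence `w` is not.
          closed-only : ∀ k → σ∂ i' k ≡ true → ∃[ l ] Σ (toℕ l ℕ.< e) (λ l<e → proj₁ (position l l<e) ≡ k)
          closed-only k eq = search (Finₚ.any? (λ (l : Fin d) → hit l (toℕ l ℕₚ.<? e)))
            where
            hit : ∀ l → Dec (toℕ l ℕ.< e) → Dec (Σ (toℕ l ℕ.< e) (λ l<e → proj₁ (position l l<e) ≡ k))
            hit l (no ¬q) = no (λ { (q , _) → ¬q q })
            hit l (yes q) = Relation.Nullary.map′ (λ e' → q , e') (λ { (q' , e') → trans (cong (λ q → proj₁ (position l q)) (ℕₚ.<-irrelevant q q')) e' }) (proj₁ (position l q) Finₚ.≟ k)
            search : Dec (∃[ l ] Σ (toℕ l ℕ.< e) (λ l<e → proj₁ (position l l<e) ≡ k)) → ∃[ l ] Σ (toℕ l ℕ.< e) (λ l<e → proj₁ (position l l<e) ≡ k)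
            search (yes found) = found
            search (no none) = ⊥-elim (lex-asym (true-lex (λ j → co B' (punchIn k' k) (w j)) eq) (lex-cong (λ l → go l (co-R B' (punchIn k' k) l (toℕ l ℕₚ.<? e))) (lex-tail i' R feasible' k)))
              where
              go : ∀ l → (toℕ l ℕ.< e × co B' (punchIn k' k) (R l) ≡ co B' (punchIn k' k) (w l)) ⊎ ((toℕ l ℕ.< e → ⊥) × co B' (punchIn k' k) (R l) ≡ - co B' (punchIn k' k) (w l)) →
                co B' (punchIn k' k) (R l) ≡ - co B' (punchIn k' k) (w l)
              go l (inj₂ (_ , e')) = e'
              go l (inj₁ (q , e')) = trans e' (trans zero' (sym (trans (cong -_ zero') neg-0)))
                where
                zero' : co B' (punchIn k' k) (w l) ≡ 0ℚ
                zero' = trans (co'-w l q k) (δ-≢ (λ e'' → none (l , q , sym (Finₚ.punchIn-injective k' _ _ e''))))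

          open-count : sumℕ (λ k → if σ∂ i' k then 0 else 1) ≡ d ℕ.∸ e
          open-count = ℕₚ.+-cancelˡ-≡ e _ _ (trans (cong (ℕ._+ sumℕ (λ k → if σ∂ i' k then 0 else 1)) (card-unique cardσ (card-true (σ∂ i')))) (trans (true+false (σ∂ i')) (sym (ℕₚ.m+[n∸m]≡n e≤d))))
            where
            choose : ∀ l → Dec (toℕ l ℕ.< e) → Fin d
            choose l (yes q) = proj₁ (position l q)
            choose l (no _)  = l
            f : Fin d → Fin d
            f l = choose l (toℕ l ℕₚ.<? e)
            f≡ : ∀ l q → f l ≡ proj₁ (position l q)
            f≡ l q = go (toℕ l ℕₚ.<? e)
              where
              go : (D : Dec (toℕ l ℕ.< e)) → choose l D ≡ proj₁ (position l q)
              go (yes q') = cong (λ q → proj₁ (position l q)) (ℕₚ.<-irrelevant q' q)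
              go (no ¬q) = ⊥-elim (¬q q)
            cardσ : Card (λ k → σ∂ i' k ≡ true) e
            cardσ = card-bij (card-initial e e≤d) f
              (λ l l' q q' eq → Finₚ.punchIn-injective k* l l' (ix-injective B* (trans (proj₂ (position l q)) (trans (cong (λ k → ix B' (punchIn k' k)) (trans (sym (f≡ l q)) (trans eq (f≡ l' q')))) (sym (proj₂ (position l' q')))))))
              (λ l q → trans (cong (σ∂ i') (f≡ l q)) (closed l q))
              (λ k eq → let l , q , e' = closed-only k eq in l , q , trans (f≡ l q) e')

          A-pos' : 1 ℕ.≤ A (d ℕ.∸ e)
          A-pos' = ℕₚ.≤-trans (subst (λ j → 1 ℕ.≤ a i' j) open-count (Cell.card-box-corner (∂T.facet i') (σ∂ i') (proj₂ (Cell.card-box (∂T.facet i') (σ∂ i') _)))) (sumℕ-≥ (λ i → a i (d ℕ.∸ e)) i')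

        A-at : ∀ e → e ℕ.≤ d → 1 ℕ.≤ A (d ℕ.∸ e)
        A-at e e≤d = go (exists∂ (Threshold.R e e≤d) (Threshold.separating-R e e≤d))
          where
          go : (∃[ i ] LexFeasible (cons q (Threshold.R e e≤d)) (T∂ i)) → 1 ℕ.≤ A (d ℕ.∸ e)
          go (i , f) = Reflected.A-pos' e e≤d i f

        -- Splitting the points of the cone into interior and boundary ones gives the equation after
        -- d further summations; `Sⁿ d` is injective and can be cancelled.
        relation : ∀ j → S H j ≡ S H⁻ j ℕ.+ A j
        relation = Sⁿ-injective d _ _ (λ n → trans (sym (Sⁿ-S d H n)) (trans (card-unique (card-K n) (split n)) (trans (cong (ℕ._+ Sⁿ d A n) (Sⁿ-S d H⁻ n)) (sym (Sⁿ-+ d (S H⁻) A n)))))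
          where
          split : ∀ n → Card (K n) (Sⁿ (suc d) H⁻ n ℕ.+ Sⁿ d A n)
          split n = card-resp (λ { y (inj₁ Iy) → I→K n y Iy ; y (inj₂ (Ky , _)) → Ky })
            (λ y Ky → Data.Sum.[ inj₁ , (λ { (i , ic) → inj₂ (cell→Bd n y i ic) }) ]′ (I⊎cell n y Ky))
            (card-⊎ (card-I n) (card-Bd n) (λ { y Iy (_ , ¬Iy) → ¬Iy Iy }))

        hstar : HStar {d} (λ n k → Card (K n) k)
        hstar = record
          { H = H ; A = A ; H-0 = H0≡1
          -- The boundary case j = d + 1 is reciprocity: `H` at d + 1 equals `H⁻` at 0, and no
          -- interior point has height 0.
          ; H-above = λ j l → Data.Sum.[ H-high j , (λ { refl → trans (sym (H⁻-reverse 0 ℕ.z≤n)) H⁻0≡0 }) ]′ (ℕₚ.m≤n⇒m<n∨m≡n l)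
          ; A-pos = λ j l → subst (λ k → 1 ℕ.≤ A k) (ℕₚ.m∸[m∸n]≡n l) (A-at (d ℕ.∸ j) (ℕₚ.m∸n≤m d j))
          ; H-A = λ j l → trans (relation j) (cong (ℕ._+ A j) (S-cong j (λ i i≤j → H⁻-reverse i (ℕₚ.≤-trans i≤j (ℕₚ.m≤n⇒m≤1+n l)))))
          ; count = card-K }

      result : HStar {d} (λ n k → Card (K n) k)
      result = Corners.hstar (proj₁ (exists∂ p (separating-cons q p separating-p)))

    hstar-vector : HStar {d} (λ n k → Card (K n) k)
    hstar-vector with generic-cost level-∂ level-∂-nonneg | generic-cost level level-nonneg
    ... | c∂ , 0≤c∂ , g∂ , l∂ | c , 0≤c , g , l with cells c∂ | cells c
    ... | t∂ , T∂ , df∂ , cover∂ , dist∂ | t , T , df , cover , dist =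
      Counting.result c∂ 0≤c∂ g∂ l∂ c 0≤c g l t∂ T∂ df∂ cover∂ dist∂ t T df cover dist

  module _ {d : ℕ} (V : List (Point d)) (spn : Spanning V) where
    open Polytope V spn

    private
      opaque
        unfolding _+_ ⟦_⟧
        dilate≡ : ∀ {k} n (l : Fin k → ℚ) (z : Fin k → ℤ) → ℕ→ℚ n ℚ.* Σℚ (λ i → l i ℚ.* ℤ→ℚ (z i)) ≡ ⟦ n ⟧ℕ * sum (λ i → l i * ⟦ z i ⟧)
        dilate≡ n l z = cong (λ s → ℕ→ℚ n ℚ.* s) (sym (sum≡Σℚ (λ i → l i * ⟦ z i ⟧)))

    K→InDilate : ∀ n y → 1 ℕ.≤ n → K n y → InDilate V n y
    K→InDilate n y 1≤n (c , 0≤c , e) = (λ i → r * c i) , (λ i → 0≤* (<⇒≤ (recip-pos 0<n)) (0≤c i)) ,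
      trans (sym (sum≡Σℚ (λ i → r * c i))) (trans (Σ-* r c) (trans (cong (r *_) height) (trans (*-comm r ⟦ n ⟧ℕ) nr))) ,
      λ j → trans (dilate≡ n (λ i → r * c i) (λ i → lookup (List.lookup V i) j)) (trans (cong (⟦ n ⟧ℕ *_) (trans (Σ-cong (λ i → *-assoc r (c i) _)) (trans (Σ-* r _) (cong (r *_) (sym (e (suc j)))))))
        (trans (sym (*-assoc ⟦ n ⟧ℕ r _)) (trans (cong (_* ⟦ lookup y j ⟧) nr) (trans (*-identityˡ _) (⟦⟧-ℚ (lookup y j))))))
      where
      r = recip ⟦ n ⟧ℕ
      0<n : 0ℚ < ⟦ n ⟧ℕ
      0<n = ⟦⟧ℕ-pos 1≤n
      nr : ⟦ n ⟧ℕ * r ≡ 1ℚ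
      nr = *-recip (>⇒≢ 0<n)
      height : sum c ≡ ⟦ n ⟧ℕ
      height = trans (Σ-cong (λ i → sym (trans (cong (c i *_) ⟦1⟧) (trans (*-comm (c i) 1ℚ) (*-identityˡ (c i)))))) (sym (e zero))

    InDilate→K : ∀ n y → InDilate V n y → K n y
    InDilate→K n y (l , 0≤l , s , e) = (λ i → ⟦ n ⟧ℕ * l i) , (λ i → 0≤* (⟦⟧ℕ-nonneg n) (0≤l i)) , λ where
      zero → sym (trans (Σ-cong (λ i → trans (cong (⟦ n ⟧ℕ * l i *_) ⟦1⟧) (trans (*-comm _ 1ℚ) (*-identityˡ _)))) (trans (Σ-* ⟦ n ⟧ℕ l) (trans (cong (⟦ n ⟧ℕ *_) (trans (sum≡Σℚ l) s)) (trans (*-comm _ 1ℚ) (*-identityˡ _)))))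
      (suc j) → sym (trans (Σ-cong (λ i → *-assoc ⟦ n ⟧ℕ (l i) _)) (trans (Σ-* ⟦ n ⟧ℕ _) (trans (sym (dilate≡ n l (λ i → lookup (List.lookup V i) j))) (trans (e j) (sym (⟦⟧-ℚ (lookup y j)))))))

  lattice-count : ∀ {d} (V : List (Point d)) → FullDimensional V → HStar {d} (λ n k → 1 ℕ.≤ n → LatticeCount V n k)
  lattice-count {d} V fd = from-cone (Triangulated.hstar-vector V spn)
    where
    spn = spanning V fd
    from-cone : HStar {d} (λ n k → Card (Polytope.K V spn n) k) → HStar {d} (λ n k → 1 ℕ.≤ n → LatticeCount V n k)
    from-cone hs = record { HStar hs ; count = λ n 1≤n → card-resp (λ y → K→InDilate V spn n y 1≤n) (λ y → InDilate→K V spn n y) (HStar.count hs n) }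

-- Simplices of any normalised volume with all nonzero box points at one height.

module Simplices where
  open import Data.Rational using (_≤_; _<_)
  open Rationals
  open LinearAlgebra
  open Cardinality
  open Cells
  open Polynomials using (ind; ind-refl; ind-≢)
  open Cones
  open HStarVectors

  int-unique : ∀ x z w → Frac true (⟦ x ⟧ - w) → Frac true (⟦ z ⟧ - w) → x ≡ z
  int-unique x z w p q = go (ℤₚ.<-cmp x z)
    where
    opaque
      unfolding _+_
      lem : ∀ x z w → (x - w) + (z - (1ℚ + x)) ≡ (z - w) - 1ℚ
      lem = solve-∀ ringℚ
    apart : ∀ x z → 0ℚ ≤ ⟦ x ⟧ - w → ⟦ z ⟧ - w < 1ℚ → x ℤ.< z → ⊥
    apart x z p q l = <-irrefl refl (<-≤-trans q (0≤-⇒≤ (subst (0ℚ ≤_) (lem ⟦ x ⟧ ⟦ z ⟧ w)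
      (0≤+ p (≤⇒0≤- (subst (_≤ ⟦ z ⟧) (trans (⟦⟧-+ (posℤ 1) x) (cong (_+ ⟦ x ⟧) ⟦1⟧)) (⟦⟧-mono-≤ (ℤₚ.i<j⇒suc[i]≤j l))))))))
    go : Tri (x ℤ.< z) (x ≡ z) (z ℤ.< x) → x ≡ z
    go (tri< l _ _) = ⊥-elim (apart x z (proj₁ p) (proj₂ q) l)
    go (tri≈ _ e _) = e
    go (tri> _ _ l) = ⊥-elim (apart z x (proj₁ q) (proj₂ p) l)

  below : ∀ {n} → ℕ → Fin n → ℕ
  below a i = if does (toℕ i ℕₚ.<? a) then 1 else 0

  below-cases : ∀ {n} a (i : Fin n) → (toℕ i ℕ.< a × below a i ≡ 1) ⊎ (¬ toℕ i ℕ.< a × below a i ≡ 0)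
  below-cases a i = go (toℕ i ℕₚ.<? a)
    where
    go : Dec (toℕ i ℕ.< a) → (toℕ i ℕ.< a × below a i ≡ 1) ⊎ (¬ toℕ i ℕ.< a × below a i ≡ 0)
    go (yes p) = inj₁ (p , cong (λ t → if t then 1 else 0) (dec-true (toℕ i ℕₚ.<? a) p))
    go (no ¬p) = inj₂ (¬p , cong (λ t → if t then 1 else 0) (dec-false (toℕ i ℕₚ.<? a) ¬p))

  sum-below : ∀ n a → a ℕ.≤ n → sum (λ (i : Fin n) → ⟦ below a i ⟧ℕ) ≡ ⟦ a ⟧ℕ
  sum-below n       zero    _ = trans (Σ-0 (λ i → ⟦0⟧)) (sym ⟦0⟧)
  sum-below (suc n) (suc a) (ℕ.s≤s l) = trans (sum-suc (λ (i : Fin (suc n)) → ⟦ below (suc a) i ⟧ℕ)) (trans (cong (⟦ 1 ⟧ℕ +_) (trans (Σ-cong (λ i → cong ⟦_⟧ℕ (step i))) (sum-below n a l))) (sym (⟦⟧ℕ-+ 1 a)))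
    where
    step : ∀ i → below (suc a) (suc i) ≡ below a i
    step i = refl

  -- The simplex with vertices 0, e₁, …, e_{d'} and (m, c), where c consists of b + 2 ones, b minus ones and zeros: its nonzero box points all have height b + 2.
  module Simplex (d' m' b : ℕ) (b≤ : (2 ℕ.+ b) ℕ.+ b ℕ.≤ d') where
    m k d : ℕ
    m = suc m'
    k = 2 ℕ.+ b
    d = suc d'

    u : Fin d' → ℕ
    u = below k

    w : Fin d' → ℕ
    w = below (k ℕ.+ b)

    -- With s = t/m, a nonzero box point has coordinate 1 - s at the k ones of `c`, and s at its b
    -- minus ones, at the apex and at the origin. Since k = b + 2 there are k coordinates of either
    -- kind, so the height is k for every t.
    c : Fin d' → ℤ
    c i = posℤ (u i) ℤ.+ posℤ (u i) ℤ.- posℤ (w i)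

    c≡ : ∀ i → ⟦ c i ⟧ ≡ ⟦ u i ⟧ℕ + ⟦ u i ⟧ℕ - ⟦ w i ⟧ℕ
    c≡ i = trans (⟦⟧-- (posℤ (u i) ℤ.+ posℤ (u i)) (posℤ (w i))) (cong (_- ⟦ w i ⟧ℕ) (⟦⟧-+ (posℤ (u i)) (posℤ (u i))))

    0<m : 0ℚ < ⟦ m ⟧ℕ
    0<m = ⟦⟧ℕ-pos (ℕ.s≤s ℕ.z≤n)

    μ : ℚ
    μ = recip ⟦ m ⟧ℕ

    mμ : ⟦ m ⟧ℕ * μ ≡ 1ℚ
    mμ = *-recip (>⇒≢ 0<m)

    sum-u : sum (λ i → ⟦ u i ⟧ℕ) ≡ ⟦ k ⟧ℕ
    sum-u = sum-below d' k (ℕₚ.≤-trans (ℕₚ.m≤m+n k b) b≤)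

    sum-c : sum (λ i → ⟦ c i ⟧) ≡ 1ℚ + 1ℚ
    sum-c = begin
      sum (λ i → ⟦ c i ⟧) ≡⟨ Σ-cong c≡ ⟩
      sum (λ i → ⟦ u i ⟧ℕ + ⟦ u i ⟧ℕ - ⟦ w i ⟧ℕ) ≡⟨ trans (Σ-- _ _) (cong (_- sum (λ i → ⟦ w i ⟧ℕ)) (Σ-+ _ _)) ⟩
      sum (λ i → ⟦ u i ⟧ℕ) + sum (λ i → ⟦ u i ⟧ℕ) - sum (λ i → ⟦ w i ⟧ℕ) ≡⟨ cong₂ (λ a b → a + a - b) sum-u (trans (sum-below d' (k ℕ.+ b) b≤) (⟦⟧ℕ-+ k b)) ⟩
      ⟦ k ⟧ℕ + ⟦ k ⟧ℕ - (⟦ k ⟧ℕ + ⟦ b ⟧ℕ) ≡⟨ cong (λ z → z + z - (z + ⟦ b ⟧ℕ)) (trans (⟦⟧ℕ-+ 2 b) (cong (_+ ⟦ b ⟧ℕ) (trans (⟦⟧ℕ-+ 1 1) (cong₂ _+_ ⟦1⟧ ⟦1⟧)))) ⟩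
      (1ℚ + 1ℚ + ⟦ b ⟧ℕ) + (1ℚ + 1ℚ + ⟦ b ⟧ℕ) - ((1ℚ + 1ℚ + ⟦ b ⟧ℕ) + ⟦ b ⟧ℕ) ≡⟨ lem ⟦ b ⟧ℕ ⟩
      1ℚ + 1ℚ ∎
      where
      opaque
        unfolding _+_
        lem : ∀ b → (1ℚ + 1ℚ + b) + (1ℚ + 1ℚ + b) - ((1ℚ + 1ℚ + b) + b) ≡ 1ℚ + 1ℚ
        lem = solve-∀ ringℚ

    vs : Fin (suc d) → Point d
    vs zero          = posℤ m ∷ Vec.tabulate c
    vs (suc zero)    = posℤ 0 ∷ Vec.replicate d' (posℤ 0)
    vs (suc (suc i)) = posℤ 0 ∷ Vec.tabulate (λ j → if does (i Finₚ.≟ j) then posℤ 1 else posℤ 0)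

    α₀ : (Fin (suc d) → ℚ) → ℚ
    α₀ x = μ * x (suc zero)

    αᵢ : Fin d' → (Fin (suc d) → ℚ) → ℚ
    αᵢ i x = x (suc (suc i)) - ⟦ c i ⟧ * α₀ x

    -- Barycentric coordinates as explicit formulas: the apex is read off from the leading entry,
    -- the unit vectors from the others, and the origin takes what remains of the height.
    α : Fin (suc d) → (Fin (suc d) → ℚ) → ℚ
    α zero          x = α₀ x
    α (suc zero)    x = x zero - sum (λ i → αᵢ i x) - α₀ x
    α (suc (suc i)) x = αᵢ i x

    fn₀ : Fin (suc d) → ℚ
    fn₀ j = μ * δ (suc zero) j

    fnᵢ : Fin d' → Fin (suc d) → ℚ
    fnᵢ i j = δ (suc (suc i)) j - ⟦ c i ⟧ * fn₀ j

    fn : Fin (suc d) → Fin (suc d) → ℚ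
    fn zero          j = fn₀ j
    -- The factor 1 gives the sum the shape of a linear combination, to which `dot-Σ` applies.
    fn (suc zero)    j = δ zero j - sum (λ i → 1ℚ * fnᵢ i j) - fn₀ j
    fn (suc (suc i)) j = fnᵢ i j

    fn₀≡ : ∀ x → dot x fn₀ ≡ α₀ x
    fn₀≡ x = trans (dot-* x μ (δ (suc zero))) (cong (μ *_) (dot-δ x (suc zero)))

    fnᵢ≡ : ∀ i x → dot x (fnᵢ i) ≡ αᵢ i x
    fnᵢ≡ i x = trans (dot-- x (δ (suc (suc i))) _) (cong₂ _-_ (dot-δ x (suc (suc i))) (trans (dot-* x ⟦ c i ⟧ fn₀) (cong (⟦ c i ⟧ *_) (fn₀≡ x))))

    fn≡α : ∀ l x → dot (fn l) x ≡ α l x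
    fn≡α zero x = trans (dot-comm fn₀ x) (fn₀≡ x)
    fn≡α (suc (suc i)) x = trans (dot-comm (fnᵢ i) x) (fnᵢ≡ i x)
    fn≡α (suc zero) x = trans (dot-comm (fn (suc zero)) x) (trans (dot-- x (λ j → δ zero j - sum (λ i → 1ℚ * fnᵢ i j)) fn₀)
      (cong₂ _-_ (trans (dot-- x (δ zero) _) (cong₂ _-_ (dot-δ x zero) (trans (dot-Σ x (λ _ → 1ℚ) fnᵢ) (Σ-cong (λ i → trans (*-identityˡ _) (fnᵢ≡ i x))))))
        (fn₀≡ x)))

    private
      opaque
        unfolding _+_
        a1 : ∀ c → c - c * 1ℚ ≡ 0ℚ
        a1 = solve-∀ ringℚ
        a2 : ∀ a b → a - b * 0ℚ ≡ a
        a2 = solve-∀ ringℚ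
        a3 : 1ℚ - 0ℚ - 1ℚ ≡ 0ℚ
        a3 = refl
        a4 : 1ℚ - 0ℚ - 0ℚ ≡ 1ℚ
        a4 = refl
        a5 : 1ℚ - 1ℚ - 0ℚ ≡ 0ℚ
        a5 = refl

    α-apex : ∀ l → α l (hom 1 (vs zero)) ≡ δ l zero
    α-apex = λ { zero → first ; (suc zero) → trans (cong₂ _-_ (cong₂ _-_ ⟦1⟧ (Σ-0 rest)) first) a3 ; (suc (suc i)) → rest i }
      where
      first : α₀ (hom 1 (vs zero)) ≡ 1ℚ
      first = trans (*-comm μ ⟦ m ⟧ℕ) mμ
      rest : ∀ i → αᵢ i (hom 1 (vs zero)) ≡ 0ℚ
      rest i = trans (cong₂ (λ a b → a - ⟦ c i ⟧ * b) (cong ⟦_⟧ (Vecₚ.lookup∘tabulate c i)) first) (a1 ⟦ c i ⟧)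

    α-zeros : ∀ (x : Fin (suc d) → ℚ) → (∀ i → x (suc i) ≡ 0ℚ) → α₀ x ≡ 0ℚ × (∀ i → αᵢ i x ≡ 0ℚ)
    α-zeros x z = first , λ i → trans (cong₂ (λ a b → a - ⟦ c i ⟧ * b) (z (suc i)) first) (a2 0ℚ ⟦ c i ⟧)
      where
      first : α₀ x ≡ 0ℚ
      first = trans (cong (μ *_) (z zero)) (zeroʳ μ)

    hom-zero : ∀ n i → hom n (vs (suc zero)) (suc i) ≡ 0ℚ
    hom-zero n zero    = ⟦0⟧
    hom-zero n (suc i) = trans (cong ⟦_⟧ (Vecₚ.lookup-replicate i (posℤ 0))) ⟦0⟧

    α-origin : ∀ l → α l (hom 1 (vs (suc zero))) ≡ δ l (suc zero)
    α-origin with α-zeros (hom 1 (vs (suc zero))) (hom-zero 1)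
    ... | first , rest = λ { zero → first ; (suc zero) → trans (cong₂ _-_ (cong₂ _-_ ⟦1⟧ (Σ-0 rest)) first) a4 ; (suc (suc i)) → rest i }

    unit≡δ : ∀ i j → ⟦ lookup (Vec.tabulate (λ j → if does (i Finₚ.≟ j) then posℤ 1 else posℤ 0)) j ⟧ ≡ δ {d'} i j
    unit≡δ i j = trans (cong ⟦_⟧ (Vecₚ.lookup∘tabulate (λ j → if does (i Finₚ.≟ j) then posℤ 1 else posℤ 0) j)) (go (does (i Finₚ.≟ j)))
      where
      go : ∀ t → ⟦ (if t then posℤ 1 else posℤ 0) ⟧ ≡ (if t then 1ℚ else 0ℚ)
      go true  = ⟦1⟧
      go false = ⟦0⟧

    α-unit : ∀ i l → α l (hom 1 (vs (suc (suc i)))) ≡ δ l (suc (suc i))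
    α-unit i = λ { zero → first ; (suc zero) → trans (cong₂ _-_ (cong₂ _-_ ⟦1⟧ (trans (Σ-cong (λ j → trans (rest j) (sym (*-identityˡ (δ j i))))) (Σ-δʳ i (λ _ → 1ℚ)))) first) a5
                 ; (suc (suc j)) → trans (rest j) (trans (sym (δ-suc j i)) (sym (δ-suc (suc j) (suc i)))) }
      where
      first : α₀ (hom 1 (vs (suc (suc i)))) ≡ 0ℚ
      first = trans (cong (μ *_) ⟦0⟧) (zeroʳ μ)
      rest : ∀ j → αᵢ j (hom 1 (vs (suc (suc i)))) ≡ δ j i
      rest j = trans (cong₂ (λ a b → a - ⟦ c j ⟧ * b) (unit≡δ i j) first) (trans (a2 (δ i j) ⟦ c j ⟧) (δ-sym i j))

    cell : Cell d (suc d)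
    cell = record { vs = vs ; fn = fn ; dual = λ { l zero → trans (fn≡α l _) (α-apex l) ; l (suc zero) → trans (fn≡α l _) (α-origin l) ; l (suc (suc i)) → trans (fn≡α l _) (α-unit i l) } }

    open Cell cell using (InCell; Box; Supported; coord)

    V : List (Point d)
    V = List.tabulate vs

    full-dimensional : FullDimensional V
    full-dimensional = vs , (λ i → ∈ₚ.∈-tabulate⁺ {f = vs} i) , independent
      where
      independent : AffinelyIndependent vs
      independent a s h l = trans (sym (trans (dot-Σ (fn l) a (λ i → hom 1 (vs i))) (trans (Σ-cong (λ i → cong (a i *_) (trans (Cell.dual cell l i) (δ-sym l i)))) (Σ-δʳ l a)))) (dot-0 (fn l) zero')
        where
        zero' : ∀ j → sum (λ i → a i * hom 1 (vs i) j) ≡ 0ℚ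
        zero' zero = trans (Σ-cong (λ i → trans (cong (a i *_) ⟦1⟧) (trans (*-comm (a i) 1ℚ) (*-identityˡ (a i))))) (trans (sum≡Σℚ a) s)
        zero' (suc j) = trans (trans (Σ-cong (λ i → trans (*-ℚ (a i) ⟦ lookup (vs i) j ⟧) (cong (a i ℚ.*_) (⟦⟧-ℚ (lookup (vs i) j))))) (sum≡Σℚ (λ i → a i ℚ.* ℤ→ℚ (lookup (vs i) j)))) (h j)

    spn : Spanning V
    spn = spanning V full-dimensional

    open Polytope V spn using (K; cone-Σ; cone-gen; cone-resp; cone-functional)

    supported : ∀ n y → Supported n y
    supported n y j = trans (Σ-cong (λ l → cong (_* hom 1 (vs l) j) (fn≡α l x))) (trans (sum-suc _) (trans (cong (α zero x * hom 1 (vs zero) j +_) (sum-suc _)) (go j)))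
      where
      x = hom n y
      opaque
        unfolding _+_
        g1 : ∀ a s x → a * 1ℚ + ((x - s - a) * 1ℚ + s * 1ℚ) ≡ x
        g1 = solve-∀ ringℚ
        g2 : ∀ u x o m → (u * x) * m + (o * 0ℚ + 0ℚ) ≡ x * (m * u)
        g2 = solve-∀ ringℚ
        g3 : ∀ a c x o → a * c + (o * 0ℚ + (x - c * a)) ≡ x
        g3 = solve-∀ ringℚ
      go : ∀ j → α zero x * hom 1 (vs zero) j + (α (suc zero) x * hom 1 (vs (suc zero)) j + sum (λ i → α (suc (suc i)) x * hom 1 (vs (suc (suc i))) j)) ≡ x j
      go zero = trans (cong₂ (λ o s → α zero x * o + (α (suc zero) x * o + s)) ⟦1⟧ (trans (Σ-cong (λ i → cong (α (suc (suc i)) x *_) ⟦1⟧)) (Σ-*ʳ 1ℚ (λ i → α (suc (suc i)) x)))) (g1 (α zero x) (sum (λ i → α (suc (suc i)) x)) (x zero))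
      go (suc zero) = trans (cong₂ (λ o s → α zero x * ⟦ m ⟧ℕ + (α (suc zero) x * o + s)) ⟦0⟧ (Σ-0 (λ i → trans (cong (α (suc (suc i)) x *_) ⟦0⟧) (zeroʳ _)))) (trans (g2 μ (x (suc zero)) (α (suc zero) x) ⟦ m ⟧ℕ) (trans (cong (x (suc zero) *_) mμ) (trans (*-comm _ 1ℚ) (*-identityˡ _))))
      go (suc (suc j)) = trans (cong₂ (λ a s → α zero x * a + s) (cong ⟦_⟧ (Vecₚ.lookup∘tabulate c j))
        (cong₂ (λ o s → α (suc zero) x * o + s) (trans (cong ⟦_⟧ (Vecₚ.lookup-replicate j (posℤ 0))) ⟦0⟧) (trans (Σ-cong (λ i → cong (α (suc (suc i)) x *_) (unit≡δ i j))) (Σ-δʳ j (λ i → α (suc (suc i)) x)))))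
        (g3 (α zero x) ⟦ c j ⟧ (x (suc (suc j))) (α (suc zero) x))

    σ : Fin (suc d) → Bool
    σ _ = true

    K→cell : ∀ n y → K n y → InCell σ n y
    K→cell n y Ky = (λ l → cone-functional (fn l) (vertex-nonneg l) Ky) , supported n y
      where
      vertex-nonneg : ∀ l i → 0ℚ ≤ dot (fn l) (hom 1 (List.lookup V i))
      vertex-nonneg l i with ∈ₚ.∈-tabulate⁻ {f = vs} (∈ₚ.∈-lookup {xs = V} i)
      ... | i' , e = subst (0ℚ ≤_) (sym (trans (cong (λ y → dot (fn l) (hom 1 y)) e) (Cell.dual cell l i'))) (δ-nonneg l i')

    cell→K : ∀ n y → InCell σ n y → K n y
    cell→K n y (nn , sup) = cone-resp sup (cone-Σ (coord n y) (λ l → hom 1 (vs l)) nn (λ l → cone-resp (λ j → cong (λ y → hom 1 y j) (sym (Anyₚ.lookup-index (∈ₚ.∈-tabulate⁺ {f = vs} l)))) (cone-gen (Any.index (∈ₚ.∈-tabulate⁺ {f = vs} l)))))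

    -- The h*-polynomial 1 + (m - 1) tᵏ.
    H : ℕ → ℕ
    H j = ind 0 j ℕ.+ m' ℕ.* ind k j

    private
      β : Fin m' → Point d
      β t = posℤ (suc (toℕ t)) ∷ Vec.tabulate (λ i → posℤ (u i))

      O : Point d
      O = posℤ 0 ∷ Vec.replicate d' (posℤ 0)

      frac0 : ∀ {a} → a ≡ 0ℚ → Frac true a
      frac0 e = ≤-reflexive (sym e) , subst (_< 1ℚ) (sym e) 0<1

      box-O : Box σ 0 O
      box-O with α-zeros (hom 0 O) (hom-zero 0)
      ... | first , rest = (λ l → frac0 (trans (fn≡α l (hom 0 O)) (go l))) , supported 0 O
        where
        opaque
          unfolding _+_
          zzz : 0ℚ - 0ℚ - 0ℚ ≡ 0ℚ
          zzz = refl
        go : ∀ l → α l (hom 0 O) ≡ 0ℚ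
        go zero          = first
        go (suc (suc i)) = rest i
        go (suc zero)    = trans (cong₂ _-_ (cong₂ _-_ ⟦0⟧ (Σ-0 rest)) first) zzz

      module Point-t (t : ℕ) (1≤t : 1 ℕ.≤ t) (t<m : t ℕ.< m) where
        s : ℚ
        s = μ * ⟦ t ⟧ℕ
        0<s : 0ℚ < s
        0<s = 0<* (recip-pos 0<m) (⟦⟧ℕ-pos 1≤t)
        s<1 : s < 1ℚ
        s<1 = 0<-⇒< (0<*-cancel 0<m (subst (0ℚ <_) (sym (trans (lem ⟦ m ⟧ℕ μ ⟦ t ⟧ℕ) (trans (cong (λ z → ⟦ m ⟧ℕ - z * ⟦ t ⟧ℕ) mμ) (cong (λ z → ⟦ m ⟧ℕ - z) (*-identityˡ ⟦ t ⟧ℕ))))) (<⇒0<- (⟦⟧-mono-< (ℤ.+<+ t<m)))))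
          where
          opaque
            unfolding _+_
            lem : ∀ m u t → m * (1ℚ - u * t) ≡ m - (m * u) * t
            lem = solve-∀ ringℚ
        opaque
          unfolding _+_
          f1 : ∀ s → 1ℚ - (1ℚ + 1ℚ - 1ℚ) * s ≡ 1ℚ - s
          f1 = solve-∀ ringℚ
          f2 : ∀ s → 0ℚ - (0ℚ + 0ℚ - 1ℚ) * s ≡ s
          f2 = solve-∀ ringℚ
          f3 : ∀ s → 0ℚ - (0ℚ + 0ℚ - 0ℚ) * s ≡ 0ℚ
          f3 = solve-∀ ringℚ
          f4 : ∀ s → s ≡ 1ℚ - (1ℚ - s)
          f4 = solve-∀ ringℚ
        frac-u : ∀ i → Frac true (⟦ u i ⟧ℕ - ⟦ c i ⟧ * s)
        frac-u i = go (below-cases k i) (below-cases (k ℕ.+ b) i)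
          where
          form : ∀ {a z} → ⟦ u i ⟧ℕ ≡ a → ⟦ w i ⟧ℕ ≡ z → ⟦ u i ⟧ℕ - ⟦ c i ⟧ * s ≡ a - (a + a - z) * s
          form eu ew = trans (cong (λ z → ⟦ u i ⟧ℕ - z * s) (c≡ i)) (cong₂ (λ a z → a - (a + a - z) * s) eu ew)
          one : ∀ {x} → x ≡ 1 → ⟦ x ⟧ℕ ≡ 1ℚ
          one e = trans (cong ⟦_⟧ℕ e) ⟦1⟧
          nil : ∀ {x} → x ≡ 0 → ⟦ x ⟧ℕ ≡ 0ℚ
          nil e = trans (cong ⟦_⟧ℕ e) ⟦0⟧
          go : (toℕ i ℕ.< k × u i ≡ 1) ⊎ (¬ toℕ i ℕ.< k × u i ≡ 0) → (toℕ i ℕ.< k ℕ.+ b × w i ≡ 1) ⊎ (¬ toℕ i ℕ.< k ℕ.+ b × w i ≡ 0) → Frac true (⟦ u i ⟧ℕ - ⟦ c i ⟧ * s)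
          go (inj₁ (p , _)) (inj₂ (¬q , _)) = ⊥-elim (¬q (ℕₚ.<-≤-trans p (ℕₚ.m≤m+n k b)))
          go (inj₁ (_ , e)) (inj₁ (_ , e')) = subst (Frac true) (sym (trans (form (one e) (one e')) (f1 s))) (<⇒≤ (<⇒0<- s<1) , 0<-⇒< (subst (0ℚ <_) (f4 s) 0<s))
          go (inj₂ (_ , e)) (inj₁ (_ , e')) = subst (Frac true) (sym (trans (form (nil e) (one e')) (f2 s))) (<⇒≤ 0<s , s<1)
          go (inj₂ (_ , e)) (inj₂ (_ , e')) = frac0 (trans (form (nil e) (nil e')) (f3 s))
        opaque
          unfolding _+_
          o1 : ∀ j k s → j - (k - (1ℚ + 1ℚ) * s) - s ≡ j - (k - s)
          o1 = solve-∀ ringℚ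
          o2 : ∀ k s → k - (k - s) ≡ s
          o2 = solve-∀ ringℚ
        sum-frac : sum (λ i → ⟦ u i ⟧ℕ - ⟦ c i ⟧ * s) ≡ ⟦ k ⟧ℕ - (1ℚ + 1ℚ) * s
        sum-frac = trans (Σ-- _ _) (cong₂ _-_ sum-u (trans (Σ-*ʳ s (λ i → ⟦ c i ⟧)) (cong (_* s) sum-c)))
        frac-k : Frac true (⟦ k ⟧ℕ - (⟦ k ⟧ℕ - s))
        frac-k = subst (Frac true) (sym (o2 ⟦ k ⟧ℕ s)) (<⇒≤ 0<s , s<1)

        y : Point d
        y = posℤ t ∷ Vec.tabulate (λ i → posℤ (u i))

        y-box : Box σ k y
        y-box = (λ l → subst (Frac true) (sym (fn≡α l (hom k y))) (go l)) , supported k y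
          where
          αi : ∀ i → α (suc (suc i)) (hom k y) ≡ ⟦ u i ⟧ℕ - ⟦ c i ⟧ * s
          αi i = cong (λ z → ⟦ z ⟧ - ⟦ c i ⟧ * s) (Vecₚ.lookup∘tabulate (λ i → posℤ (u i)) i)
          go : ∀ l → Frac true (α l (hom k y))
          go zero = <⇒≤ 0<s , s<1
          go (suc (suc i)) = subst (Frac true) (sym (αi i)) (frac-u i)
          go (suc zero) = subst (Frac true) (sym (trans (cong (λ z → ⟦ k ⟧ℕ - z - s) (trans (Σ-cong αi) sum-frac)) (o1 ⟦ k ⟧ℕ ⟦ k ⟧ℕ s))) frac-k

        -- For fixed t, each remaining entry and the height occur with coefficient 1 in one
        -- coordinate, and a single integer brings that coordinate into [0, 1).
        only : ∀ j (x : Vec ℤ d') → Box σ j (posℤ t ∷ x) → j ≡ k × x ≡ Vec.tabulate (λ i → posℤ (u i))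
        only j x (fr , _) = ℤₚ.+-injective (int-unique (posℤ j) (posℤ k) (⟦ k ⟧ℕ - s) (subst (Frac true) (trans (cong (λ z → ⟦ j ⟧ℕ - z - s) (trans (Σ-cong αi) sum-frac)) (o1 ⟦ j ⟧ℕ ⟦ k ⟧ℕ s)) (frα (suc zero))) frac-k) , x≡
          where
          frα : ∀ l → Frac true (α l (hom j (posℤ t ∷ x)))
          frα l = subst (Frac true) (fn≡α l (hom j (posℤ t ∷ x))) (fr l)
          xi : ∀ i → lookup x i ≡ posℤ (u i)
          xi i = int-unique (lookup x i) (posℤ (u i)) (⟦ c i ⟧ * s) (frα (suc (suc i))) (frac-u i)
          x≡ : x ≡ Vec.tabulate (λ i → posℤ (u i))
          x≡ = lookup-ext (λ i → trans (xi i) (sym (Vecₚ.lookup∘tabulate (λ i → posℤ (u i)) i)))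
          αi : ∀ i → α (suc (suc i)) (hom j (posℤ t ∷ x)) ≡ ⟦ u i ⟧ℕ - ⟦ c i ⟧ * s
          αi i = cong (λ z → ⟦ z ⟧ - ⟦ c i ⟧ * s) (xi i)

      box-only-O : ∀ j (x : Vec ℤ d') → Box σ j (posℤ 0 ∷ x) → j ≡ 0 × x ≡ Vec.replicate d' (posℤ 0)
      box-only-O j x (fr , _) = ℤₚ.+-injective (int-unique (posℤ j) (posℤ 0) 0ℚ (subst (Frac true) (trans (cong₂ (λ a b → ⟦ j ⟧ℕ - a - b) (Σ-0 αi) α0) (z1 ⟦ j ⟧ℕ)) (frα (suc zero))) (frac0 (trans (cong (_- 0ℚ) ⟦0⟧) z2))) ,
          lookup-ext (λ i → trans (xi i) (sym (Vecₚ.lookup-replicate i (posℤ 0))))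
        where
        X = hom j (posℤ 0 ∷ x)
        opaque
          unfolding _+_
          z1 : ∀ a → a - 0ℚ - 0ℚ ≡ a - 0ℚ
          z1 = solve-∀ ringℚ
          z2 : 0ℚ - 0ℚ ≡ 0ℚ
          z2 = refl
          z3 : ∀ a c → a - c * 0ℚ ≡ a - 0ℚ
          z3 = solve-∀ ringℚ
        frα : ∀ l → Frac true (α l X)
        frα l = subst (Frac true) (fn≡α l X) (fr l)
        α0 : α zero X ≡ 0ℚ
        α0 = trans (cong (μ *_) ⟦0⟧) (zeroʳ μ)
        xi : ∀ i → lookup x i ≡ posℤ 0
        xi i = int-unique (lookup x i) (posℤ 0) 0ℚ (subst (Frac true) (trans (cong (λ z → ⟦ lookup x i ⟧ - ⟦ c i ⟧ * z) α0) (z3 ⟦ lookup x i ⟧ ⟦ c i ⟧)) (frα (suc (suc i)))) (frac0 (trans (cong (_- 0ℚ) ⟦0⟧) z2))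
        αi : ∀ i → α (suc (suc i)) X ≡ 0ℚ
        αi i = trans (cong₂ (λ a b → a - ⟦ c i ⟧ * b) (trans (cong ⟦_⟧ (xi i)) ⟦0⟧) α0) (a2 0ℚ ⟦ c i ⟧)

      first-range : ∀ j t (x : Vec ℤ d') → Box σ j (t ∷ x) → ∃[ t' ] (t ≡ posℤ t' × t' ℕ.< m)
      first-range j t x (fr , _) = go t (subst (Frac true) (fn≡α zero (hom j (t ∷ x))) (fr zero))
        where
        opaque
          unfolding _+_
          q1 : ∀ m u t → m * (u * t) ≡ t * (m * u)
          q1 = solve-∀ ringℚ
          q2 : ∀ m a → m * (1ℚ - a) ≡ m - m * a
          q2 = solve-∀ ringℚ
        mul : ∀ t → ⟦ m ⟧ℕ * (μ * ⟦ t ⟧) ≡ ⟦ t ⟧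
        mul t = trans (q1 ⟦ m ⟧ℕ μ ⟦ t ⟧) (trans (cong (⟦ t ⟧ *_) mμ) (trans (*-comm _ 1ℚ) (*-identityˡ _)))
        go : ∀ t → Frac true (μ * ⟦ t ⟧) → ∃[ t' ] (t ≡ posℤ t' × t' ℕ.< m)
        go (posℤ t) (_ , q) = t , refl , ℤₚ.drop‿+<+ (⟦⟧-cancel-< (0<-⇒< (subst (0ℚ <_) (trans (q2 ⟦ m ⟧ℕ _) (cong (λ z → ⟦ m ⟧ℕ - z) (mul (posℤ t)))) (0<* 0<m (<⇒0<- q)))))
        go ℤ.-[1+ t ] (p , _) = ⊥-elim (absurd (⟦⟧-cancel-≤ (subst₂ _≤_ (sym ⟦0⟧) (mul ℤ.-[1+ t ]) (0≤* (<⇒≤ 0<m) p))))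
          where
          absurd : posℤ 0 ℤ.≤ ℤ.-[1+ t ] → ⊥
          absurd ()

      classify : ∀ j y → Box σ j y → (j ≡ 0 × y ≡ O) ⊎ (j ≡ k × ∃[ t ] β t ≡ y)
      classify j (t ∷ x) by with first-range j t x by
      ... | zero , refl , _ = inj₁ (proj₁ (box-only-O j x by) , cong (posℤ 0 ∷_) (proj₂ (box-only-O j x by)))
      ... | suc t' , refl , ℕ.s≤s l with Point-t.only (suc t') (ℕ.s≤s ℕ.z≤n) (ℕ.s≤s l) j x by
      ... | e , e' = inj₂ (e , Fin.fromℕ< l , cong₂ (λ a b → posℤ (suc a) ∷ b) (Finₚ.toℕ-fromℕ< l) (sym e'))

      β-box : ∀ t → Box σ k (β t)
      β-box t = Point-t.y-box (suc (toℕ t)) (ℕ.s≤s ℕ.z≤n) (ℕ.s≤s (Finₚ.toℕ<n t))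

      β-injective : ∀ s t → β s ≡ β t → s ≡ t
      β-injective s t e = Finₚ.toℕ-injective (ℕₚ.suc-injective (ℤₚ.+-injective (cong Vec.head e)))

      card-fin : ∀ n → Card (λ (_ : Fin n) → ⊤) n
      card-fin n = List.allFin n , Uniqueₚ.allFin⁺ n , (λ x → mk⇔ (λ _ → tt) (λ _ → ∈ₚ.∈-allFin x)) , Listₚ.length-tabulate (λ x → x)

    card-box : ∀ j → Card (Box σ j) (H j)
    card-box zero = subst (Card (Box σ 0)) (sym (trans (cong suc (ℕₚ.*-zeroʳ m')) refl)) (card-1 O box-O (λ y by → Data.Sum.[ proj₂ , (λ { (() , _) }) ]′ (classify 0 y by)))
    card-box (suc j) with k ℕₚ.≟ suc j
    ... | yes refl = subst (Card (Box σ k)) (sym (trans (cong (m' ℕ.*_) (ind-refl k)) (ℕₚ.*-identityʳ m')))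
            (card-bij (card-fin m') β (λ s t _ _ → β-injective s t) (λ t _ → β-box t) (λ y by → Data.Sum.[ (λ { (() , _) }) , (λ { (_ , t , e) → t , tt , e }) ]′ (classify k y by)))
    ... | no ne = subst (Card (Box σ (suc j))) (sym (trans (cong (m' ℕ.*_) (ind-≢ k (suc j) ne)) (ℕₚ.*-zeroʳ m'))) (card-0 (λ y by → Data.Sum.[ (λ { (() , _) }) , (λ { (e , _) → ne (sym e) }) ]′ (classify (suc j) y by)))

    count : ∀ n → 1 ℕ.≤ n → LatticeCount V n (Sⁿ (suc d) H n)
    count n 1≤n = card-resp (λ y ic → K→InDilate V spn n y 1≤n (cell→K n y ic)) (λ y iy → K→cell n y (InDilate→K V spn n y iy)) (Cell.card-cell cell σ card-box n)

-- From h*-vectors to Ehrhart coefficients and volumes.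

module Conclusion where
  open import Data.Rational using (_≤_; _<_)
  open Rationals
  open Cardinality
  open Cells using (hom)
  open Coefficients
  open Polynomials
  open Inequality
  open HStarVectors
  open Simplices

  opaque
    unfolding _+_ ⟦_⟧

    unit-fraction : ∀ n .{{_ : ℕ.NonZero n}} → (posℤ 1 ℚ./ n) * ⟦ n ⟧ℕ ≡ 1ℚ
    unit-fraction (suc n) = ℚₚ.toℚᵘ-injective (ℚᵘₚ.≃-trans (ℚₚ.toℚᵘ-homo-* (posℤ 1 ℚ./ suc n) (ℕ→ℚ (suc n)))
      (ℚᵘₚ.≃-trans (ℚᵘₚ.*-cong (ℚₚ.toℚᵘ-fromℚᵘ (ℚᵘ.mkℚᵘ (posℤ 1) n)) (ℚₚ.toℚᵘ-fromℚᵘ (ℚᵘ.mkℚᵘ (posℤ (suc n)) 0)))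
        (ℚᵘ.*≡* (cong posℤ (e n)))))
      where
      e : ∀ n → suc (n ℕ.+ 0) ℕ.* 1 ≡ suc (n ℕ.* 1 ℕ.+ 0)
      e = ℕSolver.solve-∀

    volume-error : ∀ k v m ε → (ℚ.∣ ℕ→ℚ k ℚ.- v ℚ.* ℕ→ℚ m ∣ ℚ.< ε ℚ.* ℕ→ℚ m) ≡ (∣ ⟦ k ⟧ℕ - v * ⟦ m ⟧ℕ ∣ < ε * ⟦ m ⟧ℕ)
    volume-error k v m ε = refl

    bound≡ : ∀ d v (t : ℚ) → t ≡ (posℤ 1 ℚ./ (d ℕ.!)) {{ℕₚ._!≢0 d}} → bound d v ≡ t * (- ⟦ stirl (suc d) (d ℕ.∸ 2) ⟧ + (⟦ d ℕ.! ⟧ℕ * v - 1ℚ) * ⟦ N (d ℕ.∸ 3) d ⟧)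
    bound≡ d v t refl = refl

    term≡ : ∀ c n → c ℚ.* ℕ→ℚ n ≡ c * ⟦ n ⟧ℕ
    term≡ c n = refl

    ⟦⟧ℕ≡ : ∀ n → ⟦ n ⟧ℕ ≡ ℕ→ℚ n
    ⟦⟧ℕ≡ n = refl

  coefAt-toℕ : ∀ {d} (c : Fin (suc d) → ℚ) r → coefAt c (toℕ r) ≡ c r
  coefAt-toℕ {d}     c zero    = refl
  coefAt-toℕ {suc d} c (suc r) = coefAt-toℕ (λ i → c (suc i)) r

  coefAt-restrict : ∀ d (f : ℕ → ℚ) r → r ℕ.≤ d → coefAt {d} (λ i → f (toℕ i)) r ≡ f r
  coefAt-restrict d       f zero    _ = refl
  coefAt-restrict (suc d) f (suc r) (ℕ.s≤s l) = coefAt-restrict d (λ r → f (suc r)) r l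

  ehrhart-value : ∀ {d} (c : Fin (suc d) → ℚ) n → Σℚ (λ r → c r ℚ.* ℕ→ℚ (n ℕ.^ toℕ r)) ≡ poly (suc d) (coefAt c) n
  ehrhart-value {d} c n = trans (sym (sum≡Σℚ (λ r → c r ℚ.* ℕ→ℚ (n ℕ.^ toℕ r)))) (trans (Σ-cong (λ r → trans (term≡ (c r) (n ℕ.^ toℕ r)) (cong (_* ⟦ n ℕ.^ toℕ r ⟧ℕ) (sym (coefAt-toℕ c r)))))
    (sum-sumTo (suc d) (λ r → coefAt c r * ⟦ n ℕ.^ r ⟧ℕ)))

  -- Subtracting v from the top coefficient reduces this to `poly-leading-0`.
  poly-leading : ∀ d c v → (∀ ε → 0ℚ < ε → ∃[ n₀ ] ∀ n → n₀ ℕ.≤ n → 1 ℕ.≤ n → ∣ poly (suc d) c n - v * ⟦ n ℕ.^ d ⟧ℕ ∣ < ε * ⟦ n ℕ.^ d ⟧ℕ) → c d ≡ v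
  poly-leading d c v small = -≡0⇒≡ (trans (sym top) (poly-leading-0 d c' (λ ε 0<ε → proj₁ (small ε 0<ε) , λ n l 1≤n → subst (λ z → ∣ z ∣ < ε * ⟦ n ℕ.^ d ⟧ℕ) (sym (poly-c' n)) (proj₂ (small ε 0<ε) n l 1≤n))))
    where
    choose : ∀ r → Dec (r ≡ d) → ℚ
    choose r (yes _) = c r - v
    choose r (no _)  = c r
    c' : ℕ → ℚ
    c' r = choose r (r ℕₚ.≟ d)
    top : c' d ≡ c d - v
    top = go (d ℕₚ.≟ d)
      where
      go : (D : Dec (d ≡ d)) → choose d D ≡ c d - v
      go (yes _) = refl
      go (no q) = ⊥-elim (q refl)
    lower : ∀ r → r ℕ.< d → c' r ≡ c r
    lower r l = go (r ℕₚ.≟ d)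
      where
      go : (D : Dec (r ≡ d)) → choose r D ≡ c r
      go (yes e) = ⊥-elim (ℕₚ.<⇒≢ l e)
      go (no _) = refl
    opaque
      unfolding _+_
      lem : ∀ s c v m → s + (c - v) * m ≡ s + c * m - v * m
      lem = solve-∀ ringℚ
    poly-c' : ∀ n → poly (suc d) c' n ≡ poly (suc d) c n - v * ⟦ n ℕ.^ d ⟧ℕ
    poly-c' n = trans (cong₂ (λ s z → s + z * ⟦ n ℕ.^ d ⟧ℕ) (sumTo-cong d (λ r l → cong (_* ⟦ n ℕ.^ r ⟧ℕ) (lower r l))) top) (lem (poly d c n) (c d) v ⟦ n ℕ.^ d ⟧ℕ)

  poly-scale : ∀ N c a n → poly N (λ r → c r * a) n ≡ poly N c n * a
  poly-scale N c a n = trans (sumTo-cong N (λ r _ → lem (c r) a ⟦ n ℕ.^ r ⟧ℕ)) (sumTo-*ʳ N a (λ r → c r * ⟦ n ℕ.^ r ⟧ℕ))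
    where
    opaque
      unfolding _+_
      lem : ∀ c a m → (c * a) * m ≡ (c * m) * a
      lem = solve-∀ ringℚ

  poly-unique : ∀ N c c' n₀ → (∀ n → n₀ ℕ.≤ n → poly N c n ≡ poly N c' n) → ∀ r → r ℕ.< N → c r ≡ c' r
  poly-unique N c c' n₀ p r l = -≡0⇒≡ (poly-0 N (λ r → c r - c' r) n₀ (λ n q → trans (difference n) (trans (cong (_- poly N c' n) (p n q)) (+-inverseʳ (poly N c' n)))) r l)
    where
    opaque
      unfolding _+_
      lem : ∀ a b m → (a - b) * m ≡ a * m + (- 1ℚ) * (b * m)
      lem = solve-∀ ringℚ
      lem' : ∀ a b → a + (- 1ℚ) * b ≡ a - b
      lem' = solve-∀ ringℚ
    difference : ∀ n → poly N (λ r → c r - c' r) n ≡ poly N c n - poly N c' n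
    difference n = trans (sumTo-cong N (λ r _ → lem (c r) (c' r) ⟦ n ℕ.^ r ⟧ℕ)) (trans (sumTo-+ N _ _) (trans (cong (poly N c n +_) (sumTo-* N (- 1ℚ) _)) (lem' (poly N c n) (poly N c' n))))

  module _ (e : ℕ) where
    open CubicBounds e

    private
      t : ℚ
      t = (posℤ 1 ℚ./ (d ℕ.!)) {{ℕₚ._!≢0 d}}

      td : t * ⟦ d ℕ.! ⟧ℕ ≡ 1ℚ
      td = unit-fraction (d ℕ.!) {{ℕₚ._!≢0 d}}

      0<d! : 0ℚ < ⟦ d ℕ.! ⟧ℕ
      0<d! = ⟦⟧ℕ-pos (ℕₚ.1≤n! d)

      0≤t : 0ℚ ≤ t
      0≤t = 0≤*-cancel 0<d! (subst (0ℚ ≤_) (sym (trans (*-comm ⟦ d ℕ.! ⟧ℕ t) td)) 0≤1)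

      -- The arguments -1 and d have opposite X, so oddness of the cubic identifies the Stirling
      -- term with the weight of h₀.
      stirl≡ : - ⟦ stirl (suc d) (d ℕ.∸ 2) ⟧ ≡ f (posℤ d)
      stirl≡ = *-cancelˡ (>⇒≢ 0<48) (begin
        48ℚ * - ⟦ stirl (suc d) (d ℕ.∸ 2) ⟧ ≡⟨ lem 48ℚ _ ⟩
        - (48ℚ * ⟦ stirl (suc d) (suc r) ⟧) ≡⟨ cong (λ z → - (48ℚ * ⟦ z ⟧)) (stirl-suc d r) ⟩
        - (48ℚ * f (ℤ.- posℤ 1))            ≡⟨ cong -_ (f≡Φ (ℤ.- posℤ 1)) ⟩
        - Φ (X (ℤ.- posℤ 1))                ≡⟨ sym (Φ-odd (X (ℤ.- posℤ 1))) ⟩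
        Φ (- X (ℤ.- posℤ 1))                ≡⟨ cong Φ (trans (cong (λ z → - (2ℚ * z - D + 1ℚ)) (trans (⟦⟧-neg (posℤ 1)) (cong -_ ⟦1⟧))) (lem' D)) ⟩
        Φ (X (posℤ d))                      ≡⟨ sym (f≡Φ (posℤ d)) ⟩
        48ℚ * f (posℤ d) ∎)
        where
        opaque
          unfolding _+_
          lem : ∀ a b → a * - b ≡ - (a * b)
          lem = solve-∀ ringℚ
          lem' : ∀ D → - (2ℚ * (- 1ℚ) - D + 1ℚ) ≡ 2ℚ * D - D + 1ℚ
          lem' = solve-∀ ringℚ

      coefficient : (ℕ → ℕ) → ℕ → ℚ
      coefficient H r = sumTo (suc d) (λ j → ⟦ H j ⟧ℕ * ⟦ C d r (posℤ d ℤ.- posℤ j) ⟧)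

      value : ∀ H → (∀ j → suc d ℕ.≤ j → H j ≡ 0) → ∀ n → ⟦ Sⁿ (suc d) H n ⟧ℕ * ⟦ d ℕ.! ⟧ℕ ≡ poly (suc d) (coefficient H) n
      value H z n = hstar-poly (suc d) d H z n (ℕ.s≤s (ℕₚ.m≤n+m d n))

      leading : ∀ H → coefficient H d ≡ sumTo (suc d) (λ j → ⟦ H j ⟧ℕ)
      leading H = sumTo-cong (suc d) (λ j _ → trans (cong (⟦ H j ⟧ℕ *_) (C-top d (posℤ d ℤ.- posℤ j))) (trans (*-comm _ 1ℚ) (*-identityˡ _)))

      bound-value : ∀ v → bound d v ≡ t * (f (posℤ d) + (⟦ d ℕ.! ⟧ℕ * v - 1ℚ) * ⟦ N r d ⟧)
      bound-value v = trans (bound≡ d v t refl) (cong (λ z → t * (z + (⟦ d ℕ.! ⟧ℕ * v - 1ℚ) * ⟦ N r d ⟧)) stirl≡)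

    -- The counts at all n ≥ 1 determine c, and the volume forces its top entry to be v. Since all
    -- weights at r = d are 1, d! v is the sum of the h*-vector, and `hstar-bound` applies.
    lower-bound : (V : List (Point d)) → FullDimensional V → (c : Fin (suc d) → ℚ) → IsEhrhartPolynomial V c → (v : ℚ) → HasVolume V v → bound d v ≤ coefAt c r
    lower-bound V fd c ehrhart v volume = conclude (lattice-count V fd)
      where
      conclude : HStar {d} (λ n k → 1 ℕ.≤ n → LatticeCount V n k) → bound d v ≤ coefAt c r
      conclude hs = subst₂ _≤_ (sym (bound-value v)) r-coefficient
          (0≤-⇒≤ (subst (0ℚ ≤_) (lem t _ _) (0≤* 0≤t (≤⇒0≤- (subst (λ z → f (posℤ d) + (z - 1ℚ) * ⟦ N r d ⟧ ≤ coefficient H r) normalized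
            (hstar-bound H A H-0 (H-above (suc d) ℕₚ.≤-refl) A-pos H-A))))))
        where
        open HStar hs
        opaque
          unfolding _+_
          lem : ∀ t a b → t * (a - b) ≡ t * a - t * b
          lem = solve-∀ ringℚ
        values : ∀ n → 1 ℕ.≤ n → ⟦ Sⁿ (suc d) H n ⟧ℕ ≡ poly (suc d) (coefAt c) n
        values n 1≤n = trans (⟦⟧ℕ≡ _) (trans (ehrhart n _ 1≤n (count n 1≤n)) (ehrhart-value c n))
        coefficients : ∀ r → r ℕ.< suc d → coefAt c r * ⟦ d ℕ.! ⟧ℕ ≡ coefficient H r
        coefficients = poly-unique (suc d) (λ r → coefAt c r * ⟦ d ℕ.! ⟧ℕ) (coefficient H) 1
          (λ n 1≤n → trans (poly-scale (suc d) (coefAt c) ⟦ d ℕ.! ⟧ℕ n) (trans (cong (_* ⟦ d ℕ.! ⟧ℕ) (sym (values n 1≤n))) (value H H-above n)))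
        r-coefficient : t * coefficient H r ≡ coefAt c r
        r-coefficient = trans (cong (t *_) (sym (coefficients r (ℕ.s≤s (ℕₚ.m≤n+m r 3))))) (trans (lem' t (coefAt c r) ⟦ d ℕ.! ⟧ℕ) (trans (cong (_* coefAt c r) td) (*-identityˡ _)))
          where
          opaque
            unfolding _+_
            lem' : ∀ t c d → t * (c * d) ≡ (t * d) * c
            lem' = solve-∀ ringℚ
        top≡v : coefAt c d ≡ v
        top≡v = poly-leading d (coefAt c) v (λ ε 0<ε → proj₁ (volume ε 0<ε) , λ n l 1≤n →
          subst (λ z → ∣ z - v * ⟦ n ℕ.^ d ⟧ℕ ∣ < ε * ⟦ n ℕ.^ d ⟧ℕ) (values n 1≤n)
            (subst (λ P → P) (volume-error (Sⁿ (suc d) H n) v (n ℕ.^ d) ε) (proj₂ (volume ε 0<ε) n _ l 1≤n (count n 1≤n))))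
        normalized : sumTo (suc d) (λ j → ⟦ H j ⟧ℕ) ≡ ⟦ d ℕ.! ⟧ℕ * v
        normalized = trans (sym (leading H)) (trans (sym (coefficients d ℕₚ.≤-refl)) (trans (*-comm _ ⟦ d ℕ.! ⟧ℕ) (cong (⟦ d ℕ.! ⟧ℕ *_) top≡v)))

    -- The argument i of the minimum N corresponds to box height k = d − i.
    extremal-height : ∃[ b ] ((2 ℕ.+ b) ℕ.+ b ℕ.≤ 6 ℕ.+ e × N r d ≡ C d r (posℤ d ℤ.- posℤ (2 ℕ.+ b)))
    extremal-height = go argminN
      where
      go : (∃[ i ] (lo ℕ.≤ i × i ℕ.≤ hi × N r d ≡ C d r (posℤ i))) → ∃[ b ] ((2 ℕ.+ b) ℕ.+ b ℕ.≤ 6 ℕ.+ e × N r d ≡ C d r (posℤ d ℤ.- posℤ (2 ℕ.+ b)))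
      go (i , p , q , eq) = b , half , trans eq (cong (C d r) (trans (lem (posℤ i) (posℤ b)) (cong (λ z → posℤ 2 ℤ.+ posℤ z ℤ.- (posℤ 2 ℤ.+ posℤ b)) i+b)))
        where
        b = hi ℕ.∸ i
        i+b : i ℕ.+ b ≡ hi
        i+b = ℕₚ.m+[n∸m]≡n q
        lem : ∀ i b → i ≡ posℤ 2 ℤ.+ (i ℤ.+ b) ℤ.- (posℤ 2 ℤ.+ b)
        lem = ℤSolver.solve-∀
        -- As i + b = d - 2, this says 2i ≥ d - 1, which is the lower end of the range over which
        -- `N` is taken.
        half : (2 ℕ.+ b) ℕ.+ b ℕ.≤ 6 ℕ.+ e
        half = ℕₚ.+-cancelˡ-≤ (2 ℕ.* i) _ _ (subst (ℕ._≤ 2 ℕ.* i ℕ.+ (6 ℕ.+ e)) (sym total)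
          (ℕₚ.≤-trans (ℕₚ.+-monoˡ-≤ (6 ℕ.+ e) (ℕₚ.≤-trans (ceilHalf-≥ (6 ℕ.+ e)) (ℕₚ.*-monoʳ-≤ 2 p))) ℕₚ.≤-refl))
          where
          lem₁ : ∀ i b → 2 ℕ.* i ℕ.+ ((2 ℕ.+ b) ℕ.+ b) ≡ 2 ℕ.+ ((i ℕ.+ b) ℕ.+ (i ℕ.+ b))
          lem₁ = ℕSolver.solve-∀
          lem₂ : ∀ e → 2 ℕ.+ ((5 ℕ.+ e) ℕ.+ (5 ℕ.+ e)) ≡ (6 ℕ.+ e) ℕ.+ (6 ℕ.+ e)
          lem₂ = ℕSolver.solve-∀
          total : 2 ℕ.* i ℕ.+ ((2 ℕ.+ b) ℕ.+ b) ≡ (6 ℕ.+ e) ℕ.+ (6 ℕ.+ e)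
          total = trans (lem₁ i b) (trans (cong (λ h → 2 ℕ.+ (h ℕ.+ h)) i+b) (lem₂ e))

    Attained : ℕ → Set
    Attained m = Σ (List (Point d)) λ V → FullDimensional V ×
      Σ ℚ (λ v → HasVolume V v × (ℕ→ℚ (d ℕ.!) ℚ.* v ≡ ℕ→ℚ m) ×
        Σ (Fin (suc d) → ℚ) (λ c → IsEhrhartPolynomial V c × (coefAt c r ≡ bound d v)))

    private
      module Extremal (m' b : ℕ) (b≤ : (2 ℕ.+ b) ℕ.+ b ℕ.≤ 6 ℕ.+ e) (N≡ : N r d ≡ C d r (posℤ d ℤ.- posℤ (2 ℕ.+ b))) where
        module S = Simplex (6 ℕ.+ e) m' b b≤
        k : ℕ
        k = 2 ℕ.+ b
        v : ℚ
        v = t * ⟦ suc m' ⟧ℕ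
        opaque
          unfolding _+_
          l1 : ∀ d t m → d * (t * m) ≡ (t * d) * m
          l1 = solve-∀ ringℚ
          l5 : ∀ s c m v → (s + c * m) - v * m ≡ s + (c - v) * m
          l5 = solve-∀ ringℚ
          l6 : ∀ F m n → F + m * n ≡ F + ((1ℚ + m) - 1ℚ) * n
          l6 = solve-∀ ringℚ
        d!v : ⟦ d ℕ.! ⟧ℕ * v ≡ ⟦ suc m' ⟧ℕ
        d!v = trans (l1 ⟦ d ℕ.! ⟧ℕ t ⟦ suc m' ⟧ℕ) (trans (cong (_* ⟦ suc m' ⟧ℕ) td) (*-identityˡ _))
        k<d : k ℕ.< suc d
        k<d = ℕ.s≤s (ℕₚ.≤-trans (ℕₚ.m≤m+n k b) (ℕₚ.≤-trans b≤ (ℕₚ.n≤1+n (6 ℕ.+ e))))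
        H-above : ∀ j → suc d ℕ.≤ j → S.H j ≡ 0
        H-above (suc j) l = trans (cong (m' ℕ.*_) (ind-≢ k (suc j) (ℕₚ.<⇒≢ (ℕₚ.<-≤-trans k<d l)))) (ℕₚ.*-zeroʳ m')
        weighted : ∀ (F : ℕ → ℚ) → sumTo (suc d) (λ j → ⟦ S.H j ⟧ℕ * F j) ≡ F 0 + ⟦ m' ⟧ℕ * F k
        weighted F = trans (sumTo-cong (suc d) (λ j _ → trans (cong (_* F j) (trans (⟦⟧ℕ-+ (ind 0 j) (m' ℕ.* ind k j)) (cong (⟦ ind 0 j ⟧ℕ +_) (⟦⟧ℕ-* m' (ind k j))))) (distribʳ (F j) ⟦ ind 0 j ⟧ℕ (⟦ m' ⟧ℕ * ⟦ ind k j ⟧ℕ))))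
          (trans (sumTo-+ (suc d) (λ j → ⟦ ind 0 j ⟧ℕ * F j) (λ j → ⟦ m' ⟧ℕ * ⟦ ind k j ⟧ℕ * F j)) (cong₂ _+_
            (trans (sumTo-single (suc d) 0 _ (ℕ.s≤s ℕ.z≤n) (λ i ne → trans (cong (λ z → ⟦ z ⟧ℕ * F i) (ind-≢ 0 i (λ e → ne (sym e)))) (trans (cong (_* F i) ⟦0⟧) (zeroˡ (F i))))) (trans (cong (_* F 0) ⟦1⟧) (*-identityˡ (F 0))))
            (trans (sumTo-single (suc d) k _ k<d (λ i ne → trans (cong (λ z → ⟦ m' ⟧ℕ * ⟦ z ⟧ℕ * F i) (ind-≢ k i (λ e → ne (sym e)))) (trans (cong (λ z → ⟦ m' ⟧ℕ * z * F i) ⟦0⟧) (trans (cong (_* F i) (zeroʳ ⟦ m' ⟧ℕ)) (zeroˡ (F i))))))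
              (trans (cong (λ z → ⟦ m' ⟧ℕ * ⟦ z ⟧ℕ * F k) (ind-refl k)) (cong (_* F k) (trans (cong (⟦ m' ⟧ℕ *_) ⟦1⟧) (trans (*-comm _ 1ℚ) (*-identityˡ _))))))))
        c' : ℕ → ℚ
        c' s = coefficient S.H s * t
        c : Fin (suc d) → ℚ
        c i = c' (toℕ i)
        values : ∀ n → ⟦ Sⁿ (suc d) S.H n ⟧ℕ ≡ poly (suc d) c' n
        values n = trans (sym (trans (cong (_* t) (sym (value S.H H-above n))) (trans (*-assoc _ _ t) (trans (cong (⟦ Sⁿ (suc d) S.H n ⟧ℕ *_) (trans (*-comm _ t) td)) (trans (*-comm _ 1ℚ) (*-identityˡ _))))))
          (sym (poly-scale (suc d) (coefficient S.H) t n))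
        count-unique : ∀ n k → 1 ℕ.≤ n → LatticeCount S.V n k → k ≡ Sⁿ (suc d) S.H n
        count-unique n k 1≤n lc = card-unique lc (S.count n 1≤n)
        -- The definition speaks of every possible count k; cardinalities are unique, so the count
        -- coming from the boxes suffices.
        ehrhart : IsEhrhartPolynomial S.V c
        ehrhart n k 1≤n lc = trans (sym (⟦⟧ℕ≡ k)) (trans (trans (cong ⟦_⟧ℕ (count-unique n k 1≤n lc)) (trans (values n) (sumTo-cong (suc d) (λ s l → cong (_* ⟦ n ℕ.^ s ⟧ℕ) (sym (coefAt-restrict d c' s (ℕ.s≤s⁻¹ l))))))) (sym (ehrhart-value c n)))
        c'd≡v : c' d ≡ v
        c'd≡v = trans (cong (_* t) (trans (weighted (λ j → ⟦ C d d (posℤ d ℤ.- posℤ j) ⟧)) (trans (cong₂ (λ a b → a + ⟦ m' ⟧ℕ * b) (C-top d (posℤ d ℤ.- posℤ 0)) (C-top d (posℤ d ℤ.- posℤ k))) (trans (cong (1ℚ +_) (trans (*-comm _ 1ℚ) (*-identityˡ _))) (sym (⟦⟧ℕ-suc m')))))) (*-comm _ t)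
        volume : HasVolume S.V v
        volume ε 0<ε = proj₁ small , λ n k l 1≤n lc → subst (λ P → P) (sym (volume-error k v (n ℕ.^ d) ε)) (subst (λ z → ∣ z ∣ < ε * ⟦ n ℕ.^ d ⟧ℕ) (sym (error n k 1≤n lc)) (proj₂ small n l 1≤n))
          where
          small : ∃[ n₀ ] ∀ n → n₀ ℕ.≤ n → 1 ℕ.≤ n → ∣ poly d c' n ∣ < ε * ⟦ n ℕ.^ d ⟧ℕ
          small = poly-little-o d c' ε 0<ε
          error : ∀ n k → 1 ℕ.≤ n → LatticeCount S.V n k → ⟦ k ⟧ℕ - v * ⟦ n ℕ.^ d ⟧ℕ ≡ poly d c' n
          error n k 1≤n lc = trans (cong (_- v * ⟦ n ℕ.^ d ⟧ℕ) (trans (cong ⟦_⟧ℕ (count-unique n k 1≤n lc)) (values n))) (trans (l5 (poly d c' n) (c' d) ⟦ n ℕ.^ d ⟧ℕ v)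
            (trans (cong (λ z → poly d c' n + (z - v) * ⟦ n ℕ.^ d ⟧ℕ) c'd≡v) (trans (cong (λ z → poly d c' n + z * ⟦ n ℕ.^ d ⟧ℕ) (+-inverseʳ v)) (trans (cong (poly d c' n +_) (zeroˡ ⟦ n ℕ.^ d ⟧ℕ)) (+-identityʳ _)))))
        F : ℕ → ℚ
        F j = f (posℤ d ℤ.- posℤ j)

        F-0 : F 0 ≡ f (posℤ d)
        F-0 = cong f (ℤₚ.+-identityʳ (posℤ d))

        F-k : F k ≡ ⟦ N r d ⟧
        F-k = cong ⟦_⟧ (sym N≡)

        coefficient-r : coefAt c r ≡ bound d v
        coefficient-r = begin
          coefAt c r                                           ≡⟨ coefAt-restrict d c' r (ℕₚ.m≤n+m r 3) ⟩
          coefficient S.H r * t                                ≡⟨ *-comm (coefficient S.H r) t ⟩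
          t * coefficient S.H r                                ≡⟨ cong (t *_) (weighted F) ⟩
          t * (F 0 + ⟦ m' ⟧ℕ * F k)                            ≡⟨ cong (t *_) (cong₂ (λ a b → a + ⟦ m' ⟧ℕ * b) F-0 F-k) ⟩
          t * (f (posℤ d) + ⟦ m' ⟧ℕ * ⟦ N r d ⟧)               ≡⟨ cong (t *_) (l6 (f (posℤ d)) ⟦ m' ⟧ℕ ⟦ N r d ⟧) ⟩
          t * (f (posℤ d) + ((1ℚ + ⟦ m' ⟧ℕ) - 1ℚ) * ⟦ N r d ⟧) ≡⟨ cong (λ z → t * (f (posℤ d) + (z - 1ℚ) * ⟦ N r d ⟧)) (trans (sym (⟦⟧ℕ-suc m')) (sym d!v)) ⟩
          t * (f (posℤ d) + (⟦ d ℕ.! ⟧ℕ * v - 1ℚ) * ⟦ N r d ⟧) ≡⟨ sym (bound-value v) ⟩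
          bound d v ∎

        scaled-volume : ℕ→ℚ (d ℕ.!) ℚ.* v ≡ ℕ→ℚ (suc m')
        scaled-volume = trans (sym (trans (cong (_* v) (⟦⟧ℕ≡ (d ℕ.!))) (*-ℚ _ v))) (trans d!v (⟦⟧ℕ≡ (suc m')))

    attained : ∀ m → 1 ℕ.≤ m → Attained m
    attained (suc m') _ = build extremal-height
      where
      build : (∃[ b ] ((2 ℕ.+ b) ℕ.+ b ℕ.≤ 6 ℕ.+ e × N r d ≡ C d r (posℤ d ℤ.- posℤ (2 ℕ.+ b)))) → Attained (suc m')
      build (b , b≤ , N≡) = E.S.V , E.S.full-dimensional , E.v , E.volume , E.scaled-volume , E.c , E.ehrhart , E.coefficient-r
        where module E = Extremal m' b b≤ N≡

open import Data.Nat using (ℕ; suc; _≤_; _∸_; _!)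
open import Data.Integer using (_<_)
open import Data.Rational using (ℚ) renaming (_≤_ to _≤ℚ_; _*_ to _*ℚ_)
open import Data.Fin using (Fin)
open import Data.List using (List)
open import Data.Product using (Σ; _×_)
open import Relation.Binary.PropositionalEquality using (_≡_)

theorem2p1 : (d : ℕ) → 7 ≤ d →
    ((V : List (Point d)) → FullDimensional V →
    (c : Fin (suc d) → ℚ) → IsEhrhartPolynomial V c →
    (v : ℚ) → HasVolume V v →
    bound d v ≤ℚ coefAt c (d ∸ 3))
    × ((m : ℕ) → 1 ≤ m →
    Σ (List (Point d)) λ V → FullDimensional V ×
    Σ ℚ (λ v → HasVolume V v × (ℕ→ℚ (d !) *ℚ v ≡ ℕ→ℚ m) ×
    Σ (Fin (suc d) → ℚ) (λ c → IsEhrhartPolynomial V c ×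
    (coefAt c (d ∸ 3) ≡ bound d v))))
    × (M (d ∸ 3) d < N (d ∸ 3) d)
theorem2p1 d 7≤d with ℕₚ.m≤n⇒∃[o]m+o≡n 7≤d
... | e , refl = Conclusion.lower-bound e , Conclusion.attained e , Inequality.CubicBounds.M<N e
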